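{- Assume the Weak Variant of the Projection Games Conjecture (stated in the context). Then there exists a constant $\epsilon>0$ such that no polynomial-time algorithm solves the $(n^{\epsilon},n^{\epsilon})$-shortcut approximation problem, and no polynomial-time algorithm solves the $(n^{\epsilon},n^{\epsilon})$-TC-spanner approximation problem, even when the inputs are restricted to satisfy $s=\Omega(m^{1+\epsilon})$ and $d=\Omega(n^{\epsilon})$.
   Context: Graphs: $G=(V,E)$ is a directed unweighted graph with $n=|V|$ vertices and $m=|E|$ edges. $u$ reaches $v$ if there is a directed path from $u$ to $v$; $\mathrm{dist}_G(u,v)$ is the minimum number of edges on such a path. The diameter of a graph is the maximum distance over all reachable ordered pairs. The transitive closure of $G$ is $G^T=(V,E^T)$ with $(u,v)\in E^T$ iff $u$ can reach $v$ in $G$. TC spanner: a set $E'\subseteq E^T$ such that $(V,E')$ has the same transitive closure as $G$; it is an $(s,d)$-TC spanner if $|E'|\le s$ and $(V,E')$ has diameter at most $d$. Shortcut: a set $E'\subseteq E^T\setminus E$; it is an $(s,d)$-shortcut if $|E'|\le s$ and $(V,E\cup E')$ has diameter at most $d$. The $(\alpha_S,\alpha_D)$-shortcut approximation problem: given a directed graph $G$ and integers $d,s$ such that $G$ admits an $(s,d)$-shortcut, find an $(\alpha_S s,\alpha_D d)$-shortcut of $G$. The $(\alpha_S,\alpha_D)$-TC-spanner approximation problem is defined analogously with TC spanners. Here $\alpha_S,\alpha_D$ may be functions of $n$, the number of vertices of the input graph. LabelCover: an instance $\mathcal{I}=(A,B,E,\mathcal{L},(\pi_e)_{e\in E})$ consists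 of a regular bipartite graph $(A\cup B,E)$ with $|A|=|B|$, a label set $\mathcal{L}$, and for each edge $e=(u,v)\in E$ a nonempty set $\pi_e\subseteq\mathcal{L}\times\mathcal{L}$. A labeling $\psi:A\cup B\to\mathcal{L}$ covers $e=(u,v)$ if $(\psi(u),\psi(v))\in\pi_e$. $N$ denotes the input size of the instance. Weak Variant of the Projection Games Conjecture (PGC): there exists a universal constant $\epsilon>0$ such that, given a LabelCover instance of size $N$, it is hard (no polynomial-time algorithm can) distinguish between (Completeness) some labeling covers every edge, and (Soundness) every labeling covers at most an $N^{ -\epsilon}$ fraction of the edges. -}

module Defs where

open import Data.Bool using (Bool; true; false; _∧_; if_then_else_)
open import Data.Fin using (Fin)
open import Data.Fin.Subset using (Subset; _∈_; _∪_; ∣_∣)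
open import Data.Integer using () renaming (∣_∣ to ∣_∣ℤ)
open import Data.Maybe using (Maybe; just; nothing; maybe′; is-just)
open import Data.Nat using (ℕ; suc; _+_; _*_; _^_; _≤_; _<_; _≡ᵇ_)
open import Data.Nat.Binary using (ℕᵇ; 2[1+_]; 1+[2_]; fromℕ)
open import Data.Product using (∃-syntax; _×_; _,_)
open import Data.Rational using (ℚ; 0ℚ; ↥_; ↧ₙ_) renaming (_<_ to _<ℚ_)
open import Data.Sum using (_⊎_; inj₁; inj₂)
open import Data.Vec using (Vec; []; _∷_; lookup; map; sum; tabulate; transpose; zipWith)
open import Function.Bundles using (_⇔_)
open import Relation.Binary.PropositionalEquality using (_≡_; _≢_)
open import Relation.Nullary using (¬_)

------------------------------------------------------------------------
-- Real powers with rational exponent ε = p / q ≥ 0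

-- Inequalities between natural numbers and n^ε · x are stated after raising
-- both sides to the q-th power, which is an equivalence over the nonnegative
-- reals.

num : ℚ → ℕ
num ε = ∣ ↥ ε ∣ℤ

-- y ≤ n^ε · x
_≤[_^_]·_ : ℕ → ℕ → ℚ → ℕ → Set
y ≤[ n ^ ε ]· x = y ^ (↧ₙ ε) ≤ n ^ num ε * x ^ (↧ₙ ε)

-- n^ε · x ≤ y
[_^_]·_≤_ : ℕ → ℚ → ℕ → ℕ → Set
[ n ^ ε ]· x ≤ y = n ^ num ε * x ^ (↧ₙ ε) ≤ y ^ (↧ₙ ε)

------------------------------------------------------------------------
-- Polynomial-time algorithms

-- The model is the WHILE language of N. D. Jones ("Computability and
-- Complexity from a Programming Perspective").  Data are binary trees.
-- Every evaluation of an expression by a command costs one more than the size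
-- of the resulting tree.  Hence no value of superpolynomial size can be built
-- in polynomial time, and polynomial time agrees with that of Turing machines,
-- for functions as well as for decision problems.

data Tree : Set where
  nil  : Tree
  cons : Tree → Tree → Tree

size : Tree → ℕ
size nil        = 1
size (cons x y) = suc (size x + size y)

head : Tree → Tree
head nil        = nil
head (cons x _) = x

tail : Tree → Tree
tail nil        = nil
tail (cons _ y) = y

treeEq : Tree → Tree → Bool
treeEq nil        nil          = true
treeEq (cons x y) (cons x′ y′) = treeEq x x′ ∧ treeEq y y′
treeEq _          _            = false

encodeBool : Bool → Tree
encodeBool false = nil
encodeBool true  = cons nil nil

Var : Set
Var = ℕ

infixr 5 _⨾_
infix  6 _≔_

data Expr : Set where
  var     : Var → Expr
  literal : Tree → Expr
  consₑ   : Expr → Expr → Expr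
  headₑ   : Expr → Expr
  tailₑ   : Expr → Expr
  _=?_    : Expr → Expr → Expr

data Program : Set where
  _≔_            : Var → Expr → Program
  _⨾_            : Program → Program → Program
  if_then_else′_ : Expr → Program → Program → Program
  while_run_     : Expr → Program → Program

Store : Set
Store = Var → Tree

_[_↦_] : Store → Var → Tree → Store
(σ [ x ↦ t ]) y = if x ≡ᵇ y then t else σ y

eval : Expr → Store → Tree
eval (var x)     σ = σ x
eval (literal t) σ = t
eval (consₑ e f) σ = cons (eval e σ) (eval f σ)
eval (headₑ e)   σ = head (eval e σ)
eval (tailₑ e)   σ = tail (eval e σ)
eval (e =? f)    σ = encodeBool (treeEq (eval e σ) (eval f σ))

cost : Expr → Store → ℕ
cost e σ = suc (size (eval e σ))

-- ⟨ p , σ ⟩⇓⟨ τ , t ⟩ : started in store σ, the program p halts in store τ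
-- at total cost t.
data ⟨_,_⟩⇓⟨_,_⟩ : Program → Store → Store → ℕ → Set where
  assign : ∀ {x e σ} →
    ⟨ x ≔ e , σ ⟩⇓⟨ σ [ x ↦ eval e σ ] , cost e σ ⟩
  sequence : ∀ {p q σ τ ρ t u} →
    ⟨ p , σ ⟩⇓⟨ τ , t ⟩ → ⟨ q , τ ⟩⇓⟨ ρ , u ⟩ →
    ⟨ p ⨾ q , σ ⟩⇓⟨ ρ , t + u ⟩
  if-true : ∀ {e p q σ τ t} → eval e σ ≢ nil →
    ⟨ p , σ ⟩⇓⟨ τ , t ⟩ →
    ⟨ if e then p else′ q , σ ⟩⇓⟨ τ , cost e σ + t ⟩
  if-false : ∀ {e p q σ τ t} → eval e σ ≡ nil →
    ⟨ q , σ ⟩⇓⟨ τ , t ⟩ →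
    ⟨ if e then p else′ q , σ ⟩⇓⟨ τ , cost e σ + t ⟩
  while-true : ∀ {e p σ τ ρ t u} → eval e σ ≢ nil →
    ⟨ p , σ ⟩⇓⟨ τ , t ⟩ → ⟨ while e run p , τ ⟩⇓⟨ ρ , u ⟩ →
    ⟨ while e run p , σ ⟩⇓⟨ ρ , cost e σ + (t + u) ⟩
  while-false : ∀ {e p σ} → eval e σ ≡ nil →
    ⟨ while e run p , σ ⟩⇓⟨ σ , cost e σ ⟩

-- Variable 0 holds the input initially and the output on termination.
initial : Tree → Store
initial x = (λ _ → nil) [ 0 ↦ x ]

Run : Program → Tree → Tree → ℕ → Set
Run p x y t = ∃[ τ ] ⟨ p , initial x ⟩⇓⟨ τ , t ⟩ × τ 0 ≡ y

Outputs : Program → Tree → Tree → Set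
Outputs p x y = ∃[ t ] Run p x y t

-- Sizes are positive, so the bounds c · size^k dominate all polynomials.
PolynomialTime : Program → Set
PolynomialTime p =
  ∃[ c ] ∃[ k ] ∀ x → ∃[ y ] ∃[ t ] Run p x y t × t ≤ c * size x ^ k

------------------------------------------------------------------------
-- Encodings

encodeBinary : ℕᵇ → Tree
encodeBinary ℕᵇ.zero  = nil
encodeBinary 2[1+ b ] = cons (encodeBool false) (encodeBinary b)
encodeBinary 1+[2 b ] = cons (encodeBool true) (encodeBinary b)

encodeℕ : ℕ → Tree
encodeℕ n = encodeBinary (fromℕ n)

encodeVec : ∀ {A : Set} {n} → (A → Tree) → Vec A n → Tree
encodeVec f []       = nil
encodeVec f (x ∷ xs) = cons (f x) (encodeVec f xs)

encodeMaybe : ∀ {A : Set} → (A → Tree) → Maybe A → Tree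
encodeMaybe f nothing  = nil
encodeMaybe f (just x) = cons nil (f x)

------------------------------------------------------------------------
-- Sets of pairs

-- A subset of Fin m × Fin n, given by its rows: the entry at u is the set of
-- all v with (u , v) in the set.
Pairs : ℕ → ℕ → Set
Pairs m n = Vec (Subset n) m

_∈ₚ_ : ∀ {m n} → Fin m × Fin n → Pairs m n → Set
(u , v) ∈ₚ R = v ∈ lookup R u

card : ∀ {m n} → Pairs m n → ℕ
card R = sum (map ∣_∣ R)

_∪ₚ_ : ∀ {m n} → Pairs m n → Pairs m n → Pairs m n
_∪ₚ_ = zipWith _∪_

encodePairs : ∀ {m n} → Pairs m n → Tree
encodePairs = encodeVec (encodeVec encodeBool)

------------------------------------------------------------------------
-- Directed graphs, TC spanners and shortcuts

-- The edge set of a directed graph with vertex set Fin n.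
Graph : ℕ → Set
Graph n = Pairs n n

data Walk {n} (E : Graph n) : Fin n → Fin n → ℕ → Set where
  []  : ∀ {u} → Walk E u u 0
  _∷_ : ∀ {u v w k} → (u , v) ∈ₚ E → Walk E v w k → Walk E u w (suc k)

-- Membership of (u , v) in the transitive closure; a vertex reaches itself by
-- the path without edges.
Reaches : ∀ {n} → Graph n → Fin n → Fin n → Set
Reaches E u v = ∃[ k ] Walk E u v k

IsDist : ∀ {n} → Graph n → Fin n → Fin n → ℕ → Set
IsDist E u v k = Walk E u v k × (∀ j → Walk E u v j → k ≤ j)

DiameterAtMost : ∀ {n} → Graph n → ℕ → Set
DiameterAtMost E d = ∀ u v k → IsDist E u v k → k ≤ d

IsShortcut : ∀ {n} → Graph n → ℕ → ℕ → Graph n → Set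
IsShortcut E s d E′ =
    (∀ u v → (u , v) ∈ₚ E′ → Reaches E u v × ¬ ((u , v) ∈ₚ E))
  × card E′ ≤ s
  × DiameterAtMost (E ∪ₚ E′) d

IsTCSpanner : ∀ {n} → Graph n → ℕ → ℕ → Graph n → Set
IsTCSpanner E s d E′ =
    (∀ u v → (u , v) ∈ₚ E′ → Reaches E u v)
  × (∀ u v → Reaches E′ u v ⇔ Reaches E u v)
  × card E′ ≤ s
  × DiameterAtMost E′ d

------------------------------------------------------------------------
-- Approximation problems

encodeInput : ∀ {n} → Graph n → ℕ → ℕ → Tree
encodeInput E d s = cons (encodePairs E) (cons (encodeℕ d) (encodeℕ s))

-- s ≥ m^(1+ε) / C and d ≥ n^ε / C, where m is the number of edges.
InRange : ℚ → ℕ → ∀ {n} → Graph n → ℕ → ℕ → Set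
InRange ε C {n} E d s =
  ([ card E ^ ε ]· card E ≤ (C * s)) × ([ n ^ ε ]· 1 ≤ (C * d))

-- IsSolution is IsShortcut or IsTCSpanner.  Cardinalities and diameters are
-- integers, so an (n^ε s , n^ε d)-solution is the same as an (s′ , d′)-solution
-- for some naturals s′ ≤ n^ε s and d′ ≤ n^ε d.
Approximates : (∀ {n} → Graph n → ℕ → ℕ → Graph n → Set) →
               ℚ → ℕ → Program → Set
Approximates IsSolution ε C p =
  ∀ n (E : Graph n) d s → InRange ε C E d s →
  (∃[ F ] IsSolution E s d F) →
  ∃[ E′ ] Outputs p (encodeInput E d s) (encodePairs E′) ×
    (∃[ s′ ] ∃[ d′ ] (s′ ≤[ n ^ ε ]· s) × (d′ ≤[ n ^ ε ]· d) ×
      IsSolution E s′ d′ E′)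

------------------------------------------------------------------------
-- LabelCover

-- A = B = Fin k and the label set is Fin l.  The entry of constraints at (u , v)
-- is nothing if (u , v) is not an edge, and just π₍ᵤ,ᵥ₎ if it is one.
Constraints : ℕ → ℕ → Set
Constraints k l = Vec (Vec (Maybe (Pairs l l)) k) k

constraintAt : ∀ {k l} → Constraints k l → Fin k → Fin k → Maybe (Pairs l l)
constraintAt c u v = lookup (lookup c u) v

edgesOf : ∀ {k l} → Constraints k l → Pairs k k
edgesOf = map (map is-just)

record LabelCover : Set where
  field
    k l         : ℕ
    constraints : Constraints k l

  edges : Pairs k k
  edges = edgesOf constraints

  field
    degree    : ℕ
    regular-A : ∀ u → ∣ lookup edges u ∣ ≡ degree
    regular-B : ∀ v → ∣ lookup (transpose edges) v ∣ ≡ degree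
    -- An instance without edges would satisfy both completeness and soundness,
    -- making them trivially indistinguishable.
    has-edge  : 0 < card edges
    nonempty  : ∀ u v π → constraintAt constraints u v ≡ just π →
                ∃[ a ] ∃[ b ] (a , b) ∈ₚ π

  Labeling : Set
  Labeling = Fin k ⊎ Fin k → Fin l

  Covers : Labeling → Fin k → Fin k → Set
  Covers ψ u v =
    ∃[ π ] constraintAt constraints u v ≡ just π × (ψ (inj₁ u) , ψ (inj₂ v)) ∈ₚ π

  covered : Labeling → Pairs k k
  covered ψ = tabulate λ u → tabulate λ v →
    maybe′ (λ π → lookup (lookup π (ψ (inj₁ u))) (ψ (inj₂ v))) false
           (constraintAt constraints u v)

  encoding : Tree
  encoding = encodeVec (encodeVec (encodeMaybe encodePairs)) constraints

  inputSize : ℕ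
  inputSize = size encoding

  Complete : Set
  Complete = ∃[ ψ ] ∀ u v → (u , v) ∈ₚ edges → Covers ψ u v

  -- |covered| / |edges| ≤ N^(-ε)
  Sound : ℚ → Set
  Sound ε = ∀ ψ → [ inputSize ^ ε ]· card (covered ψ) ≤ card edges

Distinguishes : ℚ → Program → Set
Distinguishes ε p = ∀ (I : LabelCover) → let open LabelCover I in
    (Complete → Outputs p encoding (encodeBool true))
  × (Sound ε → Outputs p encoding (encodeBool false))

WeakPGC : Set
WeakPGC =
  ∃[ ε ] 0ℚ <ℚ ε × ¬ (∃[ p ] PolynomialTime p × Distinguishes ε p)

{-# OPTIONS --safe #-}
module Submission where

-- The reduction maps a LabelCover instance to a layered graph.  A vertex consists of a time, a vertex of the instance with a label, and a
-- position made of a sum of squares, two counters and Y digits.  The steps follow the schedule (U D^ℓ V D^ℓ)^L: U chooses any u in A and any label,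
-- V any v in B and a label that satisfies the constraint of (u , v), and D a number below T; a choice is added to one of the coordinates and its square
-- to the sum of squares.  A walk whose choices repeat the same (u , v , y) minimises the sum of squares for its displacement, so every walk
-- between the same positions makes the same choices, and only the labels are free on such a critical walk.
--
-- If a labeling covers all edges, the jumps over the blocks D^ℓ that keep the labels of this labeling form a solution of diameter β⁴.
-- Conversely, in a graph of diameter β⁵ < L² some stage of each critical walk has a jump in both of its halves.  The labels read off these jumps at
-- given positions form lists: there are too few jumps for many of the lists to be long, and short lists give a labeling that covers a large
-- fraction of the edges.  All sizes are powers of β, a root of the size of the instance; the finitely many instances with small β go into a table.

open import Defs
open import Data.Bool using (Bool; true; false; not; if_then_else_)
open import Data.Empty using (⊥; ⊥-elim)
open import Data.Fin using (Fin; toℕ; fromℕ<) renaming (zero to fzero; suc to fsuc)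
open import Data.Fin.Properties using (toℕ<n; toℕ-fromℕ<; fromℕ<-toℕ; toℕ-injective)
open import Data.Fin.Subset using (∣_∣) renaming (_∈_ to _∈ˢ_; _∪_ to _∪ˢ_)
open import Data.Fin.Subset.Properties using (x∈p∪q⁺; x∈p∪q⁻; ∣p∣≤n)
import Data.Integer as ℤ
open import Data.List using (List; []; _∷_; _++_; map; concatMap; length; replicate; upTo; applyUpTo; lookup; reverse; _ʳ++_; zipWith; cartesianProduct)
import Data.List.Membership.DecPropositional as DecMembership
open import Data.List.Membership.Propositional using () renaming (_∈_ to _∈ˡ_)
open import Data.List.Membership.Propositional.Properties using (∈-upTo⁺; ∈-upTo⁻; ∈-++⁺ˡ; ∈-++⁺ʳ; ∈-++⁻; ∈-lookup; ∈-cartesianProduct⁺; ∈-cartesianProduct⁻; ∈-map⁺)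
open import Data.List.Properties using (++-assoc; ++-identityʳ; ++-ʳ++; ʳ++-defn; reverse-involutive; upTo-∷ʳ; concatMap-cong; length-++; length-upTo; length-replicate; length-map) renaming (≡-dec to List-≡-dec)
open import Data.List.Relation.Unary.All using (All; []; _∷_) renaming (lookup to All-lookup; map to All-map)
open import Data.List.Relation.Unary.All.Properties using () renaming (++⁻ to All-++⁻; ++⁺ to All-++⁺)
open import Data.List.Relation.Unary.Any using (here; there; index)
open import Data.List.Relation.Unary.Any.Properties using (lookup-index)
open import Data.List.Relation.Unary.Unique.Propositional using (Unique; []; _∷_)
open import Data.List.Relation.Unary.Unique.Propositional.Properties using (upTo⁺; cartesianProduct⁺) renaming (++⁺ to Unique-++⁺; map⁺ to Unique-map⁺)
open import Data.Maybe using (Maybe; just; nothing; is-just; maybe′)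
open import Data.Nat
open import Data.Nat.Binary using (ℕᵇ; 2[1+_]; 1+[2_]; fromℕ; fromℕ') renaming (suc to sucᵇ)
open import Data.Nat.Binary.Properties using (fromℕ≡fromℕ')
open import Data.Nat.Coprimality using (1-coprimeTo)
open import Data.Nat.DivMod using (m≡m%n+[m/n]*n; m%n<n)
open import Data.Nat.Properties
open import Data.Nat.Tactic.RingSolver using (solve-∀)
open import Data.Product using (∃-syntax; _×_; _,_; proj₁; proj₂)
open import Data.Product.Properties using () renaming (≡-dec to ×-≡-dec)
open import Data.Rational using (ℚ; 0ℚ; mkℚ; ↧ₙ_; positive) renaming (_<_ to _<ℚ_; Positive to Positiveℚ)
open import Data.Rational.Properties using (positive⁻¹)
open import Data.Sum using (_⊎_; inj₁; inj₂; map₁; map₂; [_,_]′) renaming (map to map⊎)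
import Data.Vec
open import Data.Vec using (Vec; transpose; _⊛_) renaming ([] to []ᵛ; _∷_ to _∷ᵛ_; lookup to lookupᵛ; tabulate to tabulateᵛ; map to mapᵛ; replicate to replicateᵛ)
open import Data.Vec.Properties using (lookup∘tabulate; lookup-zipWith; []=⇒lookup; lookup⇒[]=; lookup-map; lookup-⊛; lookup-replicate)
open import Function using (_∘_; id; case_of_)
open import Function.Bundles using (Equivalence; mk⇔)
open import Relation.Binary.PropositionalEquality
open import Relation.Nullary using (¬_; Dec; yes; no; does)

-- The inputs must satisfy s ≥ m^(1+ε), so the jumps have to outnumber the edges; yet even β times
-- the budget must not pay for many labels per vertex. So a block of moves needs many displacements,
-- most of them indispensable. With Y digits moved by numbers below T = β^Y, a block that repeats
-- one vector of digits has T^Y displacements, while all walks together realise at most (L T)^Y ℓ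
-- T². The ratio is a power of β with exponent linear in Y, against the exponent Y² of T^Y. It
-- determines τ, then X, whose exponent 13 Y + 60 is still linear in Y, and K = q₀ (13 Y + 60), for
-- which X is at most N^ε₀. The number of edges per position has an exponent linear in K and Y, so
-- Y² wins for Y = 100 q₀.
--
-- A solution may also exceed the diameter by a factor β and so cut a block into pieces. Hence a
-- block has L rounds with the same digits: one intact round still betrays the digits and the label.
-- As the sum of squares is a coordinate, the convexity of x² takes the place of a specially chosen
-- convex set of directions.

module _ where

  -- Polynomial bounds

  private variable
    f g h : Tree → Tree

  Poly : (Tree → ℕ) → Set
  Poly b = ∃[ e ] ∀ x → b x ≤ (2 + size x) ^ e

  n≤2^n : ∀ n → n ≤ 2 ^ n
  n≤2^n zero    = z≤n
  n≤2^n (suc n) = begin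
    suc n         ≤⟨ s≤s (n≤2^n n) ⟩
    1 + 2 ^ n     ≤⟨ +-monoˡ-≤ (2 ^ n) (m^n>0 2 n) ⟩
    2 ^ n + 2 ^ n ≡⟨ cong (2 ^ n +_) (sym (+-identityʳ _)) ⟩
    2 * 2 ^ n     ∎
    where open ≤-Reasoning

  ^-sum : ∀ n a b → (2 + n) ^ a + (2 + n) ^ b ≤ (2 + n) ^ (1 + (a + b))
  ^-sum n a b = begin
    X ^ a + X ^ b             ≤⟨ +-mono-≤ (^-monoʳ-≤ X (m≤m+n a b)) (^-monoʳ-≤ X (m≤n+m b a)) ⟩
    X ^ (a + b) + X ^ (a + b) ≡⟨ cong (X ^ (a + b) +_) (sym (+-identityʳ _)) ⟩
    2 * X ^ (a + b)           ≤⟨ *-monoˡ-≤ (X ^ (a + b)) (m≤m+n 2 n) ⟩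
    X * X ^ (a + b)           ∎
    where
    open ≤-Reasoning
    X = 2 + n

  -- Exponents are kept abstract: unfolding them is expensive and never needed.
  abstract
    poly-≤ : ∀ {b b′} → (∀ x → b x ≤ b′ x) → Poly b′ → Poly b
    poly-≤ b≤b′ (e , p) = e , λ x → ≤-trans (b≤b′ x) (p x)

    poly-const : ∀ n → Poly (λ _ → n)
    poly-const n = n , λ x → ≤-trans (n≤2^n n) (^-monoˡ-≤ n (m≤m+n 2 (size x)))

    poly-size : Poly size
    poly-size = 1 , λ x → ≤-trans (m≤n+m (size x) 2) (≤-reflexive (sym (*-identityʳ (2 + size x))))

    poly-+ : ∀ {b b′} → Poly b → Poly b′ → Poly (λ x → b x + b′ x)
    poly-+ (e , p) (e′ , p′) = 1 + (e + e′) , λ x → ≤-trans (+-mono-≤ (p x) (p′ x)) (^-sum (size x) e e′)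

    poly-* : ∀ {b b′} → Poly b → Poly b′ → Poly (λ x → b x * b′ x)
    poly-* (e , p) (e′ , p′) = e + e′ , λ x →
      ≤-trans (*-mono-≤ (p x) (p′ x)) (≤-reflexive (sym (^-distribˡ-+-* (2 + size x) e e′)))

    poly-^ : ∀ {b} n → Poly b → Poly (λ x → b x ^ n)
    poly-^ n (e , p) = e * n , λ x →
      ≤-trans (^-monoˡ-≤ n (p x)) (≤-reflexive (^-*-assoc (2 + size x) e n))

    poly-∘ : ∀ {b b′} → Poly b → (∀ x → size (f x) ≤ b′ x) → Poly b′ → Poly (b ∘ f)
    poly-∘ {f = f} (e , p) f≤ b′-poly =
      poly-≤ (λ x → ≤-trans (p (f x)) (^-monoˡ-≤ e (+-monoʳ-≤ 2 (f≤ x))))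
             (poly-^ e (poly-+ (poly-const 2) b′-poly))

  size>0 : ∀ x → 0 < size x
  size>0 nil        = s≤s z≤n
  size>0 (cons _ _) = s≤s z≤n

  size-head : ∀ x → size (head x) ≤ size x
  size-head nil        = ≤-refl
  size-head (cons x y) = ≤-trans (m≤m+n (size x) (size y)) (n≤1+n _)

  size-tail : ∀ x → size (tail x) ≤ size x
  size-tail nil        = ≤-refl
  size-tail (cons x y) = ≤-trans (m≤n+m (size y) (size x)) (n≤1+n _)

  ≡ᵇ-refl : ∀ x → (x ≡ᵇ x) ≡ true
  ≡ᵇ-refl zero    = refl
  ≡ᵇ-refl (suc x) = ≡ᵇ-refl x

  get-same : ∀ (σ : Store) x {t} → (σ [ x ↦ t ]) x ≡ t
  get-same σ x rewrite ≡ᵇ-refl x = refl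

  ≢⇒≡ᵇ-false : ∀ x y → x ≢ y → (x ≡ᵇ y) ≡ false
  ≢⇒≡ᵇ-false zero    zero    x≢y = ⊥-elim (x≢y refl)
  ≢⇒≡ᵇ-false zero    (suc y) x≢y = refl
  ≢⇒≡ᵇ-false (suc x) zero    x≢y = refl
  ≢⇒≡ᵇ-false (suc x) (suc y) x≢y = ≢⇒≡ᵇ-false x y (x≢y ∘ cong suc)

  get-other : ∀ (σ : Store) {x y t} → x ≢ y → (σ [ x ↦ t ]) y ≡ σ y
  get-other σ {x} {y} x≢y rewrite ≢⇒≡ᵇ-false x y x≢y = refl

  get-above : ∀ (σ : Store) {x y t} → y < x → (σ [ x ↦ t ]) y ≡ σ y
  get-above σ {x} {y} {t} y<x = get-other σ {x} {y} {t} (λ { refl → <-irrefl refl y<x })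

  -- Functions on trees computed in polynomial time.  The code takes its argument
  -- from and leaves its result in variable b, and it may overwrite the
  -- variables above b but not those below.

  _AgreesBelow_With_ : Store → ℕ → Store → Set
  τ AgreesBelow b With σ = ∀ v → v < b → τ v ≡ σ v

  record PT (f : Tree → Tree) : Set where
    field
      code   : ℕ → Program
      bound  : Tree → ℕ
      poly   : Poly bound
      run    : ∀ b σ → ∃[ τ ] ∃[ t ] ⟨ code b , σ ⟩⇓⟨ τ , t ⟩ ×
               τ b ≡ f (σ b) × τ AgreesBelow b With σ × t ≤ bound (σ b)
      size-≤ : ∀ x → size (f x) ≤ bound x

  open PT

  assignPT : (e : ℕ → Expr) → (∀ b σ → eval (e b) σ ≡ f (σ b)) →
             (b : Tree → ℕ) → Poly b → (∀ x → suc (size (f x)) ≤ b x) → PT f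
  assignPT {f} e e-ok b b-poly f≤ = record
    { code   = λ v → v ≔ e v
    ; bound  = b
    ; poly   = b-poly
    ; run    = λ v σ → σ [ v ↦ eval (e v) σ ] , cost (e v) σ , assign ,
               trans (get-same σ v) (e-ok v σ) , (λ w → get-above σ) ,
               subst (λ t → suc (size t) ≤ b (σ v)) (sym (e-ok v σ)) (f≤ (σ v))
    ; size-≤ = λ x → ≤-trans (n≤1+n _) (f≤ x)
    }

  idPT : PT id
  idPT = assignPT var (λ _ _ → refl) (suc ∘ size) (poly-+ (poly-const 1) poly-size) (λ _ → ≤-refl)

  constPT : ∀ t → PT (λ _ → t)
  constPT t = assignPT (λ _ → literal t) (λ _ _ → refl) (λ _ → suc (size t)) (poly-const _) (λ _ → ≤-refl)

  headPT : PT head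
  headPT = assignPT (headₑ ∘ var) (λ _ _ → refl) (suc ∘ size) (poly-+ (poly-const 1) poly-size) (s≤s ∘ size-head)

  tailPT : PT tail
  tailPT = assignPT (tailₑ ∘ var) (λ _ _ → refl) (suc ∘ size) (poly-+ (poly-const 1) poly-size) (s≤s ∘ size-tail)

  size-encodeBool : ∀ b → size (encodeBool b) ≤ 3
  size-encodeBool false = s≤s z≤n
  size-encodeBool true  = ≤-refl

  eqPT : PT (λ x → encodeBool (treeEq (head x) (tail x)))
  eqPT = assignPT (λ b → headₑ (var b) =? tailₑ (var b)) (λ _ _ → refl) (λ _ → 4) (poly-const 4)
                  (λ x → s≤s (size-encodeBool (treeEq (head x) (tail x))))

  infixr 9 _∘PT_

  _∘PT_ : PT g → PT f → PT (g ∘ f)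
  _∘PT_ {g} {f} G F = record
    { code   = λ b → code F b ⨾ code G b
    ; bound  = λ x → bound F x + bound G (f x)
    ; poly   = poly-+ (poly F) (poly-∘ (poly G) (size-≤ F) (poly F))
    ; run    = λ b σ →
        let τ , t , F⇓ , τb , τ≈σ , t≤ = run F b σ
            ρ , u , G⇓ , ρb , ρ≈τ , u≤ = run G b τ
        in ρ , t + u , sequence F⇓ G⇓ , trans ρb (cong g τb) ,
           (λ v v<b → trans (ρ≈τ v v<b) (τ≈σ v v<b)) ,
           +-mono-≤ t≤ (subst (λ z → u ≤ bound G z) τb u≤)
    ; size-≤ = λ x → ≤-trans (size-≤ G (f x)) (m≤n+m _ (bound F x))
    }

  consPT : PT f → PT g → PT (λ x → cons (f x) (g x))
  consPT {f} {g} F G = record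
    -- The second argument is computed one variable higher than the first, so that the code for it
    -- leaves the first result intact.
    { code   = λ b → (1 + b) ≔ var b ⨾ code F (1 + b) ⨾ (2 + b) ≔ var b ⨾ code G (2 + b) ⨾
                     b ≔ consₑ (var (1 + b)) (var (2 + b))
    ; bound  = B
    ; poly   = poly-+ p (poly-+ (poly F) (poly-+ p (poly-+ (poly G)
                 (poly-+ (poly-const 2) (poly-+ (poly F) (poly G))))))
    ; run    = go
    ; size-≤ = λ x → ≤-trans (n≤1+n _) (≤-trans (s≤s (s≤s (+-mono-≤ (size-≤ F x) (size-≤ G x))))
                 (≤-trans (m≤n+m _ (bound G x)) (≤-trans (m≤n+m _ (1 + size x))
                 (≤-trans (m≤n+m _ (bound F x)) (m≤n+m _ (1 + size x))))))
    }
    where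
    p : Poly (λ x → 1 + size x)
    p = poly-+ (poly-const 1) poly-size

    B : Tree → ℕ
    B x = (1 + size x) + (bound F x + ((1 + size x) + (bound G x + (2 + (bound F x + bound G x)))))

    go : ∀ b σ → _
    go b σ =
      let σ₁ = σ [ 1 + b ↦ σ b ]
          τ₁ , t₁ , F⇓ , τ₁b , τ₁≈ , t₁≤ = run F (1 + b) σ₁
          b₁ = trans (τ₁≈ b ≤-refl) (get-above σ ≤-refl)
          σ₂ = τ₁ [ 2 + b ↦ τ₁ b ]
          τ₂ , t₂ , G⇓ , τ₂b , τ₂≈ , t₂≤ = run G (2 + b) σ₂
          f-ok = trans (τ₂≈ (1 + b) ≤-refl) (trans (get-above τ₁ ≤-refl)
                   (trans τ₁b (cong f (get-same σ (1 + b)))))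
          g-ok = trans τ₂b (cong g (trans (get-same τ₁ (2 + b)) b₁))
          res  = cong₂ cons f-ok g-ok
          ρ    = τ₂ [ b ↦ cons (τ₂ (1 + b)) (τ₂ (2 + b)) ]
          t₁≤′ = subst (λ z → t₁ ≤ bound F z) (get-same σ (1 + b)) t₁≤
          t₂≤′ = subst (λ z → t₂ ≤ bound G z) (trans (get-same τ₁ (2 + b)) b₁) t₂≤
      in ρ , _ , sequence assign (sequence F⇓ (sequence assign (sequence G⇓ assign))) ,
         trans (get-same τ₂ b) res ,
         (λ v v<b → trans (get-above τ₂ v<b) (trans (τ₂≈ v (m≤n⇒m≤1+n (m≤n⇒m≤1+n v<b)))
           (trans (get-above τ₁ (m≤n⇒m≤1+n (m≤n⇒m≤1+n v<b))) (trans (τ₁≈ v (m≤n⇒m≤1+n v<b))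
             (get-above σ (m≤n⇒m≤1+n v<b)))))) ,
         +-monoʳ-≤ (1 + size (σ b)) (+-mono-≤ t₁≤′ (+-mono-≤
           (≤-reflexive (cong (suc ∘ size) b₁)) (+-mono-≤ t₂≤′
           (subst (λ z → suc (size z) ≤ 2 + (bound F (σ b) + bound G (σ b))) (sym res)
             (s≤s (s≤s (+-mono-≤ (size-≤ F (σ b)) (size-≤ G (σ b)))))))))

  ifT : Tree → Tree → Tree → Tree
  ifT nil        t e = e
  ifT (cons _ _) t e = t

  ifPT : PT f → PT g → PT h → PT (λ x → ifT (f x) (g x) (h x))
  ifPT {f} {g} {h} F G H = record
    { code   = λ b → (1 + b) ≔ var b ⨾ code F (1 + b) ⨾ (if var (1 + b) then code G b else′ code H b)
    ; bound  = λ x → (1 + size x) + (bound F x + (suc (bound F x) + (bound G x + bound H x)))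
    ; poly   = poly-+ (poly-+ (poly-const 1) poly-size) (poly-+ (poly F)
                 (poly-+ (poly-+ (poly-const 1) (poly F)) (poly-+ (poly G) (poly H))))
    ; run    = go
    ; size-≤ = λ x → ≤-trans (if-≤ (f x) (size-≤ G x) (size-≤ H x))
                 (≤-trans (m≤n+m _ (suc (bound F x))) (≤-trans (m≤n+m _ (bound F x)) (m≤n+m _ (1 + size x))))
    }
    where
    if-≤ : ∀ c {t e m n} → size t ≤ m → size e ≤ n → size (ifT c t e) ≤ m + n
    if-≤ nil        t≤ e≤ = m≤n⇒m≤o+n _ e≤
    if-≤ (cons _ _) t≤ e≤ = m≤n⇒m≤n+o _ t≤

    go : ∀ b σ → _
    go b σ with run F (1 + b) (σ [ 1 + b ↦ σ b ])
    ... | τ , t , F⇓ , τb , τ≈ , t≤ = finish (τ (1 + b)) refl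
      where
      f-ok : τ (1 + b) ≡ f (σ b)
      f-ok = trans τb (cong f (get-same σ (1 + b)))
      b-ok : τ b ≡ σ b
      b-ok = trans (τ≈ b ≤-refl) (get-above σ ≤-refl)
      below : τ AgreesBelow b With σ
      below v v<b = trans (τ≈ v (m≤n⇒m≤1+n v<b)) (get-above σ (m≤n⇒m≤1+n v<b))
      t≤′ = subst (λ z → t ≤ bound F z) (get-same σ (1 + b)) t≤
      c≤ : suc (size (τ (1 + b))) ≤ suc (bound F (σ b))
      c≤ = s≤s (≤-trans (≤-reflexive (cong size f-ok)) (size-≤ F (σ b)))

      finish : ∀ c → τ (1 + b) ≡ c → _
      finish nil eq =
        let ρ , u , H⇓ , ρb , ρ≈ , u≤ = run H b τ
        in ρ , _ , sequence assign (sequence F⇓ (if-false eq H⇓)) ,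
           trans ρb (trans (cong h b-ok) (cong (λ z → ifT z (g (σ b)) (h (σ b))) (trans (sym eq) f-ok))) ,
           (λ v v<b → trans (ρ≈ v v<b) (below v v<b)) ,
           +-monoʳ-≤ (1 + size (σ b)) (+-mono-≤ t≤′ (+-mono-≤ c≤
             (m≤n⇒m≤o+n _ (subst (λ z → u ≤ bound H z) b-ok u≤))))
      finish (cons x y) eq =
        let ρ , u , G⇓ , ρb , ρ≈ , u≤ = run G b τ
        in ρ , _ , sequence assign (sequence F⇓ (if-true (λ n → case trans (sym n) eq of λ ()) G⇓)) ,
           trans ρb (trans (cong g b-ok) (cong (λ z → ifT z (g (σ b)) (h (σ b))) (trans (sym eq) f-ok))) ,
           (λ v v<b → trans (ρ≈ v v<b) (below v v<b)) ,
           +-monoʳ-≤ (1 + size (σ b)) (+-mono-≤ t≤′ (+-mono-≤ c≤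
             (m≤n⇒m≤n+o _ (subst (λ z → u ≤ bound G z) b-ok u≤))))

  -- The step function sees the whole remaining list, not only its first element.
  foldT : (Tree → Tree) → Tree → Tree → Tree → Tree
  foldT s env nil         acc = acc
  foldT s env (cons x xs) acc = foldT s env xs (s (cons env (cons (cons x xs) acc)))

  -- Growth by a summand independent of the accumulator is what keeps the size of
  -- the accumulator polynomial over the whole loop.
  AdditiveGrowth : (Tree → Tree) → Set
  AdditiveGrowth s = ∃[ e ] ∀ env xs acc →
    size (s (cons env (cons xs acc))) ≤ size acc + (2 + (size env + size xs)) ^ e

  foldOn : (Tree → Tree) → Tree → Tree
  foldOn s x = foldT s (head x) (head (tail x)) (tail (tail x))

  foldT-size : ∀ {s} (gr : AdditiveGrowth s) env xs acc R → size xs ≤ R →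
    size (foldT s env xs acc) ≤ size acc + size xs * (2 + (size env + R)) ^ proj₁ gr
  foldT-size gr env nil acc R xs≤R = m≤m+n _ _
  foldT-size {s} gr@(e , p) env (cons x xs) acc R xs≤R = begin
    size (foldT s env xs acc′)               ≤⟨ foldT-size gr env xs acc′ R (≤-trans (size-tail (cons x xs)) xs≤R) ⟩
    size acc′ + size xs * A                  ≤⟨ +-monoˡ-≤ _ (p env (cons x xs) acc) ⟩
    size acc + (2 + (size env + size (cons x xs))) ^ e + size xs * A
      ≤⟨ +-monoˡ-≤ _ (+-monoʳ-≤ (size acc) (^-monoˡ-≤ e (+-monoʳ-≤ 2 (+-monoʳ-≤ (size env) xs≤R)))) ⟩
    size acc + A + size xs * A               ≡⟨ +-assoc (size acc) A _ ⟩
    size acc + (A + size xs * A)             ≤⟨ +-monoʳ-≤ (size acc) (+-monoʳ-≤ A (*-monoˡ-≤ A (m≤n+m (size xs) (size x)))) ⟩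
    size acc + size (cons x xs) * A          ∎
    where
    open ≤-Reasoning
    acc′ = s (cons env (cons (cons x xs) acc))
    A = (2 + (size env + R)) ^ e

  -- Variables `1 + b` and `2 + b` hold the environment and the remaining list, `b` the accumulator.
  -- Additive growth keeps the accumulator below `Z x`, so a pass with its test costs at most `C x`,
  -- and the size of the list pays for all passes and the final test.
  foldPT : ∀ {s} → PT s → AdditiveGrowth s → PT (foldOn s)
  foldPT {s} S gr@(e , growth) = record
    { code   = λ b → (1 + b) ≔ headₑ (var b) ⨾ (2 + b) ≔ headₑ (tailₑ (var b)) ⨾
                     b ≔ tailₑ (tailₑ (var b)) ⨾ while var (2 + b) run body b
    ; bound  = λ x → (1 + size x) + ((1 + size x) + ((1 + size x) + (Z x + size x * C x)))
    ; poly   = poly-+ p (poly-+ p (poly-+ p (poly-+ Z-poly (poly-* poly-size C-poly))))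
    ; run    = go
    ; size-≤ = λ x → ≤-trans (out≤Z x) (≤-trans (m≤m+n (Z x) _)
                 (≤-trans (m≤n+m _ (1 + size x)) (≤-trans (m≤n+m _ (1 + size x)) (m≤n+m _ (1 + size x)))))
    }
    where
    body : ℕ → Program
    body b = (3 + b) ≔ consₑ (var (1 + b)) (consₑ (var (2 + b)) (var b)) ⨾
             code S (3 + b) ⨾ b ≔ var (3 + b) ⨾ (2 + b) ≔ tailₑ (var (2 + b))

    es = proj₁ (poly S)

    A Z I C : Tree → ℕ
    A x = (2 + (size x + size x)) ^ e
    Z x = size x + size x * A x
    I x = 2 + (size x + (size x + Z x))
    C x = (1 + size x) + ((1 + I x) + ((2 + I x) ^ es + ((1 + Z x) + (1 + size x))))

    p = poly-+ (poly-const 1) poly-size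
    Z-poly : Poly Z
    Z-poly = poly-+ poly-size (poly-* poly-size (poly-^ e (poly-+ (poly-const 2) (poly-+ poly-size poly-size))))
    I-poly : Poly I
    I-poly = poly-+ (poly-const 2) (poly-+ poly-size (poly-+ poly-size Z-poly))
    C-poly : Poly C
    C-poly = poly-+ p (poly-+ (poly-+ (poly-const 1) I-poly)
               (poly-+ (poly-^ es (poly-+ (poly-const 2) I-poly)) (poly-+ (poly-+ (poly-const 1) Z-poly) p)))

    acc₀≤ : ∀ x → size (tail (tail x)) ≤ size x
    acc₀≤ x = ≤-trans (size-tail (tail x)) (size-tail x)
    xs₀≤ : ∀ x → size (head (tail x)) ≤ size x
    xs₀≤ x = ≤-trans (size-head (tail x)) (size-tail x)

    out≤Z : ∀ x → size (foldOn s x) ≤ Z x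
    out≤Z x = ≤-trans (foldT-size {s} gr (head x) (head (tail x)) (tail (tail x)) (size x) (xs₀≤ x))
      (+-mono-≤ (acc₀≤ x) (*-mono-≤ (xs₀≤ x) (^-monoˡ-≤ e (+-monoʳ-≤ 2 (+-monoˡ-≤ (size x) (size-head x))))))

    -- The invariant reserves `A x` for every node of the remaining list; each pass pays for the
    -- growth of the accumulator from this reserve.
    loop : ∀ b x env xs σ → σ (1 + b) ≡ env → σ (2 + b) ≡ xs → size env ≤ size x → size xs ≤ size x →
           size (σ b) + size xs * A x ≤ Z x →
           ∃[ τ ] ∃[ t ] ⟨ while var (2 + b) run body b , σ ⟩⇓⟨ τ , t ⟩ ×
             τ b ≡ foldT s env xs (σ b) × τ AgreesBelow b With σ × t ≤ size xs * C x
    loop b x env nil σ e≡ xs≡ env≤ xs≤ inv = σ , _ , while-false xs≡ , refl , (λ _ _ → refl) ,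
      ≤-trans (≤-reflexive (cong (suc ∘ size) xs≡))
        (≤-trans (s≤s (size>0 x)) (≤-trans (m≤m+n (1 + size x) _) (≤-reflexive (sym (+-identityʳ _)))))
    loop b x env (cons y ys) σ refl xs≡ env≤ xs≤ inv =
      let inp = cons (σ (1 + b)) (cons (σ (2 + b)) (σ b))
          inp≡ = cong (λ z → cons (σ (1 + b)) (cons z (σ b))) xs≡
          σ₁ = σ [ 3 + b ↦ inp ]
          τ₁ , t₁ , S⇓ , τ₁b , τ₁≈ , t₁≤ = run S (3 + b) σ₁
          keep = λ v (v<3+b : v < 3 + b) → trans (τ₁≈ v v<3+b) (get-above σ v<3+b)
          τ₁b′ = trans τ₁b (cong s (trans (get-same σ (3 + b)) inp≡))
          acc′ = s (cons env (cons (cons y ys) (σ b)))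
          σ₂ = τ₁ [ b ↦ τ₁ (3 + b) ]
          σ₂2 = trans (get-other τ₁ {b} {2 + b} (<⇒≢ (m≤n⇒m≤1+n ≤-refl))) (trans (keep (2 + b) ≤-refl) xs≡)
          σ₃ = σ₂ [ 2 + b ↦ tail (σ₂ (2 + b)) ]
          σ₃b = trans (get-above σ₂ (m≤n⇒m≤1+n ≤-refl)) (trans (get-same τ₁ b) τ₁b′)
          σ₃1 = trans (get-above σ₂ ≤-refl) (trans (get-other τ₁ {b} {1 + b} (<⇒≢ ≤-refl))
                  (keep (1 + b) (m≤n⇒m≤1+n ≤-refl)))
          σ₃2 = trans (get-same σ₂ (2 + b)) (cong tail σ₂2)
          grow = ≤-trans (growth env (cons y ys) (σ b))
                   (+-monoʳ-≤ (size (σ b)) (^-monoˡ-≤ e (+-monoʳ-≤ 2 (+-mono-≤ env≤ xs≤))))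
          inv′ = begin
            size acc′ + size ys * A x              ≤⟨ +-monoˡ-≤ _ grow ⟩
            size (σ b) + A x + size ys * A x       ≡⟨ +-assoc (size (σ b)) (A x) _ ⟩
            size (σ b) + (A x + size ys * A x)     ≤⟨ +-monoʳ-≤ (size (σ b)) (+-monoʳ-≤ (A x) (*-monoˡ-≤ (A x) (m≤n+m (size ys) (size y)))) ⟩
            size (σ b) + size (cons y ys) * A x    ≤⟨ inv ⟩
            Z x                                    ∎
          ρ , u , W⇓ , ρb , ρ≈ , u≤ = loop b x env ys σ₃ σ₃1 σ₃2 env≤
            (≤-trans (size-tail (cons y ys)) xs≤)
            (subst (λ z → size z + size ys * A x ≤ Z x) (sym σ₃b) inv′)
          inp≤ : size inp ≤ I x
          inp≤ = ≤-trans (≤-reflexive (cong size inp≡)) (≤-trans (≤-reflexive (+-suc (suc (size env)) _))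
                   (s≤s (s≤s (+-mono-≤ env≤ (+-mono-≤ xs≤ (≤-trans (m≤m+n _ _) inv))))))
          acc′≤ = ≤-trans (m≤m+n _ _) inv′
      in ρ , _ ,
         while-true (λ n → case trans (sym n) xs≡ of λ ())
           (sequence assign (sequence S⇓ (sequence assign assign))) W⇓ ,
         trans ρb (cong (foldT s env ys) σ₃b) ,
         (λ v v<b → trans (ρ≈ v v<b) (trans (get-above σ₂ (m≤n⇒m≤1+n (m≤n⇒m≤1+n v<b)))
           (trans (get-above τ₁ v<b) (keep v (m≤n⇒m≤1+n (m≤n⇒m≤1+n (m≤n⇒m≤1+n v<b))))))) ,
         (begin
           suc (size (σ (2 + b))) + ((suc (size inp) + (t₁ + (suc (size (τ₁ (3 + b))) + suc (size (tail (σ₂ (2 + b))))))) + u)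
             ≡⟨ +-assoc (suc (size (σ (2 + b)))) _ u ⟨
           suc (size (σ (2 + b))) + (suc (size inp) + (t₁ + (suc (size (τ₁ (3 + b))) + suc (size (tail (σ₂ (2 + b))))))) + u
             ≤⟨ +-mono-≤ (+-mono-≤ (s≤s (≤-trans (≤-reflexive (cong size xs≡)) xs≤))
                  (+-mono-≤ (s≤s inp≤) (+-mono-≤
                    (≤-trans t₁≤ (≤-trans (proj₂ (poly S) _) (^-monoˡ-≤ es (+-monoʳ-≤ 2
                      (≤-trans (≤-reflexive (cong size (get-same σ (3 + b)))) inp≤)))))
                    (+-mono-≤ (s≤s (≤-trans (≤-reflexive (cong size τ₁b′)) acc′≤))
                              (s≤s (≤-trans (≤-reflexive (cong (size ∘ tail) σ₂2))
                                     (≤-trans (size-tail (cons y ys)) xs≤)))))))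
                  u≤ ⟩
           C x + size ys * C x      ≤⟨ +-monoʳ-≤ (C x) (*-monoˡ-≤ (C x) (m≤n+m (size ys) (size y))) ⟩
           size (cons y ys) * C x   ∎)
      where open ≤-Reasoning

    go : ∀ b σ → _
    go b σ =
      let x  = σ b
          σ₁ = σ [ 1 + b ↦ head x ]
          σ₁b = get-above σ {1 + b} {b} ≤-refl
          σ₂ = σ₁ [ 2 + b ↦ head (tail (σ₁ b)) ]
          σ₂b = trans (get-above σ₁ {2 + b} {b} (m≤n⇒m≤1+n ≤-refl)) σ₁b
          σ₃ = σ₂ [ b ↦ tail (tail (σ₂ b)) ]
          σ₃b = trans (get-same σ₂ b) (cong (tail ∘ tail) σ₂b)
          σ₃1 = trans (get-other σ₂ {b} {1 + b} (<⇒≢ ≤-refl)) (trans (get-above σ₁ ≤-refl) (get-same σ (1 + b)))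
          σ₃2 = trans (get-other σ₂ {b} {2 + b} (<⇒≢ (m≤n⇒m≤1+n ≤-refl)))
                  (trans (get-same σ₁ (2 + b)) (cong (head ∘ tail) σ₁b))
          ρ , u , W⇓ , ρb , ρ≈ , u≤ = loop b x (head x) (head (tail x)) σ₃ σ₃1 σ₃2 (size-head x) (xs₀≤ x)
            (+-mono-≤ (≤-trans (≤-reflexive (cong size σ₃b)) (acc₀≤ x)) (*-monoˡ-≤ (A x) (xs₀≤ x)))
      in ρ , _ , sequence assign (sequence assign (sequence assign W⇓)) ,
         trans ρb (cong (foldT s (head x) (head (tail x))) σ₃b) ,
         (λ v v<b → trans (ρ≈ v v<b) (trans (get-above σ₂ v<b) (trans (get-above σ₁ (m≤n⇒m≤1+n (m≤n⇒m≤1+n v<b)))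
           (get-above σ (m≤n⇒m≤1+n v<b))))) ,
         +-mono-≤ (s≤s (size-head x)) (+-mono-≤ (s≤s (≤-trans (≤-reflexive (cong (size ∘ head ∘ tail) σ₁b)) (xs₀≤ x)))
           (+-mono-≤ (s≤s (≤-trans (≤-reflexive (cong (size ∘ tail ∘ tail) σ₂b)) (acc₀≤ x)))
             (≤-trans u≤ (≤-trans (*-monoˡ-≤ (C x) (xs₀≤ x)) (m≤n+m _ (Z x))))))

  -- Arbitrary polynomial-time programs as components of larger ones

  private variable
    p : Program

  ⇓-deterministic : ∀ {σ τ τ′ t t′} → ⟨ p , σ ⟩⇓⟨ τ , t ⟩ → ⟨ p , σ ⟩⇓⟨ τ′ , t′ ⟩ → τ ≡ τ′
  ⇓-deterministic assign assign = refl
  ⇓-deterministic (sequence a b) (sequence a′ b′) with ⇓-deterministic a a′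
  ... | refl = ⇓-deterministic b b′
  ⇓-deterministic (if-true _ a)    (if-true _ b)    = ⇓-deterministic a b
  ⇓-deterministic (if-true n _)    (if-false y _)   = ⊥-elim (n y)
  ⇓-deterministic (if-false y _)   (if-true n _)    = ⊥-elim (n y)
  ⇓-deterministic (if-false _ a)   (if-false _ b)   = ⇓-deterministic a b
  ⇓-deterministic (while-true n _ _) (while-false y) = ⊥-elim (n y)
  ⇓-deterministic (while-false y) (while-true n _ _) = ⊥-elim (n y)
  ⇓-deterministic (while-false _) (while-false _)   = refl
  ⇓-deterministic (while-true _ a b) (while-true _ a′ b′) with ⇓-deterministic a a′
  ... | refl = ⇓-deterministic b b′

  -- An assignment costs more than the size of the value it stores, so the time spent pays for the
  -- growth of every variable. This bounds the output of a foreign program, about which only the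
  -- running time is known.
  ⇓-size : ∀ {σ τ t} → ⟨ p , σ ⟩⇓⟨ τ , t ⟩ → ∀ v → size (τ v) ≤ size (σ v) + t
  ⇓-size (assign {x} {e} {σ}) v with x ≡ᵇ v
  ... | true  = m≤n⇒m≤o+n (size (σ v)) (n≤1+n _)
  ... | false = m≤m+n _ _
  ⇓-size {σ = σ} (sequence {t = t} a b) v =
    ≤-trans (⇓-size b v) (≤-trans (+-monoˡ-≤ _ (⇓-size a v)) (≤-reflexive (+-assoc (size (σ v)) t _)))
  ⇓-size {σ = σ} (if-true {e} _ a)  v = ≤-trans (⇓-size a v) (+-monoʳ-≤ (size (σ v)) (m≤n+m _ (cost e σ)))
  ⇓-size {σ = σ} (if-false {e} _ a) v = ≤-trans (⇓-size a v) (+-monoʳ-≤ (size (σ v)) (m≤n+m _ (cost e σ)))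
  ⇓-size {σ = σ} (while-true {e} {t = t} _ a b) v =
    ≤-trans (⇓-size b v) (≤-trans (+-monoˡ-≤ _ (⇓-size a v))
      (≤-trans (≤-reflexive (+-assoc (size (σ v)) t _)) (+-monoʳ-≤ (size (σ v)) (m≤n+m _ (cost e σ)))))
  ⇓-size (while-false _) v = m≤m+n _ _

  shiftE : ℕ → Expr → Expr
  shiftE b (var x)     = var (b + x)
  shiftE b (literal t) = literal t
  shiftE b (consₑ e f) = consₑ (shiftE b e) (shiftE b f)
  shiftE b (headₑ e)   = headₑ (shiftE b e)
  shiftE b (tailₑ e)   = tailₑ (shiftE b e)
  shiftE b (e =? f)    = shiftE b e =? shiftE b f

  shift : ℕ → Program → Program
  shift b (x ≔ e)                 = (b + x) ≔ shiftE b e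
  shift b (p ⨾ q)                 = shift b p ⨾ shift b q
  shift b (if e then p else′ q)   = if shiftE b e then shift b p else′ shift b q
  shift b (while e run p)         = while shiftE b e run shift b p

  varsE : Expr → ℕ
  varsE (var x)     = suc x
  varsE (literal t) = 0
  varsE (consₑ e f) = varsE e ⊔ varsE f
  varsE (headₑ e)   = varsE e
  varsE (tailₑ e)   = varsE e
  varsE (e =? f)    = varsE e ⊔ varsE f

  vars : Program → ℕ
  vars (x ≔ e)               = suc x ⊔ varsE e
  vars (p ⨾ q)               = vars p ⊔ vars q
  vars (if e then p else′ q) = varsE e ⊔ (vars p ⊔ vars q)
  vars (while e run p)       = varsE e ⊔ vars p

  _≈[_+,_]_ : Store → ℕ → ℕ → Store → Set
  σ′ ≈[ b +, m ] σ = ∀ v → v < m → σ′ (b + v) ≡ σ v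

  shiftE-eval : ∀ {b m σ σ′} e → varsE e ≤ m → σ′ ≈[ b +, m ] σ → eval (shiftE b e) σ′ ≡ eval e σ
  shiftE-eval (var x)     x<m ≈ = ≈ x x<m
  shiftE-eval (literal t) _   ≈ = refl
  shiftE-eval (consₑ e f) ≤m  ≈ = cong₂ cons (shiftE-eval e (m⊔n≤o⇒m≤o _ _ ≤m) ≈) (shiftE-eval f (m⊔n≤o⇒n≤o _ _ ≤m) ≈)
  shiftE-eval (headₑ e)   ≤m  ≈ = cong head (shiftE-eval e ≤m ≈)
  shiftE-eval (tailₑ e)   ≤m  ≈ = cong tail (shiftE-eval e ≤m ≈)
  shiftE-eval (e =? f)    ≤m  ≈ =
    cong₂ (λ x y → encodeBool (treeEq x y)) (shiftE-eval e (m⊔n≤o⇒m≤o _ _ ≤m) ≈) (shiftE-eval f (m⊔n≤o⇒n≤o _ _ ≤m) ≈)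

  -- All variables of the program lie below `m`, so agreement of the stores there is enough; the
  -- shifted program cannot reach the variables below `b`.
  shift-run : ∀ {b m σ σ′ τ t} → vars p ≤ m → σ′ ≈[ b +, m ] σ → ⟨ p , σ ⟩⇓⟨ τ , t ⟩ →
    ∃[ τ′ ] ⟨ shift b p , σ′ ⟩⇓⟨ τ′ , t ⟩ × τ′ ≈[ b +, m ] τ × τ′ AgreesBelow b With σ′
  shift-run {b = b} {m} {σ} {σ′} ≤m ≈ (assign {x} {e}) =
    ρ , subst (λ z → ⟨ shift b (x ≔ e) , σ′ ⟩⇓⟨ ρ , suc (size z) ⟩) e-ok assign , upd ,
    λ v v<b → get-above σ′ (m≤n⇒m≤n+o x v<b)
    where
    ρ = σ′ [ b + x ↦ eval (shiftE b e) σ′ ]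
    e-ok = shiftE-eval e (m⊔n≤o⇒n≤o _ _ ≤m) ≈
    upd : ∀ v → v < m → _
    upd v v<m with x ≟ v
    ... | yes refl = trans (get-same σ′ (b + x)) (trans e-ok (sym (get-same σ x)))
    ... | no x≢v   = trans (get-other σ′ (x≢v ∘ +-cancelˡ-≡ b x v)) (trans (≈ v v<m) (sym (get-other σ x≢v)))
  shift-run ≤m ≈ (sequence {p} {q} a b) =
    let τ₁ , a′ , ≈₁ , below₁ = shift-run (m⊔n≤o⇒m≤o _ _ ≤m) ≈ a
        τ₂ , b′ , ≈₂ , below₂ = shift-run (m⊔n≤o⇒n≤o (vars p) _ ≤m) ≈₁ b
    in τ₂ , sequence a′ b′ , ≈₂ , λ v v<b → trans (below₂ v v<b) (below₁ v v<b)
  shift-run {σ = σ} {σ′} ≤m ≈ (if-true {e} {p} {q} {t = t} n a) =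
    let τ , a′ , ≈′ , below = shift-run (m⊔n≤o⇒m≤o (vars p) (vars q) (m⊔n≤o⇒n≤o (varsE e) _ ≤m)) ≈ a
        e-ok = shiftE-eval e (m⊔n≤o⇒m≤o _ _ ≤m) ≈
    in τ , subst (λ z → ⟨ _ , _ ⟩⇓⟨ τ , suc (size z) + t ⟩) e-ok (if-true (n ∘ trans (sym e-ok)) a′) , ≈′ , below
  shift-run {σ = σ} {σ′} ≤m ≈ (if-false {e} {p} {q} {t = t} n a) =
    let τ , a′ , ≈′ , below = shift-run (m⊔n≤o⇒n≤o (vars p) (vars q) (m⊔n≤o⇒n≤o (varsE e) _ ≤m)) ≈ a
        e-ok = shiftE-eval e (m⊔n≤o⇒m≤o _ _ ≤m) ≈
    in τ , subst (λ z → ⟨ _ , _ ⟩⇓⟨ τ , suc (size z) + t ⟩) e-ok (if-false (trans e-ok n) a′) , ≈′ , below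
  shift-run ≤m ≈ (while-true {e} {p} {t = t} {u} n a b) =
    let τ₁ , a′ , ≈₁ , below₁ = shift-run (m⊔n≤o⇒n≤o (varsE e) _ ≤m) ≈ a
        τ₂ , b′ , ≈₂ , below₂ = shift-run ≤m ≈₁ b
        e-ok = shiftE-eval e (m⊔n≤o⇒m≤o _ _ ≤m) ≈
    in τ₂ , subst (λ z → ⟨ _ , _ ⟩⇓⟨ τ₂ , suc (size z) + (t + u) ⟩) e-ok (while-true (n ∘ trans (sym e-ok)) a′ b′) ,
       ≈₂ , λ v v<b → trans (below₂ v v<b) (below₁ v v<b)
  shift-run {b = b} {σ′ = σ′} ≤m ≈ (while-false {e} {p} n) =
    let e-ok = shiftE-eval e (m⊔n≤o⇒m≤o _ _ ≤m) ≈
    in σ′ , subst (λ z → ⟨ shift b (while e run p) , σ′ ⟩⇓⟨ σ′ , suc (size z) ⟩) e-ok (while-false (trans e-ok n)) ,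
       ≈ , λ _ _ → refl

  -- A program expects every variable but its input to be `nil`. Only finitely many occur in it, so
  -- clearing these suffices. Assigning `b` to itself stands for the empty command.
  clear : ℕ → ℕ → Program
  clear b zero    = b ≔ var b
  clear b (suc m) = (b + suc m) ≔ literal nil ⨾ clear b m

  clear-run : ∀ b m σ → ∃[ τ ] ∃[ t ] ⟨ clear b m , σ ⟩⇓⟨ τ , t ⟩ × τ b ≡ σ b ×
    (∀ v → v < m → τ (b + suc v) ≡ nil) × (∀ v → b + m < v → τ v ≡ σ v) ×
    τ AgreesBelow b With σ × t ≤ 2 * m + suc (size (σ b))
  clear-run b zero σ = σ [ b ↦ σ b ] , _ , assign , get-same σ b , (λ _ ()) ,
    (λ v b<v → get-other σ (<⇒≢ (subst (_< v) (+-identityʳ b) b<v))) , (λ v → get-above σ) , ≤-refl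
  clear-run b (suc m) σ =
    let σ₁ = σ [ b + suc m ↦ nil ]
        b≢ = λ eq → <-irrefl (sym eq) (m<m+n b (s≤s z≤n))
        τ , t , c⇓ , τb , τ-nil , τ-above , τ≈ , t≤ = clear-run b m σ₁
        σ₁b = get-other σ {b + suc m} {b} b≢
        cleared = λ v (v<1+m : v < suc m) → case m≤n⇒m<n∨m≡n v<1+m of λ where
          (inj₁ v<m) → τ-nil v (s≤s⁻¹ v<m)
          (inj₂ refl) → trans (τ-above (b + suc m) (+-monoʳ-< b ≤-refl)) (get-same σ (b + suc m))
    in τ , _ , sequence assign c⇓ , trans τb σ₁b , cleared ,
       (λ v lt → trans (τ-above v (<-trans (+-monoʳ-< b ≤-refl) lt)) (get-other σ (<⇒≢ lt))) ,
       (λ v v<b → trans (τ≈ v v<b) (get-above σ (m≤n⇒m≤n+o (suc m) v<b))) ,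
       ≤-trans (+-monoʳ-≤ 2 (subst (λ z → t ≤ 2 * m + suc (size z)) σ₁b t≤))
         (≤-reflexive (trans (sym (+-assoc 2 (2 * m) _)) (cong (_+ suc (size (σ b))) (sym (*-suc 2 m)))))

  programPT : (P : PolynomialTime p) → PT (λ x → proj₁ (proj₂ (proj₂ P) x))
  programPT {p} (c , k , runs) = record
    { code   = λ b → clear b m ⨾ shift b p
    ; bound  = B
    ; poly   = poly-+ (poly-+ (poly-const (2 * m)) (poly-+ (poly-const 1) poly-size))
                 (poly-* (poly-const c) (poly-^ k poly-size))
    ; run    = go
    ; size-≤ = out
    }
    where
    m = suc (vars p)
    B : Tree → ℕ
    B x = (2 * m + suc (size x)) + c * size x ^ k

    go : ∀ b σ → ∃[ τ ] ∃[ t ] ⟨ clear b m ⨾ shift b p , σ ⟩⇓⟨ τ , t ⟩ ×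
         τ b ≡ proj₁ (runs (σ b)) × τ AgreesBelow b With σ × t ≤ B (σ b)
    go b σ with clear-run b m σ | runs (σ b)
    ... | τ , t , c⇓ , τb , τ-nil , _ , τ≈ , t≤ | y , u , (ρ , p⇓ , ρ0) , u≤ =
      let ρ′ , p⇓′ , ≈ρ , below = shift-run {b = b} {m} {initial (σ b)} {τ} (n≤1+n _) init p⇓
      in ρ′ , _ , sequence c⇓ p⇓′ ,
         trans (subst (λ z → ρ′ z ≡ ρ 0) (+-identityʳ b) (≈ρ 0 (s≤s z≤n))) ρ0 ,
         (λ v v<b → trans (below v v<b) (τ≈ v v<b)) , +-mono-≤ t≤ u≤
      where
      init : ∀ v → v < m → τ (b + v) ≡ initial (σ b) v
      init zero    _   = trans (cong τ (+-identityʳ b)) τb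
      init (suc v) v<m = τ-nil v (<⇒≤ v<m)

    out : ∀ x → size (proj₁ (runs x)) ≤ B x
    out x with runs x
    ... | y , u , (ρ , p⇓ , refl) , u≤ = ≤-trans (⇓-size p⇓ 0)
      (+-mono-≤ (≤-trans (n≤1+n (size x)) (m≤n+m _ (2 * m))) u≤)

  -- `PolynomialTime` and `Outputs` each supply some run on the input. Determinism identifies their
  -- results, so the function composed with the reduction is the one that `Approximates` speaks of.
  outputs-unique : (P : PolynomialTime p) → ∀ {x y} → Outputs p x y → proj₁ (proj₂ (proj₂ P) x) ≡ y
  outputs-unique (c , k , runs) {x} (t , τ , p⇓ , τ0) with runs x
  ... | y , u , (ρ , q⇓ , ρ0) , _ = trans (sym ρ0) (trans (cong (λ s → s 0) (⇓-deterministic q⇓ p⇓)) τ0)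

  ^-distribʳ-* : ∀ n a b → (a * b) ^ n ≡ a ^ n * b ^ n
  ^-distribʳ-* zero    a b = refl
  ^-distribʳ-* (suc n) a b = trans (cong (a * b *_) (^-distribʳ-* n a b)) (swap a b (a ^ n) (b ^ n))
    where
    swap : ∀ a b c d → a * b * (c * d) ≡ a * c * (b * d)
    swap = solve-∀

  toProgram : PT f → ∃[ p ] PolynomialTime p × (∀ x → Outputs p x (f x))
  toProgram {f} F = code F 0 , (3 ^ e , e , λ x → f x , proj₁ (proj₂ (run′ x)) , proj₁ (proj₂ (proj₂ (run′ x))) ,
      proj₂ (proj₂ (proj₂ (run′ x)))) ,
    λ x → _ , proj₁ (proj₂ (proj₂ (run′ x)))
    where
    e = proj₁ (poly F)
    run′ : ∀ x → ∃[ y ] ∃[ t ] Run (code F 0) x (f x) t × t ≤ 3 ^ e * size x ^ e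
    run′ x = let τ , t , F⇓ , τ0 , _ , t≤ = run F 0 (initial x) in
      nil , t , (τ , F⇓ , τ0) , (begin
        t                       ≤⟨ t≤ ⟩
        bound F x               ≤⟨ proj₂ (poly F) x ⟩
        (2 + size x) ^ e        ≤⟨ ^-monoˡ-≤ e (+-monoˡ-≤ (size x) (*-monoʳ-≤ 2 (size>0 x))) ⟩
        (2 * size x + size x) ^ e ≡⟨ cong (_^ e) (lemma (size x)) ⟩
        (3 * size x) ^ e        ≡⟨ ^-distribʳ-* e 3 (size x) ⟩
        3 ^ e * size x ^ e      ∎)
      where
      open ≤-Reasoning
      lemma : ∀ n → 2 * n + n ≡ 3 * n
      lemma = solve-∀

  -- A language of polynomial-time functions between encoded types

  record Ty : Set₁ where
    constructor ty
    field
      Car : Set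
      enc : Car → Tree

  open Ty

  -- Time and size bounds hold for `tf` on all trees, whereas agreement with `fn` is demanded on
  -- encodings only.
  record Fun (A B : Ty) : Set where
    constructor mkFun
    field
      {tf} : Tree → Tree
      fn   : Car A → Car B
      pt   : PT tf
      ok   : ∀ a → tf (enc A a) ≡ enc B (fn a)

  open Fun

  encList : ∀ {A : Set} → (A → Tree) → List A → Tree
  encList f []       = nil
  encList f (x ∷ xs) = cons (f x) (encList f xs)

  unary : ℕ → Tree
  unary zero    = nil
  unary (suc n) = cons nil (unary n)

  treeᵗ boolᵗ natᵗ : Ty
  treeᵗ = ty Tree id
  boolᵗ = ty Bool encodeBool
  natᵗ  = ty ℕ unary

  listᵗ : Ty → Ty
  listᵗ A = ty (List (Car A)) (encList (enc A))

  infixr 4 _⊗_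

  _⊗_ : Ty → Ty → Ty
  A ⊗ B = ty (Car A × Car B) λ (a , b) → cons (enc A a) (enc B b)

  private variable
    A B A′ Γ : Ty

  idF : Fun A A
  idF = mkFun id idPT λ _ → refl

  constF : Car B → Fun A B
  constF {B} b = mkFun (λ _ → b) (constPT (enc B b)) λ _ → refl

  infixr 9 _∘F_
  _∘F_ : Fun B A′ → Fun A B → Fun A A′
  G ∘F F = mkFun (fn G ∘ fn F) (pt G ∘PT pt F) λ a → trans (cong (tf G) (ok F a)) (ok G (fn F a))

  fstF : Fun (A ⊗ B) A
  fstF = mkFun proj₁ headPT λ _ → refl

  sndF : Fun (A ⊗ B) B
  sndF = mkFun proj₂ tailPT λ _ → refl

  infixr 4 _▵_
  _▵_ : Fun Γ A → Fun Γ B → Fun Γ (A ⊗ B)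
  F ▵ G = mkFun (λ x → fn F x , fn G x) (consPT (pt F) (pt G)) λ x → cong₂ cons (ok F x) (ok G x)

  eqF : Fun Γ A → Fun Γ A → Fun Γ boolᵗ
  eqF {A = A} F G = mkFun (λ x → treeEq (enc A (fn F x)) (enc A (fn G x))) (eqPT ∘PT consPT (pt F) (pt G))
    λ x → cong₂ (λ s t → encodeBool (treeEq s t)) (ok F x) (ok G x)

  ifF : Fun Γ boolᵗ → Fun Γ A → Fun Γ A → Fun Γ A
  ifF {Γ} {A} F G H = mkFun (λ x → if fn F x then fn G x else fn H x) (ifPT (pt F) (pt G) (pt H)) correct
    where
    correct : ∀ x → ifT (tf F (enc Γ x)) (tf G (enc Γ x)) (tf H (enc Γ x)) ≡ enc A (if fn F x then fn G x else fn H x)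
    correct x rewrite ok F x with fn F x
    ... | false = ok H x
    ... | true  = ok G x

  notF : Fun Γ boolᵗ → Fun Γ boolᵗ
  notF F = ifF F (constF false) (constF true)

  _∧F_ _∨F_ : Fun Γ boolᵗ → Fun Γ boolᵗ → Fun Γ boolᵗ
  F ∧F G = ifF F G (constF false)
  F ∨F G = ifF F (constF true) G

  isCons : Tree → Bool
  isCons nil        = false
  isCons (cons _ _) = true

  isConsF : Fun treeᵗ boolᵗ
  isConsF = mkFun isCons (ifPT idPT (constPT (encodeBool true)) (constPT nil)) λ where
    nil        → refl
    (cons _ _) → refl

  untypedF : Fun Γ A → Fun Γ treeᵗ
  untypedF {A = A} F = mkFun (enc A ∘ fn F) (pt F) (ok F)

  nilF : Fun Γ (listᵗ A)
  nilF = constF []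

  infixr 5 _∷F_
  _∷F_ : Fun Γ A → Fun Γ (listᵗ A) → Fun Γ (listᵗ A)
  F ∷F G = mkFun (λ x → fn F x ∷ fn G x) (consPT (pt F) (pt G)) λ x → cong₂ cons (ok F x) (ok G x)

  sucF : Fun Γ natᵗ → Fun Γ natᵗ
  sucF F = mkFun (λ x → suc (fn F x)) (consPT (constPT nil) (pt F)) λ x → cong (cons nil) (ok F x)

  toList : Tree → List Tree
  toList nil        = []
  toList (cons x y) = x ∷ toList y

  encList-toList : ∀ t → encList id (toList t) ≡ t
  encList-toList nil        = refl
  encList-toList (cons x y) = cong (cons x) (encList-toList y)

  toListF : Fun Γ treeᵗ → Fun Γ (listᵗ treeᵗ)
  toListF F = mkFun (λ x → toList (fn F x)) (pt F) λ x → trans (ok F x) (sym (encList-toList (fn F x)))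

  foldPT′ : ∀ {s env xs acc} → PT env → PT xs → PT acc → PT s → AdditiveGrowth s →
            PT (λ x → foldT s (env x) (xs x) (acc x))
  foldPT′ E X A S gr = foldPT S gr ∘PT consPT E (consPT X A)

  revStep : Tree → Tree
  revStep z = cons (head (head (tail z))) (tail (tail z))

  revStep-growth : AdditiveGrowth revStep
  revStep-growth = 1 , λ env xs acc → begin
    suc (size (head xs) + size acc)              ≡⟨ +-comm (suc (size (head xs))) (size acc) ⟩
    size acc + suc (size (head xs))              ≤⟨ +-monoʳ-≤ (size acc) (s≤s (size-head xs)) ⟩
    size acc + suc (size xs)                     ≤⟨ +-monoʳ-≤ (size acc) (s≤s (m≤n⇒m≤1+n (m≤n+m (size xs) (size env)))) ⟩
    size acc + (2 + (size env + size xs))        ≡⟨ cong (size acc +_) (sym (*-identityʳ _)) ⟩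
    size acc + (2 + (size env + size xs)) ^ 1    ∎
    where open ≤-Reasoning

  -- Loops join their results by reversing one list onto another: applied twice this is
  -- concatenation, and on unary numbers, where order is immaterial, a single application is
  -- addition.
  revOnto : Tree → Tree → Tree
  revOnto = foldT revStep nil

  revOnto-size : ∀ xs acc → size (revOnto xs acc) ≤ size acc + size xs
  revOnto-size nil         acc = m≤m+n _ _
  revOnto-size (cons x xs) acc = ≤-trans (revOnto-size xs (cons x acc)) (≤-reflexive (lemma (size x) (size xs) (size acc)))
    where
    lemma : ∀ a b c → suc (a + c) + b ≡ c + suc (a + b)
    lemma = solve-∀

  revOntoPT : PT f → PT g → PT (λ x → revOnto (f x) (g x))
  revOntoPT F G = foldPT′ (constPT nil) F G (consPT (headPT ∘PT headPT ∘PT tailPT) (tailPT ∘PT tailPT)) revStep-growth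

  revOnto-list : ∀ {A : Set} (e : A → Tree) xs ys → revOnto (encList e xs) (encList e ys) ≡ encList e (xs ʳ++ ys)
  revOnto-list e []       ys = refl
  revOnto-list e (x ∷ xs) ys = revOnto-list e xs (x ∷ ys)

  revOnto-unary : ∀ m n → revOnto (unary m) (unary n) ≡ unary (m + n)
  revOnto-unary zero    n = refl
  revOnto-unary (suc m) n = trans (revOnto-unary m (suc n)) (cong unary (+-suc m n))

  infixl 6 _+F_
  _+F_ : Fun Γ natᵗ → Fun Γ natᵗ → Fun Γ natᵗ
  F +F G = mkFun (λ x → fn F x + fn G x) (revOntoPT (pt F) (pt G))
    λ x → trans (cong₂ revOnto (ok F x) (ok G x)) (revOnto-unary (fn F x) (fn G x))

  infixr 5 _++F_
  _++F_ : Fun Γ (listᵗ A) → Fun Γ (listᵗ A) → Fun Γ (listᵗ A)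
  _++F_ {A = A} F G = mkFun (λ x → fn F x ++ fn G x) (revOntoPT (revOntoPT (pt F) (constPT nil)) (pt G))
    λ x → trans (cong₂ (λ s → revOnto (revOnto s nil)) (ok F x) (ok G x))
      (trans (cong (λ t → revOnto t (encList (enc A) (fn G x))) (revOnto-list (enc A) (fn F x) []))
        (trans (revOnto-list (enc A) (fn F x ʳ++ []) (fn G x))
          (cong (encList (enc A)) (trans (ʳ++-defn (reverse (fn F x))) (cong (_++ fn G x) (reverse-involutive (fn F x)))))))

  forStep : (Tree → Tree) → Tree → Tree
  forStep f z = revOnto (f (cons (head z) (head (head (tail z))))) (tail (tail z))

  forStep-growth : PT f → AdditiveGrowth (forStep f)
  forStep-growth {f} F = 2 * e , λ env xs acc →
    let z = cons env (head xs) in begin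
    size (revOnto (f z) acc)                       ≤⟨ revOnto-size (f z) acc ⟩
    size acc + size (f z)                          ≤⟨ +-monoʳ-≤ (size acc) (≤-trans (size-≤ F z) (proj₂ (poly F) z)) ⟩
    size acc + (2 + size z) ^ e                    ≤⟨ +-monoʳ-≤ (size acc) (^-monoˡ-≤ e (s≤s (s≤s (s≤s (+-monoʳ-≤ (size env) (size-head xs)))))) ⟩
    size acc + (3 + (size env + size xs)) ^ e      ≤⟨ +-monoʳ-≤ (size acc) (bigger e (size env + size xs)) ⟩
    size acc + (2 + (size env + size xs)) ^ (2 * e) ∎
    where
    open ≤-Reasoning
    e = proj₁ (poly F)
    bigger : ∀ e n → (3 + n) ^ e ≤ (2 + n) ^ (2 * e)
    bigger e n = ≤-trans (^-monoˡ-≤ e {3 + n} {(2 + n) ^ 2} (lemma n)) (≤-reflexive (^-*-assoc (2 + n) 2 e))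
      where
      lemma : ∀ n → 3 + n ≤ (2 + n) ^ 2
      lemma n = ≤-trans (m≤m+n (3 + n) (1 + 3 * n + n * n)) (≤-reflexive (ring n))
        where
        ring : ∀ n → 3 + n + (1 + 3 * n + n * n) ≡ (2 + n) * ((2 + n) * 1)
        ring = solve-∀

  -- As the body returns a list, this one loop serves as map, filter and comprehension. The results
  -- reach the accumulator in reverse, hence the final reversal.
  forF : Fun Γ (listᵗ A) → Fun (Γ ⊗ A) (listᵗ B) → Fun Γ (listᵗ B)
  forF {Γ} {A} {B} X F = mkFun (λ x → concatMap (λ a → fn F (x , a)) (fn X x))
    (revOntoPT (foldPT′ idPT (pt X) (constPT nil)
       (revOntoPT (pt F ∘PT consPT headPT (headPT ∘PT headPT ∘PT tailPT)) (tailPT ∘PT tailPT))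
       (forStep-growth (pt F))) (constPT nil))
    λ x → trans (cong (λ xs → revOnto (foldT (forStep (tf F)) (enc Γ x) xs nil) nil) (ok X x))
      (trans (cong (λ t → revOnto t nil) (loop x (fn X x) []))
        (trans (revOnto-list (enc B) (concatMap (λ a → fn F (x , a)) (fn X x) ʳ++ []) [])
          (cong (encList (enc B)) (reverse-involutive _))))
    where
    loop : ∀ x xs acc → foldT (forStep (tf F)) (enc Γ x) (encList (enc A) xs) (encList (enc B) acc) ≡
                        encList (enc B) (concatMap (λ a → fn F (x , a)) xs ʳ++ acc)
    loop x []       acc = refl
    loop x (y ∷ ys) acc =
      trans (cong (foldT (forStep (tf F)) (enc Γ x) (encList (enc A) ys))
              (trans (cong (λ t → revOnto t (encList (enc B) acc)) (ok F (x , y))) (revOnto-list (enc B) (fn F (x , y)) acc)))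
        (trans (loop x ys (fn F (x , y) ʳ++ acc)) (cong (encList (enc B)) (sym (++-ʳ++ (fn F (x , y))))))

  -- Arithmetic on unary numbers

  mulStep-growth : AdditiveGrowth (λ z → revOnto (head z) (tail (tail z)))
  mulStep-growth = 1 , λ env xs acc → ≤-trans (revOnto-size env acc)
    (+-monoʳ-≤ (size acc) (≤-trans (m≤m+n (size env) (size xs)) (≤-trans (m≤n+m _ 2) (≤-reflexive (sym (*-identityʳ _))))))

  infixl 7 _*F_
  _*F_ : Fun Γ natᵗ → Fun Γ natᵗ → Fun Γ natᵗ
  F *F G = mkFun (λ x → fn F x * fn G x)
    (foldPT′ (pt G) (pt F) (constPT nil) (revOntoPT headPT (tailPT ∘PT tailPT)) mulStep-growth)
    λ x → trans (cong₂ (λ s t → foldT _ s t nil) (ok G x) (ok F x))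
      (trans (loop (fn G x) (fn F x) 0) (cong unary (+-identityʳ _)))
    where
    loop : ∀ n m acc → foldT (λ z → revOnto (head z) (tail (tail z))) (unary n) (unary m) (unary acc) ≡ unary (m * n + acc)
    loop n zero    acc = refl
    loop n (suc m) acc = trans (cong (foldT _ (unary n) (unary m)) (revOnto-unary n acc))
      (trans (loop n m (n + acc)) (cong unary (lemma (m * n) n acc)))
      where
      lemma : ∀ a n b → a + (n + b) ≡ n + a + b
      lemma = solve-∀

  -- The program stays, and only the function that it is said to compute is exchanged for an equal
  -- one; this lets later goals mention the intended expression.
  retarget : (F : Fun A B) (f : Car A → Car B) → (∀ a → fn F a ≡ f a) → Fun A B
  retarget {B = B} F f F≡f = mkFun f (pt F) λ a → trans (ok F a) (cong (enc B) (F≡f a))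

  powF : Fun Γ natᵗ → ℕ → Fun Γ natᵗ
  powF F e = retarget (power e) (λ x → fn F x ^ e) (correct e)
    where
    power : ℕ → Fun _ natᵗ
    power zero    = constF 1
    power (suc e) = F *F power e
    correct : ∀ e x → fn (power e) x ≡ fn F x ^ e
    correct zero    x = refl
    correct (suc e) x = cong (fn F x *_) (correct e x)

  tailStep : Tree → Tree
  tailStep z = tail (tail (tail z))

  tailStep-growth : AdditiveGrowth tailStep
  tailStep-growth = 0 , λ env xs acc → m≤n⇒m≤n+o 1 (size-tail acc)

  dropT : Tree → Tree → Tree
  dropT = foldT tailStep nil

  dropPT : PT f → PT g → PT (λ x → dropT (f x) (g x))
  dropPT F G = foldPT′ (constPT nil) F G (tailPT ∘PT tailPT ∘PT tailPT) tailStep-growth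

  infixl 6 _∸F_
  _∸F_ : Fun Γ natᵗ → Fun Γ natᵗ → Fun Γ natᵗ
  F ∸F G = mkFun (λ x → fn F x ∸ fn G x) (dropPT (pt G) (pt F))
    λ x → trans (cong₂ dropT (ok G x) (ok F x)) (loop (fn G x) (fn F x))
    where
    loop : ∀ m n → dropT (unary m) (unary n) ≡ unary (n ∸ m)
    loop zero    n       = refl
    loop (suc m) zero    = trans (loop m zero) (cong unary (0∸n≡0 m))
    loop (suc m) (suc n) = loop m n

  isSuc : ℕ → Bool
  isSuc zero    = false
  isSuc (suc _) = true

  _≤F_ : Fun Γ natᵗ → Fun Γ natᵗ → Fun Γ boolᵗ
  F ≤F G = mkFun (λ x → isSuc (suc (fn G x) ∸ fn F x)) (pt (isConsF ∘F untypedF D))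
    λ x → trans (ok (isConsF ∘F untypedF D) x) (cong encodeBool (lemma (fn D x)))
    where
    D = sucF G ∸F F
    lemma : ∀ n → isCons (unary n) ≡ isSuc n
    lemma zero    = refl
    lemma (suc n) = refl

  isSuc-≤ : ∀ m n → isSuc (suc n ∸ m) ≡ true → m ≤ n
  isSuc-≤ zero    n       _ = z≤n
  isSuc-≤ (suc m) (suc n) h = s≤s (isSuc-≤ m n h)
  isSuc-≤ (suc zero)    zero ()
  isSuc-≤ (suc (suc m)) zero ()

  ≤-isSuc : ∀ {m n} → m ≤ n → isSuc (suc n ∸ m) ≡ true
  ≤-isSuc z≤n       = refl
  ≤-isSuc (s≤s m≤n) = ≤-isSuc m≤n

  lengthStep-growth : AdditiveGrowth (λ z → cons nil (tail (tail z)))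
  lengthStep-growth = 1 , λ env xs acc → ≤-trans (≤-reflexive (+-comm 2 (size acc)))
    (+-monoʳ-≤ (size acc) (≤-trans (m≤m+n 2 (size env + size xs)) (≤-reflexive (sym (*-identityʳ _)))))

  lengthF : Fun Γ (listᵗ A) → Fun Γ natᵗ
  lengthF {A = A} F = mkFun (λ x → length (fn F x))
    (foldPT′ (constPT nil) (pt F) (constPT nil) (consPT (constPT nil) (tailPT ∘PT tailPT)) lengthStep-growth)
    λ x → trans (cong (λ t → foldT _ nil t nil) (ok F x)) (trans (loop (fn F x) 0) (cong unary (+-identityʳ _)))
    where
    loop : ∀ xs n → foldT (λ z → cons nil (tail (tail z))) nil (encList (enc A) xs) (unary n) ≡ unary (length xs + n)
    loop []       n = refl
    loop (x ∷ xs) n = trans (loop xs (suc n)) (cong unary (+-suc (length xs) n))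

  upToStep-growth : AdditiveGrowth (λ z → cons (tail (head (tail z))) (tail (tail z)))
  upToStep-growth = 1 , λ env xs acc → begin
    suc (size (tail xs) + size acc)              ≡⟨ +-comm (suc (size (tail xs))) (size acc) ⟩
    size acc + suc (size (tail xs))              ≤⟨ +-monoʳ-≤ (size acc) (s≤s (size-tail xs)) ⟩
    size acc + suc (size xs)                     ≤⟨ +-monoʳ-≤ (size acc) (s≤s (m≤n⇒m≤1+n (m≤n+m (size xs) (size env)))) ⟩
    size acc + (2 + (size env + size xs))        ≡⟨ cong (size acc +_) (sym (*-identityʳ _)) ⟩
    size acc + (2 + (size env + size xs)) ^ 1    ∎
    where open ≤-Reasoning

  -- The number is traversed as a list: when `suc j` of it remains, its tail is the number `j`.
  -- Pushing these tails, largest first, leaves the list in increasing order. This is a use of the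
  -- fact that steps see the whole remaining list.
  upToF : Fun Γ natᵗ → Fun Γ (listᵗ natᵗ)
  upToF F = mkFun (λ x → upTo (fn F x))
    (foldPT′ (constPT nil) (pt F) (constPT nil) (consPT (tailPT ∘PT headPT ∘PT tailPT) (tailPT ∘PT tailPT)) upToStep-growth)
    λ x → trans (cong (λ t → foldT _ nil t nil) (ok F x)) (trans (loop (fn F x) []) (cong (encList unary) (++-identityʳ _)))
    where
    loop : ∀ n acc → foldT (λ z → cons (tail (head (tail z))) (tail (tail z))) nil (unary n) (encList unary acc) ≡
                     encList unary (upTo n ++ acc)
    loop zero    acc = refl
    loop (suc n) acc = trans (loop n (n ∷ acc)) (cong (encList unary)
      (trans (sym (++-assoc (upTo n) (n ∷ []) acc)) (cong (_++ acc) (upTo-∷ʳ n))))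

  headℕ : List ℕ → ℕ
  headℕ []      = 0
  headℕ (x ∷ _) = x

  tailL : ∀ {A : Set} → List A → List A
  tailL []       = []
  tailL (_ ∷ xs) = xs

  headF : Fun Γ (listᵗ natᵗ) → Fun Γ natᵗ
  headF F = mkFun (λ x → headℕ (fn F x)) (headPT ∘PT pt F) λ x → trans (cong head (ok F x)) (lemma (fn F x))
    where
    lemma : ∀ xs → head (encList unary xs) ≡ unary (headℕ xs)
    lemma []       = refl
    lemma (x ∷ xs) = refl

  tailF : Fun Γ (listᵗ A) → Fun Γ (listᵗ A)
  tailF {A = A} F = mkFun (λ x → tailL (fn F x)) (tailPT ∘PT pt F) λ x → trans (cong tail (ok F x)) (lemma (fn F x))
    where
    lemma : ∀ xs → tail (encList (enc A) xs) ≡ encList (enc A) (tailL xs)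
    lemma []       = refl
    lemma (x ∷ xs) = refl

  -- Entries of trees read as lists and as matrices; missing entries are nil.

  entry : Tree → ℕ → Tree
  entry t zero    = head t
  entry t (suc i) = entry (tail t) i

  entryF : Fun Γ treeᵗ → Fun Γ natᵗ → Fun Γ treeᵗ
  entryF F I = mkFun (λ x → entry (fn F x) (fn I x)) (headPT ∘PT dropPT (pt I) (pt F))
    λ x → trans (cong₂ (λ s t → head (dropT s t)) (ok I x) (ok F x)) (loop (fn I x) (fn F x))
    where
    loop : ∀ i t → head (dropT (unary i) t) ≡ entry t i
    loop zero    t = refl
    loop (suc i) t = loop i (tail t)

  _⟦_,_⟧ : Tree → ℕ → ℕ → Bool
  t ⟦ i , j ⟧ = isCons (entry (entry t i) j)

  entryF₂ : Fun Γ treeᵗ → Fun Γ natᵗ → Fun Γ natᵗ → Fun Γ boolᵗ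
  entryF₂ F I J = isConsF ∘F entryF (entryF F I) J

  -- Binary increments are made on digits of equal size, so that they do not
  -- enlarge the number by more than one digit.

  digit₀ digit₁ : Tree
  digit₀ = cons nil (cons nil nil)
  digit₁ = cons (cons nil nil) nil

  digits : ℕᵇ → Tree
  digits ℕᵇ.zero  = nil
  digits 2[1+ b ] = cons digit₀ (digits b)
  digits 1+[2 b ] = cons digit₁ (digits b)

  -- In the digits of `ℕᵇ` an increment exchanges the two digits from the lowest place up to and
  -- including the first `digit₁` and leaves the rest alone; if there is no `digit₁`, one is
  -- appended.
  newCarry newBit : Tree → Tree → Tree
  newCarry c b = ifT (encodeBool (treeEq b digit₁)) nil c
  newBit   c b = ifT c (ifT (encodeBool (treeEq b digit₀)) digit₁ (ifT (encodeBool (treeEq b digit₁)) digit₀ b)) b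

  -- The accumulator consists of the carry and of the reversed output.
  incStep : Tree → Tree
  incStep z = cons (newCarry carry bit) (cons (newBit carry bit) (tail (tail (tail z))))
    where
    carry = head (tail (tail z))
    bit   = head (head (tail z))

  increment : Tree → Tree
  increment t = revOnto (tail r) (ifT (head r) (cons digit₁ nil) nil)
    where r = foldT incStep nil t (cons (cons nil nil) nil)

  treeEq-sound : ∀ s t → treeEq s t ≡ true → s ≡ t
  treeEq-sound nil        nil          _ = refl
  treeEq-sound (cons x y) (cons x′ y′) h with treeEq x x′ in eq
  ... | true = cong₂ cons (treeEq-sound x x′ eq) (treeEq-sound y y′ h)
  treeEq-sound nil        (cons _ _) ()
  treeEq-sound (cons _ _) nil        ()

  treeEq-refl : ∀ t → treeEq t t ≡ true
  treeEq-refl nil        = refl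
  treeEq-refl (cons x y) rewrite treeEq-refl x = treeEq-refl y

  newCarry-size : ∀ c b → size (newCarry c b) ≤ size c
  newCarry-size c b with treeEq b digit₁
  ... | true  = size>0 c
  ... | false = ≤-refl

  newBit-size : ∀ c b → size (newBit c b) ≤ size b
  newBit-size nil        b = ≤-refl
  newBit-size (cons _ _) b with treeEq b digit₀ in eq₀ | treeEq b digit₁ in eq₁
  ... | true  | _     rewrite treeEq-sound b digit₀ eq₀ = ≤-refl
  ... | false | true  rewrite treeEq-sound b digit₁ eq₁ = ≤-refl
  ... | false | false = ≤-refl

  incStep-size : ∀ c b o → size (cons (newCarry c b) (cons (newBit c b) o)) ≤ 2 + (size c + (size b + size o))
  incStep-size c b o = ≤-trans (≤-reflexive (+-suc (suc (size (newCarry c b))) _))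
    (s≤s (s≤s (+-mono-≤ (newCarry-size c b) (+-monoˡ-≤ (size o) (newBit-size c b)))))

  incStep-growth : AdditiveGrowth incStep
  incStep-growth = 1 , λ env xs acc → begin
    size (incStep (cons env (cons xs acc)))                    ≤⟨ incStep-size (head acc) (head xs) (tail acc) ⟩
    2 + (size (head acc) + (size (head xs) + size (tail acc))) ≡⟨ lemma (size (head acc)) (size (head xs)) (size (tail acc)) ⟩
    size (head acc) + size (tail acc) + (2 + size (head xs))   ≤⟨ +-mono-≤ (parts acc) (+-monoʳ-≤ 2 (size-head xs)) ⟩
    size acc + 1 + (2 + size xs)                               ≡⟨ +-assoc (size acc) 1 _ ⟩
    size acc + (2 + (1 + size xs))                             ≤⟨ +-monoʳ-≤ (size acc) (+-monoʳ-≤ 2 (+-monoˡ-≤ (size xs) (size>0 env))) ⟩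
    size acc + (2 + (size env + size xs))                      ≡⟨ cong (size acc +_) (sym (*-identityʳ _)) ⟩
    size acc + (2 + (size env + size xs)) ^ 1                  ∎
    where
    open ≤-Reasoning
    lemma : ∀ a b c → 2 + (a + (b + c)) ≡ a + c + (2 + b)
    lemma = solve-∀
    parts : ∀ t → size (head t) + size (tail t) ≤ size t + 1
    parts nil        = ≤-refl
    parts (cons x y) = ≤-trans (n≤1+n _) (m≤m+n _ 1)

  incLoop-size : ∀ t c o → size (foldT incStep nil t (cons c o)) ≤ size (cons c o) + size t
  incLoop-size nil        c o = m≤m+n _ _
  incLoop-size (cons x t) c o = begin
    size (foldT incStep nil t (cons (newCarry c x) (cons (newBit c x) o)))
                                                  ≤⟨ incLoop-size t (newCarry c x) (cons (newBit c x) o) ⟩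
    size (cons (newCarry c x) (cons (newBit c x) o)) + size t ≤⟨ +-monoˡ-≤ (size t) (incStep-size c x o) ⟩
    2 + (size c + (size x + size o)) + size t     ≡⟨ lemma (size c) (size x) (size o) (size t) ⟩
    size (cons c o) + size (cons x t)             ∎
    where
    open ≤-Reasoning
    lemma : ∀ a b c d → 2 + (a + (b + c)) + d ≡ suc (a + c) + suc (b + d)
    lemma = solve-∀

  increment-size : ∀ t → size (increment t) ≤ size t + 12
  increment-size t = begin
    size (increment t)     ≤⟨ revOnto-size (tail r) (ifT (head r) (cons digit₁ nil) nil) ⟩
    _                      ≤⟨ +-mono-≤ (last (head r)) (≤-trans (size-tail r) (incLoop-size t (cons nil nil) nil)) ⟩
    7 + (5 + size t)       ≡⟨ +-comm 12 (size t) ⟩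
    size t + 12            ∎
    where
    open ≤-Reasoning
    r = foldT incStep nil t (cons (cons nil nil) nil)
    last : ∀ c → size (ifT c (cons digit₁ nil) nil) ≤ 7
    last nil        = s≤s z≤n
    last (cons _ _) = ≤-refl

  incrementPT : PT increment
  incrementPT = revOntoPT (tailPT ∘PT R) (ifPT (headPT ∘PT R) (constPT _) (constPT nil))
    where
    carryPT = headPT ∘PT tailPT ∘PT tailPT
    bitPT   = headPT ∘PT headPT ∘PT tailPT
    isPT : ∀ d → PT (λ z → encodeBool (treeEq (head (head (tail z))) d))
    isPT d = eqPT ∘PT consPT bitPT (constPT d)
    R : PT (λ t → foldT incStep nil t (cons (cons nil nil) nil))
    R = foldPT′ (constPT nil) idPT (constPT _)
      (consPT (ifPT (isPT digit₁) (constPT nil) carryPT)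
        (consPT (ifPT carryPT (ifPT (isPT digit₀) (constPT digit₁) (ifPT (isPT digit₁) (constPT digit₀) bitPT)) bitPT)
          (tailPT ∘PT tailPT ∘PT tailPT)))
      incStep-growth

  increment-digits : ∀ b → increment (digits b) ≡ digits (sucᵇ b)
  increment-digits b = carried b nil
    where
    finish : Tree → Tree
    finish r = revOnto (tail r) (ifT (head r) (cons digit₁ nil) nil)

    rev-rev : ∀ t o → revOnto (revOnto t o) nil ≡ revOnto o t
    rev-rev nil        o = refl
    rev-rev (cons x t) o = rev-rev t (cons x o)

    copied : ∀ b o → finish (foldT incStep nil (digits b) (cons nil o)) ≡ revOnto (revOnto (digits b) o) nil
    copied ℕᵇ.zero  o = refl
    copied 2[1+ b ] o = copied b (cons digit₀ o)
    copied 1+[2 b ] o = copied b (cons digit₁ o)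

    carried : ∀ b o → finish (foldT incStep nil (digits b) (cons (cons nil nil) o)) ≡ revOnto o (digits (sucᵇ b))
    carried ℕᵇ.zero  o = refl
    carried 2[1+ b ] o = carried b (cons digit₁ o)
    carried 1+[2 b ] o = trans (copied b (cons digit₀ o)) (rev-rev (digits b) (cons digit₀ o))

  -- Counting up by `increment` avoids division. Only afterwards is each digit replaced by the bit
  -- of `encodeBinary`, whose two values differ in size.
  toBinaryF : Fun Γ natᵗ → Fun Γ treeᵗ
  toBinaryF {Γ} F = mkFun (λ x → encodeℕ (fn F x)) (pt G) λ x → trans (ok G x)
    (trans (cong (encList id ∘ concatMap bitOf ∘ toList) (cong digits (sym (fromℕ≡fromℕ' (fn F x)))))
      (bits (fromℕ (fn F x))))
    where
    count : Fun Γ treeᵗ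
    count = mkFun (λ x → digits (fromℕ' (fn F x)))
      (foldPT′ (constPT nil) (pt F) (constPT nil) (incrementPT ∘PT tailPT ∘PT tailPT)
        (4 , λ env xs acc → ≤-trans (increment-size acc) (+-monoʳ-≤ (size acc)
          (≤-trans (m≤m+n 12 4) (^-monoˡ-≤ 4 (m≤m+n 2 (size env + size xs)))))))
      λ x → trans (cong (λ t → foldT _ nil t nil) (ok F x))
        (trans (loop (fn F x) 0) (cong (digits ∘ fromℕ') (+-identityʳ (fn F x))))
      where
      loop : ∀ n m → foldT (λ z → increment (tail (tail z))) nil (unary n) (digits (fromℕ' m)) ≡ digits (fromℕ' (n + m))
      loop zero    m = refl
      loop (suc n) m = trans (cong (foldT _ nil (unary n)) (increment-digits (fromℕ' m)))
        (trans (loop n (suc m)) (cong (digits ∘ fromℕ') (+-suc n m)))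
    bitOf : Tree → List Tree
    bitOf t = if treeEq t digit₁ then encodeBool true ∷ [] else (nil ∷ [])
    G : Fun Γ treeᵗ
    G = untypedF (forF (toListF count) (ifF (eqF sndF (constF digit₁)) (constF (encodeBool true) ∷F nilF) (constF nil ∷F nilF)))
    bits : ∀ b → encList id (concatMap bitOf (toList (digits b))) ≡ encodeBinary b
    bits ℕᵇ.zero  = refl
    bits 2[1+ b ] = cong (cons nil) (bits b)
    bits 1+[2 b ] = cong (cons (encodeBool true)) (bits b)

  wk : Fun Γ B → Fun (Γ ⊗ A) B
  wk F = F ∘F fstF

  iter : ∀ {X : Set} → ℕ → (X → X) → X → X
  iter zero    s x = x
  iter (suc n) s x = iter n s (s x)

  iterF : Fun Γ natᵗ → Fun Γ A → (S : Fun (Γ ⊗ A) A) → AdditiveGrowth (λ z → tf S (cons (head z) (tail (tail z)))) → Fun Γ A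
  iterF {Γ} {A} N I S gr = mkFun (λ x → iter (fn N x) (λ a → fn S (x , a)) (fn I x))
    (foldPT′ idPT (pt N) (pt I) (pt S ∘PT consPT headPT (tailPT ∘PT tailPT)) gr)
    λ x → trans (cong₂ (foldT _ (enc Γ x)) (ok N x) (ok I x)) (loop x (fn N x) (fn I x))
    where
    loop : ∀ x n a → foldT (λ z → tf S (cons (head z) (tail (tail z)))) (enc Γ x) (unary n) (enc A a) ≡
                     enc A (iter n (λ a → fn S (x , a)) a)
    loop x zero    a = refl
    loop x (suc n) a = trans (cong (foldT _ (enc Γ x) (unary n)) (ok S (x , a))) (loop x n (fn S (x , a)))

  nonEmpty : ∀ {X : Set} → List X → Bool
  nonEmpty []      = false
  nonEmpty (_ ∷ _) = true

  nonEmptyF : Fun Γ (listᵗ A) → Fun Γ boolᵗ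
  nonEmptyF {A = A} F = mkFun (λ x → nonEmpty (fn F x)) (pt G) λ x → trans (ok G x) (cong encodeBool (lemma (fn F x)))
    where
    G = isConsF ∘F untypedF F
    lemma : ∀ xs → isCons (encList (enc A) xs) ≡ nonEmpty xs
    lemma []      = refl
    lemma (_ ∷ _) = refl

  nthℕ : List ℕ → ℕ → ℕ
  nthℕ xs       zero    = headℕ xs
  nthℕ []       (suc i) = 0
  nthℕ (x ∷ xs) (suc i) = nthℕ xs i

  nthF : Fun Γ (listᵗ natᵗ) → Fun Γ natᵗ → Fun Γ natᵗ
  nthF F I = mkFun (λ x → nthℕ (fn F x) (fn I x)) (pt G)
    λ x → trans (ok G x) (lemma (fn F x) (fn I x))
    where
    G = entryF (untypedF F) I
    lemma : ∀ xs i → entry (encList unary xs) i ≡ unary (nthℕ xs i)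
    lemma []       zero    = refl
    lemma (x ∷ xs) zero    = refl
    lemma []       (suc i) = entry-nil i
      where
      entry-nil : ∀ i → entry nil i ≡ nil
      entry-nil zero    = refl
      entry-nil (suc i) = entry-nil i
    lemma (x ∷ xs) (suc i) = lemma xs i

  -- Boolean matrices and reachability in a bounded number of steps

  mkMat : ℕ → (ℕ → ℕ → Bool) → Tree
  mkMat n f = encList (encList encodeBool) (concatMap (λ i → concatMap (λ j → f i j ∷ []) (upTo n) ∷ []) (upTo n))

  matF : Fun Γ natᵗ → Fun ((Γ ⊗ natᵗ) ⊗ natᵗ) boolᵗ → Fun Γ treeᵗ
  matF N F = untypedF (forF (upToF N) (forF (wk (upToF N)) (F ∷F nilF) ∷F nilF))

  -- `AdditiveGrowth` ranges over all trees, so a bound on encoded values would not do: sizes have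
  -- to be controlled for `tf` on arbitrary input.
  for-size : ∀ (X : Fun Γ (listᵗ A)) (F : Fun (Γ ⊗ A) (listᵗ B)) x b → (∀ y → size (tf F (cons x y)) ≤ b) →
    size (tf (forF X F) x) ≤ 2 + size (tf X x) * b
  for-size X F x b F≤ = ≤-trans (revOnto-size (foldT (forStep (tf F)) x (tf X x) nil) nil) (s≤s (loop (tf X x) nil))
    where
    loop : ∀ xs acc → size (foldT (forStep (tf F)) x xs acc) ≤ size acc + size xs * b
    loop nil         acc = m≤m+n _ _
    loop (cons y ys) acc = begin
      size (foldT (forStep (tf F)) x ys (revOnto (tf F (cons x y)) acc)) ≤⟨ loop ys _ ⟩
      size (revOnto (tf F (cons x y)) acc) + size ys * b                  ≤⟨ +-monoˡ-≤ _ (revOnto-size (tf F (cons x y)) acc) ⟩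
      size acc + size (tf F (cons x y)) + size ys * b                     ≤⟨ +-monoˡ-≤ _ (+-monoʳ-≤ (size acc) (F≤ y)) ⟩
      size acc + b + size ys * b                                          ≡⟨ +-assoc (size acc) b _ ⟩
      size acc + (b + size ys * b)                                        ≤⟨ +-monoʳ-≤ (size acc) (+-monoʳ-≤ b (*-monoˡ-≤ b (m≤n+m (size ys) (size y)))) ⟩
      size acc + size (cons y ys) * b                                     ∎
      where open ≤-Reasoning

  orF-size : ∀ (F G : Fun Γ boolᵗ) z → size (tf G z) ≤ 3 → size (tf (F ∨F G) z) ≤ 3
  orF-size F G z G≤ with tf F z
  ... | nil      = G≤
  ... | cons _ _ = ≤-refl

  nonEmptyF-size : ∀ (F : Fun Γ (listᵗ A)) z → size (tf (nonEmptyF F) z) ≤ 3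
  nonEmptyF-size F z with tf F z
  ... | nil      = s≤s z≤n
  ... | cons _ _ = ≤-refl

  matBound : ℕ → ℕ
  matBound n = 2 + n * suc ((2 + n * 5) + 1)

  matF-size : ∀ (N : Fun Γ natᵗ) F x → (∀ z → size (tf F z) ≤ 3) → size (tf (matF N F) x) ≤ matBound (size (tf (upToF N) x))
  matF-size N F x F≤ = for-size (upToF N) (forF (wk (upToF N)) (F ∷F nilF) ∷F nilF) x
    (suc ((2 + size (tf (upToF N) x) * 5) + 1)) λ y → s≤s (+-monoˡ-≤ 1
    (for-size (wk (upToF N)) (F ∷F nilF) (cons x y) 5 λ y′ → s≤s (+-monoˡ-≤ 1 (F≤ (cons (cons x y) y′)))))

  -- The new matrix is as large as the number of vertices dictates, whatever the
  -- old one is.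
  iterMatF : Fun Γ natᵗ → Fun Γ natᵗ → Fun Γ treeᵗ → (F : Fun (((Γ ⊗ treeᵗ) ⊗ natᵗ) ⊗ natᵗ) boolᵗ) →
             (∀ z → size (tf F z) ≤ 3) → Fun Γ treeᵗ
  iterMatF N R I F F≤ = iterF R I (matF (wk N) F) (proj₁ bnd-poly , growth)
    where
    X = upToF N
    bnd-poly : Poly (matBound ∘ size ∘ tf X)
    bnd-poly = poly-+ (poly-const 2) (poly-* X-poly (poly-+ (poly-const 1) (poly-+ (poly-+ (poly-const 2)
                 (poly-* X-poly (poly-const 5))) (poly-const 1))))
      where
      X-poly : Poly (size ∘ tf X)
      X-poly = poly-≤ (size-≤ (pt X)) (poly (pt X))
    growth : ∀ env xs acc → size (tf (matF (wk N) F) (cons env acc)) ≤ size acc + (2 + (size env + size xs)) ^ proj₁ bnd-poly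
    growth env xs acc = ≤-trans (matF-size (wk N) F (cons env acc) F≤)
      (m≤n⇒m≤o+n (size acc) (≤-trans (proj₂ bnd-poly env) (^-monoˡ-≤ (proj₁ bnd-poly) (+-monoʳ-≤ 2 (m≤m+n (size env) (size xs))))))

  reachStep : ℕ → Tree → Tree → Tree
  reachStep n M R = mkMat n λ i j →
    if R ⟦ i , j ⟧ then true else nonEmpty (concatMap (λ l → if (if R ⟦ i , l ⟧ then M ⟦ l , j ⟧ else false) then (true ∷ []) else []) (upTo n))

  reach : ℕ → Tree → ℕ → Tree
  reach n M r = iter r (reachStep n M) (mkMat n λ i j → treeEq (unary i) (unary j))

  reachF : Fun Γ natᵗ → Fun Γ treeᵗ → Fun Γ natᵗ → Fun Γ treeᵗ
  reachF {Γ} N M R = iterMatF N R (matF N (eqF (sndF ∘F fstF) sndF)) (old ∨F new)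
    (λ z → orF-size old new z (nonEmptyF-size via z))
    where
    i j : Fun (((Γ ⊗ treeᵗ) ⊗ natᵗ) ⊗ natᵗ) natᵗ
    i = sndF ∘F fstF
    j = sndF
    old new : Fun (((Γ ⊗ treeᵗ) ⊗ natᵗ) ⊗ natᵗ) boolᵗ
    old = entryF₂ (sndF ∘F fstF ∘F fstF) i j
    via : Fun (((Γ ⊗ treeᵗ) ⊗ natᵗ) ⊗ natᵗ) (listᵗ boolᵗ)
    via = forF (upToF N ∘F fstF ∘F fstF ∘F fstF)
      (ifF (entryF₂ (sndF ∘F fstF ∘F fstF ∘F fstF) (wk i) sndF ∧F entryF₂ (M ∘F fstF ∘F fstF ∘F fstF ∘F fstF) sndF (wk j))
        (constF true ∷F nilF) nilF)
    new = nonEmptyF via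

  -- The graph of the reduction

  -- In order: the current vertex of the instance, its label, the sum of squares, the sums of the
  -- elements chosen in A and in B, and the digits. A vertex of the graph adds the time in front.
  State Vert : Set
  State = ℕ × ℕ × ℕ × ℕ × ℕ × List ℕ
  Vert  = ℕ × State

  stateᵗ vertᵗ : Ty
  stateᵗ = natᵗ ⊗ natᵗ ⊗ natᵗ ⊗ natᵗ ⊗ natᵗ ⊗ listᵗ natᵗ
  vertᵗ  = natᵗ ⊗ stateᵗ

  uNbrs : ℕ → ℕ → State → List State
  uNbrs k M (w , a , sq , gu , gv , ds) =
    concatMap (λ u → concatMap (λ a′ → (u , a′ , sq + u * u , gu + u , gv , ds) ∷ []) (upTo M)) (upTo k)

  vNbrs : ℕ → ℕ → (ℕ → ℕ → ℕ → ℕ → Bool) → State → List State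
  vNbrs k M rel (w , a , sq , gu , gv , ds) =
    concatMap (λ v → concatMap (λ b → if rel w v a b then (v , b , sq + v * v , gu , gv + v , ds) ∷ [] else [])
      (upTo M)) (upTo k)

  -- The digits are moved in turn; the list rotates so that the digit to be moved
  -- is always the first one.
  dNbrs : ℕ → State → List State
  dNbrs T (w , a , sq , gu , gv , ds) =
    concatMap (λ x → (w , a , sq + x * x , gu , gv , tailL ds ++ (headℕ ds + x ∷ [])) ∷ []) (upTo T)

  nbrsOf : ℕ → ℕ → ℕ → (ℕ → ℕ → ℕ → ℕ → Bool) → ℕ → State → List State
  nbrsOf k M T rel κ s =
    if treeEq (unary κ) (unary 0) then uNbrs k M s
    else if treeEq (unary κ) (unary 1) then vNbrs k M rel s
    else dNbrs T s

  digitLists : ℕ → ℕ → List (List ℕ)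
  digitLists P zero    = [] ∷ []
  digitLists P (suc c) = concatMap (λ x → concatMap (λ ds → (x ∷ ds) ∷ []) (digitLists P c)) (upTo P)

  module _ (P c : ℕ) where
    fibre₁ : ℕ → ℕ → ℕ → ℕ → ℕ → ℕ → List Vert
    fibre₁ θ w a sq gu gv = concatMap (λ ds → (θ , w , a , sq , gu , gv , ds) ∷ []) (digitLists P c)

    fibre₂ : ℕ → ℕ → ℕ → ℕ → ℕ → List Vert
    fibre₂ θ w a sq gu = concatMap (fibre₁ θ w a sq gu) (upTo P)

    fibre₃ : ℕ → ℕ → ℕ → ℕ → List Vert
    fibre₃ θ w a sq = concatMap (fibre₂ θ w a sq) (upTo P)

    fibre₄ : ℕ → ℕ → ℕ → List Vert
    fibre₄ θ w a = concatMap (fibre₃ θ w a) (upTo P)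

    fibre₅ : ℕ → ℕ → ℕ → List Vert
    fibre₅ M θ w = concatMap (fibre₄ θ w) (upTo M)

    fibre₆ : ℕ → ℕ → ℕ → List Vert
    fibre₆ k M θ = concatMap (fibre₅ M θ) (upTo k)

  vertexList : ℕ → ℕ → ℕ → ℕ → ℕ → List Vert
  vertexList Θ k M P c = concatMap (fibre₆ P c k M) (upTo (suc Θ))

  -- Abstract, as normalising the vertex set is expensive.
  abstract
    vertices : ℕ → ℕ → ℕ → ℕ → ℕ → List Vert
    vertices = vertexList

    vertices≡ : ∀ Θ k M P c → vertices Θ k M P c ≡ vertexList Θ k M P c
    vertices≡ _ _ _ _ _ = refl

  halfStage : ℕ → ℕ → List ℕ
  halfStage κ ℓ = κ ∷ concatMap (λ _ → 2 ∷ []) (upTo ℓ)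

  schedule : ℕ → ℕ → List ℕ
  schedule q ℓ = concatMap (λ _ → halfStage 0 ℓ ++ halfStage 1 ℓ) (upTo q)

  -- The tail of an encoded `just π` is the matrix of `π`, and that of `nothing` is `nil`, so a pair
  -- that is not an edge relates no labels.
  relOf : Tree → ℕ → ℕ → ℕ → ℕ → Bool
  relOf x u v a b = tail (entry (entry x u) v) ⟦ a , b ⟧

  -- Past the end of the schedule `nthℕ` returns 0, but a step from the last layer would lead to
  -- time `suc Θ`, at which there is no vertex.
  adjOf : ℕ → ℕ → ℕ → (ℕ → ℕ → ℕ → ℕ → Bool) → List ℕ → Vert → Vert → Bool
  adjOf k M T rel sched (θ , s) v = nonEmpty (concatMap (λ w → if treeEq (enc vertᵗ w) (enc vertᵗ v) then true ∷ [] else [])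
    (concatMap (λ s′ → (suc θ , s′) ∷ []) (nbrsOf k M T rel (nthℕ sched θ) s)))

  graphOf : (Vert → Vert → Bool) → List Vert → List (List Bool)
  graphOf adj verts = concatMap (λ u → concatMap (λ v → adj u v ∷ []) verts ∷ []) verts

  -- The checks made on the output y of the approximation algorithm for the graph
  -- G on n vertices

  closureOf : ℕ → Tree → ℕ → Tree
  closureOf n G Θ = reach n G Θ

  cutOf unionOf : ℕ → Tree → Tree → Tree
  cutOf   n C y = mkMat n λ i j → if C ⟦ i , j ⟧ then y ⟦ i , j ⟧ else false
  unionOf n G F = mkMat n λ i j → if G ⟦ i , j ⟧ then true else F ⟦ i , j ⟧

  pairsOf : ℕ → (ℕ → ℕ → Bool) → List (ℕ × ℕ)
  pairsOf n f = concatMap (λ i → concatMap (λ j → if f i j then (i , j) ∷ [] else []) (upTo n)) (upTo n)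

  farOf : ℕ → Tree → Tree → List (ℕ × ℕ)
  farOf n C R = pairsOf n λ i j → if C ⟦ i , j ⟧ then (if R ⟦ i , j ⟧ then false else true) else false

  cutPairsOf : ℕ → Tree → List (ℕ × ℕ)
  cutPairsOf n F = pairsOf n λ i j → F ⟦ i , j ⟧

  -- Cutting `y` down to the closure gives the test a meaning for every tree `y`. Adding the edges
  -- of the graph before distances are measured lets one test serve shortcuts and TC spanners alike.
  checkOf : ℕ → Tree → ℕ → ℕ → ℕ → Tree → Bool
  checkOf n G Θ d′ cap y =
    if (if nonEmpty (farOf n C (reach n (unionOf n G F) d′)) then false else true)
    then isSuc (suc cap ∸ length (cutPairsOf n F)) else false
    where
    C = closureOf n G Θ
    F = cutOf n C y

  -- The reduction and its check as polynomial-time functions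

  module Reduction (Y K p : ℕ) where

    kF MF βF TF LF ℓF SF ΘF dF d′F P₁F PF DF sF capF : Fun treeᵗ natᵗ
    kF  = lengthF (toListF idF)
    -- The rows of all constraint matrices taken together. By `rows≡` this is the number of edges
    -- times the number of labels, so it bounds the vertices of a side as well as the labels, and it
    -- does not exceed the size of the input. It serves as the range of labels and as the number of
    -- which β is a root.
    MF  = lengthF (forF (toListF idF) (forF (toListF sndF) (toListF (tailᶠ ∘F sndF))))
      where
      tailᶠ : Fun treeᵗ treeᵗ
      tailᶠ = mkFun tail tailPT λ _ → refl
    βF  = iterF MF (constF 0) (ifF (powF (sucF sndF) K ≤F wk MF) (sucF sndF) sndF)
      (1 , λ env xs acc → ≤-trans (if≤ (tf (powF (sucF sndF) K ≤F wk MF) (cons env acc)) acc)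
        (+-monoʳ-≤ (size acc) (≤-trans (m≤m+n 2 (size env + size xs)) (≤-reflexive (sym (*-identityʳ _))))))
      where
      if≤ : ∀ c acc → size (ifT c (cons nil acc) acc) ≤ size acc + 2
      if≤ nil        acc = m≤m+n _ 2
      if≤ (cons _ _) acc = ≤-reflexive (+-comm 2 (size acc))
    TF  = powF βF Y
    LF  = powF βF 3
    ℓF  = constF Y *F LF
    SF  = constF 2 *F sucF ℓF
    ΘF  = LF *F SF
    dF  = powF βF 4
    d′F = powF βF 5
    P₁F = powF βF p
    PF  = βF *F P₁F
    DF  = powF (LF *F TF) Y *F (ℓF *F (TF *F TF))
    -- One jump for every stage, vertex of a side, position and displacement of a block. The factor
    -- 4 covers both halves of a stage and, for a spanner, the edges of the graph too.
    sF  = constF 4 *F (LF *F (kF *F (powF PF (3 + Y) *F DF)))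
    capF = βF *F sF

    schedF : Fun treeᵗ (listᵗ natᵗ)
    schedF = forF (upToF LF) (wk (half 0 ++F half 1))
      where
      half : ℕ → Fun treeᵗ (listᵗ natᵗ)
      half κ = constF κ ∷F forF (upToF ℓF) (constF 2 ∷F nilF)

    digitListsF : Fun Γ natᵗ → ℕ → Fun Γ (listᵗ (listᵗ natᵗ))
    digitListsF P c = retarget (lists P c) (λ x → digitLists (fn P x) c) (correct P c)
      where
      lists : ∀ {Γ} → Fun Γ natᵗ → ℕ → Fun Γ (listᵗ (listᵗ natᵗ))
      lists P zero    = constF ([] ∷ [])
      lists P (suc c) = forF (upToF P) (forF (lists (wk P) c) (((sndF ∘F fstF) ∷F sndF) ∷F nilF))
      correct : ∀ {Γ} (P : Fun Γ natᵗ) c x → fn (lists P c) x ≡ digitLists (fn P x) c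
      correct P zero    x = refl
      correct P (suc c) x = concatMap-cong (λ y → cong (concatMap (λ ds → (y ∷ ds) ∷ []))
        (correct (wk P) c (x , y))) (upTo (fn P x))

    vertexListF : Fun treeᵗ (listᵗ vertᵗ)
    vertexListF = forF (upToF (sucF ΘF)) (forF (w1 (upToF kF)) (forF (w2 (upToF MF)) (forF (w3 (upToF PF))
      (forF (w4 (upToF PF)) (forF (w5 (upToF PF)) (forF (w6 (digitListsF PF Y))
      ((v6 ▵ v5 ▵ v4 ▵ v3 ▵ v2 ▵ v1 ▵ sndF) ∷F nilF)))))))
      where
      w1 : ∀ {A B} → Fun treeᵗ B → Fun (treeᵗ ⊗ A) B
      w1 = wk
      w2 : ∀ {A B C} → Fun treeᵗ B → Fun ((treeᵗ ⊗ A) ⊗ C) B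
      w2 F = wk (w1 F)
      w3 : ∀ {A B C D} → Fun treeᵗ B → Fun (((treeᵗ ⊗ A) ⊗ C) ⊗ D) B
      w3 F = wk (w2 F)
      w4 : ∀ {A B C D E} → Fun treeᵗ B → Fun ((((treeᵗ ⊗ A) ⊗ C) ⊗ D) ⊗ E) B
      w4 F = wk (w3 F)
      w5 : ∀ {A B C D E G} → Fun treeᵗ B → Fun (((((treeᵗ ⊗ A) ⊗ C) ⊗ D) ⊗ E) ⊗ G) B
      w5 F = wk (w4 F)
      w6 : ∀ {A B C D E G H} → Fun treeᵗ B → Fun ((((((treeᵗ ⊗ A) ⊗ C) ⊗ D) ⊗ E) ⊗ G) ⊗ H) B
      w6 F = wk (w5 F)
      v1 : ∀ {A B C} → Fun ((A ⊗ B) ⊗ C) B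
      v1 = wk sndF
      v2 : ∀ {A B C D} → Fun (((A ⊗ B) ⊗ C) ⊗ D) B
      v2 = wk v1
      v3 : ∀ {A B C D E} → Fun ((((A ⊗ B) ⊗ C) ⊗ D) ⊗ E) B
      v3 = wk v2
      v4 : ∀ {A B C D E G} → Fun (((((A ⊗ B) ⊗ C) ⊗ D) ⊗ E) ⊗ G) B
      v4 = wk v3
      v5 : ∀ {A B C D E G H} → Fun ((((((A ⊗ B) ⊗ C) ⊗ D) ⊗ E) ⊗ G) ⊗ H) B
      v5 = wk v4
      v6 : ∀ {A B C D E G H I} → Fun (((((((A ⊗ B) ⊗ C) ⊗ D) ⊗ E) ⊗ G) ⊗ H) ⊗ I) B
      v6 = wk v5

    relF : Fun Γ treeᵗ → Fun Γ natᵗ → Fun Γ natᵗ → Fun Γ natᵗ → Fun Γ natᵗ → Fun Γ boolᵗ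
    relF X u v a b = entryF₂ (mkFun tail tailPT (λ _ → refl) ∘F entryF (entryF X u) v) a b

    stepF : Fun (treeᵗ ⊗ vertᵗ) (listᵗ stateᵗ)
    stepF = ifF (eqF κ (constF 0)) uF (ifF (eqF κ (constF 1)) vF xF)
      where
      Δ = treeᵗ ⊗ vertᵗ
      κ w a sq gu gv : Fun Δ natᵗ
      κ  = nthF (wk schedF) (fstF ∘F sndF)
      w  = fstF ∘F sndF ∘F sndF
      a  = fstF ∘F sndF ∘F sndF ∘F sndF
      sq = fstF ∘F sndF ∘F sndF ∘F sndF ∘F sndF
      gu = fstF ∘F sndF ∘F sndF ∘F sndF ∘F sndF ∘F sndF
      gv = fstF ∘F sndF ∘F sndF ∘F sndF ∘F sndF ∘F sndF ∘F sndF
      ds : Fun Δ (listᵗ natᵗ)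
      ds = sndF ∘F sndF ∘F sndF ∘F sndF ∘F sndF ∘F sndF ∘F sndF
      w2 : ∀ {A B C D} → Fun A B → Fun ((A ⊗ C) ⊗ D) B
      w2 F = wk (wk F)
      uF vF xF : Fun Δ (listᵗ stateᵗ)
      uF = forF (upToF (wk kF)) (forF (wk (upToF (wk MF)))
        ((u ▵ sndF ▵ (w2 sq +F u *F u) ▵ (w2 gu +F u) ▵ w2 gv ▵ w2 ds) ∷F nilF))
        where
        u : Fun ((Δ ⊗ natᵗ) ⊗ natᵗ) natᵗ
        u = wk sndF
      vF = forF (upToF (wk kF)) (forF (wk (upToF (wk MF)))
        (ifF (relF (fstF ∘F fstF ∘F fstF) (w2 w) v (w2 a) sndF)
          ((v ▵ sndF ▵ (w2 sq +F v *F v) ▵ w2 gu ▵ (w2 gv +F v) ▵ w2 ds) ∷F nilF) nilF))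
        where
        v : Fun ((Δ ⊗ natᵗ) ⊗ natᵗ) natᵗ
        v = wk sndF
      xF = forF (upToF (wk TF))
        ((wk w ▵ wk a ▵ (wk sq +F sndF *F sndF) ▵ wk gu ▵ wk gv ▵ (tailF (wk ds) ++F ((headF (wk ds) +F sndF) ∷F nilF))) ∷F nilF)

    nbrsF : Fun (treeᵗ ⊗ vertᵗ) (listᵗ vertᵗ)
    nbrsF = forF stepF ((sucF (fstF ∘F sndF ∘F fstF) ▵ sndF) ∷F nilF)

    adjF : Fun ((treeᵗ ⊗ vertᵗ) ⊗ vertᵗ) boolᵗ
    adjF = nonEmptyF {A = boolᵗ} (forF (wk nbrsF) (ifF (eqF sndF (wk sndF)) (constF true ∷F nilF) nilF))

    sched : Tree → List ℕ
    sched x = schedule (fn LF x) (fn ℓF x)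

    verts : Tree → List Vert
    verts x = vertices (fn ΘF x) (fn kF x) (fn MF x) (fn PF x) Y

    verticesF : Fun treeᵗ (listᵗ vertᵗ)
    verticesF = retarget vertexListF verts λ x → sym (vertices≡ (fn ΘF x) (fn kF x) (fn MF x) (fn PF x) Y)

    graph : Tree → List (List Bool)
    graph x = graphOf (adjOf (fn kF x) (fn MF x) (fn TF x) (relOf x) (sched x)) (verts x)

    graphF : Fun treeᵗ (listᵗ (listᵗ boolᵗ))
    graphF = retarget (forF verticesF (forF (wk verticesF) (adjF ∷F nilF) ∷F nilF)) graph λ _ → refl

    inputF : Fun treeᵗ (treeᵗ ⊗ (treeᵗ ⊗ treeᵗ))
    inputF = untypedF graphF ▵ toBinaryF dF ▵ toBinaryF sF

    nF : Fun treeᵗ natᵗ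
    nF = retarget (lengthF verticesF) (length ∘ verts) λ _ → refl

    G C : Tree → Tree
    G x = encList (encList encodeBool) (graph x)
    C x = closureOf (length (verts x)) (G x) (fn ΘF x)

    cut union near : Tree × Tree → Tree
    cut   (x , y) = cutOf (length (verts x)) (C x) y
    union (x , y) = unionOf (length (verts x)) (G x) (cut (x , y))
    near  (x , y) = reach (length (verts x)) (union (x , y)) (fn d′F x)

    GF CF : Fun treeᵗ treeᵗ
    GF = retarget (untypedF graphF) G λ _ → refl
    CF = retarget (reachF nF GF ΘF) C λ _ → refl

    cutF unionF nearF : Fun (treeᵗ ⊗ treeᵗ) treeᵗ
    cutF   = retarget (matF (wk nF) (entryF₂ (CF ∘F fstF ∘F fstF ∘F fstF) (wk sndF) sndF ∧F
                                     entryF₂ (sndF ∘F fstF ∘F fstF) (wk sndF) sndF)) cut λ _ → refl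
    unionF = retarget (matF (wk nF) (entryF₂ (GF ∘F fstF ∘F fstF ∘F fstF) (wk sndF) sndF ∨F
                                     entryF₂ (cutF ∘F fstF ∘F fstF) (wk sndF) sndF)) union λ _ → refl
    nearF  = retarget (reachF (wk nF) unionF (wk d′F)) near λ _ → refl

    pairsF : Fun (((treeᵗ ⊗ treeᵗ) ⊗ natᵗ) ⊗ natᵗ) boolᵗ → Fun (treeᵗ ⊗ treeᵗ) (listᵗ (natᵗ ⊗ natᵗ))
    pairsF F = forF (upToF (wk nF)) (forF (wk (upToF (wk nF))) (ifF F ((wk sndF ▵ sndF) ∷F nilF) nilF))

    farF cutPairsF : Fun (treeᵗ ⊗ treeᵗ) (listᵗ (natᵗ ⊗ natᵗ))
    farF      = retarget (pairsF (entryF₂ (CF ∘F fstF ∘F fstF ∘F fstF) (wk sndF) sndF ∧F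
                          notF (entryF₂ (nearF ∘F fstF ∘F fstF) (wk sndF) sndF)))
                  (λ (x , y) → farOf (length (verts x)) (C x) (near (x , y))) λ _ → refl
    cutPairsF = retarget (pairsF (entryF₂ (cutF ∘F fstF ∘F fstF) (wk sndF) sndF))
                  (λ (x , y) → cutPairsOf (length (verts x)) (cut (x , y))) λ _ → refl

    checkF : Fun (treeᵗ ⊗ treeᵗ) boolᵗ
    checkF = retarget (notF (nonEmptyF farF) ∧F (lengthF cutPairsF ≤F wk capF))
      (λ (x , y) → checkOf (length (verts x)) (G x) (fn ΘF x) (fn d′F x) (fn capF x) y) λ _ → refl

open PT
open Ty
open Fun

-- Walks

data RWalk {X : Set} (R : X → X → Set) : X → X → ℕ → Set where
  done : ∀ {x} → RWalk R x x 0
  step : ∀ {x y z n} → R x y → RWalk R y z n → RWalk R x z (suc n)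

module _ {X : Set} {R : X → X → Set} where

  _⋈_ : ∀ {x y z m n} → RWalk R x y m → RWalk R y z n → RWalk R x z (m + n)
  done     ⋈ q = q
  step r p ⋈ q = step r (p ⋈ q)

  snoc : ∀ {x y z n} → RWalk R x y n → R y z → RWalk R x z (suc n)
  snoc done       r = step r done
  snoc (step s p) r = step s (snoc p r)

  unsnoc : ∀ {x z n} → RWalk R x z (suc n) → ∃[ y ] RWalk R x y n × R y z
  unsnoc (step r done)         = _ , done , r
  unsnoc (step r p@(step _ _)) = let y , q , s = unsnoc p in y , step r q , s

  splitAt : ∀ m {n x z} → RWalk R x z (m + n) → ∃[ y ] RWalk R x y m × RWalk R y z n
  splitAt zero    p          = _ , done , p
  splitAt (suc m) (step r p) = let y , q , q′ = splitAt m p in y , step r q , q′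

mapWalk : ∀ {X Z : Set} {R : X → X → Set} {Q : Z → Z → Set} (f : X → Z) → (∀ x y → R x y → Q (f x) (f y)) →
          ∀ {x y n} → RWalk R x y n → RWalk Q (f x) (f y) n
mapWalk f h done       = done
mapWalk f h (step r p) = step (h _ _ r) (mapWalk f h p)

isCons-encodeBool : ∀ b → isCons (encodeBool b) ≡ b
isCons-encodeBool false = refl
isCons-encodeBool true  = refl

concatMap-single : ∀ {X Z : Set} (f : X → Z) xs → concatMap (λ x → f x ∷ []) xs ≡ map f xs
concatMap-single f []       = refl
concatMap-single f (x ∷ xs) = cong (f x ∷_) (concatMap-single f xs)

entry-map : ∀ {X Z : Set} (e : Z → Tree) (f : X → Z) xs (i : Fin (length xs)) →
  entry (encList e (map f xs)) (toℕ i) ≡ e (f (lookup xs i))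
entry-map e f (x ∷ xs) fzero    = refl
entry-map e f (x ∷ xs) (fsuc i) = entry-map e f xs i

entry-upTo : ∀ {Z : Set} (e : Z → Tree) (f : ℕ → Z) (h : ℕ → ℕ) {n i} → i < n →
  entry (encList e (map f (applyUpTo h n))) i ≡ e (f (h i))
entry-upTo e f h {suc n} {zero}  (s≤s _)   = refl
entry-upTo e f h {suc n} {suc i} (s≤s i<n) = entry-upTo e f (h ∘ suc) i<n

mkMat-entry : ∀ {n f i j} → i < n → j < n → mkMat n f ⟦ i , j ⟧ ≡ f i j
mkMat-entry {n} {f} {i} {j} i<n j<n = begin
  isCons (entry (entry (encList (encList encodeBool) (concatMap (λ i → row i ∷ []) (upTo n))) i) j)
    ≡⟨ cong (λ xs → isCons (entry (entry (encList (encList encodeBool) xs) i) j)) (concatMap-single row (upTo n)) ⟩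
  isCons (entry (entry (encList (encList encodeBool) (map row (upTo n))) i) j)
    ≡⟨ cong (λ t → isCons (entry t j)) (entry-upTo (encList encodeBool) row id i<n) ⟩
  isCons (entry (encList encodeBool (concatMap (λ j → f i j ∷ []) (upTo n))) j)
    ≡⟨ cong (λ xs → isCons (entry (encList encodeBool xs) j)) (concatMap-single (f i) (upTo n)) ⟩
  isCons (entry (encList encodeBool (map (f i) (upTo n))) j)
    ≡⟨ cong isCons (entry-upTo encodeBool (f i) id j<n) ⟩
  isCons (encodeBool (f i j))  ≡⟨ isCons-encodeBool (f i j) ⟩
  f i j                        ∎
  where
  open ≡-Reasoning
  row : ℕ → List Bool
  row i = concatMap (λ j → f i j ∷ []) (upTo n)

∈-for⁻ : ∀ {X Z : Set} (p : X → Bool) (f : X → Z) xs {z} →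
  z ∈ˡ concatMap (λ x → if p x then f x ∷ [] else []) xs → ∃[ x ] x ∈ˡ xs × p x ≡ true × z ≡ f x
∈-for⁻ p f (x ∷ xs) z∈ with p x in eq
∈-for⁻ p f (x ∷ xs) (here refl) | true  = x , here refl , eq , refl
∈-for⁻ p f (x ∷ xs) (there z∈)  | true  = let y , y∈ , q = ∈-for⁻ p f xs z∈ in y , there y∈ , q
∈-for⁻ p f (x ∷ xs) z∈          | false = let y , y∈ , q = ∈-for⁻ p f xs z∈ in y , there y∈ , q

∈-for⁺ : ∀ {X Z : Set} (p : X → Bool) (f : X → Z) {xs x} → x ∈ˡ xs → p x ≡ true →
  f x ∈ˡ concatMap (λ x → if p x then f x ∷ [] else []) xs
∈-for⁺ p f {x ∷ xs} (here refl) px rewrite px = here refl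
∈-for⁺ p f {y ∷ xs} (there x∈)  px with p y
... | true  = there (∈-for⁺ p f x∈ px)
... | false = ∈-for⁺ p f x∈ px

nonEmpty⁻ : ∀ {X : Set} (xs : List X) → nonEmpty xs ≡ true → ∃[ x ] x ∈ˡ xs
nonEmpty⁻ (x ∷ xs) _ = x , here refl

nonEmpty⁺ : ∀ {X : Set} {x} {xs : List X} → x ∈ˡ xs → nonEmpty xs ≡ true
nonEmpty⁺ (here _)  = refl
nonEmpty⁺ (there _) = refl

and⁻ : ∀ {a b} → (if a then b else false) ≡ true → a ≡ true × b ≡ true
and⁻ {true} h = refl , h

and⁺ : ∀ {a b} → a ≡ true → b ≡ true → (if a then b else false) ≡ true
and⁺ refl h = h

or⁻ : ∀ {a b} → (if a then true else b) ≡ true → a ≡ true ⊎ b ≡ true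
or⁻ {true}  _ = inj₁ refl
or⁻ {false} h = inj₂ h

or⁺ : ∀ {a b} → a ≡ true ⊎ b ≡ true → (if a then true else b) ≡ true
or⁺ {true}  _          = refl
or⁺ {false} (inj₂ h)   = h
or⁺ {false} (inj₁ ())

module _ (n : ℕ) (M : Tree) where
  private
    E : Fin n → Fin n → Set
    E i j = M ⟦ toℕ i , toℕ j ⟧ ≡ true

    Correct : Tree → ℕ → Set
    Correct R m = ∀ i j → (R ⟦ toℕ i , toℕ j ⟧ ≡ true → ∃[ l ] l ≤ m × RWalk E i j l) ×
                          (∀ l → l ≤ m → RWalk E i j l → R ⟦ toℕ i , toℕ j ⟧ ≡ true)

    start : Correct (mkMat n λ i j → treeEq (unary i) (unary j)) 0
    start i j rewrite mkMat-entry {n} {λ i j → treeEq (unary i) (unary j)} (toℕ<n i) (toℕ<n j) =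
      (λ h → 0 , z≤n , subst (λ j → RWalk E i j 0) (toℕ-injective (unary-injective _ _ (treeEq-sound _ _ h))) done) ,
      λ { .0 z≤n done → treeEq-refl (unary (toℕ i)) }
      where
      unary-injective : ∀ m n → unary m ≡ unary n → m ≡ n
      unary-injective zero    zero    _  = refl
      unary-injective (suc m) (suc n) eq = cong suc (unary-injective m n (cong tail eq))

    next : ∀ R m → Correct R m → Correct (reachStep n M R) (suc m)
    next R m cor i j rewrite mkMat-entry {n} {λ i j → if R ⟦ i , j ⟧ then true else nonEmpty (concatMap (λ l →
        if (if R ⟦ i , l ⟧ then M ⟦ l , j ⟧ else false) then (true ∷ []) else []) (upTo n))} (toℕ<n i) (toℕ<n j) =
      sound , complete
      where
      p : ℕ → Bool
      p l = if R ⟦ toℕ i , l ⟧ then M ⟦ l , toℕ j ⟧ else false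
      sound : _ → ∃[ l ] l ≤ suc m × RWalk E i j l
      sound h with or⁻ {R ⟦ toℕ i , toℕ j ⟧} h
      ... | inj₁ r = let l , l≤m , w = proj₁ (cor i j) r in l , m≤n⇒m≤1+n l≤m , w
      ... | inj₂ e with nonEmpty⁻ _ e
      ...   | _ , t∈ with ∈-for⁻ p (λ _ → true) (upTo n) t∈
      ...     | v , v∈ , pv , _ with and⁻ {R ⟦ toℕ i , v ⟧} pv
      ...       | r , e′ =
        let v<n = ∈-upTo⁻ v∈
            v≡  = toℕ-fromℕ< v<n
            l , l≤m , w = proj₁ (cor i (fromℕ< v<n)) (subst (λ v → R ⟦ toℕ i , v ⟧ ≡ true) (sym v≡) r)
        in suc l , s≤s l≤m , snoc w (subst (λ v → M ⟦ v , toℕ j ⟧ ≡ true) (sym v≡) e′)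
      complete : ∀ l → l ≤ suc m → RWalk E i j l → _
      complete l l≤ w with m≤n⇒m<n∨m≡n l≤
      ... | inj₁ (s≤s l≤m) = or⁺ {R ⟦ toℕ i , toℕ j ⟧} (inj₁ (proj₂ (cor i j) l l≤m w))
      ... | inj₂ refl = let v , w′ , e = unsnoc w in or⁺ {R ⟦ toℕ i , toℕ j ⟧} (inj₂ (nonEmpty⁺ (∈-for⁺ p (λ _ → true)
        (∈-upTo⁺ (toℕ<n v)) (and⁺ (proj₂ (cor i v) m ≤-refl w′) e))))

    loop : ∀ r R m → Correct R m → Correct (iter r (reachStep n M) R) (r + m)
    loop zero    R m cor = cor
    loop (suc r) R m cor = subst (Correct _) (+-suc r m) (loop r (reachStep n M R) (suc m) (next R m cor))

  reach-correct : ∀ r i j → (reach n M r ⟦ toℕ i , toℕ j ⟧ ≡ true → ∃[ l ] l ≤ r × RWalk E i j l) ×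
                            (∀ l → l ≤ r → RWalk E i j l → reach n M r ⟦ toℕ i , toℕ j ⟧ ≡ true)
  reach-correct r = subst (Correct _) (+-identityʳ r) (loop r _ 0 start)

∈-concatMap⁺ : ∀ {X Z : Set} (f : X → List Z) {xs x z} → x ∈ˡ xs → z ∈ˡ f x → z ∈ˡ concatMap f xs
∈-concatMap⁺ f (here refl) z∈ = ∈-++⁺ˡ z∈
∈-concatMap⁺ f {y ∷ _} (there x∈) z∈ = ∈-++⁺ʳ (f y) (∈-concatMap⁺ f x∈ z∈)

∈-concatMap⁻ : ∀ {X Z : Set} (f : X → List Z) xs {z} → z ∈ˡ concatMap f xs → ∃[ x ] x ∈ˡ xs × z ∈ˡ f x
∈-concatMap⁻ f (x ∷ xs) z∈ with ∈-++⁻ (f x) z∈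
... | inj₁ z∈fx = x , here refl , z∈fx
... | inj₂ z∈xs = let y , y∈ , q = ∈-concatMap⁻ f xs z∈xs in y , there y∈ , q

unary-injective : ∀ {m n} → unary m ≡ unary n → m ≡ n
unary-injective {zero}  {zero}  _  = refl
unary-injective {suc m} {suc n} eq = cong suc (unary-injective (cong tail eq))

cons-injective : ∀ {a b c d} → cons a b ≡ cons c d → a ≡ c × b ≡ d
cons-injective refl = refl , refl

encList-injective : ∀ {X : Set} (e : X → Tree) → (∀ {x y} → e x ≡ e y → x ≡ y) → ∀ {xs ys} → encList e xs ≡ encList e ys → xs ≡ ys
encList-injective e inj {[]}     {[]}     _  = refl
encList-injective e inj {x ∷ xs} {y ∷ ys} eq = cong₂ _∷_ (inj (cong head eq)) (encList-injective e inj (cong tail eq))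

enc-vert-injective : ∀ {u v : Vert} → enc vertᵗ u ≡ enc vertᵗ v → u ≡ v
enc-vert-injective eq =
  let e₁ , eq = cons-injective eq
      e₂ , eq = cons-injective eq
      e₃ , eq = cons-injective eq
      e₄ , eq = cons-injective eq
      e₅ , eq = cons-injective eq
      e₆ , e₇ = cons-injective eq
  in cong₂ _,_ (unary-injective e₁) (cong₂ _,_ (unary-injective e₂) (cong₂ _,_ (unary-injective e₃)
    (cong₂ _,_ (unary-injective e₄) (cong₂ _,_ (unary-injective e₅) (cong₂ _,_ (unary-injective e₆)
      (encList-injective unary unary-injective e₇))))))

-- The steps of the graph

module _ (k M T : ℕ) (rel : ℕ → ℕ → ℕ → ℕ → Bool) where

  data Step : ℕ → State → State → Set where
    choose : ∀ {w a sq gu gv ds u a′} → u < k → a′ < M →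
      Step 0 (w , a , sq , gu , gv , ds) (u , a′ , sq + u * u , gu + u , gv , ds)
    constrain : ∀ {w a sq gu gv ds v b} → v < k → b < M → rel w v a b ≡ true →
      Step 1 (w , a , sq , gu , gv , ds) (v , b , sq + v * v , gu , gv + v , ds)
    move : ∀ {κ w a sq gu gv ds x} → x < T →
      Step (2 + κ) (w , a , sq , gu , gv , ds) (w , a , sq + x * x , gu , gv , tailL ds ++ (headℕ ds + x ∷ []))

  Step⁻ : ∀ κ {s s′} → s′ ∈ˡ nbrsOf k M T rel κ s → Step κ s s′
  Step⁻ zero s′∈ with ∈-concatMap⁻ _ (upTo k) s′∈
  ... | u , u∈ , s′∈ with ∈-concatMap⁻ _ (upTo M) s′∈
  ...   | a , a∈ , here refl = choose (∈-upTo⁻ u∈) (∈-upTo⁻ a∈)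
  Step⁻ (suc zero) {w , a , _} s′∈ with ∈-concatMap⁻ _ (upTo k) s′∈
  ... | v , v∈ , s′∈ with ∈-for⁻ (rel w v a) _ (upTo M) s′∈
  ...   | b , b∈ , r , refl = constrain (∈-upTo⁻ v∈) (∈-upTo⁻ b∈) r
  Step⁻ (suc (suc κ)) s′∈ with ∈-concatMap⁻ _ (upTo T) s′∈
  ... | x , x∈ , here refl = move (∈-upTo⁻ x∈)

  Step⁺ : ∀ {κ s s′} → Step κ s s′ → s′ ∈ˡ nbrsOf k M T rel κ s
  Step⁺ (choose u<k a<M) = ∈-concatMap⁺ _ (∈-upTo⁺ u<k) (∈-concatMap⁺ _ (∈-upTo⁺ a<M) (here refl))
  Step⁺ (constrain {w} {a} {v = v} v<k b<M r) = ∈-concatMap⁺ _ (∈-upTo⁺ v<k) (∈-for⁺ (rel w v a) _ (∈-upTo⁺ b<M) r)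
  Step⁺ (move x<T) = ∈-concatMap⁺ _ (∈-upTo⁺ x<T) (here refl)

-- What acceptance by the check means

module Check (n : ℕ) (G : Tree) (Θ d′ cap : ℕ) (y : Tree) where
  private
    C F U R : Tree
    C = closureOf n G Θ
    F = cutOf n C y
    U = unionOf n G F
    R = reach n U d′

  Cut GEdge EdgeOrCut : Fin n → Fin n → Set
  Cut i j       = C ⟦ toℕ i , toℕ j ⟧ ≡ true × y ⟦ toℕ i , toℕ j ⟧ ≡ true
  GEdge i j     = G ⟦ toℕ i , toℕ j ⟧ ≡ true
  EdgeOrCut i j = GEdge i j ⊎ Cut i j

  cutPairs : List (ℕ × ℕ)
  cutPairs = cutPairsOf n F

  private
    cut-entry : ∀ (i j : Fin n) → F ⟦ toℕ i , toℕ j ⟧ ≡ (if C ⟦ toℕ i , toℕ j ⟧ then y ⟦ toℕ i , toℕ j ⟧ else false)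
    cut-entry i j = mkMat-entry (toℕ<n i) (toℕ<n j)

    cut⁺ : ∀ {i j} → Cut i j → F ⟦ toℕ i , toℕ j ⟧ ≡ true
    cut⁺ {i} {j} (c , h) = trans (cut-entry i j) (and⁺ c h)

    cut⁻ : ∀ {i j} → F ⟦ toℕ i , toℕ j ⟧ ≡ true → Cut i j
    cut⁻ {i} {j} h = and⁻ (trans (sym (cut-entry i j)) h)

    union-entry : ∀ (i j : Fin n) → U ⟦ toℕ i , toℕ j ⟧ ≡ (if G ⟦ toℕ i , toℕ j ⟧ then true else F ⟦ toℕ i , toℕ j ⟧)
    union-entry i j = mkMat-entry (toℕ<n i) (toℕ<n j)

    union⁺ : ∀ i j → EdgeOrCut i j → U ⟦ toℕ i , toℕ j ⟧ ≡ true
    union⁺ i j e = trans (union-entry i j) (or⁺ (map₂ (cut⁺ {i} {j}) e))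

    union⁻ : ∀ i j → U ⟦ toℕ i , toℕ j ⟧ ≡ true → EdgeOrCut i j
    union⁻ i j h = map₂ (cut⁻ {i} {j}) (or⁻ (trans (sym (union-entry i j)) h))

    far : ℕ → ℕ → Bool
    far i j = if C ⟦ i , j ⟧ then (if R ⟦ i , j ⟧ then false else true) else false

    ∈-pairs⁺ : ∀ f {i j} → i < n → j < n → f i j ≡ true → (i , j) ∈ˡ pairsOf n f
    ∈-pairs⁺ f {i} i<n j<n h = ∈-concatMap⁺ _ (∈-upTo⁺ i<n) (∈-for⁺ (f i) _ (∈-upTo⁺ j<n) h)

    none-in : ∀ {X : Set} (xs : List X) → (if nonEmpty xs then false else true) ≡ true → ∀ {z} → z ∈ˡ xs → ⊥
    none-in [] _ ()

  cutPairs⁺ : ∀ {i j} → Cut i j → (toℕ i , toℕ j) ∈ˡ cutPairs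
  cutPairs⁺ {i} {j} c = ∈-pairs⁺ (λ i j → F ⟦ i , j ⟧) (toℕ<n i) (toℕ<n j) (cut⁺ {i} {j} c)

  check⁻ : checkOf n G Θ d′ cap y ≡ true → length cutPairs ≤ cap ×
    (∀ {i j l} → l ≤ Θ → RWalk GEdge i j l → ∃[ l′ ] l′ ≤ d′ × RWalk EdgeOrCut i j l′)
  check⁻ h = isSuc-≤ (length cutPairs) cap (proj₂ (and⁻ h)) , close
    where
    close : ∀ {i j l} → l ≤ Θ → RWalk GEdge i j l → ∃[ l′ ] l′ ≤ d′ × RWalk EdgeOrCut i j l′
    close {i} {j} l≤ w with R ⟦ toℕ i , toℕ j ⟧ in eq
    ... | true  = let l′ , l′≤ , w′ = proj₁ (reach-correct n U d′ i j) eq in l′ , l′≤ , mapWalk id union⁻ w′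
    ... | false = ⊥-elim (none-in (pairsOf n far) (proj₁ (and⁻ h)) (∈-pairs⁺ far (toℕ<n i) (toℕ<n j)
            (and⁺ (proj₂ (reach-correct n G Θ i j) _ l≤ w) (cong (λ b → if b then false else true) eq))))

  check⁺ : length cutPairs ≤ cap →
    (∀ {i j l} → RWalk GEdge i j l → ∃[ l′ ] l′ ≤ d′ × RWalk EdgeOrCut i j l′) → checkOf n G Θ d′ cap y ≡ true
  check⁺ len close = and⁺ (empty (pairsOf n far) none) (≤-isSuc len)
    where
    empty : ∀ {X : Set} (xs : List X) → (∀ {z} → z ∈ˡ xs → ⊥) → (if nonEmpty xs then false else true) ≡ true
    empty []       _ = refl
    empty (z ∷ xs) h = ⊥-elim (h (here refl))
    none : ∀ {z} → z ∈ˡ pairsOf n far → ⊥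
    none z∈ with ∈-concatMap⁻ _ (upTo n) z∈
    ... | i , i∈ , z∈′ with ∈-for⁻ (far i) (i ,_) (upTo n) z∈′
    ...   | j , j∈ , f , _ with and⁻ {C ⟦ i , j ⟧} f
    ...     | c , f′ =
      let i<n = ∈-upTo⁻ i∈
          j<n = ∈-upTo⁻ j∈
          i≡ = toℕ-fromℕ< i<n
          j≡ = toℕ-fromℕ< j<n
          l , _ , w = proj₁ (reach-correct n G Θ (fromℕ< i<n) (fromℕ< j<n))
                        (subst₂ (λ i j → C ⟦ i , j ⟧ ≡ true) (sym i≡) (sym j≡) c)
          l′ , l′≤ , w′ = close w
          h = proj₂ (reach-correct n U d′ _ _) l′ l′≤ (mapWalk id union⁺ w′)
      in contra (subst₂ (λ i j → R ⟦ i , j ⟧ ≡ true) i≡ j≡ h) f′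
      where
      contra : ∀ {b} → b ≡ true → (if b then false else true) ≡ true → ⊥
      contra refl ()

-- The layered graph in terms of states

module Semantics (k M T L c P : ℕ) (rel : ℕ → ℕ → ℕ → ℕ → Bool) where

  ℓ S Θ : ℕ
  ℓ = c * L
  S = 2 * suc ℓ
  Θ = L * S

  sched : List ℕ
  sched = schedule L ℓ

  kind : ℕ → ℕ
  kind = nthℕ sched

  verts : List Vert
  verts = vertices Θ k M P c

  n : ℕ
  n = length verts

  vtx : Fin n → Vert
  vtx = lookup verts

  StepAt : ℕ → State → State → Set
  StepAt θ = Step k M T rel (kind θ)

  -- This is an infinite graph, without bounds on time and position; the graph of the reduction is
  -- its restriction to the listed vertices. Walks are easier to build and to analyse here.
  data VEdge : Vert → Vert → Set where
    at : ∀ {θ s s′} → StepAt θ s s′ → VEdge (θ , s) (suc θ , s′)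

  adj : Vert → Vert → Bool
  adj = adjOf k M T rel sched

  adj⁻ : ∀ u v → adj u v ≡ true → VEdge u v
  adj⁻ (θ , s) v h with nonEmpty⁻ _ h
  ... | _ , b∈ with ∈-for⁻ (λ w → treeEq (enc vertᵗ w) (enc vertᵗ v)) (λ _ → true) _ b∈
  ...   | w , w∈ , eq , _ with ∈-concatMap⁻ _ (nbrsOf k M T rel (kind θ) s) w∈
  ...     | s′ , s′∈ , here refl with enc-vert-injective {w} {v} (treeEq-sound _ _ eq)
  ...       | refl = at (Step⁻ k M T rel (kind θ) s′∈)

  adj⁺ : ∀ {u v} → VEdge u v → adj u v ≡ true
  adj⁺ {u} {v} (at st) = nonEmpty⁺ (∈-for⁺ (λ w → treeEq (enc vertᵗ w) (enc vertᵗ v)) (λ _ → true)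
    (∈-concatMap⁺ _ (Step⁺ k M T rel st) (here refl)) (treeEq-refl (enc vertᵗ v)))

  graph : List (List Bool)
  graph = graphOf adj verts

  graphTree closure : Tree
  graphTree = encList (encList encodeBool) graph
  closure   = closureOf n graphTree Θ

  graph-entry : ∀ i j → graphTree ⟦ toℕ i , toℕ j ⟧ ≡ adj (vtx i) (vtx j)
  graph-entry i j = begin
    isCons (entry (entry (encList (encList encodeBool) graph) (toℕ i)) (toℕ j))
      ≡⟨ cong (λ xs → isCons (entry (entry (encList (encList encodeBool) xs) (toℕ i)) (toℕ j))) (concatMap-single row verts) ⟩
    isCons (entry (entry (encList (encList encodeBool) (map row verts)) (toℕ i)) (toℕ j))
      ≡⟨ cong (λ t → isCons (entry t (toℕ j))) (entry-map (encList encodeBool) row verts i) ⟩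
    isCons (entry (encList encodeBool (row (vtx i))) (toℕ j))
      ≡⟨ cong (λ xs → isCons (entry (encList encodeBool xs) (toℕ j))) (concatMap-single (adj (vtx i)) verts) ⟩
    isCons (entry (encList encodeBool (map (adj (vtx i)) verts)) (toℕ j))
      ≡⟨ cong isCons (entry-map encodeBool (adj (vtx i)) verts j) ⟩
    isCons (encodeBool (adj (vtx i) (vtx j)))  ≡⟨ isCons-encodeBool _ ⟩
    adj (vtx i) (vtx j)                        ∎
    where
    open ≡-Reasoning
    row : Vert → List Bool
    row u = concatMap (λ v → adj u v ∷ []) verts

  Edge : Fin n → Fin n → Set
  Edge i j = VEdge (vtx i) (vtx j)

  edge⁻ : ∀ i j → graphTree ⟦ toℕ i , toℕ j ⟧ ≡ true → Edge i j
  edge⁻ i j h = adj⁻ (vtx i) (vtx j) (trans (sym (graph-entry i j)) h)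

  edge⁺ : ∀ i j → Edge i j → graphTree ⟦ toℕ i , toℕ j ⟧ ≡ true
  edge⁺ i j h = trans (graph-entry i j) (adj⁺ h)

  closure⁻ : ∀ {i j} → closure ⟦ toℕ i , toℕ j ⟧ ≡ true → ∃[ l ] RWalk Edge i j l
  closure⁻ {i} {j} h = let l , _ , w = proj₁ (reach-correct n graphTree Θ i j) h in l , mapWalk id edge⁻ w

  closure⁺ : ∀ {i j l} → l ≤ Θ → RWalk Edge i j l → closure ⟦ toℕ i , toℕ j ⟧ ≡ true
  closure⁺ {i} {j} l≤ w = proj₂ (reach-correct n graphTree Θ i j) _ l≤ (mapWalk id edge⁺ w)

-- Enumerations without repetition and the entries of the schedule

unique-concatMap : ∀ {X Z : Set} (f : X → List Z) (tag : Z → X) {xs} → Unique xs →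
  (∀ x → Unique (f x)) → (∀ {x z} → z ∈ˡ f x → tag z ≡ x) → Unique (concatMap f xs)
unique-concatMap f tag []         uf tagged = []
unique-concatMap f tag {x ∷ xs} (x∉ ∷ uxs) uf tagged = Unique-++⁺ (uf x) (unique-concatMap f tag uxs uf tagged)
  λ (z∈fx , z∈) → let y , y∈ , z∈fy = ∈-concatMap⁻ f xs z∈ in
    All-lookup x∉ y∈ (trans (sym (tagged z∈fx)) (tagged z∈fy))

length-concatMap : ∀ {X Z : Set} (f : X → List Z) m → (∀ x → length (f x) ≡ m) → ∀ xs → length (concatMap f xs) ≡ length xs * m
length-concatMap f m len []       = refl
length-concatMap f m len (x ∷ xs) = trans (length-++ (f x)) (cong₂ _+_ (len x) (length-concatMap f m len xs))

length-for : ∀ {Z : Set} (f : ℕ → List Z) m n → (∀ x → length (f x) ≡ m) → length (concatMap f (upTo n)) ≡ n * m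
length-for f m n len = trans (length-concatMap f m len (upTo n)) (cong (_* m) (length-upTo n))

singles : ∀ {X Z : Set} (f : X → Z) → (∀ {x y} → f x ≡ f y → x ≡ y) → ∀ {xs} → Unique xs → Unique (concatMap (λ x → f x ∷ []) xs)
singles f inj {xs} u rewrite concatMap-single f xs = Unique-map⁺ inj u

lookup-injective : ∀ {X : Set} {xs : List X} → Unique xs → ∀ i j → lookup xs i ≡ lookup xs j → i ≡ j
lookup-injective {xs = x ∷ xs} (x∉ ∷ u) fzero    fzero    eq = refl
lookup-injective {xs = x ∷ xs} (x∉ ∷ u) fzero    (fsuc j) eq = ⊥-elim (All-lookup x∉ (∈-lookup j) eq)
lookup-injective {xs = x ∷ xs} (x∉ ∷ u) (fsuc i) fzero    eq = ⊥-elim (All-lookup x∉ (∈-lookup i) (sym eq))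
lookup-injective {xs = x ∷ xs} (x∉ ∷ u) (fsuc i) (fsuc j) eq = cong fsuc (lookup-injective u i j eq)

digitLists-unique : ∀ P c → Unique (digitLists P c)
digitLists-unique P zero    = [] ∷ []
digitLists-unique P (suc c) = unique-concatMap _ headℕ (upTo⁺ P)
  (λ x → singles (x ∷_) (λ { refl → refl }) (digitLists-unique P c))
  λ {x} z∈ → case ∈-concatMap⁻ _ (digitLists P c) z∈ of λ { (ds , _ , here refl) → refl }

digitLists-length : ∀ P c → length (digitLists P c) ≡ P ^ c
digitLists-length P zero    = refl
digitLists-length P (suc c) = length-for _ (P ^ c) P λ x →
  trans (length-concatMap _ 1 (λ _ → refl) (digitLists P c)) (trans (*-identityʳ _) (digitLists-length P c))

∈-digitLists⁺ : ∀ {P} ds → All (_< P) ds → ds ∈ˡ digitLists P (length ds)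
∈-digitLists⁺ []       []         = here refl
∈-digitLists⁺ (d ∷ ds) (d<P ∷ ds<P) = ∈-concatMap⁺ _ (∈-upTo⁺ d<P) (∈-concatMap⁺ _ (∈-digitLists⁺ ds ds<P) (here refl))

∈-digitLists⁻ : ∀ {P} c {ds} → ds ∈ˡ digitLists P c → length ds ≡ c × All (_< P) ds
∈-digitLists⁻ zero    (here refl) = refl , []
∈-digitLists⁻ {P} (suc c) ds∈ with ∈-concatMap⁻ _ (upTo P) ds∈
... | d , d∈ , ds∈ with ∈-concatMap⁻ _ (digitLists P c) ds∈
...   | ds , ds∈ , here refl = let len , all = ∈-digitLists⁻ c ds∈ in cong suc len , ∈-upTo⁻ d∈ ∷ all

nthℕ-++ˡ : ∀ xs {ys i} → i < length xs → nthℕ (xs ++ ys) i ≡ nthℕ xs i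
nthℕ-++ˡ (x ∷ xs) {i = zero}  _         = refl
nthℕ-++ˡ (x ∷ xs) {i = suc i} (s≤s i<n) = nthℕ-++ˡ xs i<n

nthℕ-++ʳ : ∀ xs {ys} i → nthℕ (xs ++ ys) (length xs + i) ≡ nthℕ ys i
nthℕ-++ʳ []       i = refl
nthℕ-++ʳ (x ∷ xs) i = nthℕ-++ʳ xs i

nthℕ-repeat : ∀ {X : Set} (b : List ℕ) (xs : List X) {i r} → i < length xs → r < length b →
  nthℕ (concatMap (λ _ → b) xs) (i * length b + r) ≡ nthℕ b r
nthℕ-repeat b (x ∷ xs) {zero}  _         r<b = nthℕ-++ˡ b r<b
nthℕ-repeat b (x ∷ xs) {suc i} {r} (s≤s i<n) r<b = trans (cong (nthℕ (b ++ concatMap (λ _ → b) xs)) (+-assoc (length b) _ r))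
  (trans (nthℕ-++ʳ b (i * length b + r)) (nthℕ-repeat b xs i<n r<b))

halfStage-length : ∀ κ ℓ → length (halfStage κ ℓ) ≡ suc ℓ
halfStage-length κ ℓ = cong suc (trans (length-for _ 1 ℓ (λ _ → refl)) (*-identityʳ ℓ))

nthℕ-twos : ∀ {X : Set} (xs : List X) {i} → i < length xs → nthℕ (concatMap (λ _ → 2 ∷ []) xs) i ≡ 2
nthℕ-twos (x ∷ xs) {zero}  _         = refl
nthℕ-twos (x ∷ xs) {suc i} (s≤s i<n) = nthℕ-twos xs i<n

nthℕ-schedule : ∀ q ℓ {i r} → i < q → r < 2 * suc ℓ →
  nthℕ (schedule q ℓ) (i * (2 * suc ℓ) + r) ≡ nthℕ (halfStage 0 ℓ ++ halfStage 1 ℓ) r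
nthℕ-schedule q ℓ {i} {r} i<q r<S = trans (cong (λ m → nthℕ (schedule q ℓ) (i * m + r)) (sym len))
  (nthℕ-repeat (halfStage 0 ℓ ++ halfStage 1 ℓ) (upTo q) (subst (i <_) (sym (length-upTo q)) i<q) (subst (r <_) (sym len) r<S))
  where
  len : length (halfStage 0 ℓ ++ halfStage 1 ℓ) ≡ 2 * suc ℓ
  len = trans (length-++ (halfStage 0 ℓ)) (cong₂ _+_ (halfStage-length 0 ℓ)
    (trans (halfStage-length 1 ℓ) (sym (+-identityʳ (suc ℓ)))))

-- The vertex set and walks inside it

module Paths (k M T L c P : ℕ) (c>0 : 0 < c) (rel : ℕ → ℕ → ℕ → ℕ → Bool) where
  open Semantics k M T L c P rel public

  kindA : ∀ {i} → i < L → kind (i * S) ≡ 0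
  kindA {i} i<L = trans (cong kind (sym (+-identityʳ (i * S)))) (nthℕ-schedule L ℓ i<L (s≤s z≤n))

  kindA′ : ∀ {i r} → i < L → r < ℓ → kind (i * S + suc r) ≡ 2
  kindA′ {i} {r} i<L r<ℓ = trans (nthℕ-schedule L ℓ i<L (≤-trans (s≤s r<ℓ) (m≤m+n (suc ℓ) _)))
    (trans (nthℕ-++ˡ (halfStage 0 ℓ) (subst (suc r <_) (sym (halfStage-length 0 ℓ)) (s≤s r<ℓ)))
      (nthℕ-twos (upTo ℓ) (subst (r <_) (sym (length-upTo ℓ)) r<ℓ)))

  private
    secondHalf : ∀ {i} r → i < L → r < suc ℓ → kind (i * S + (suc ℓ + r)) ≡ nthℕ (halfStage 1 ℓ) r
    secondHalf {i} r i<L r≤ℓ = trans (nthℕ-schedule L ℓ i<L (≤-trans (+-monoʳ-< (suc ℓ) r≤ℓ) (≤-reflexive (cong (suc ℓ +_) (sym (+-identityʳ (suc ℓ)))))))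
      (trans (cong (λ m → nthℕ (halfStage 0 ℓ ++ halfStage 1 ℓ) (m + r)) (sym (halfStage-length 0 ℓ)))
        (nthℕ-++ʳ (halfStage 0 ℓ) r))

  kindB : ∀ {i} → i < L → kind (i * S + suc ℓ) ≡ 1
  kindB {i} i<L = trans (cong (λ m → kind (i * S + m)) (sym (+-identityʳ (suc ℓ)))) (secondHalf 0 i<L (s≤s z≤n))

  kindB′ : ∀ {i r} → i < L → r < ℓ → kind (i * S + (suc ℓ + suc r)) ≡ 2
  kindB′ {i} {r} i<L r<ℓ = trans (secondHalf (suc r) i<L (s≤s r<ℓ)) (nthℕ-twos (upTo ℓ) (subst (r <_) (sym (length-upTo ℓ)) r<ℓ))

  -- The box is split by the direction in which its conditions travel. Bounds on vertex and label
  -- and the number of digits pass from the start of a walk onwards; bounds on the coordinates pass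
  -- back from its end, as coordinates never decrease. So a walk between two listed vertices uses
  -- listed vertices only.
  Fwd Bwd : State → Set
  Fwd (w , a , sq , gu , gv , ds) = w < k × a < M × length ds ≡ c
  Bwd (w , a , sq , gu , gv , ds) = sq < P × gu < P × gv < P × All (_< P) ds

  Box : Vert → Set
  Box (θ , s) = θ ≤ Θ × Fwd s × Bwd s

  private
    verts≡ : verts ≡ vertexList Θ k M P c
    verts≡ = vertices≡ Θ k M P c

  verts⁺ : ∀ {v} → Box v → v ∈ˡ verts
  verts⁺ {θ , w , a , sq , gu , gv , ds} (θ≤ , (w< , a< , len) , sq< , gu< , gv< , ds<) = subst (_ ∈ˡ_) (sym verts≡)
    (∈-concatMap⁺ _ (∈-upTo⁺ (s≤s θ≤)) (∈-concatMap⁺ _ (∈-upTo⁺ w<) (∈-concatMap⁺ _ (∈-upTo⁺ a<)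
    (∈-concatMap⁺ _ (∈-upTo⁺ sq<) (∈-concatMap⁺ _ (∈-upTo⁺ gu<) (∈-concatMap⁺ _ (∈-upTo⁺ gv<)
    (∈-concatMap⁺ _ (subst (λ m → ds ∈ˡ digitLists P m) len (∈-digitLists⁺ ds ds<)) (here refl))))))))

  verts⁻ : ∀ {v} → v ∈ˡ verts → Box v
  verts⁻ v∈ with ∈-concatMap⁻ _ (upTo (suc Θ)) (subst (_ ∈ˡ_) verts≡ v∈)
  ... | θ , θ∈ , v∈ with ∈-concatMap⁻ _ (upTo k) v∈
  ... | w , w∈ , v∈ with ∈-concatMap⁻ _ (upTo M) v∈
  ... | a , a∈ , v∈ with ∈-concatMap⁻ _ (upTo P) v∈
  ... | sq , sq∈ , v∈ with ∈-concatMap⁻ _ (upTo P) v∈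
  ... | gu , gu∈ , v∈ with ∈-concatMap⁻ _ (upTo P) v∈
  ... | gv , gv∈ , v∈ with ∈-concatMap⁻ _ (digitLists P c) v∈
  ... | ds , ds∈ , here refl = let len , all = ∈-digitLists⁻ c ds∈ in
    s≤s⁻¹ (∈-upTo⁻ θ∈) , (∈-upTo⁻ w∈ , ∈-upTo⁻ a∈ , len) , ∈-upTo⁻ sq∈ , ∈-upTo⁻ gu∈ , ∈-upTo⁻ gv∈ , all

  box : ∀ i → Box (vtx i)
  box i = verts⁻ (∈-lookup i)

  idx : ∀ {v} → Box v → Fin n
  idx b = index (verts⁺ b)

  vtx-idx : ∀ {v} (b : Box v) → vtx (idx b) ≡ v
  vtx-idx b = sym (lookup-index (verts⁺ b))

  n≡ : n ≡ suc Θ * (k * (M * (P * (P * (P * P ^ c)))))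
  n≡ = trans (cong length verts≡) (length-for (fibre₆ P c k M) _ (suc Θ) λ θ → length-for (fibre₅ P c M θ) _ k λ w →
    length-for (fibre₄ P c θ w) _ M λ a → length-for (fibre₃ P c θ w a) _ P λ sq →
    length-for (fibre₂ P c θ w a sq) _ P λ gu → length-for (fibre₁ P c θ w a sq gu) _ P λ gv →
    trans (length-concatMap (λ ds → (θ , w , a , sq , gu , gv , ds) ∷ []) 1 (λ _ → refl) (digitLists P c))
      (trans (*-identityʳ _) (digitLists-length P c)))

  verts-unique : Unique verts
  verts-unique = subst Unique (sym verts≡) (
    unique-concatMap (fibre₆ P c k M) θOf (upTo⁺ (suc Θ)) (λ θ →
    unique-concatMap (fibre₅ P c M θ) wOf (upTo⁺ k) (λ w →
    unique-concatMap (fibre₄ P c θ w) aOf (upTo⁺ M) (λ a →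
    unique-concatMap (fibre₃ P c θ w a) sqOf (upTo⁺ P) (λ sq →
    unique-concatMap (fibre₂ P c θ w a sq) guOf (upTo⁺ P) (λ gu →
    unique-concatMap (fibre₁ P c θ w a sq gu) gvOf (upTo⁺ P) (λ gv →
    singles (λ ds → (θ , w , a , sq , gu , gv , ds)) (λ { refl → refl }) (digitLists-unique P c))
    (λ z∈ → case t₁ z∈ of λ { (_ , refl) → refl }))
    (λ z∈ → case t₂ z∈ of λ { (_ , _ , refl) → refl }))
    (λ z∈ → case t₃ z∈ of λ { (_ , _ , _ , refl) → refl }))
    (λ z∈ → case t₄ z∈ of λ { (_ , _ , _ , _ , refl) → refl }))
    (λ z∈ → case t₅ z∈ of λ { (_ , _ , _ , _ , _ , refl) → refl }))
    (λ z∈ → case t₆ z∈ of λ { (_ , _ , _ , _ , _ , _ , refl) → refl }))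
    where
    θOf wOf aOf sqOf guOf gvOf : Vert → ℕ
    θOf (θ , _) = θ
    wOf (_ , w , _) = w
    aOf (_ , _ , a , _) = a
    sqOf (_ , _ , _ , sq , _) = sq
    guOf (_ , _ , _ , _ , gu , _) = gu
    gvOf (_ , _ , _ , _ , _ , gv , _) = gv
    t₁ : ∀ {θ w a sq gu gv} {z : Vert} → z ∈ˡ fibre₁ P c θ w a sq gu gv → ∃[ ds ] z ≡ (θ , w , a , sq , gu , gv , ds)
    t₁ z∈ with ∈-concatMap⁻ _ (digitLists P c) z∈
    ... | ds , _ , here eq = ds , eq
    t₂ : ∀ {θ w a sq gu} {z : Vert} → z ∈ˡ fibre₂ P c θ w a sq gu → ∃[ gv ] ∃[ ds ] z ≡ (θ , w , a , sq , gu , gv , ds)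
    t₂ z∈ with ∈-concatMap⁻ _ (upTo P) z∈
    ... | gv , _ , z∈ = gv , t₁ z∈
    t₃ : ∀ {θ w a sq} {z : Vert} → z ∈ˡ fibre₃ P c θ w a sq → ∃[ gu ] ∃[ gv ] ∃[ ds ] z ≡ (θ , w , a , sq , gu , gv , ds)
    t₃ z∈ with ∈-concatMap⁻ _ (upTo P) z∈
    ... | gu , _ , z∈ = gu , t₂ z∈
    t₄ : ∀ {θ w a} {z : Vert} → z ∈ˡ fibre₄ P c θ w a → ∃[ sq ] ∃[ gu ] ∃[ gv ] ∃[ ds ] z ≡ (θ , w , a , sq , gu , gv , ds)
    t₄ z∈ with ∈-concatMap⁻ _ (upTo P) z∈
    ... | sq , _ , z∈ = sq , t₃ z∈
    t₅ : ∀ {θ w} {z : Vert} → z ∈ˡ fibre₅ P c M θ w → ∃[ a ] ∃[ sq ] ∃[ gu ] ∃[ gv ] ∃[ ds ] z ≡ (θ , w , a , sq , gu , gv , ds)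
    t₅ z∈ with ∈-concatMap⁻ _ (upTo M) z∈
    ... | a , _ , z∈ = a , t₄ z∈
    t₆ : ∀ {θ} {z : Vert} → z ∈ˡ fibre₆ P c k M θ → ∃[ w ] ∃[ a ] ∃[ sq ] ∃[ gu ] ∃[ gv ] ∃[ ds ] z ≡ (θ , w , a , sq , gu , gv , ds)
    t₆ z∈ with ∈-concatMap⁻ _ (upTo k) z∈
    ... | w , _ , z∈ = w , t₅ z∈

  walk-time : ∀ {θ s θ′ s′ l} → RWalk VEdge (θ , s) (θ′ , s′) l → θ′ ≡ θ + l
  walk-time done                       = sym (+-identityʳ _)
  walk-time {θ} (step (at _) w) = trans (walk-time w) (sym (+-suc θ _))

  rotate-length : ∀ ds x → length ds ≡ c → length (tailL ds ++ (headℕ ds + x ∷ [])) ≡ c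
  rotate-length []       x len = ⊥-elim (<-irrefl len c>0)
  rotate-length (d ∷ ds) x len = trans (length-++ ds) (trans (+-comm (length ds) 1) len)

  step-fwd : ∀ {κ s s′} → Step k M T rel κ s s′ → Fwd s → Fwd s′
  step-fwd (choose u< a<)      (_ , _ , len)   = u< , a< , len
  step-fwd (constrain v< b< _) (_ , _ , len)   = v< , b< , len
  step-fwd (move {ds = ds} {x} _) (w< , a< , len) = w< , a< , rotate-length ds x len

  step-bwd : ∀ {κ s s′} → Step k M T rel κ s s′ → Bwd s′ → Bwd s
  step-bwd (choose _ _)      (sq< , gu< , gv< , ds<) = m+n≤o⇒m≤o _ sq< , m+n≤o⇒m≤o _ gu< , gv< , ds<
  step-bwd (constrain _ _ _) (sq< , gu< , gv< , ds<) = m+n≤o⇒m≤o _ sq< , gu< , m+n≤o⇒m≤o _ gv< , ds<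
  step-bwd (move {ds = ds} {x} _) (sq< , gu< , gv< , ds<) = m+n≤o⇒m≤o _ sq< , gu< , gv< , unrotate ds ds<
    where
    unrotate : ∀ ds → All (_< P) (tailL ds ++ (headℕ ds + x ∷ [])) → All (_< P) ds
    unrotate []       _   = []
    unrotate (d ∷ ds) all with All-++⁻ ds all
    ... | ds< , d< ∷ [] = m+n≤o⇒m≤o _ d< ∷ ds<

  walk-bwd : ∀ {θ s θ′ s′ l} → RWalk VEdge (θ , s) (θ′ , s′) l → Bwd s′ → Bwd s
  walk-bwd done             b = b
  walk-bwd (step (at st) w) b = step-bwd st (walk-bwd w b)

  vtx-injective : ∀ {i j} → vtx i ≡ vtx j → i ≡ j
  vtx-injective {i} {j} = lookup-injective verts-unique i j

  lift : ∀ {u v l} i j → vtx i ≡ u → vtx j ≡ v → RWalk VEdge u v l → RWalk Edge i j l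
  lift i j i≡ j≡ done = subst (λ j → RWalk Edge i j 0) (vtx-injective (trans i≡ (sym j≡))) done
  lift {θ , s} {θ′ , s′} i j i≡ j≡ (step {y = _ , s₁} (at st) w) =
    step (subst₂ VEdge (sym i≡) (sym (vtx-idx b)) (at st)) (lift (idx b) j (vtx-idx b) j≡ w)
    where
    b : Box (suc θ , s₁)
    b = ≤-trans (≤-trans (m≤m+n (suc θ) _) (≤-reflexive (sym (walk-time w)))) (proj₁ (subst Box j≡ (box j))) ,
        step-fwd st (proj₁ (proj₂ (subst Box i≡ (box i)))) , walk-bwd w (proj₂ (proj₂ (subst Box j≡ (box j))))

-- Sums over initial segments of the natural numbers

Σ< : ℕ → (ℕ → ℕ) → ℕ
Σ< zero    f = 0
Σ< (suc n) f = f 0 + Σ< n (f ∘ suc)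

Σ<-mono : ∀ n {f g : ℕ → ℕ} → (∀ {i} → i < n → f i ≤ g i) → Σ< n f ≤ Σ< n g
Σ<-mono zero    _ = z≤n
Σ<-mono (suc n) h = +-mono-≤ (h (s≤s z≤n)) (Σ<-mono n (h ∘ s≤s))

Σ<-cong : ∀ n {f g : ℕ → ℕ} → (∀ i → f i ≡ g i) → Σ< n f ≡ Σ< n g
Σ<-cong zero    _ = refl
Σ<-cong (suc n) h = cong₂ _+_ (h 0) (Σ<-cong n (h ∘ suc))

Σ<-split : ∀ m n (f : ℕ → ℕ) → Σ< (m + n) f ≡ Σ< m f + Σ< n (λ i → f (m + i))
Σ<-split zero    n f = refl
Σ<-split (suc m) n f = trans (cong (f 0 +_) (Σ<-split m n (f ∘ suc))) (sym (+-assoc (f 0) _ _))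

Σ<-product : ∀ m n (f : ℕ → ℕ) → Σ< (m * n) f ≡ Σ< m (λ i → Σ< n (λ j → f (i * n + j)))
Σ<-product zero    n f = refl
Σ<-product (suc m) n f = trans (Σ<-split n (m * n) f) (cong (Σ< n f +_)
  (trans (Σ<-product m n (λ i → f (n + i))) (Σ<-cong m λ i → Σ<-cong n λ j → cong f (sym (+-assoc n (i * n) j)))))

Σ<-const : ∀ n m → Σ< n (λ _ → m) ≡ n * m
Σ<-const zero    m = refl
Σ<-const (suc n) m = cong (m +_) (Σ<-const n m)

Σ<-term : ∀ {n} {f : ℕ → ℕ} {i} → i < n → f i ≤ Σ< n f
Σ<-term {suc n} {f} {zero}  _         = m≤m+n (f 0) _
Σ<-term {suc n} {f} {suc i} (s≤s i<n) = m≤n⇒m≤o+n (f 0) (Σ<-term {f = f ∘ suc} i<n)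

Σ<-+ : ∀ n (f g : ℕ → ℕ) → Σ< n (λ i → f i + g i) ≡ Σ< n f + Σ< n g
Σ<-+ zero    f g = refl
Σ<-+ (suc n) f g = trans (cong (f 0 + g 0 +_) (Σ<-+ n (f ∘ suc) (g ∘ suc))) (lemma (f 0) (g 0) _ _)
  where
  lemma : ∀ a b c d → a + b + (c + d) ≡ a + c + (b + d)
  lemma = solve-∀

search : ∀ n {A B : ℕ → Set} → (∀ {i} → i < n → A i ⊎ B i) → (∃[ i ] i < n × A i) ⊎ (∀ {i} → i < n → B i)
search zero    h = inj₂ λ ()
search (suc n) h with h (s≤s z≤n) | search n (h ∘ s≤s)
... | inj₁ a | _                  = inj₁ (0 , s≤s z≤n , a)
... | inj₂ b | inj₁ (i , i< , a)  = inj₁ (suc i , s≤s i< , a)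
... | inj₂ b | inj₂ all           = inj₂ λ { {zero} _ → b ; {suc i} (s≤s i<) → all i< }

-- The square exceeds its tangent at `t` by exactly the squared deviation from `t`. All uses of
-- convexity go through this identity.
square-deviation : ∀ x t → x * x + t * t ≡ 2 * (t * x) + ∣ x - t ∣ * ∣ x - t ∣
square-deviation x t with ≤-total t x
... | inj₁ t≤x rewrite m≤n⇒∣n-m∣≡n∸m t≤x = subst (λ x′ → x′ * x′ + t * t ≡ 2 * (t * x′) + (x ∸ t) * (x ∸ t)) (m+[n∸m]≡n t≤x) (ring t (x ∸ t))
  where
  ring : ∀ t d → (t + d) * (t + d) + t * t ≡ 2 * (t * (t + d)) + d * d
  ring = solve-∀
... | inj₂ x≤t rewrite m≤n⇒∣m-n∣≡n∸m x≤t = subst (λ t′ → x * x + t′ * t′ ≡ 2 * (t′ * x) + (t ∸ x) * (t ∸ x)) (m+[n∸m]≡n x≤t) (ring x (t ∸ x))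
  where
  ring : ∀ x d → x * x + (x + d) * (x + d) ≡ 2 * ((x + d) * x) + d * d
  ring = solve-∀

deviation-zero : ∀ {x t} → ∣ x - t ∣ * ∣ x - t ∣ ≡ 0 → x ≡ t
deviation-zero {x} {t} eq with m*n≡0⇒m≡0∨n≡0 ∣ x - t ∣ eq
... | inj₁ h = ∣m-n∣≡0⇒m≡n h
... | inj₂ h = ∣m-n∣≡0⇒m≡n h

dot : List ℕ → List ℕ → ℕ
dot (y ∷ ys) (d ∷ ds) = y * d + dot ys ds
dot _        _        = 0

dot-snoc : ∀ ys ds y d → length ys ≡ length ds → dot (ys ++ (y ∷ [])) (ds ++ (d ∷ [])) ≡ dot ys ds + y * d
dot-snoc []        []        y d len = +-identityʳ _
dot-snoc (y₀ ∷ ys) (d₀ ∷ ds) y d len =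
  trans (cong (y₀ * d₀ +_) (dot-snoc ys ds y d (suc-injective len))) (sym (+-assoc (y₀ * d₀) _ _))

rotate : List ℕ → List ℕ
rotate ys = tailL ys ++ (headℕ ys ∷ [])

dot-rotate : ∀ ys ds x → 0 < length ys → length ys ≡ length ds →
  dot (rotate ys) (tailL ds ++ (headℕ ds + x ∷ [])) ≡ dot ys ds + headℕ ys * x
dot-rotate (y ∷ ys) (d ∷ ds) x _ len = trans (dot-snoc ys ds y (d + x) (suc-injective len)) (ring (dot ys ds) y d x)
  where
  ring : ∀ a y d x → a + y * (d + x) ≡ y * d + a + y * x
  ring = solve-∀

-- The energy of a walk and the rigidity of critical walks

Place : Set
Place = ℕ × ℕ × ℕ × ℕ × List ℕ

-- The label is dropped because it is the only component that the ends of a critical walk leave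
-- undetermined.
place : State → Place
place (w , a , sq , gu , gv , ds) = w , sq , gu , gv , ds

label : State → ℕ
label (w , a , _) = a

module Tube (k M T L c P : ℕ) (c>0 : 0 < c) (rel : ℕ → ℕ → ℕ → ℕ → Bool) (μ ν : ℕ) where
  open Paths k M T L c P c>0 rel

  -- The choices are required to be μ in the steps of kind 0, ν in those of
  -- kind 1, and to follow the list of digits, rotated along, in the others.

  target : ℕ → List ℕ → ℕ
  target 0             ys = μ
  target 1             ys = ν
  target (suc (suc _)) ys = headℕ ys

  turn : ℕ → List ℕ → List ℕ
  turn 0             ys = ys
  turn 1             ys = ys
  turn (suc (suc _)) ys = rotate ys

  critStep : ℕ → List ℕ → Place → Place
  critStep 0             ys (w , sq , gu , gv , ds) = μ , sq + μ * μ , gu + μ , gv , ds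
  critStep 1             ys (w , sq , gu , gv , ds) = ν , sq + ν * ν , gu , gv + ν , ds
  critStep (suc (suc _)) ys (w , sq , gu , gv , ds) =
    w , sq + headℕ ys * headℕ ys , gu , gv , tailL ds ++ (headℕ ds + headℕ ys ∷ [])

  crit : ℕ → ℕ → List ℕ → Place → Place
  crit zero    θ ys e = e
  crit (suc l) θ ys e = crit l (suc θ) (turn (kind θ) ys) (critStep (kind θ) ys e)

  track : ℕ → ℕ → List ℕ → List ℕ
  track zero    θ ys = ys
  track (suc l) θ ys = track l (suc θ) (turn (kind θ) ys)

  targetSum : ℕ → ℕ → List ℕ → ℕ
  targetSum zero    θ ys = 0
  targetSum (suc l) θ ys = target (kind θ) ys * target (kind θ) ys + targetSum l (suc θ) (turn (kind θ) ys)

  sqOf : Place → ℕ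
  sqOf (w , sq , _) = sq

  -- Half the gradient of the sum of squares at the targets, as a functional of the position. In a
  -- step, `sq` minus twice `lin` changes by the squared deviation minus the squared target.
  -- Rotating `ys` together with the digits keeps weights and digits matched.
  lin : List ℕ → Place → ℕ
  lin ys (w , sq , gu , gv , ds) = μ * gu + ν * gv + dot ys ds

  Same : List ℕ → Place → Set
  Same ys (w , sq , gu , gv , ds) = length ys ≡ length ds

  private
    balance : ∀ sq x t lin → sq + x * x + (2 * lin + t * t) ≡ sq + (2 * (lin + t * x) + ∣ x - t ∣ * ∣ x - t ∣)
    balance sq x t lin = trans (r₁ sq x t lin) (trans (cong (λ z → sq + (2 * lin + z)) (square-deviation x t)) (r₂ sq (t * x) _ lin))
      where
      r₁ : ∀ sq x t lin → sq + x * x + (2 * lin + t * t) ≡ sq + (2 * lin + (x * x + t * t))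
      r₁ = solve-∀
      r₂ : ∀ sq tx dd lin → sq + (2 * lin + (2 * tx + dd)) ≡ sq + (2 * (lin + tx) + dd)
      r₂ = solve-∀

    turn-length : ∀ κ ys → 0 < length ys → length (turn κ ys) ≡ length ys
    turn-length 0             ys       _ = refl
    turn-length 1             ys       _ = refl
    turn-length (suc (suc _)) (y ∷ ys) _ = trans (length-++ ys) (+-comm (length ys) 1)

    rotate-len : ∀ (ds : List ℕ) x → 0 < length ds → length (tailL ds ++ (headℕ ds + x ∷ [])) ≡ length ds
    rotate-len (d ∷ ds) x _ = trans (length-++ ds) (+-comm (length ds) 1)

    one : ∀ {κ s s′} → Step k M T rel κ s s′ → ∀ ys → 0 < length ys → Same ys (place s) →
      Same (turn κ ys) (place s′) ×
      ∃[ dev ] sqOf (place s′) + (2 * lin ys (place s) + target κ ys * target κ ys) ≡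
               sqOf (place s) + (2 * lin (turn κ ys) (place s′) + dev) ×
               (dev ≡ 0 → place s′ ≡ critStep κ ys (place s))
    one (choose {sq = sq} {gu} {gv} {ds} {u} _ _) ys pos same = same , ∣ u - μ ∣ * ∣ u - μ ∣ ,
      trans (balance sq u μ (μ * gu + ν * gv + dot ys ds)) (cong (λ z → sq + (2 * z + ∣ u - μ ∣ * ∣ u - μ ∣)) (ring μ gu u (ν * gv) (dot ys ds))) ,
      λ h → cong (λ u → u , sq + u * u , gu + u , gv , ds) (deviation-zero h)
      where
      ring : ∀ μ gu u b a → μ * gu + b + a + μ * u ≡ μ * (gu + u) + b + a
      ring = solve-∀
    one (constrain {sq = sq} {gu} {gv} {ds} {v} _ _ _) ys pos same = same , ∣ v - ν ∣ * ∣ v - ν ∣ ,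
      trans (balance sq v ν (μ * gu + ν * gv + dot ys ds)) (cong (λ z → sq + (2 * z + ∣ v - ν ∣ * ∣ v - ν ∣)) (ring ν gv v (μ * gu) (dot ys ds))) ,
      λ h → cong (λ v → v , sq + v * v , gu , gv + v , ds) (deviation-zero h)
      where
      ring : ∀ ν gv v b a → b + ν * gv + a + ν * v ≡ b + ν * (gv + v) + a
      ring = solve-∀
    one (move {κ} {w} {sq = sq} {gu} {gv} {ds} {x} _) ys pos same =
      trans (turn-length (2 + κ) ys pos) (trans same (sym (rotate-len ds x (subst (0 <_) same pos)))) ,
      ∣ x - headℕ ys ∣ * ∣ x - headℕ ys ∣ ,
      trans (balance sq x (headℕ ys) (μ * gu + ν * gv + dot ys ds)) (cong (λ z → sq + (2 * z + ∣ x - headℕ ys ∣ * ∣ x - headℕ ys ∣))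
        (trans (+-assoc (μ * gu + ν * gv) _ _) (cong (μ * gu + ν * gv +_) (sym (dot-rotate ys ds x pos same))))) ,
      λ h → cong (λ x → w , sq + x * x , gu , gv , tailL ds ++ (headℕ ds + x ∷ [])) (deviation-zero h)

    critOne : ∀ κ ys e → 0 < length ys → Same ys e → Same (turn κ ys) (critStep κ ys e) ×
      sqOf (critStep κ ys e) + (2 * lin ys e + target κ ys * target κ ys) ≡ sqOf e + 2 * lin (turn κ ys) (critStep κ ys e)
    critOne 0 ys (w , sq , gu , gv , ds) pos same = same , ring sq μ gu (ν * gv) (dot ys ds)
      where
      ring : ∀ sq μ gu b a → sq + μ * μ + (2 * (μ * gu + b + a) + μ * μ) ≡ sq + 2 * (μ * (gu + μ) + b + a)
      ring = solve-∀
    critOne 1 ys (w , sq , gu , gv , ds) pos same = same , ring sq ν gv (μ * gu) (dot ys ds)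
      where
      ring : ∀ sq ν gv b a → sq + ν * ν + (2 * (b + ν * gv + a) + ν * ν) ≡ sq + 2 * (b + ν * (gv + ν) + a)
      ring = solve-∀
    critOne (suc (suc κ)) ys (w , sq , gu , gv , ds) pos same =
      trans (turn-length (2 + κ) ys pos) (trans same (sym (rotate-len ds (headℕ ys) (subst (0 <_) same pos)))) ,
      trans (ring sq (headℕ ys) (μ * gu + ν * gv) (dot ys ds))
        (cong (λ z → sq + 2 * (μ * gu + ν * gv + z)) (sym (dot-rotate ys ds (headℕ ys) pos same)))
      where
      ring : ∀ sq t b a → sq + t * t + (2 * (b + a) + t * t) ≡ sq + 2 * (b + (a + t * t))
      ring = solve-∀

    -- This composes two consecutive balances: `a` and `e` are the sum of squares and twice the
    -- functional at the state between them, and both cancel.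
    chain : ∀ a b c d e f g h i → a + (b + c) ≡ d + (e + f) → g + (e + h) ≡ a + i →
      g + (b + (c + h)) ≡ d + (i + f)
    chain a b c d e f g h i p q = +-cancelˡ-≡ (a + e) _ _ (begin
      a + e + (g + (b + (c + h)))       ≡⟨ r₁ a b c e g h ⟩
      (a + (b + c)) + (g + (e + h))     ≡⟨ cong₂ _+_ p q ⟩
      (d + (e + f)) + (a + i)           ≡⟨ r₂ a d e f i ⟩
      a + e + (d + (i + f))             ∎)
      where
      open ≡-Reasoning
      r₁ : ∀ a b c e g h → a + e + (g + (b + (c + h))) ≡ (a + (b + c)) + (g + (e + h))
      r₁ = solve-∀
      r₂ : ∀ a d e f i → (d + (e + f)) + (a + i) ≡ a + e + (d + (i + f))
      r₂ = solve-∀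

  -- The balances of the steps telescope, so the total deviation depends only on the end positions
  -- and the schedule. As a sum of squares it vanishes only if every choice meets its target.
  energy : ∀ {θ s θ′ s′ l} → RWalk VEdge (θ , s) (θ′ , s′) l → ∀ ys → 0 < length ys → Same ys (place s) →
    Same (track l θ ys) (place s′) × ∃[ dev ]
    sqOf (place s′) + (2 * lin ys (place s) + targetSum l θ ys) ≡ sqOf (place s) + (2 * lin (track l θ ys) (place s′) + dev) ×
    (dev ≡ 0 → place s′ ≡ crit l θ ys (place s))
  energy {s = s} done ys pos same = same , 0 , cong (sqOf (place s) +_) refl , λ _ → refl
  energy {θ} {s} {θ′} {s′} (step {n = l} (at {s′ = s₁} st) w) ys pos same =
    let same₁ , dev₁ , eq₁ , crit₁ = one st ys pos same
        same₂ , dev₂ , eq₂ , crit₂ = energy w (turn (kind θ) ys) (subst (0 <_) (sym (turn-length (kind θ) ys pos)) pos) same₁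
    in same₂ , dev₁ + dev₂ ,
       trans (chain (sqOf (place s₁)) (2 * lin ys (place s)) (target (kind θ) ys * target (kind θ) ys) (sqOf (place s))
         (2 * lin (turn (kind θ) ys) (place s₁)) dev₁ (sqOf (place s′)) (targetSum l (suc θ) (turn (kind θ) ys))
         (2 * lin (track l (suc θ) (turn (kind θ) ys)) (place s′) + dev₂) eq₁ eq₂)
         (cong (sqOf (place s) +_) (ring (2 * lin (track l (suc θ) (turn (kind θ) ys)) (place s′)) dev₁ dev₂)) ,
       λ h → trans (crit₂ (m+n≡0⇒n≡0 dev₁ h)) (cong (crit l (suc θ) (turn (kind θ) ys)) (crit₁ (m+n≡0⇒m≡0 dev₁ h)))
    where
    ring : ∀ a b c → a + c + b ≡ a + (b + c)
    ring = solve-∀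

  critEnergy : ∀ l θ ys e → 0 < length ys → Same ys e →
    sqOf (crit l θ ys e) + (2 * lin ys e + targetSum l θ ys) ≡ sqOf e + 2 * lin (track l θ ys) (crit l θ ys e)
  critEnergy zero    θ ys e pos same = cong (sqOf e +_) (+-identityʳ _)
  critEnergy (suc l) θ ys e pos same =
    let same₁ , eq₁ = critOne (kind θ) ys e pos same
        eq₂ = critEnergy l (suc θ) (turn (kind θ) ys) _ (subst (0 <_) (sym (turn-length (kind θ) ys pos)) pos) same₁
    in trans (chain (sqOf (critStep (kind θ) ys e)) (2 * lin ys e) (target (kind θ) ys * target (kind θ) ys) (sqOf e)
         (2 * lin (turn (kind θ) ys) (critStep (kind θ) ys e)) 0 (sqOf (crit (suc l) θ ys e))
         (targetSum l (suc θ) (turn (kind θ) ys)) (2 * lin (track (suc l) θ ys) (crit (suc l) θ ys e))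
         (trans eq₁ (cong (sqOf e +_) (sym (+-identityʳ _)))) eq₂)
         (cong (sqOf e +_) (+-identityʳ _))

  track-+ : ∀ m l θ ys → track (m + l) θ ys ≡ track l (θ + m) (track m θ ys)
  track-+ zero    l θ ys = cong (λ θ → track l θ ys) (sym (+-identityʳ θ))
  track-+ (suc m) l θ ys = trans (track-+ m l (suc θ) (turn (kind θ) ys)) (cong (λ θ′ → track l θ′ (track m (suc θ) (turn (kind θ) ys))) (sym (+-suc θ m)))

  targetSum-+ : ∀ m l θ ys → targetSum (m + l) θ ys ≡ targetSum m θ ys + targetSum l (θ + m) (track m θ ys)
  targetSum-+ zero    l θ ys = cong (λ θ → targetSum l θ ys) (sym (+-identityʳ θ))
  targetSum-+ (suc m) l θ ys = trans (cong (target (kind θ) ys * target (kind θ) ys +_)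
    (trans (targetSum-+ m l (suc θ) (turn (kind θ) ys))
      (cong (λ θ′ → targetSum m (suc θ) (turn (kind θ) ys) + targetSum l θ′ (track m (suc θ) (turn (kind θ) ys))) (sym (+-suc θ m)))))
    (sym (+-assoc (target (kind θ) ys * target (kind θ) ys) _ _))

  crit-+ : ∀ m l θ ys e → crit (m + l) θ ys e ≡ crit l (θ + m) (track m θ ys) (crit m θ ys e)
  crit-+ zero    l θ ys e = cong (λ θ → crit l θ ys e) (sym (+-identityʳ θ))
  crit-+ (suc m) l θ ys e = trans (crit-+ m l (suc θ) (turn (kind θ) ys) (critStep (kind θ) ys e))
    (cong (λ θ′ → crit l θ′ (track m (suc θ) (turn (kind θ) ys)) (crit m (suc θ) (turn (kind θ) ys) (critStep (kind θ) ys e))) (sym (+-suc θ m)))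

  -- A walk whose end has the position of the critical walk is critical
  -- throughout: its deviations sum up to zero.
  tube : ∀ {s s₁ s₂ m l θ′} ys → 0 < length ys → Same ys (place s) →
    RWalk VEdge (0 , s) (m , s₁) m → RWalk VEdge (m , s₁) (θ′ , s₂) l →
    proj₂ (place s₂) ≡ proj₂ (crit (m + l) 0 ys (place s)) → place s₁ ≡ crit m 0 ys (place s)
  tube {s} {s₁} {s₂} {m} {l} ys pos same w₁ w₂ end =
    let same₁ , dev₁ , eq₁ , crit₁ = energy w₁ ys pos same
        _ , dev₂ , eq₂ , _ = energy w₂ (track m 0 ys) (subst (0 <_) (sym (track-length m 0 ys pos)) pos) same₁
        whole = trans (chain (sqOf (place s₁)) (2 * lin ys (place s)) (targetSum m 0 ys) (sqOf (place s))
                  (2 * lin (track m 0 ys) (place s₁)) dev₁ (sqOf (place s₂)) (targetSum l m (track m 0 ys))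
                  (2 * lin (track l m (track m 0 ys)) (place s₂) + dev₂) eq₁ eq₂) (ring (sqOf (place s)) (2 * lin (track l m (track m 0 ys)) (place s₂)) dev₁ dev₂)
        expected = critEnergy (m + l) 0 ys (place s) pos same
        sq≡ = cong proj₁ end
        lin≡ = cong (λ { (sq , gu , gv , ds) → μ * gu + ν * gv + dot (track (m + l) 0 ys) ds }) end
        eq = begin
          sqOf (place s) + 2 * lin (track (m + l) 0 ys) (place s₂) + (dev₁ + dev₂)
            ≡⟨ cong (λ z → sqOf (place s) + 2 * lin z (place s₂) + (dev₁ + dev₂)) (track-+ m l 0 ys) ⟩
          _ ≡⟨ whole ⟨
          sqOf (place s₂) + (2 * lin ys (place s) + (targetSum m 0 ys + targetSum l m (track m 0 ys)))
            ≡⟨ cong (λ z → sqOf (place s₂) + (2 * lin ys (place s) + z)) (targetSum-+ m l 0 ys) ⟨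
          sqOf (place s₂) + (2 * lin ys (place s) + targetSum (m + l) 0 ys)
            ≡⟨ cong (_+ (2 * lin ys (place s) + targetSum (m + l) 0 ys)) sq≡ ⟩
          sqOf (crit (m + l) 0 ys (place s)) + (2 * lin ys (place s) + targetSum (m + l) 0 ys) ≡⟨ expected ⟩
          sqOf (place s) + 2 * lin (track (m + l) 0 ys) (crit (m + l) 0 ys (place s)) ≡⟨ cong (λ z → sqOf (place s) + 2 * z) lin≡ ⟨
          sqOf (place s) + 2 * lin (track (m + l) 0 ys) (place s₂)                     ≡⟨ +-identityʳ _ ⟨
          sqOf (place s) + 2 * lin (track (m + l) 0 ys) (place s₂) + 0 ∎
    in crit₁ (m+n≡0⇒m≡0 dev₁ (+-cancelˡ-≡ (sqOf (place s) + 2 * lin (track (m + l) 0 ys) (place s₂)) _ _ eq))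
    where
    open ≡-Reasoning
    ring : ∀ a b d₁ d₂ → a + (b + d₂ + d₁) ≡ a + b + (d₁ + d₂)
    ring = solve-∀
    track-length : ∀ l θ ys → 0 < length ys → length (track l θ ys) ≡ length ys
    track-length zero    θ ys pos = refl
    track-length (suc l) θ ys pos = trans (track-length l (suc θ) _ (subst (0 <_) (sym (turn-length (kind θ) ys pos)) pos)) (turn-length (kind θ) ys pos)

-- The positions of critical walks in closed form

normSq : List ℕ → ℕ
normSq []       = 0
normSq (y ∷ ys) = y * y + normSq ys

infixl 6 _⊞_
_⊞_ : List ℕ → List ℕ → List ℕ
_⊞_ = zipWith _+_

⊞-assoc : ∀ xs ys zs → (xs ⊞ ys) ⊞ zs ≡ xs ⊞ (ys ⊞ zs)
⊞-assoc []       _        _        = refl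
⊞-assoc (_ ∷ _)  []       _        = refl
⊞-assoc (_ ∷ _)  (_ ∷ _)  []       = refl
⊞-assoc (x ∷ xs) (y ∷ ys) (z ∷ zs) = cong₂ _∷_ (+-assoc x y z) (⊞-assoc xs ys zs)

zeros : ℕ → List ℕ
zeros n = replicate n 0

⊞-zeros : ∀ xs {n} → length xs ≡ n → xs ⊞ zeros n ≡ xs
⊞-zeros []       {zero}  _   = refl
⊞-zeros (x ∷ xs) {suc n} len = cong₂ _∷_ (+-identityʳ x) (⊞-zeros xs (suc-injective len))

⊞-length : ∀ xs ys → length xs ≡ length ys → length (xs ⊞ ys) ≡ length xs
⊞-length []       _        _   = refl
⊞-length (_ ∷ xs) (_ ∷ ys) len = cong suc (⊞-length xs ys (suc-injective len))

⊞-cancelʳ : ∀ xs ys zs → length xs ≡ length zs → length ys ≡ length zs → xs ⊞ zs ≡ ys ⊞ zs → xs ≡ ys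
⊞-cancelʳ []       []       []       _  _  _  = refl
⊞-cancelʳ (x ∷ xs) (y ∷ ys) (z ∷ zs) lx ly eq = cong₂ _∷_ (+-cancelʳ-≡ z x y (cong headℕ eq))
  (⊞-cancelʳ xs ys zs (suc-injective lx) (suc-injective ly) (cong tailL eq))

⊞-cancelˡ : ∀ xs ys zs → length xs ≡ length zs → length ys ≡ length zs → zs ⊞ xs ≡ zs ⊞ ys → xs ≡ ys
⊞-cancelˡ []       []       []       _  _  _  = refl
⊞-cancelˡ (x ∷ xs) (y ∷ ys) (z ∷ zs) lx ly eq = cong₂ _∷_ (+-cancelˡ-≡ z x y (cong headℕ eq))
  (⊞-cancelˡ xs ys zs (suc-injective lx) (suc-injective ly) (cong tailL eq))

times : ℕ → ℕ → List ℕ → List ℕ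
times n zero    xs = zeros n
times n (suc r) xs = xs ⊞ times n r xs

zeros-length : ∀ n → length (zeros n) ≡ n
zeros-length n = length-replicate n

times-length : ∀ n r xs → length xs ≡ n → length (times n r xs) ≡ n
times-length n zero    xs len = zeros-length n
times-length n (suc r) xs len = trans (⊞-length xs (times n r xs) (trans len (sym (times-length n r xs len)))) len

iter-⊞ : ∀ n r xs {X : Set} (s : X → X) (p : X → List ℕ) (Inv : X → Set) → (∀ {e} → Inv e → Inv (s e)) →
  (∀ {e} → Inv e → length (p e) ≡ n) → (∀ {e} → Inv e → p (s e) ≡ p e ⊞ xs) →
  ∀ {e} → Inv e → p (iter r s e) ≡ p e ⊞ times n r xs
iter-⊞ n zero    xs s p Inv inv len eq {e} i = sym (⊞-zeros (p e) (len i))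
iter-⊞ n (suc r) xs s p Inv inv len eq {e} i = trans (iter-⊞ n r xs s p Inv inv len eq (inv i))
  (trans (cong (_⊞ times n r xs) (eq i)) (⊞-assoc (p e) xs _))

iter-inv : ∀ r {X : Set} (s : X → X) (Inv : X → Set) → (∀ {e} → Inv e → Inv (s e)) → ∀ {e} → Inv e → Inv (iter r s e)
iter-inv zero    s Inv inv i = i
iter-inv (suc r) s Inv inv i = iter-inv r s Inv inv (inv i)

iter-+ : ∀ m n {X : Set} (s : X → X) x → iter (m + n) s x ≡ iter n s (iter m s x)
iter-+ zero    n s x = refl
iter-+ (suc m) n s x = iter-+ m n s (s x)

position : Place → List ℕ
position (w , sq , gu , gv , ds) = sq ∷ gu ∷ gv ∷ ds

-- The displacement of a position by the choice of `μ` in A and by the choice of `ν` in B; `rVec` is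
-- the displacement by one round of moves.
uVec vVec : ℕ → ℕ → List ℕ
uVec c μ = μ * μ ∷ μ ∷ 0 ∷ zeros c
vVec c ν = ν * ν ∷ 0 ∷ ν ∷ zeros c

rVec : List ℕ → List ℕ
rVec ys = normSq ys ∷ 0 ∷ 0 ∷ ys

module Critical (k M T L c P : ℕ) (c>0 : 0 < c) (rel : ℕ → ℕ → ℕ → ℕ → Bool) (μ ν : ℕ) (ys : List ℕ) (ys-len : length ys ≡ c) where
  open Paths k M T L c P c>0 rel
  open Tube k M T L c P c>0 rel μ ν

  chooseP constrainP roundP stageP : Place → Place
  chooseP    (w , sq , gu , gv , ds) = μ , sq + μ * μ , gu + μ , gv , ds
  constrainP (w , sq , gu , gv , ds) = ν , sq + ν * ν , gu , gv + ν , ds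
  roundP     (w , sq , gu , gv , ds) = w , sq + normSq ys , gu , gv , ds ⊞ ys
  stageP e = iter L roundP (constrainP (iter L roundP (chooseP e)))

  Len : Place → Set
  Len (w , sq , gu , gv , ds) = length ds ≡ c

  round-len : ∀ {e} → Len e → Len (roundP e)
  round-len {w , sq , gu , gv , ds} len = trans (⊞-length ds ys (trans len (sym ys-len))) len

  private
    -- The digits yet to be moved stand in front, and the moved ones collect behind `ds₂`. With both
    -- second parts empty, the rotation comes full circle and one round has been made.
    sweep : ∀ θ {m} ys₁ ys₂ {w sq gu gv} ds₁ ds₂ → length ys₁ ≡ m → length ds₁ ≡ m → (∀ j → j < m → kind (θ + j) ≡ 2) →
      crit m θ (ys₁ ++ ys₂) (w , sq , gu , gv , ds₁ ++ ds₂) ≡ (w , sq + normSq ys₁ , gu , gv , ds₂ ++ (ds₁ ⊞ ys₁)) ×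
      track m θ (ys₁ ++ ys₂) ≡ ys₂ ++ ys₁
    sweep θ {zero} [] ys₂ {sq = sq} [] ds₂ _ _ _ =
      cong₂ (λ a b → _ , a , _ , _ , b) (sym (+-identityʳ sq)) (sym (++-identityʳ ds₂)) , sym (++-identityʳ ys₂)
    sweep θ {suc m} (y ∷ ys₁) ys₂ {w} {sq} {gu} {gv} (d ∷ ds₁) ds₂ ly ld kinds
      rewrite trans (cong kind (sym (+-identityʳ θ))) (kinds 0 (s≤s z≤n))
            | ++-assoc ys₁ ys₂ (y ∷ []) | ++-assoc ds₁ ds₂ (d + y ∷ []) =
      let eq₁ , eq₂ = sweep (suc θ) ys₁ (ys₂ ++ (y ∷ [])) ds₁ (ds₂ ++ (d + y ∷ [])) (suc-injective ly) (suc-injective ld)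
                        (λ j j<m → trans (cong kind (sym (+-suc θ j))) (kinds (suc j) (s≤s j<m)))
      in trans eq₁ (cong₂ (λ a b → w , a , gu , gv , b) (+-assoc sq (y * y) (normSq ys₁)) (++-assoc ds₂ (d + y ∷ []) (ds₁ ⊞ ys₁))) ,
         trans eq₂ (++-assoc ys₂ (y ∷ []) ys₁)

    oneRound : ∀ θ e → Len e → (∀ j → j < c → kind (θ + j) ≡ 2) → crit c θ ys e ≡ roundP e × track c θ ys ≡ ys
    oneRound θ (w , sq , gu , gv , ds) len kinds = let eq₁ , eq₂ = sweep θ ys [] ds [] ys-len len kinds in
      trans (cong₂ (λ a b → crit c θ a (w , sq , gu , gv , b)) (sym (++-identityʳ ys)) (sym (++-identityʳ ds))) eq₁ ,
      trans (cong (track c θ) (sym (++-identityʳ ys))) eq₂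

    rounds : ∀ r θ e → Len e → (∀ j → j < r * c → kind (θ + j) ≡ 2) → crit (r * c) θ ys e ≡ iter r roundP e × track (r * c) θ ys ≡ ys
    rounds zero    θ e len kinds = refl , refl
    rounds (suc r) θ e len kinds =
      let eq₁ , eq₂ = oneRound θ e len (λ j j<c → kinds j (≤-trans j<c (m≤m+n c _)))
          eq₃ , eq₄ = rounds r (θ + c) (roundP e) (round-len {e} len)
                        (λ j j< → trans (cong kind (+-assoc θ c j)) (kinds (c + j) (+-monoʳ-< c j<)))
      in trans (crit-+ c (r * c) θ ys e) (trans (cong₂ (crit (r * c) (θ + c)) eq₂ eq₁) eq₃) ,
         trans (track-+ c (r * c) θ ys) (trans (cong (track (r * c) (θ + c)) eq₂) eq₄)

    rc≤ℓ : ∀ {r} → r ≤ L → r * c ≤ ℓ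
    rc≤ℓ r≤L = ≤-trans (*-monoˡ-≤ c r≤L) (≤-reflexive (*-comm L c))

    halfA : ∀ {i r} e → i < L → r ≤ L → Len e →
      crit (suc (r * c)) (i * S) ys e ≡ iter r roundP (chooseP e) × track (suc (r * c)) (i * S) ys ≡ ys
    halfA {i} {r} (w , sq , gu , gv , ds) i<L r≤L len rewrite kindA i<L =
      rounds r (suc (i * S)) (μ , sq + μ * μ , gu + μ , gv , ds) len (λ j j< → trans (cong kind (sym (+-suc (i * S) j))) (kindA′ i<L (<-≤-trans j< (rc≤ℓ r≤L))))

    halfB : ∀ {i r} e → i < L → r ≤ L → Len e →
      crit (suc (r * c)) (i * S + suc ℓ) ys e ≡ iter r roundP (constrainP e) × track (suc (r * c)) (i * S + suc ℓ) ys ≡ ys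
    halfB {i} {r} (w , sq , gu , gv , ds) i<L r≤L len rewrite kindB i<L =
      rounds r (suc (i * S + suc ℓ)) (ν , sq + ν * ν , gu , gv + ν , ds) len (λ j j< → trans (cong kind (trans (sym (+-suc (i * S + suc ℓ) j)) (+-assoc (i * S) (suc ℓ) (suc j))))
        (kindB′ i<L (<-≤-trans j< (rc≤ℓ r≤L))))

    sucℓ : suc (L * c) ≡ suc ℓ
    sucℓ = cong suc (*-comm L c)

    mid-len : ∀ {e} → Len e → Len (iter L roundP (chooseP e))
    mid-len {e} len = iter-inv L roundP Len (λ {e} → round-len {e}) {chooseP e} len

    wholeA : ∀ {i} e → i < L → Len e → crit (suc ℓ) (i * S) ys e ≡ iter L roundP (chooseP e) × track (suc ℓ) (i * S) ys ≡ ys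
    wholeA {i} e i<L len = subst (λ m → crit m (i * S) ys e ≡ iter L roundP (chooseP e) × track m (i * S) ys ≡ ys) sucℓ (halfA e i<L ≤-refl len)

    stageB : ∀ {i r} e → i < L → r ≤ L → Len e →
      crit (suc ℓ + suc (r * c)) (i * S) ys e ≡ iter r roundP (constrainP (iter L roundP (chooseP e))) × track (suc ℓ + suc (r * c)) (i * S) ys ≡ ys
    stageB {i} {r} e i<L r≤L len =
      let eq₁ , eq₂ = wholeA e i<L len
          eq₃ , eq₄ = halfB (iter L roundP (chooseP e)) i<L r≤L (mid-len {e} len)
      in trans (crit-+ (suc ℓ) _ (i * S) ys e) (trans (cong₂ (crit (suc (r * c)) (i * S + suc ℓ)) eq₂ eq₁) eq₃) ,
         trans (track-+ (suc ℓ) _ (i * S) ys) (trans (cong (track (suc (r * c)) (i * S + suc ℓ)) eq₂) eq₄)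

  stage-len : ∀ {e} → Len e → Len (stageP e)
  stage-len {e} len = iter-inv L roundP Len (λ {e} → round-len {e}) {constrainP (iter L roundP (chooseP e))} (mid-len {e} len)

  stages-len : ∀ i {e} → Len e → Len (iter i stageP e)
  stages-len i {e} len = iter-inv i stageP Len (λ {e} → stage-len {e}) {e} len

  critStages : ∀ {i} e → i ≤ L → Len e → crit (i * S) 0 ys e ≡ iter i stageP e × track (i * S) 0 ys ≡ ys
  critStages {zero}  e i≤L len = refl , refl
  critStages {suc i} e i≤L len =
    let eq₁ , eq₂ = critStages {i} e (≤-trans (n≤1+n i) i≤L) len
        eq₃ , eq₄ = subst (λ m → crit m (i * S) ys (iter i stageP e) ≡ stageP (iter i stageP e) × track m (i * S) ys ≡ ys)
                      (trans (cong (suc ℓ +_) sucℓ) (cong (suc ℓ +_) (sym (+-identityʳ (suc ℓ)))))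
                      (stageB (iter i stageP e) i≤L ≤-refl (stages-len i {e} len))
        comm = +-comm S (i * S)
    in trans (cong (λ m → crit m 0 ys e) comm) (trans (crit-+ (i * S) S 0 ys e) (trans (cong₂ (crit S (i * S)) eq₂ eq₁)
         (trans eq₃ (trans (sym (iter-+ i 1 stageP e)) (cong (λ m → iter m stageP e) (+-comm i 1)))))) ,
       trans (cong (λ m → track m 0 ys) comm) (trans (track-+ (i * S) S 0 ys) (trans (cong (track S (i * S)) eq₂) eq₄))

  critA : ∀ {i r} e → i < L → r ≤ L → Len e → crit (i * S + suc (r * c)) 0 ys e ≡ iter r roundP (chooseP (iter i stageP e))
  critA {i} {r} e i<L r≤L len = let eq₁ , eq₂ = critStages {i} e (<⇒≤ i<L) len in
    trans (crit-+ (i * S) _ 0 ys e) (trans (cong₂ (crit (suc (r * c)) (i * S)) eq₂ eq₁)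
      (proj₁ (halfA (iter i stageP e) i<L r≤L (stages-len i {e} len))))

  critB : ∀ {i r} e → i < L → r ≤ L → Len e → crit (i * S + (suc ℓ + suc (r * c))) 0 ys e ≡
    iter r roundP (constrainP (iter L roundP (chooseP (iter i stageP e))))
  critB {i} {r} e i<L r≤L len = let eq₁ , eq₂ = critStages {i} e (<⇒≤ i<L) len in
    trans (crit-+ (i * S) _ 0 ys e) (trans (cong₂ (crit (suc ℓ + suc (r * c)) (i * S)) eq₂ eq₁)
      (proj₁ (stageB (iter i stageP e) i<L r≤L (stages-len i {e} len))))

  private
    pos-len : ∀ {e} → Len e → length (position e) ≡ 3 + c
    pos-len len = cong (3 +_) len

    round-pos : ∀ e → position (roundP e) ≡ position e ⊞ rVec ys
    round-pos (w , sq , gu , gv , ds) = cong₂ (λ a b → sq + normSq ys ∷ a ∷ b ∷ ds ⊞ ys) (sym (+-identityʳ gu)) (sym (+-identityʳ gv))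

  rounds-pos : ∀ r {e} → Len e → position (iter r roundP e) ≡ position e ⊞ times (3 + c) r (rVec ys)
  rounds-pos r = iter-⊞ (3 + c) r (rVec ys) roundP position Len (λ {e} → round-len {e}) (λ {e} → pos-len {e}) (λ {e} _ → round-pos e)

  choose-pos : ∀ {e} → Len e → position (chooseP e) ≡ position e ⊞ uVec c μ
  choose-pos {w , sq , gu , gv , ds} len = cong₂ (λ a b → sq + μ * μ ∷ gu + μ ∷ a ∷ b) (sym (+-identityʳ gv)) (sym (⊞-zeros ds len))

  constrain-pos : ∀ {e} → Len e → position (constrainP e) ≡ position e ⊞ vVec c ν
  constrain-pos {w , sq , gu , gv , ds} len = cong₂ (λ a b → sq + ν * ν ∷ a ∷ gv + ν ∷ b) (sym (+-identityʳ gu)) (sym (⊞-zeros ds len))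

  stageVec : List ℕ
  stageVec = uVec c μ ⊞ (times (3 + c) L (rVec ys) ⊞ (vVec c ν ⊞ times (3 + c) L (rVec ys)))

  stage-pos : ∀ {e} → Len e → position (stageP e) ≡ position e ⊞ stageVec
  stage-pos {e} len = begin
    position (stageP e)
      ≡⟨ rounds-pos L {constrainP mid} (mid-len {e} len) ⟩
    position (constrainP mid) ⊞ R             ≡⟨ cong (_⊞ R) (constrain-pos {mid} (mid-len {e} len)) ⟩
    position mid ⊞ V ⊞ R                      ≡⟨ cong (λ z → z ⊞ V ⊞ R) (rounds-pos L {chooseP e} len) ⟩
    position (chooseP e) ⊞ R ⊞ V ⊞ R          ≡⟨ cong (λ z → z ⊞ R ⊞ V ⊞ R) (choose-pos {e} len) ⟩
    position e ⊞ uVec c μ ⊞ R ⊞ V ⊞ R         ≡⟨ ⊞-assoc (position e ⊞ uVec c μ ⊞ R) V R ⟩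
    position e ⊞ uVec c μ ⊞ R ⊞ (V ⊞ R)       ≡⟨ ⊞-assoc (position e ⊞ uVec c μ) R (V ⊞ R) ⟩
    position e ⊞ uVec c μ ⊞ (R ⊞ (V ⊞ R))     ≡⟨ ⊞-assoc (position e) (uVec c μ) _ ⟩
    position e ⊞ stageVec                     ∎
    where
    open ≡-Reasoning
    mid = iter L roundP (chooseP e)
    R = times (3 + c) L (rVec ys)
    V = vVec c ν

  stages-pos : ∀ i {e} → Len e → position (iter i stageP e) ≡ position e ⊞ times (3 + c) i stageVec
  stages-pos i = iter-⊞ (3 + c) i stageVec stageP position Len (λ {e} → stage-len {e}) (λ {e} → pos-len {e}) (λ {e} → stage-pos {e})

-- Walks with few hops and the rounds that they jump over

hit : ℕ → ℕ → ℕ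
hit x y = if x ≡ᵇ y then 1 else 0

hit-self : ∀ x → hit x x ≡ 1
hit-self x rewrite ≡ᵇ-refl x = refl

Σ<-hit : ∀ n x → Σ< n (hit x) ≤ 1
Σ<-hit zero    x       = z≤n
Σ<-hit (suc n) zero    = s≤s (≤-reflexive (trans (Σ<-const n 0) (*-zeroʳ n)))
Σ<-hit (suc n) (suc x) = Σ<-hit n x

module Extract (k M T L c P : ℕ) (c>1 : 1 < c) (rel : ℕ → ℕ → ℕ → ℕ → Bool)
  (canon : ∀ i j → Maybe (∃[ l ] RWalk (Semantics.VEdge k M T L c P rel) (Semantics.vtx k M T L c P rel i) (Semantics.vtx k M T L c P rel j) l))
  (J : Fin (Semantics.n k M T L c P rel) → Fin (Semantics.n k M T L c P rel) → Set) (J⇒ : ∀ {i j} → J i j → ∃[ w ] canon i j ≡ just w) where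
  open Paths k M T L c P (<⇒≤ c>1) rel

  stateAt : ∀ {u v l} → RWalk VEdge u v l → ℕ → State
  stateAt {u} w          zero    = proj₂ u
  stateAt {u} done       (suc m) = proj₂ u
  stateAt     (step _ w) (suc m) = stateAt w m

  stateAt-⋈ˡ : ∀ {x y z l m j} (p : RWalk VEdge x y l) (q : RWalk VEdge y z m) → j ≤ l → stateAt (p ⋈ q) j ≡ stateAt p j
  stateAt-⋈ˡ {j = zero}  p          q _         = refl
  stateAt-⋈ˡ {j = suc j} (step r p) q (s≤s j≤l) = stateAt-⋈ˡ p q j≤l

  stateAt-⋈ʳ : ∀ {x y z l m} j (p : RWalk VEdge x y l) (q : RWalk VEdge y z m) → stateAt (p ⋈ q) (l + j) ≡ stateAt q j
  stateAt-⋈ʳ j done       q = refl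
  stateAt-⋈ʳ j (step r p) q = stateAt-⋈ʳ j p q

  time : ∀ {u v l} → RWalk VEdge u v l → proj₁ v ≡ proj₁ u + l
  time = walk-time

  stateAt-step : ∀ {u v l} (w : RWalk VEdge u v l) {j} → j < l → StepAt (proj₁ u + j) (stateAt w j) (stateAt w (suc j))
  stateAt-step {u} (step (at {θ} st) w) {zero} _ = subst (λ θ → StepAt θ _ _) (sym (+-identityʳ θ)) st
  stateAt-step {u} (step (at {θ} st) w) {suc j} (s≤s j<l) = subst (λ θ → StepAt θ (stateAt w j) (stateAt w (suc j))) (sym (+-suc θ j)) (stateAt-step w j<l)

  cutWalk : ∀ {u v l} (w : RWalk VEdge u v l) {j} → j ≤ l →
    RWalk VEdge u (proj₁ u + j , stateAt w j) j × RWalk VEdge (proj₁ u + j , stateAt w j) v (l ∸ j)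
  cutWalk {u} w {zero} _ = subst (λ θ → RWalk VEdge u (θ , proj₂ u) 0) (sym (+-identityʳ (proj₁ u))) done ,
    subst (λ θ → RWalk VEdge (θ , proj₂ u) _ _) (sym (+-identityʳ (proj₁ u))) w
  cutWalk {v = v} (step {n = l} (at {θ} {s′ = s′} st) w) {suc j} (s≤s j≤l) = let p , q = cutWalk w j≤l in
    step (at st) (subst (λ t → RWalk VEdge (suc θ , s′) (t , stateAt w j) j) (sym (+-suc θ j)) p) ,
    subst (λ t → RWalk VEdge (t , stateAt w j) v (l ∸ j)) (sym (+-suc θ j)) q

  Hop : Fin n → Fin n → Set
  Hop i j = Edge i j ⊎ J i j

  -- A jump is always replaced by the walk that `canon` fixes for its two ends. Therefore what is
  -- read off a jump does not depend on the walk that uses it, and each jump can be charged once.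
  expand : ∀ {i j l} → RWalk Hop i j l → ∃[ m ] RWalk VEdge (vtx i) (vtx j) m
  expand done                = 0 , done
  expand (step (inj₁ e) p)   = let m , w = expand p in suc m , step e w
  expand (step (inj₂ jmp) p) = let m , w = expand p in _ , proj₂ (proj₁ (J⇒ jmp)) ⋈ w

  clock : Fin n → ℕ
  clock i = proj₁ (vtx i)

  visits : ∀ {i j l} → RWalk Hop i j l → ℕ → ℕ
  visits done               τ = 0
  visits (step {y = y} _ p) τ = hit (clock y) τ + visits p τ

  visits-total : ∀ {i j l} m (N : RWalk Hop i j l) → Σ< m (visits N) ≤ l
  visits-total m done               = ≤-reflexive (trans (Σ<-const m 0) (*-zeroʳ m))
  visits-total m (step {y = y} _ p) = ≤-trans (≤-reflexive (Σ<-+ m (hit (clock y)) (visits p))) (+-mono-≤ (Σ<-hit m (clock y)) (visits-total m p))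

  -- The states at the two ends of the round that begins at time t
  readFrom : ∀ i j → ℕ → Maybe (∃[ l ] RWalk VEdge (vtx i) (vtx j) l) → Maybe (State × State)
  readFrom i j t nothing        = nothing
  readFrom i j t (just (l , w)) = just (stateAt w (t ∸ clock i) , stateAt w (t + c ∸ clock i))

  readAt : Fin n → Fin n → ℕ → Maybe (State × State)
  readAt i j t = readFrom i j t (canon i j)

  readAt-just : ∀ i j t {l w} → canon i j ≡ just (l , w) →
    readAt i j t ≡ just (stateAt w (t ∸ clock i) , stateAt w (t + c ∸ clock i))
  readAt-just i j t eq = cong (readFrom i j t) eq

  Jumped : ∀ {i j l} → RWalk Hop i j l → ℕ → Set
  Jumped {i} N t = ∃[ z ] ∃[ z′ ] J z z′ ×
    readAt z z′ t ≡ just (stateAt (proj₂ (expand N)) (t ∸ clock i) , stateAt (proj₂ (expand N)) (t + c ∸ clock i))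

  private
    reindex : ∀ a l t → a + l ≤ t → t ∸ a ≡ l + (t ∸ (a + l))
    reindex a l t a+l≤t = begin
      t ∸ a                       ≡⟨ cong (_∸ a) (m+[n∸m]≡n a+l≤t) ⟨
      a + l + (t ∸ (a + l)) ∸ a   ≡⟨ cong (_∸ a) (+-assoc a l _) ⟩
      a + (l + (t ∸ (a + l))) ∸ a ≡⟨ m+n∸m≡n a _ ⟩
      l + (t ∸ (a + l))           ∎
      where open ≡-Reasoning

    tail-state : ∀ {x y z l m} t (p : RWalk VEdge x y l) (q : RWalk VEdge y z m) → proj₁ y ≤ t →
      stateAt (p ⋈ q) (t ∸ proj₁ x) ≡ stateAt q (t ∸ proj₁ y)
    tail-state {x} {y} {l = l} t p q y≤t rewrite time p =
      trans (cong (stateAt (p ⋈ q)) (reindex (proj₁ x) l t y≤t)) (stateAt-⋈ʳ _ p q)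

    later : ∀ {i y j l h t} (hop : Hop i y) (p : RWalk Hop y j l) → h ≡ step hop p → clock y ≤ t → Jumped p t → Jumped h t
    later {t = t} (inj₁ e) p refl y≤t (z , z′ , jmp , eq) = z , z′ , jmp ,
      trans eq (cong just (cong₂ _,_ (sym (tail-state t (step e done) (proj₂ (expand p)) y≤t))
        (sym (tail-state (t + c) (step e done) (proj₂ (expand p)) (m≤n⇒m≤n+o c y≤t)))))
    later {t = t} (inj₂ jmp′) p refl y≤t (z , z′ , jmp , eq) = z , z′ , jmp ,
      trans eq (cong just (cong₂ _,_ (sym (tail-state t w (proj₂ (expand p)) y≤t))
        (sym (tail-state (t + c) w (proj₂ (expand p)) (m≤n⇒m≤n+o c y≤t)))))
      where w = proj₂ (proj₁ (J⇒ jmp′))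

  Covered : ∀ {i j l} → RWalk Hop i j l → ℕ → Set
  Covered N t = Jumped N t ⊎ (∃[ σ ] t < σ × σ < t + c × 1 ≤ visits N σ)

  private
    landing : ∀ {i y j l} (hop : Hop i y) (p : RWalk Hop y j l) t → clock i ≤ t → t + c ≤ clock y → Jumped (step hop p) t
    landing {i} {y} (inj₁ e) p t i≤t t≤y = ⊥-elim (<-irrefl refl (begin-strict
      t + 1       <⟨ +-monoʳ-< t c>1 ⟩
      t + c       ≤⟨ t≤y ⟩
      clock y     ≡⟨ time (step e done) ⟩
      clock i + 1 ≤⟨ +-monoˡ-≤ 1 i≤t ⟩
      t + 1       ∎))
      where open ≤-Reasoning
    landing {i} {y} (inj₂ jmp) p t i≤t t≤y = i , y , jmp , trans (readAt-just i y t eq) (cong just (cong₂ _,_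
      (sym (stateAt-⋈ˡ w (proj₂ (expand p)) (inside (≤-trans (m≤m+n t c) t≤y))))
      (sym (stateAt-⋈ˡ w (proj₂ (expand p)) (inside t≤y)))))
      where
      w  = proj₂ (proj₁ (J⇒ jmp))
      eq = proj₂ (J⇒ jmp)
      inside : ∀ {m} → m ≤ clock y → m ∸ clock i ≤ proj₁ (proj₁ (J⇒ jmp))
      inside m≤y = ≤-trans (∸-monoˡ-≤ (clock i) m≤y) (≤-reflexive (trans (cong (_∸ clock i) (time w)) (m+n∸m≡n (clock i) _)))

    coverStep : ∀ {i y j l} (hop : Hop i y) (p : RWalk Hop y j l) t → clock i ≤ t → (clock y ≤ t → Covered p t) →
      Dec (clock y ≤ t) → Dec (clock y < t + c) → Covered (step hop p) t
    coverStep hop p t i≤t rec (yes y≤t) _ =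
      map⊎ (later hop p refl y≤t) (λ (σ , t<σ , σ<t+c , v) → σ , t<σ , σ<t+c , m≤n⇒m≤o+n _ v) (rec y≤t)
    coverStep {y = y} hop p t i≤t rec (no y≰t) (yes y<t+c) =
      inj₂ (clock y , ≰⇒> y≰t , y<t+c , ≤-trans (≤-reflexive (sym (hit-self (clock y)))) (m≤m+n _ _))
    coverStep hop p t i≤t rec (no y≰t) (no y≮t+c) = inj₁ (landing hop p t i≤t (≮⇒≥ y≮t+c))

  -- Consider the first vertex of `N` later than `t`. Either it falls strictly inside the round, or
  -- the hop leading to it passes over the whole round. An edge advances time by 1 only, and a round
  -- is longer because `c` exceeds 1, so such a hop is a jump.
  cover : ∀ {i j l} (N : RWalk Hop i j l) t → clock i ≤ t → t + c ≤ clock j → Covered N t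
  cover done t i≤t t≤j = ⊥-elim (<-irrefl refl (<-≤-trans (m<m+n t (<⇒≤ c>1)) (≤-trans t≤j i≤t)))
  cover (step {y = y} hop p) t i≤t t≤j =
    coverStep hop p t i≤t (λ y≤t → cover p t y≤t t≤j) (clock y ≤? t) (clock y <? t + c)

  tA tB : ℕ → ℕ → ℕ
  tA i r = i * S + suc (r * c)
  tB i r = i * S + (suc ℓ + suc (r * c))

  private
    rounds-≤ : ∀ {r} → r < L → r * c + c ≤ ℓ
    rounds-≤ {r} r<L = ≤-trans (≤-reflexive (+-comm (r * c) c)) (≤-trans (*-monoˡ-≤ c r<L) (≤-reflexive (*-comm L c)))

    stage-≤ : ∀ {i m} → i < L → m ≤ S → i * S + m ≤ Θ
    stage-≤ {i} i<L m≤S = ≤-trans (+-monoʳ-≤ (i * S) m≤S) (≤-trans (≤-reflexive (+-comm (i * S) S)) (*-monoˡ-≤ S i<L))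

    tA-end : ∀ {i r} → i < L → r < L → tA i r + c ≤ Θ
    tA-end {i} {r} i<L r<L = ≤-trans (≤-reflexive (+-assoc (i * S) _ c)) (stage-≤ i<L (≤-trans (s≤s (rounds-≤ r<L)) (m≤m+n (suc ℓ) _)))

    tB-end : ∀ {i r} → i < L → r < L → tB i r + c ≤ Θ
    tB-end {i} {r} i<L r<L = ≤-trans (≤-reflexive (+-assoc (i * S) _ c)) (stage-≤ i<L
      (≤-trans (≤-reflexive (+-assoc (suc ℓ) (suc (r * c)) c)) (+-monoʳ-≤ (suc ℓ) (≤-trans (s≤s (rounds-≤ r<L)) (≤-reflexive (sym (+-identityʳ (suc ℓ))))))))

    -- Different rounds occupy disjoint intervals of time, so their visits add up.
    many : ∀ (f : ℕ → ℕ) base → (∀ {r} → r < L → ∃[ σ ] base + r * c < σ × σ < base + r * c + c × 1 ≤ f σ) →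
      L ≤ Σ< ℓ (λ τ → f (base + τ))
    many f base h = begin
      L                                                  ≡⟨ *-identityʳ L ⟨
      L * 1                                              ≡⟨ Σ<-const L 1 ⟨
      Σ< L (λ _ → 1)                                     ≤⟨ Σ<-mono L (λ {r} → each r) ⟩
      Σ< L (λ r → Σ< c (λ j → f (base + (r * c + j))))   ≡⟨ Σ<-product L c (λ τ → f (base + τ)) ⟨
      Σ< (L * c) (λ τ → f (base + τ))                    ≡⟨ cong (λ m → Σ< m (λ τ → f (base + τ))) (*-comm L c) ⟩
      Σ< ℓ (λ τ → f (base + τ))                          ∎
      where
      open ≤-Reasoning
      each : ∀ r → r < L → 1 ≤ Σ< c (λ j → f (base + (r * c + j)))
      each r r<L = let σ , lo , hi , v = h r<L
                       j = σ ∸ (base + r * c)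
                       σ≡ : base + r * c + j ≡ σ
                       σ≡ = m+[n∸m]≡n (<⇒≤ lo)
                   in ≤-trans (≤-trans v (≤-reflexive (cong f (trans (sym σ≡) (+-assoc base (r * c) j)))))
                        (Σ<-term {f = λ j → f (base + (r * c + j))} (+-cancelˡ-< (base + r * c) j c (subst (_< base + r * c + c) (sym σ≡) hi)))

  -- A walk with fewer than L * L hops leaves out a round in both halves of some stage.
  fastStage : ∀ {i j l} (N : RWalk Hop i j l) → clock i ≡ 0 → clock j ≡ Θ → l < L * L →
    ∃[ m ] m < L × (∃[ r ] r < L × Jumped N (tA m r)) × (∃[ r ] r < L × Jumped N (tB m r))
  fastStage {i} {j} {l} N i≡0 j≡Θ l< = conclude (search L {A = λ m → (∃[ r ] r < L × Jumped N (tA m r)) × (∃[ r ] r < L × Jumped N (tB m r))}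
      {B = λ m → L ≤ Σ< S (λ τ → visits N (m * S + τ))} stage)
    where
    Slow : ℕ → Set
    Slow t = ∃[ σ ] t < σ × σ < t + c × 1 ≤ visits N σ
    at? : ∀ t → t + c ≤ Θ → Jumped N t ⊎ Slow t
    at? t t≤ = cover N t (≤-trans (≤-reflexive i≡0) z≤n) (≤-trans t≤ (≤-reflexive (sym j≡Θ)))
    regroup : ∀ a b r → suc (a + b) + r ≡ a + (b + suc r)
    regroup = solve-∀
    inA : ∀ m → (∀ {r} → r < L → Slow (tA m r)) → L ≤ Σ< S (λ τ → visits N (m * S + τ))
    inA m h = ≤-trans (many (visits N) (suc (m * S)) (λ {r} r<L → subst (λ t → ∃[ σ ] t < σ × σ < t + c × 1 ≤ visits N σ) (+-suc (m * S) (r * c)) (h r<L)))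
      (≤-trans (≤-reflexive (Σ<-cong ℓ λ τ → cong (visits N) (sym (+-suc (m * S) τ))))
        (≤-trans (m≤n+m _ (visits N (m * S + 0))) (≤-trans (m≤m+n (Σ< (suc ℓ) (λ τ → visits N (m * S + τ))) _)
          (≤-reflexive (sym (Σ<-split (suc ℓ) (suc ℓ + 0) (λ τ → visits N (m * S + τ))))))))
    inB : ∀ m → (∀ {r} → r < L → Slow (tB m r)) → L ≤ Σ< S (λ τ → visits N (m * S + τ))
    inB m h = ≤-trans (many (visits N) (suc (m * S + suc ℓ)) (λ {r} r<L → subst (λ t → ∃[ σ ] t < σ × σ < t + c × 1 ≤ visits N σ)
        (sym (regroup (m * S) (suc ℓ) (r * c))) (h r<L)))
      (≤-trans (≤-reflexive (Σ<-cong ℓ λ τ → cong (visits N) (regroup (m * S) (suc ℓ) τ)))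
        (≤-trans (m≤n+m _ (visits N (m * S + (suc ℓ + 0)))) (≤-trans (≤-reflexive (cong (λ z → Σ< z (λ τ → visits N (m * S + (suc ℓ + τ)))) (sym (+-identityʳ (suc ℓ)))))
          (≤-trans (m≤n+m _ (Σ< (suc ℓ) (λ τ → visits N (m * S + τ))))
            (≤-reflexive (sym (Σ<-split (suc ℓ) (suc ℓ + 0) (λ τ → visits N (m * S + τ)))))))))
    combine : ∀ m → (∃[ r ] r < L × Jumped N (tA m r)) ⊎ (∀ {r} → r < L → Slow (tA m r)) → (∃[ r ] r < L × Jumped N (tB m r)) ⊎ (∀ {r} → r < L → Slow (tB m r)) →
      ((∃[ r ] r < L × Jumped N (tA m r)) × (∃[ r ] r < L × Jumped N (tB m r))) ⊎ (L ≤ Σ< S (λ τ → visits N (m * S + τ)))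
    combine m (inj₁ a) (inj₁ b) = inj₁ (a , b)
    combine m (inj₂ a) _        = inj₂ (inA m a)
    combine m (inj₁ _) (inj₂ b) = inj₂ (inB m b)
    stage : ∀ {m} → m < L → ((∃[ r ] r < L × Jumped N (tA m r)) × (∃[ r ] r < L × Jumped N (tB m r))) ⊎ (L ≤ Σ< S (λ τ → visits N (m * S + τ)))
    stage {m} m<L = combine m (search L {A = λ r → Jumped N (tA m r)} {B = λ r → Slow (tA m r)} (λ {r} r<L → at? (tA m r) (tA-end {m} {r} m<L r<L)))
      (search L {A = λ r → Jumped N (tB m r)} {B = λ r → Slow (tB m r)} (λ {r} r<L → at? (tB m r) (tB-end {m} {r} m<L r<L)))
    -- Each of the `L` stages would contain `L` visits, and every visit is the end of a hop of its
    -- own; this needs `L * L` hops.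
    tooMany : (∀ {m} → m < L → L ≤ Σ< S (λ τ → visits N (m * S + τ))) → ⊥
    tooMany slow = <-irrefl refl (begin-strict
      l                                                  <⟨ l< ⟩
      L * L                                              ≡⟨ Σ<-const L L ⟨
      Σ< L (λ _ → L)                                     ≤⟨ Σ<-mono L slow ⟩
      Σ< L (λ m → Σ< S (λ τ → visits N (m * S + τ)))     ≡⟨ Σ<-product L S (visits N) ⟨
      Σ< Θ (visits N)                                    ≤⟨ visits-total Θ N ⟩
      l                                                  ∎)
      where open ≤-Reasoning
    conclude : (∃[ m ] m < L × (∃[ r ] r < L × Jumped N (tA m r)) × (∃[ r ] r < L × Jumped N (tB m r))) ⊎ (∀ {m} → m < L → L ≤ Σ< S (λ τ → visits N (m * S + τ))) →
      ∃[ m ] m < L × (∃[ r ] r < L × Jumped N (tA m r)) × (∃[ r ] r < L × Jumped N (tB m r))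
    conclude (inj₁ found) = found
    conclude (inj₂ slow)  = ⊥-elim (tooMany slow)

-- Sums over lists

ΣL : ∀ {X : Set} → List X → (X → ℕ) → ℕ
ΣL []       f = 0
ΣL (x ∷ xs) f = f x + ΣL xs f

module _ {X : Set} where

  ΣL-mono : ∀ (xs : List X) {f g} → (∀ {x} → x ∈ˡ xs → f x ≤ g x) → ΣL xs f ≤ ΣL xs g
  ΣL-mono []       h = z≤n
  ΣL-mono (x ∷ xs) h = +-mono-≤ (h (here refl)) (ΣL-mono xs (h ∘ there))

  ΣL-cong : ∀ (xs : List X) {f g} → (∀ x → f x ≡ g x) → ΣL xs f ≡ ΣL xs g
  ΣL-cong []       h = refl
  ΣL-cong (x ∷ xs) h = cong₂ _+_ (h x) (ΣL-cong xs h)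

  ΣL-const : ∀ (xs : List X) n → ΣL xs (λ _ → n) ≡ length xs * n
  ΣL-const []       n = refl
  ΣL-const (x ∷ xs) n = cong (n +_) (ΣL-const xs n)

  ΣL-+ : ∀ (xs : List X) f g → ΣL xs (λ x → f x + g x) ≡ ΣL xs f + ΣL xs g
  ΣL-+ []       f g = refl
  ΣL-+ (x ∷ xs) f g = trans (cong (f x + g x +_) (ΣL-+ xs f g)) (ring (f x) (g x) _ _)
    where
    ring : ∀ a b c d → a + b + (c + d) ≡ a + c + (b + d)
    ring = solve-∀

  ΣL-* : ∀ (xs : List X) n f → n * ΣL xs f ≡ ΣL xs (λ x → n * f x)
  ΣL-* []       n f = *-zeroʳ n
  ΣL-* (x ∷ xs) n f = trans (*-distribˡ-+ n (f x) _) (cong (n * f x +_) (ΣL-* xs n f))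

  ΣL-term : ∀ {xs : List X} {f x} → x ∈ˡ xs → f x ≤ ΣL xs f
  ΣL-term             (here refl)    = m≤m+n _ _
  ΣL-term {y ∷ xs} {f} (there x∈) = m≤n⇒m≤o+n (f y) (ΣL-term x∈)

  ΣL-positive : ∀ (xs : List X) {f} → 0 < ΣL xs f → ∃[ x ] x ∈ˡ xs × 0 < f x
  ΣL-positive (x ∷ xs) {f} pos with f x in eq
  ... | suc m = x , here refl , subst (0 <_) (sym eq) (s≤s z≤n)
  ... | zero  = let y , y∈ , p = ΣL-positive xs pos in y , there y∈ , p

  ΣL-one : ∀ {xs : List X} {f} → Unique xs → (∀ {x} → x ∈ˡ xs → f x ≤ 1) →
    (∀ {x y} → x ∈ˡ xs → y ∈ˡ xs → 0 < f x → 0 < f y → x ≡ y) → ΣL xs f ≤ 1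
  ΣL-one []                _  _ = z≤n
  ΣL-one {x ∷ xs} {f} (x∉ ∷ u) ≤1 inj with f x in eq | ΣL xs f in rest
  ... | zero  | _     = subst (_≤ 1) rest (ΣL-one u (≤1 ∘ there) (λ a b → inj (there a) (there b)))
  ... | suc m | zero  = subst (_≤ 1) (trans eq (sym (+-identityʳ (suc m)))) (≤1 (here refl))
  ... | suc m | suc r = let y , y∈ , p = ΣL-positive xs {f} (subst (0 <_) (sym rest) (s≤s z≤n)) in
    ⊥-elim (All-lookup x∉ y∈ (inj (here refl) (there y∈) (subst (0 <_) (sym eq) (s≤s z≤n)) p))

ΣL-swap : ∀ {X Z : Set} (xs : List X) (zs : List Z) (f : X → Z → ℕ) → ΣL xs (λ x → ΣL zs (f x)) ≡ ΣL zs (λ z → ΣL xs (λ x → f x z))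
ΣL-swap []       zs f = sym (trans (ΣL-const zs 0) (*-zeroʳ (length zs)))
ΣL-swap (x ∷ xs) zs f = trans (cong (ΣL zs (f x) +_) (ΣL-swap xs zs f)) (sym (ΣL-+ zs (f x) _))

ΣL-concatMap : ∀ {X Z : Set} (g : X → List Z) xs (f : Z → ℕ) → ΣL (concatMap g xs) f ≡ ΣL xs (λ x → ΣL (g x) f)
ΣL-concatMap g []       f = refl
ΣL-concatMap g (x ∷ xs) f = trans (app (g x)) (cong (ΣL (g x) f +_) (ΣL-concatMap g xs f))
  where
  app : ∀ zs → ΣL (zs ++ concatMap g xs) f ≡ ΣL zs f + ΣL (concatMap g xs) f
  app []       = refl
  app (z ∷ zs) = trans (cong (f z +_) (app zs)) (sym (+-assoc (f z) _ _))

ΣL-singles : ∀ {X Z : Set} (g : X → Z) xs (f : Z → ℕ) → ΣL (concatMap (λ x → g x ∷ []) xs) f ≡ ΣL xs (f ∘ g)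
ΣL-singles g xs f = trans (ΣL-concatMap (λ x → g x ∷ []) xs f) (ΣL-cong xs λ x → +-identityʳ (f (g x)))

ΣL-upTo : ∀ n (f : ℕ → ℕ) → ΣL (upTo n) f ≡ Σ< n f
ΣL-upTo n f = go n id
  where
  go : ∀ n h → ΣL (applyUpTo h n) f ≡ Σ< n (f ∘ h)
  go zero    h = refl
  go (suc n) h = cong (f (h 0) +_) (go n (h ∘ suc))

ΣL-translate : ∀ P₁ P t (f : ℕ → ℕ) → t + P₁ ≤ P → ΣL (upTo P₁) (λ x → f (x + t)) ≤ ΣL (upTo P) f
ΣL-translate P₁ P t f le = begin
  ΣL (upTo P₁) (λ x → f (x + t))        ≡⟨ ΣL-upTo P₁ _ ⟩
  Σ< P₁ (λ x → f (x + t))               ≡⟨ Σ<-cong P₁ (λ x → cong f (+-comm x t)) ⟩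
  Σ< P₁ (λ x → f (t + x))               ≤⟨ m≤n+m _ (Σ< t f) ⟩
  Σ< t f + Σ< P₁ (λ x → f (t + x))      ≡⟨ Σ<-split t P₁ f ⟨
  Σ< (t + P₁) f                         ≤⟨ m≤m+n _ _ ⟩
  Σ< (t + P₁) f + Σ< (P ∸ (t + P₁)) (λ x → f (t + P₁ + x)) ≡⟨ Σ<-split (t + P₁) _ f ⟨
  Σ< (t + P₁ + (P ∸ (t + P₁))) f        ≡⟨ cong (λ m → Σ< m f) (m+[n∸m]≡n le) ⟩
  Σ< P f                                ≡⟨ ΣL-upTo P f ⟨
  ΣL (upTo P) f                         ∎
  where open ≤-Reasoning

-- Adding `t` maps the small box injectively into the large one. So critical walks, which are given
-- by their starting positions, can be counted by their absolute positions at a later stage, where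
-- the jumps are found.
translate : ∀ P₁ P t (f : List ℕ → ℕ) → All (λ x → x + P₁ ≤ P) t →
  ΣL (digitLists P₁ (length t)) (λ g → f (g ⊞ t)) ≤ ΣL (digitLists P (length t)) f
translate P₁ P []      f []       = ≤-refl
translate P₁ P (x ∷ t) f (x≤ ∷ t≤) = begin
  ΣL (digitLists P₁ (suc (length t))) (λ g → f (g ⊞ (x ∷ t)))
    ≡⟨ trans (ΣL-concatMap _ (upTo P₁) _) (ΣL-cong (upTo P₁) λ y → ΣL-singles (y ∷_) (digitLists P₁ (length t)) _) ⟩
  ΣL (upTo P₁) (λ y → ΣL (digitLists P₁ (length t)) (λ g → f (y + x ∷ g ⊞ t)))
    ≤⟨ ΣL-mono (upTo P₁) (λ {y} _ → translate P₁ P t (λ g → f (y + x ∷ g)) t≤) ⟩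
  ΣL (upTo P₁) (λ y → ΣL (digitLists P (length t)) (λ g → f (y + x ∷ g)))
    ≤⟨ ΣL-translate P₁ P x (λ y → ΣL (digitLists P (length t)) (λ g → f (y ∷ g))) x≤ ⟩
  ΣL (upTo P) (λ y → ΣL (digitLists P (length t)) (λ g → f (y ∷ g)))
    ≡⟨ trans (ΣL-concatMap _ (upTo P) _) (ΣL-cong (upTo P) λ y → ΣL-singles (y ∷_) (digitLists P (length t)) _) ⟨
  ΣL (digitLists P (suc (length t))) f ∎
  where open ≤-Reasoning

bit : Bool → ℕ
bit true  = 1
bit false = 0

bit-≤1 : ∀ b → bit b ≤ 1
bit-≤1 true  = ≤-refl
bit-≤1 false = z≤n

bit⁻ : ∀ {b} → 0 < bit b → b ≡ true
bit⁻ {true} _ = refl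

-- The counting argument.  The lists of entries record the labels that are read
-- off the jumps; few of them are long, and a critical walk both of whose lists are
-- short is covered by one of few labelings.

Entry : Set
Entry = (ℕ × List ℕ × List ℕ) × ℕ

_≟ᵏ_ : (x y : ℕ × List ℕ × List ℕ) → Dec (x ≡ y)
_≟ᵏ_ = ×-≡-dec _≟_ (×-≡-dec (List-≡-dec _≟_) (List-≡-dec _≟_))

labelsAt : List Entry → ℕ × List ℕ × List ℕ → List ℕ
labelsAt []             κ = []
labelsAt ((κ′ , a) ∷ es) κ = if does (κ′ ≟ᵏ κ) then a ∷ labelsAt es κ else labelsAt es κ

labelsAt⁺ : ∀ {es κ a} → (κ , a) ∈ˡ es → a ∈ˡ labelsAt es κ
labelsAt⁺ {_} {κ} (here refl) with κ ≟ᵏ κ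
... | yes _ = here refl
... | no ≢  = ⊥-elim (≢ refl)
labelsAt⁺ {(κ′ , _) ∷ _} {κ} (there x∈) with does (κ′ ≟ᵏ κ)
... | true  = there (labelsAt⁺ x∈)
... | false = labelsAt⁺ x∈

labelsAt-length : ∀ es κ → length (labelsAt es κ) ≡ ΣL es (λ e → bit (does (proj₁ e ≟ᵏ κ)))
labelsAt-length []              κ = refl
labelsAt-length ((κ′ , a) ∷ es) κ with does (κ′ ≟ᵏ κ)
... | true  = cong suc (labelsAt-length es κ)
... | false = labelsAt-length es κ

-- Distinct parameters have distinct keys, so each entry is counted once.
labelsAt-total : ∀ {Z : Set} es {zs : List Z} (key : Z → ℕ × List ℕ × List ℕ) → Unique zs →
  (∀ {x y} → x ∈ˡ zs → y ∈ˡ zs → key x ≡ key y → x ≡ y) → ΣL zs (λ z → length (labelsAt es (key z))) ≤ length es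
labelsAt-total es {zs} key u inj = begin
  ΣL zs (λ z → length (labelsAt es (key z)))                       ≡⟨ ΣL-cong zs (λ z → labelsAt-length es (key z)) ⟩
  ΣL zs (λ z → ΣL es (λ e → bit (does (proj₁ e ≟ᵏ key z))))        ≡⟨ ΣL-swap zs es (λ z e → bit (does (proj₁ e ≟ᵏ key z))) ⟩
  ΣL es (λ e → ΣL zs (λ z → bit (does (proj₁ e ≟ᵏ key z))))        ≤⟨ ΣL-mono es (λ {e} _ → ΣL-one u (λ _ → bit-≤1 _) (λ x∈ y∈ p q →
                                                                       inj x∈ y∈ (trans (sym (same e p)) (same e q)))) ⟩
  ΣL es (λ _ → 1)                                                  ≡⟨ trans (ΣL-const es 1) (*-identityʳ _) ⟩
  length es                                                        ∎
  where
  open ≤-Reasoning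
  same : ∀ e {z} → 0 < bit (does (proj₁ e ≟ᵏ key z)) → proj₁ e ≡ key z
  same e {z} pos with proj₁ e ≟ᵏ key z
  ... | yes eq = eq

∈-nth : ∀ {a xs} → a ∈ˡ xs → ∃[ α ] α < length xs × nthℕ xs α ≡ a
∈-nth (here refl) = 0 , s≤s z≤n , refl
∈-nth (there a∈)  = let α , α< , eq = ∈-nth a∈ in suc α , s≤s α< , eq

ΣL-product : ∀ {X Z : Set} (xs : List X) (zs : List Z) (f : X × Z → ℕ) →
  ΣL (cartesianProduct xs zs) f ≡ ΣL xs (λ x → ΣL zs (λ z → f (x , z)))
ΣL-product []       zs f = refl
ΣL-product (x ∷ xs) zs f = trans (app zs) (cong (ΣL zs (λ z → f (x , z)) +_) (ΣL-product xs zs f))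
  where
  app : ∀ zs′ → ΣL (map (x ,_) zs′ ++ cartesianProduct xs zs) f ≡ ΣL zs′ (λ z → f (x , z)) + ΣL (cartesianProduct xs zs) f
  app []        = refl
  app (z ∷ zs′) = trans (cong (f (x , z) +_) (app zs′)) (sym (+-assoc (f (x , z)) _ _))

isLong : ℕ → List ℕ → Bool
isLong τ xs = isSuc (length xs ∸ τ)

isLong-weight : ∀ τ xs → τ * bit (isLong τ xs) ≤ length xs
isLong-weight τ xs with length xs ∸ τ in eq
... | zero  = ≤-trans (≤-reflexive (*-zeroʳ τ)) z≤n
... | suc m = ≤-trans (≤-reflexive (*-identityʳ τ)) (<⇒≤ (m∸n≢0⇒n<m (λ h → case trans (sym eq) h of λ ())))

short : ∀ τ xs → isLong τ xs ≡ false → length xs ≤ τ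
short τ xs eq = m∸n≡0⇒m≤n (lemma _ eq)
  where
  lemma : ∀ m → isSuc m ≡ false → m ≡ 0
  lemma zero _ = refl

stageVecOf : ℕ → ℕ → ℕ → ℕ → List ℕ → List ℕ
stageVecOf L c μ ν ys = uVec c μ ⊞ (times (3 + c) L (rVec ys) ⊞ (vVec c ν ⊞ times (3 + c) L (rVec ys)))

offset : ℕ → ℕ → ℕ → ℕ → List ℕ → ℕ → List ℕ
offset L c μ ν ys i = times (3 + c) i (stageVecOf L c μ ν ys) ⊞ uVec c μ

-- A key is what a jump over round `r` betrays apart from the label: the current vertex of the
-- instance and the positions at both ends of the round. The argument `h` is the position just after
-- the choice in A; the rounds of the second half start one block and one choice later.
keyA keyB : ℕ → ℕ → ℕ → ℕ → List ℕ → List ℕ → ℕ × List ℕ × List ℕ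
keyA L c r w ys h = w , h ⊞ times (3 + c) r (rVec ys) , h ⊞ times (3 + c) (suc r) (rVec ys)
keyB L c r w ys h = keyA L c r w ys (h ⊞ times (3 + c) L (rVec ys) ⊞ vVec c w)

uVec-length : ∀ c μ → length (uVec c μ) ≡ 3 + c
uVec-length c μ = cong (3 +_) (zeros-length c)

vVec-length : ∀ c ν → length (vVec c ν) ≡ 3 + c
vVec-length c ν = cong (3 +_) (zeros-length c)

⊞-len : ∀ {n} xs ys → length xs ≡ n → length ys ≡ n → length (xs ⊞ ys) ≡ n
⊞-len xs ys lx ly = trans (⊞-length xs ys (trans lx (sym ly))) lx

module _ (L c : ℕ) where
  private
    m = 3 + c

  stageVec-length : ∀ μ ν ys → length ys ≡ c → length (stageVecOf L c μ ν ys) ≡ m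
  stageVec-length μ ν ys len =
    ⊞-len (uVec c μ) (R ⊞ (vVec c ν ⊞ R)) (uVec-length c μ) (⊞-len R (vVec c ν ⊞ R) tl (⊞-len (vVec c ν) R (vVec-length c ν) tl))
    where
    R = times m L (rVec ys)
    tl : length R ≡ m
    tl = times-length m L (rVec ys) (cong (3 +_) len)

  offset-length : ∀ μ ν ys i → length ys ≡ c → length (offset L c μ ν ys i) ≡ m
  offset-length μ ν ys i len =
    ⊞-len (times m i (stageVecOf L c μ ν ys)) (uVec c μ) (times-length m i (stageVecOf L c μ ν ys) (stageVec-length μ ν ys len)) (uVec-length c μ)

  -- The two positions differ by `rVec ys`, which contains `ys`. Once `ys` is known, the
  -- displacement of the first `r` rounds can be removed from the first position, which leaves `h`.
  keyA-injective : ∀ r {w w′ ys ys′ h h′} → length ys ≡ c → length ys′ ≡ c → length h ≡ m → length h′ ≡ m →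
    keyA L c r w ys h ≡ keyA L c r w′ ys′ h′ → w ≡ w′ × ys ≡ ys′ × h ≡ h′
  keyA-injective r {w} {w′} {ys} {ys′} {h} {h′} ly ly′ lh lh′ eq = cong proj₁ eq , ys≡ , h≡
    where
    p p′ : List ℕ
    p  = h ⊞ times m r (rVec ys)
    p′ = h′ ⊞ times m r (rVec ys′)
    p≡ : p ≡ p′
    p≡ = cong (proj₁ ∘ proj₂) eq
    move-out : ∀ h ys → length ys ≡ c → length h ≡ m → h ⊞ times m (suc r) (rVec ys) ≡ h ⊞ times m r (rVec ys) ⊞ rVec ys
    move-out h ys ly lh = trans (cong (h ⊞_) (⊞-comm (rVec ys) (times m r (rVec ys)))) (sym (⊞-assoc h _ _))
      where
      ⊞-comm : ∀ xs zs → xs ⊞ zs ≡ zs ⊞ xs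
      ⊞-comm []       []       = refl
      ⊞-comm []       (_ ∷ _)  = refl
      ⊞-comm (_ ∷ _)  []       = refl
      ⊞-comm (x ∷ xs) (z ∷ zs) = cong₂ _∷_ (+-comm x z) (⊞-comm xs zs)
    p-len : length p ≡ m
    p-len = ⊞-len h (times m r (rVec ys)) lh (times-length m r (rVec ys) (cong (3 +_) ly))
    r≡ : rVec ys ≡ rVec ys′
    r≡ = ⊞-cancelˡ (rVec ys) (rVec ys′) p (trans (cong (3 +_) ly) (sym p-len)) (trans (cong (3 +_) ly′) (sym p-len))
      (trans (sym (move-out h ys ly lh)) (trans (cong (proj₂ ∘ proj₂) eq) (trans (move-out h′ ys′ ly′ lh′) (cong (_⊞ rVec ys′) (sym p≡)))))
    ys≡ : ys ≡ ys′
    ys≡ = cong (tailL ∘ tailL ∘ tailL) r≡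
    tl : length (times m r (rVec ys)) ≡ m
    tl = times-length m r (rVec ys) (cong (3 +_) ly)
    h≡ : h ≡ h′
    h≡ = ⊞-cancelʳ h h′ (times m r (rVec ys)) (trans lh (sym tl)) (trans lh′ (sym tl))
      (trans p≡ (cong (λ ys → h′ ⊞ times m r (rVec ys)) (sym ys≡)))

  keyB-injective : ∀ r {w w′ ys ys′ h h′} → length ys ≡ c → length ys′ ≡ c → length h ≡ m → length h′ ≡ m →
    keyB L c r w ys h ≡ keyB L c r w′ ys′ h′ → w ≡ w′ × ys ≡ ys′ × h ≡ h′
  keyB-injective r {w} {w′} {ys} {ys′} {h} {h′} ly ly′ lh lh′ eq
    with keyA-injective r ly ly′ (base-len h ys w ly lh) (base-len h′ ys′ w′ ly′ lh′) eq
    where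
    base-len : ∀ h ys w → length ys ≡ c → length h ≡ m → length (h ⊞ times m L (rVec ys) ⊞ vVec c w) ≡ m
    base-len h ys w ly lh = ⊞-len (h ⊞ times m L (rVec ys)) (vVec c w) (⊞-len h (times m L (rVec ys)) lh (times-length m L (rVec ys) (cong (3 +_) ly))) (vVec-length c w)
  ... | refl , refl , base≡ = refl , refl , ⊞-cancelʳ h h′ R (trans lh (sym R-len)) (trans lh′ (sym R-len))
    (⊞-cancelʳ (h ⊞ R) (h′ ⊞ R) (vVec c w) (trans (⊞-len h R lh R-len) (sym (vVec-length c w)))
      (trans (⊞-len h′ R lh′ R-len) (sym (vVec-length c w))) base≡)
    where
    R = times m L (rVec ys)
    R-len : length R ≡ m
    R-len = times-length m L (rVec ys) (cong (3 +_) ly)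

-- `τ` separates short lists from long ones, `X` is the factor gained from soundness, `Δ` the
-- degree, and `N` bounds the number of entries at any one round. Walks start in the box of side
-- `P₁`, and `room` keeps their later positions in the box of side `P`.
module Counting (k T c P₁ P L τ X Δ N : ℕ) (rel : ℕ → ℕ → ℕ → ℕ → Bool) (e : ℕ → ℕ → Bool)
  (EA EB : ℕ → ℕ → List Entry) (EA≤ : ∀ i r → length (EA i r) ≤ N) (EB≤ : ∀ i r → length (EB i r) ≤ N)
  (room : ∀ {μ ν ys i} → μ < k → ν < k → ys ∈ˡ digitLists T c → i < L → All (λ x → x + P₁ ≤ P) (offset L c μ ν ys i))
  (critical : ∀ {μ ν ys g} → μ < k → ν < k → e μ ν ≡ true → ys ∈ˡ digitLists T c → g ∈ˡ digitLists P₁ (3 + c) →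
    ∃[ i ] i < L × (∃[ r ] r < L × (∃[ r′ ] r′ < L × (∃[ a ] ∃[ b ] rel μ ν a b ≡ true ×
      (keyA L c r μ ys (g ⊞ offset L c μ ν ys i) , a) ∈ˡ EA i r ×
      (keyB L c r′ ν ys (g ⊞ offset L c μ ν ys i) , b) ∈ˡ EB i r′))))
  (regularA : ∀ {μ} → μ < k → ΣL (upTo k) (λ ν → bit (e μ ν)) ≡ Δ)
  (regularB : ∀ {ν} → ν < k → ΣL (upTo k) (λ μ → bit (e μ ν)) ≡ Δ)
  (sound : ∀ (ψ φ : ℕ → ℕ) → X * ΣL (upTo k) (λ μ → ΣL (upTo k) (λ ν → bit (e μ ν) * bit (rel μ ν (ψ μ) (φ ν)))) ≤ k * Δ)
  where

  private
    m : ℕ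
    m = 3 + c
    YL HL : List (List ℕ)
    YL = digitLists T c
    HL = digitLists P m
    KL LL τL : List ℕ
    KL = upTo k
    LL = upTo L
    τL = upTo τ

    listA listB : ℕ → ℕ → ℕ → List ℕ → List ℕ → List ℕ
    listA i r μ ys h = labelsAt (EA i r) (keyA L c r μ ys h)
    listB i r ν ys h = labelsAt (EB i r) (keyB L c r ν ys h)

    -- Indices into the lists replace the labels: for fixed `ys`, `h`, `α` and `β` the listed labels
    -- at these indices form a labeling of all vertices, to which soundness applies. Where a list is
    -- too short, the default 0 of `nthℕ` is as good as any label.
    covers : ℕ → ℕ → ℕ → List ℕ → List ℕ → ℕ → ℕ → ℕ
    covers i r r′ ys h μ ν = ΣL τL λ α → ΣL τL λ β → bit (rel μ ν (nthℕ (listA i r μ ys h) α) (nthℕ (listB i r′ ν ys h) β))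

    Z : ℕ → ℕ → ℕ → List ℕ → List ℕ → ℕ → ℕ → ℕ
    Z i r r′ ys h μ ν = bit (isLong τ (listA i r μ ys h)) + (bit (isLong τ (listB i r′ ν ys h)) + covers i r r′ ys h μ ν)

    -- If neither list is long, both labels occur at indices below `τ`, and the summand of `covers`
    -- for these indices is 1.
    caught : ∀ {i r r′ ys h μ ν a b} → rel μ ν a b ≡ true →
      (keyA L c r μ ys h , a) ∈ˡ EA i r → (keyB L c r′ ν ys h , b) ∈ˡ EB i r′ → 1 ≤ Z i r r′ ys h μ ν
    caught {i} {r} {r′} {ys} {h} {μ} {ν} R a∈ b∈ with isLong τ (listA i r μ ys h) in longA | isLong τ (listB i r′ ν ys h) in longB
    ... | true  | _     = s≤s z≤n
    ... | false | true  = s≤s z≤n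
    ... | false | false with ∈-nth (labelsAt⁺ a∈) | ∈-nth (labelsAt⁺ b∈)
    ...   | α , α< , α≡ | β , β< , β≡ = begin
      1                                       ≡⟨ cong bit R ⟨
      bit (rel μ ν _ _)                       ≡⟨ cong₂ (λ a b → bit (rel μ ν a b)) α≡ β≡ ⟨
      bit (rel μ ν (nthℕ (listA i r μ ys h) α) (nthℕ (listB i r′ ν ys h) β))
        ≤⟨ ΣL-term {f = λ β → bit (rel μ ν (nthℕ (listA i r μ ys h) α) (nthℕ (listB i r′ ν ys h) β))}
             (∈-upTo⁺ (<-≤-trans β< (short τ (listB i r′ ν ys h) longB))) ⟩
      ΣL τL (λ β → bit (rel μ ν (nthℕ (listA i r μ ys h) α) (nthℕ (listB i r′ ν ys h) β)))
        ≤⟨ ΣL-term {f = λ α → ΣL τL (λ β → bit (rel μ ν (nthℕ (listA i r μ ys h) α) (nthℕ (listB i r′ ν ys h) β)))}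
             (∈-upTo⁺ (<-≤-trans α< (short τ (listA i r μ ys h) longA))) ⟩
      covers i r r′ ys h μ ν                  ∎
      where open ≤-Reasoning

    Triples : List (ℕ × ℕ × ℕ)
    Triples = cartesianProduct LL (cartesianProduct LL LL)

    Zt : ℕ × ℕ × ℕ → List ℕ → List ℕ → ℕ → ℕ → ℕ
    Zt (i , r , r′) = Z i r r′

    Edges : List (ℕ × ℕ)
    Edges = cartesianProduct KL KL

    w : ℕ × ℕ → ℕ
    w (μ , ν) = bit (e μ ν)

    -- Every critical walk is caught, and the positions at a stage are
    -- translates of the initial ones.
    perWalk : ∀ {μ ν ys} → μ < k → ν < k → e μ ν ≡ true → ys ∈ˡ YL →
      P₁ ^ m ≤ ΣL Triples (λ t → ΣL HL (λ h → Zt t ys h μ ν))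
    perWalk {μ} {ν} {ys} μ<k ν<k edge ys∈ = begin
      P₁ ^ m                                         ≡⟨ digitLists-length P₁ m ⟨
      length (digitLists P₁ m)                       ≡⟨ *-identityʳ _ ⟨
      length (digitLists P₁ m) * 1                   ≡⟨ ΣL-const (digitLists P₁ m) 1 ⟨
      ΣL (digitLists P₁ m) (λ _ → 1)                 ≤⟨ ΣL-mono (digitLists P₁ m) one ⟩
      ΣL (digitLists P₁ m) (λ g → ΣL Triples (λ t → Zt t ys (g ⊞ off t) μ ν)) ≡⟨ ΣL-swap (digitLists P₁ m) Triples (λ g t → Zt t ys (g ⊞ off t) μ ν) ⟩
      ΣL Triples (λ t → ΣL (digitLists P₁ m) (λ g → Zt t ys (g ⊞ off t) μ ν)) ≤⟨ ΣL-mono Triples shifted ⟩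
      ΣL Triples (λ t → ΣL HL (λ h → Zt t ys h μ ν)) ∎
      where
      open ≤-Reasoning
      off : ℕ × ℕ × ℕ → List ℕ
      off (i , _) = offset L c μ ν ys i
      one : ∀ {g} → g ∈ˡ digitLists P₁ m → 1 ≤ ΣL Triples (λ t → Zt t ys (g ⊞ off t) μ ν)
      one {g} g∈ = let i , i< , r , r< , r′ , r′< , a , b , R , a∈ , b∈ = critical μ<k ν<k edge ys∈ g∈ in
        ≤-trans (caught R a∈ b∈) (ΣL-term {f = λ t → Zt t ys (g ⊞ off t) μ ν}
          (∈-cartesianProduct⁺ (∈-upTo⁺ i<) (∈-cartesianProduct⁺ (∈-upTo⁺ r<) (∈-upTo⁺ r′<))))
      shifted : ∀ {t} → t ∈ˡ Triples → ΣL (digitLists P₁ m) (λ g → Zt t ys (g ⊞ off t) μ ν) ≤ ΣL HL (λ h → Zt t ys h μ ν)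
      shifted {t@(i , r , r′)} t∈ =
        subst (λ n → ΣL (digitLists P₁ n) (λ g → Zt t ys (g ⊞ off t) μ ν) ≤ ΣL (digitLists P n) (λ h → Zt t ys h μ ν))
          (offset-length L c μ ν ys i (proj₁ (∈-digitLists⁻ c ys∈)))
          (translate P₁ P (off t) (λ h → Zt t ys h μ ν) (room μ<k ν<k ys∈ (∈-upTo⁻ (proj₁ (∈-cartesianProduct⁻ LL _ t∈)))))

    W : ℕ × ℕ × ℕ → ℕ
    W t = ΣL Edges (λ (μ , ν) → ΣL YL (λ ys → ΣL HL (λ h → w (μ , ν) * Zt t ys h μ ν)))

    edge-count : ΣL Edges w ≡ k * Δ
    edge-count = trans (ΣL-product KL KL w) (trans (≤-antisym (ΣL-mono KL (λ μ∈ → ≤-reflexive (regularA (∈-upTo⁻ μ∈))))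
      (ΣL-mono KL (λ μ∈ → ≤-reflexive (sym (regularA (∈-upTo⁻ μ∈)))))) (trans (ΣL-const KL Δ) (cong (_* Δ) (length-upTo k))))

    bit-cases : ∀ b {x y} → (b ≡ true → x ≤ y) → bit b * x ≤ bit b * y
    bit-cases true  h = +-monoˡ-≤ 0 (h refl)
    bit-cases false h = z≤n

    total : k * Δ * (T ^ c * P₁ ^ m) ≤ ΣL Triples W
    total = begin
      k * Δ * (T ^ c * P₁ ^ m)                       ≡⟨ cong (_* (T ^ c * P₁ ^ m)) edge-count ⟨
      ΣL Edges w * (T ^ c * P₁ ^ m)                  ≡⟨ *-comm (ΣL Edges w) _ ⟩
      T ^ c * P₁ ^ m * ΣL Edges w                    ≡⟨ ΣL-* Edges (T ^ c * P₁ ^ m) w ⟩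
      ΣL Edges (λ q → T ^ c * P₁ ^ m * w q)          ≤⟨ ΣL-mono Edges (λ {q} q∈ → each q q∈) ⟩
      ΣL Edges (λ q → ΣL Triples (λ t → ΣL YL (λ ys → ΣL HL (λ h → w q * Zt t ys h (proj₁ q) (proj₂ q)))))
        ≡⟨ ΣL-swap Edges Triples (λ q t → ΣL YL (λ ys → ΣL HL (λ h → w q * Zt t ys h (proj₁ q) (proj₂ q)))) ⟩
      ΣL Triples W                                   ∎
      where
      open ≤-Reasoning
      each : ∀ q → q ∈ˡ Edges → T ^ c * P₁ ^ m * w q ≤ ΣL Triples (λ t → ΣL YL (λ ys → ΣL HL (λ h → w q * Zt t ys h (proj₁ q) (proj₂ q))))
      each (μ , ν) q∈ = begin
        T ^ c * P₁ ^ m * w (μ , ν)                                                ≡⟨ *-comm (T ^ c * P₁ ^ m) (w (μ , ν)) ⟩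
        w (μ , ν) * (T ^ c * P₁ ^ m)                                              ≡⟨ cong (λ z → w (μ , ν) * (z * P₁ ^ m)) (digitLists-length T c) ⟨
        w (μ , ν) * (length YL * P₁ ^ m)                                          ≡⟨ cong (w (μ , ν) *_) (ΣL-const YL (P₁ ^ m)) ⟨
        w (μ , ν) * ΣL YL (λ _ → P₁ ^ m)                                          ≤⟨ bit-cases (e μ ν) (λ edge → ΣL-mono YL (perWalk (∈-upTo⁻ (proj₁ ∈s)) (∈-upTo⁻ (proj₂ ∈s)) edge)) ⟩
        w (μ , ν) * ΣL YL (λ ys → ΣL Triples (λ t → ΣL HL (λ h → Zt t ys h μ ν))) ≡⟨ cong (w (μ , ν) *_) (ΣL-swap YL Triples (λ ys t → ΣL HL (λ h → Zt t ys h μ ν))) ⟩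
        w (μ , ν) * ΣL Triples (λ t → ΣL YL (λ ys → ΣL HL (λ h → Zt t ys h μ ν))) ≡⟨ ΣL-* Triples (w (μ , ν)) _ ⟩
        ΣL Triples (λ t → w (μ , ν) * ΣL YL (λ ys → ΣL HL (λ h → Zt t ys h μ ν))) ≡⟨ ΣL-cong Triples (λ t → trans (ΣL-* YL (w (μ , ν)) _) (ΣL-cong YL λ ys → ΣL-* HL (w (μ , ν)) _)) ⟩
        _                                                                         ∎
        where ∈s = ∈-cartesianProduct⁻ KL KL q∈

    Params : List (ℕ × List ℕ × List ℕ)
    Params = cartesianProduct KL (cartesianProduct YL HL)

    params-unique : Unique Params
    params-unique = cartesianProduct⁺ (upTo⁺ k) (cartesianProduct⁺ (digitLists-unique T c) (digitLists-unique P m))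

    params-len : ∀ {z} → z ∈ˡ Params → length (proj₁ (proj₂ z)) ≡ c × length (proj₂ (proj₂ z)) ≡ m
    params-len z∈ = let _ , z∈′ = ∈-cartesianProduct⁻ KL _ z∈
                        y∈ , h∈ = ∈-cartesianProduct⁻ YL HL z∈′
                    in proj₁ (∈-digitLists⁻ {T} c y∈) , proj₁ (∈-digitLists⁻ {P} m h∈)

    -- A long list has at least `τ` members, and all lists together have at most as many as there
    -- are entries, because keys are injective. Each list is shared by the `Δ` edges at its vertex,
    -- whence the factor `Δ`. Stated for an abstract key, it serves both sides of the instance.
    long-part : ∀ (es : List Entry) (key : ℕ → List ℕ → List ℕ → ℕ × List ℕ × List ℕ) → length es ≤ N →
      (∀ {v v′ ys ys′ h h′} → length ys ≡ c → length ys′ ≡ c → length h ≡ m → length h′ ≡ m →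
         key v ys h ≡ key v′ ys′ h′ → v ≡ v′ × ys ≡ ys′ × h ≡ h′) →
      ∀ (f : ℕ → ℕ → ℕ) → (∀ {v} → v < k → ΣL KL (f v) ≡ Δ) →
      τ * ΣL KL (λ v → ΣL KL (λ v′ → ΣL YL (λ ys → ΣL HL (λ h → f v v′ * bit (isLong τ (labelsAt es (key v ys h))))))) ≤ Δ * N
    long-part es key es≤ inj f reg = begin
      τ * ΣL KL (λ v → ΣL KL (λ v′ → ΣL YL (λ ys → ΣL HL (λ h → f v v′ * b v ys h))))
        ≤⟨ *-monoʳ-≤ τ (ΣL-mono KL λ {v} v∈ → ≤-reflexive (inner v (∈-upTo⁻ v∈))) ⟩
      τ * ΣL KL (λ v → Δ * ΣL YL (λ ys → ΣL HL (b v ys)))  ≡⟨ cong (τ *_) (ΣL-* KL Δ _) ⟨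
      τ * (Δ * ΣL KL (λ v → ΣL YL (λ ys → ΣL HL (b v ys)))) ≡⟨ ring τ Δ _ ⟩
      Δ * (τ * ΣL KL (λ v → ΣL YL (λ ys → ΣL HL (b v ys))))
        ≡⟨ cong (λ z → Δ * (τ * z)) (trans (ΣL-product KL _ _) (ΣL-cong KL λ v → ΣL-product YL HL _)) ⟨
      Δ * (τ * ΣL Params (λ (v , ys , h) → b v ys h))      ≡⟨ cong (Δ *_) (ΣL-* Params τ _) ⟩
      Δ * ΣL Params (λ (v , ys , h) → τ * b v ys h)        ≤⟨ *-monoʳ-≤ Δ (ΣL-mono Params λ { {v , ys , h} _ → isLong-weight τ (labelsAt es (key v ys h)) }) ⟩
      Δ * ΣL Params (λ (v , ys , h) → length (labelsAt es (key v ys h)))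
        ≤⟨ *-monoʳ-≤ Δ (labelsAt-total es (λ (v , ys , h) → key v ys h) params-unique (λ {x} {y} x∈ y∈ eq →
             let ly , lh = params-len x∈
                 ly′ , lh′ = params-len y∈
                 e₁ , e₂ , e₃ = inj ly ly′ lh lh′ eq
             in cong₂ _,_ e₁ (cong₂ _,_ e₂ e₃))) ⟩
      Δ * length es                                        ≤⟨ *-monoʳ-≤ Δ es≤ ⟩
      Δ * N                                                ∎
      where
      open ≤-Reasoning
      b : ℕ → List ℕ → List ℕ → ℕ
      b v ys h = bit (isLong τ (labelsAt es (key v ys h)))
      ring : ∀ a b c → a * (b * c) ≡ b * (a * c)
      ring = solve-∀
      inner : ∀ v → v < k → ΣL KL (λ v′ → ΣL YL (λ ys → ΣL HL (λ h → f v v′ * b v ys h))) ≡ Δ * ΣL YL (λ ys → ΣL HL (b v ys))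
      inner v v<k = trans (ΣL-cong KL λ v′ → trans (ΣL-cong YL λ ys → sym (ΣL-* HL (f v v′) _)) (trans (sym (ΣL-* YL (f v v′) _)) (*-comm (f v v′) _)))
        (trans (sym (ΣL-* KL (ΣL YL (λ ys → ΣL HL (b v ys))) (f v))) (trans (cong (ΣL YL (λ ys → ΣL HL (b v ys)) *_) (reg v<k)) (*-comm _ Δ)))

    -- Once the order of summation is exchanged, each choice of digits, position and two indices
    -- gives one labeling, and soundness bounds the edges it covers by `k * Δ` over `X`.
    short-part : ∀ i r r′ → X * ΣL Edges (λ (μ , ν) → ΣL YL (λ ys → ΣL HL (λ h → w (μ , ν) * covers i r r′ ys h μ ν))) ≤
      T ^ c * (P ^ m * (τ * (τ * (k * Δ))))
    short-part i r r′ = begin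
      X * ΣL Edges (λ q → ΣL YL (λ ys → ΣL HL (λ h → w q * covers i r r′ ys h (proj₁ q) (proj₂ q))))
        ≡⟨ cong (X *_) (trans (ΣL-swap Edges YL _) (ΣL-cong YL λ ys → trans (ΣL-swap Edges HL _) (ΣL-cong HL λ h → pull ys h))) ⟩
      X * ΣL YL (λ ys → ΣL HL (λ h → ΣL τL (λ α → ΣL τL (λ β → cov ys h α β))))
        ≡⟨ trans (ΣL-* YL X _) (ΣL-cong YL λ ys → trans (ΣL-* HL X _) (ΣL-cong HL λ h → trans (ΣL-* τL X _) (ΣL-cong τL λ α → ΣL-* τL X _))) ⟩
      ΣL YL (λ ys → ΣL HL (λ h → ΣL τL (λ α → ΣL τL (λ β → X * cov ys h α β))))
        ≤⟨ ΣL-mono YL (λ {ys} _ → ΣL-mono HL (λ {h} _ → ΣL-mono τL (λ {α} _ → ΣL-mono τL (λ {β} _ →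
             ≤-trans (≤-reflexive (cong (X *_) (ΣL-product KL KL _))) (sound (λ μ → nthℕ (listA i r μ ys h) α) (λ ν → nthℕ (listB i r′ ν ys h) β)))))) ⟩
      ΣL YL (λ ys → ΣL HL (λ h → ΣL τL (λ α → ΣL τL (λ β → k * Δ))))
        ≡⟨ trans (ΣL-cong YL λ _ → trans (ΣL-cong HL λ _ → trans (ΣL-cong τL λ _ → const τ) (const τ))
             (trans (ΣL-const HL _) (cong (_* (τ * (τ * (k * Δ)))) (digitLists-length P m))))
             (trans (ΣL-const YL _) (cong (_* (P ^ m * (τ * (τ * (k * Δ))))) (digitLists-length T c))) ⟩
      T ^ c * (P ^ m * (τ * (τ * (k * Δ)))) ∎
      where
      open ≤-Reasoning
      const : ∀ n {x} → ΣL (upTo n) (λ _ → x) ≡ n * x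
      const n {x} = trans (ΣL-const (upTo n) x) (cong (_* x) (length-upTo n))
      term : List ℕ → List ℕ → ℕ → ℕ → ℕ × ℕ → ℕ
      term ys h α β (μ , ν) = w (μ , ν) * bit (rel μ ν (nthℕ (listA i r μ ys h) α) (nthℕ (listB i r′ ν ys h) β))
      cov : List ℕ → List ℕ → ℕ → ℕ → ℕ
      cov ys h α β = ΣL Edges (term ys h α β)
      pull : ∀ ys h → ΣL Edges (λ q → w q * covers i r r′ ys h (proj₁ q) (proj₂ q)) ≡ ΣL τL (λ α → ΣL τL (λ β → cov ys h α β))
      pull ys h = trans (ΣL-cong Edges λ q → trans (ΣL-* τL (w q) _) (ΣL-cong τL λ α → ΣL-* τL (w q) _))
        (trans (ΣL-swap Edges τL _) (ΣL-cong τL λ α → ΣL-swap Edges τL _))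

    perTriple : ∀ t → X * (τ * W t) ≤ X * (2 * (Δ * N)) + τ * (T ^ c * (P ^ m * (τ * (τ * (k * Δ)))))
    perTriple (i , r , r′) = begin
      X * (τ * W (i , r , r′))      ≡⟨ cong (λ z → X * (τ * z)) split ⟩
      X * (τ * (A + (B + C)))       ≡⟨ ring X τ A B C ⟩
      X * (τ * A + τ * B) + τ * (X * C) ≤⟨ +-mono-≤ (*-monoʳ-≤ X (+-mono-≤ A≤ B≤)) (*-monoʳ-≤ τ (short-part i r r′)) ⟩
      X * (Δ * N + Δ * N) + _       ≡⟨ cong (λ z → X * (Δ * N + z) + τ * (T ^ c * (P ^ m * (τ * (τ * (k * Δ)))))) (+-identityʳ (Δ * N)) ⟨
      X * (2 * (Δ * N)) + τ * (T ^ c * (P ^ m * (τ * (τ * (k * Δ))))) ∎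
      where
      open ≤-Reasoning
      sumOf : (List ℕ → List ℕ → ℕ → ℕ → ℕ) → ℕ
      sumOf f = ΣL Edges (λ (μ , ν) → ΣL YL (λ ys → ΣL HL (λ h → w (μ , ν) * f ys h μ ν)))
      a b z : List ℕ → List ℕ → ℕ → ℕ → ℕ
      a ys h μ ν = bit (isLong τ (listA i r μ ys h))
      b ys h μ ν = bit (isLong τ (listB i r′ ν ys h))
      z = covers i r r′
      A B C : ℕ
      A = sumOf a
      B = sumOf b
      C = sumOf z
      sumOf-+ : ∀ f g → sumOf (λ ys h μ ν → f ys h μ ν + g ys h μ ν) ≡ sumOf f + sumOf g
      sumOf-+ f g = trans (ΣL-cong Edges λ (μ , ν) → trans (ΣL-cong YL λ ys → trans (ΣL-cong HL λ h → *-distribˡ-+ (w (μ , ν)) _ _) (ΣL-+ HL _ _)) (ΣL-+ YL _ _)) (ΣL-+ Edges _ _)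
      split : W (i , r , r′) ≡ A + (B + C)
      split = trans (sumOf-+ a (λ ys h μ ν → b ys h μ ν + z ys h μ ν)) (cong (A +_) (sumOf-+ b z))
      ring : ∀ X τ A B C → X * (τ * (A + (B + C))) ≡ X * (τ * A + τ * B) + τ * (X * C)
      ring = solve-∀
      A≤ : τ * A ≤ Δ * N
      A≤ = ≤-trans (≤-reflexive (cong (τ *_) (ΣL-product KL KL _)))
        (long-part (EA i r) (keyA L c r) (EA≤ i r) (keyA-injective L c r) (λ μ ν → bit (e μ ν)) regularA)
      B≤ : τ * B ≤ Δ * N
      B≤ = ≤-trans (≤-reflexive (cong (τ *_) (trans (ΣL-product KL KL _) (ΣL-swap KL KL _))))
        (long-part (EB i r′) (keyB L c r′) (EB≤ i r′) (keyB-injective L c r′) (λ ν μ → bit (e μ ν)) regularB)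

  -- The left side stands for the number of critical walks, the right side for those caught at each
  -- of the `L * (L * L)` triples of a stage and two rounds. The factors `X` and `τ` clear the
  -- denominators of soundness and of the count of long lists.
  count : X * (τ * (k * Δ * (T ^ c * P₁ ^ m))) ≤
    L * (L * L) * (X * (2 * (Δ * N)) + τ * (T ^ c * (P ^ m * (τ * (τ * (k * Δ))))))
  count = begin
    X * (τ * (k * Δ * (T ^ c * P₁ ^ m)))   ≤⟨ *-monoʳ-≤ X (*-monoʳ-≤ τ total) ⟩
    X * (τ * ΣL Triples W)                 ≡⟨ trans (cong (X *_) (ΣL-* Triples τ W)) (ΣL-* Triples X _) ⟩
    ΣL Triples (λ t → X * (τ * W t))       ≤⟨ ΣL-mono Triples (λ {t} _ → perTriple t) ⟩
    ΣL Triples (λ _ → bnd)                 ≡⟨ trans (ΣL-product LL _ _) (trans (ΣL-cong LL λ _ → trans (ΣL-product LL LL _) (trans (ΣL-cong LL λ _ → const) const)) const) ⟩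
    L * (L * (L * bnd))                    ≡⟨ ring L bnd ⟩
    L * (L * L) * bnd                      ∎
    where
    open ≤-Reasoning
    bnd = X * (2 * (Δ * N)) + τ * (T ^ c * (P ^ m * (τ * (τ * (k * Δ)))))
    const : ∀ {x} → ΣL LL (λ _ → x) ≡ L * x
    const {x} = trans (ΣL-const LL x) (cong (_* x) (length-upTo L))
    ring : ∀ L b → L * (L * (L * b)) ≡ L * (L * L) * b
    ring = solve-∀

-- The counting inequality from an accepted solution

constraint : ∀ {k M T rel κ s s′} → κ ≡ 1 → Step k M T rel κ s s′ → rel (proj₁ s) (proj₁ s′) (label s) (label s′) ≡ true
constraint refl (constrain _ _ R) = R

module NoCase (k M T L c P₁ P d′ cap : ℕ) (c>1 : 1 < c) (rel : ℕ → ℕ → ℕ → ℕ → Bool) (e : ℕ → ℕ → Bool) (y : Tree)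
  (0<k : 0 < k) (0<M : 0 < M) (0<L : 0 < L) (d′<L² : d′ < L * L)
  (accepted : checkOf (Semantics.n k M T L c P rel) (Semantics.graphTree k M T L c P rel) (Semantics.Θ k M T L c P rel) d′ cap y ≡ true)
  (satisfiable : ∀ {μ ν} → μ < k → ν < k → e μ ν ≡ true → ∃[ a ] ∃[ b ] a < M × b < M × rel μ ν a b ≡ true)
  (room : ∀ {μ ν ys i} → μ < k → ν < k → ys ∈ˡ digitLists T c → i < L → All (λ x → x + P₁ ≤ P) (offset L c μ ν ys i))
  (roomEnd : ∀ {μ ν ys} → μ < k → ν < k → ys ∈ˡ digitLists T c → All (λ x → x + P₁ ≤ P) (times (3 + c) L (stageVecOf L c μ ν ys)))
  where
  open Paths k M T L c P (<⇒≤ c>1) rel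

  private
    module Ch = Check n graphTree Θ d′ cap y

    canonOf : ∀ i j b → closure ⟦ toℕ i , toℕ j ⟧ ≡ b → Maybe (∃[ l ] RWalk VEdge (vtx i) (vtx j) l)
    canonOf i j true  eq = just (let l , w = closure⁻ {i} {j} eq in l , mapWalk vtx (λ _ _ r → r) w)
    canonOf i j false eq = nothing

    canon : ∀ i j → Maybe (∃[ l ] RWalk VEdge (vtx i) (vtx j) l)
    canon i j = canonOf i j (closure ⟦ toℕ i , toℕ j ⟧) refl

    canonOf-just : ∀ i j b eq → b ≡ true → ∃[ w ] canonOf i j b eq ≡ just w
    canonOf-just i j true eq _ = _ , refl

    J⇒ : ∀ {i j} → Ch.Cut i j → ∃[ w ] canon i j ≡ just w
    J⇒ {i} {j} (h , _) = canonOf-just i j (closure ⟦ toℕ i , toℕ j ⟧) refl h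

    module Ex = Extract k M T L c P c>1 rel canon Ch.Cut J⇒
    open Ex using (tA; tB; readAt; stateAt; Hop)

    entryFrom : Maybe (State × State) → List Entry
    entryFrom nothing          = []
    entryFrom (just (s₁ , s₂)) = ((proj₁ s₁ , position (place s₁) , position (place s₂)) , label s₁) ∷ []

    entryAt : ℕ → ∀ {i j} → Dec (i < n) → Dec (j < n) → List Entry
    entryAt t (yes i<) (yes j<) = entryFrom (readAt (fromℕ< i<) (fromℕ< j<) t)
    entryAt t _        _        = []

    entries : ℕ → List Entry
    entries t = concatMap (λ (i , j) → entryAt t (i <? n) (j <? n)) Ch.cutPairs

    entryFrom-length : ∀ m → length (entryFrom m) ≤ 1
    entryFrom-length nothing  = z≤n
    entryFrom-length (just _) = ≤-refl

    entryAt-length : ∀ t {i j} (p : Dec (i < n)) (q : Dec (j < n)) → length (entryAt t p q) ≤ 1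
    entryAt-length t (yes i<) (yes j<) = entryFrom-length (readAt (fromℕ< i<) (fromℕ< j<) t)
    entryAt-length t (yes _)  (no _)   = z≤n
    entryAt-length t (no _)   _        = z≤n

    -- A jump may pass over many rounds, but at a given time it contributes at most one entry. The
    -- resulting repetition over rounds is paid for by the sum over triples.
    entries-length : ∀ t → length (entries t) ≤ cap
    entries-length t = ≤-trans (go Ch.cutPairs) (proj₁ (Ch.check⁻ accepted))
      where
      go : ∀ ps → length (concatMap (λ (i , j) → entryAt t (i <? n) (j <? n)) ps) ≤ length ps
      go []             = z≤n
      go ((i , j) ∷ ps) = ≤-trans (≤-reflexive (length-++ (entryAt t (i <? n) (j <? n))))
        (+-mono-≤ (entryAt-length t (i <? n) (j <? n)) (go ps))

    entryAt⁺ : ∀ t (z z′ : Fin n) (p : Dec (toℕ z < n)) (q : Dec (toℕ z′ < n)) {s₁ s₂} → readAt z z′ t ≡ just (s₁ , s₂) →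
      ((proj₁ s₁ , position (place s₁) , position (place s₂)) , label s₁) ∈ˡ entryAt t p q
    entryAt⁺ t z z′ (yes p) (yes q) {s₁} {s₂} eq =
      subst (λ m → ((proj₁ s₁ , position (place s₁) , position (place s₂)) , label s₁) ∈ˡ entryFrom m)
        (sym (trans (cong₂ (λ a b → readAt a b t) (fromℕ<-toℕ z p) (fromℕ<-toℕ z′ q)) eq)) (here refl)
    entryAt⁺ t z z′ (no p)  _       eq = ⊥-elim (p (toℕ<n z))
    entryAt⁺ t z z′ (yes _) (no q)  eq = ⊥-elim (q (toℕ<n z′))

    entries⁺ : ∀ t {z z′ s₁ s₂} → Ch.Cut z z′ → readAt z z′ t ≡ just (s₁ , s₂) →
      ((proj₁ s₁ , position (place s₁) , position (place s₂)) , label s₁) ∈ˡ entries t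
    entries⁺ t {z} {z′} cut eq = ∈-concatMap⁺ _ (Ch.cutPairs⁺ {z} {z′} cut)
      (entryAt⁺ t z z′ (toℕ z <? n) (toℕ z′ <? n) eq)

    near : ∀ {i j l} → l ≤ Θ → RWalk Edge i j l → ∃[ l′ ] l′ < L * L × RWalk Hop i j l′
    near l≤ w = let l′ , l′≤ , w′ = proj₂ (Ch.check⁻ accepted) l≤ (mapWalk id edge⁺ w) in
      l′ , ≤-<-trans l′≤ d′<L² , mapWalk id (λ i j → map₁ (edge⁻ i j)) w′

    -- One actual walk with the critical choices is built, with labels that satisfy the constraint
    -- of the edge. Its purpose is to make its two ends reachable from each other, so that the
    -- accepted solution has to join them by few hops; its own labels are then forgotten.
    module CritWalk (μ ν : ℕ) (μ<k : μ < k) (ν<k : ν < k) (edge : e μ ν ≡ true) (ys : List ℕ) (ys∈ : ys ∈ˡ digitLists T c)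
      (g : List ℕ) (g∈ : g ∈ˡ digitLists P₁ (3 + c)) where

      ys-len = proj₁ (∈-digitLists⁻ {T} c ys∈)
      open Tube k M T L c P (<⇒≤ c>1) rel μ ν
      open Critical k M T L c P (<⇒≤ c>1) rel μ ν ys ys-len

      ys-pos : 0 < length ys
      ys-pos = subst (0 <_) (sym ys-len) (<⇒≤ c>1)

      a₀ b₀ : ℕ
      a₀ = proj₁ (satisfiable μ<k ν<k edge)
      b₀ = proj₁ (proj₂ (satisfiable μ<k ν<k edge))
      a₀<M = proj₁ (proj₂ (proj₂ (satisfiable μ<k ν<k edge)))
      b₀<M = proj₁ (proj₂ (proj₂ (proj₂ (satisfiable μ<k ν<k edge))))
      rel₀ = proj₂ (proj₂ (proj₂ (proj₂ (satisfiable μ<k ν<k edge))))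

      moves : ∀ m {θ zs s} → 0 < length zs → All (_< T) zs → (∀ j → j < m → kind (θ + j) ≡ 2) →
        ∃[ s′ ] RWalk VEdge (θ , s) (θ + m , s′) m × place s′ ≡ crit m θ zs (place s) × label s′ ≡ label s × proj₁ s′ ≡ proj₁ s
      moves zero {θ} {s = s} _ _ _ = s , subst (λ t → RWalk VEdge (θ , s) (t , s) 0) (sym (+-identityʳ θ)) done , refl , refl , refl
      moves (suc m) {θ} {z ∷ zs} {s@(w , a , sq , gu , gv , ds)} _ (z<T ∷ zs<T) kinds =
        let κ≡ = trans (cong kind (sym (+-identityʳ θ))) (kinds 0 (s≤s z≤n))
            s₁ = (w , a , sq + z * z , gu , gv , tailL ds ++ (headℕ ds + z ∷ []))
            s′ , walk , pl , lab , ww = moves m {suc θ} {zs ++ (z ∷ [])} {s₁} (subst (0 <_) (sym (trans (length-++ zs) (+-comm (length zs) 1))) (s≤s z≤n))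
              (All-++⁺ zs<T (z<T ∷ [])) (λ j j<m → trans (cong kind (sym (+-suc θ j))) (kinds (suc j) (s≤s j<m)))
        in s′ , step (at (subst (λ κ → Step k M T rel κ s s₁) (sym κ≡) (move z<T))) (subst (λ t → RWalk VEdge (suc θ , s₁) (t , s′) m) (sym (+-suc θ m)) walk) ,
           trans pl (cong (λ κ → crit m (suc θ) (turn κ (z ∷ zs)) (critStep κ (z ∷ zs) (place s))) (sym κ≡)) , lab , ww

      half : ∀ {θ κ s s₁} → kind θ ≡ κ → Step k M T rel κ s s₁ → place s₁ ≡ critStep κ ys (place s) → turn κ ys ≡ ys →
        (∀ j → j < ℓ → kind (suc θ + j) ≡ 2) →
        ∃[ s′ ] RWalk VEdge (θ , s) (θ + suc ℓ , s′) (suc ℓ) × place s′ ≡ crit (suc ℓ) θ ys (place s) × label s′ ≡ label s₁ × proj₁ s′ ≡ proj₁ s₁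
      half {θ} {κ} {s} {s₁} κ≡ st pl₁ tr kinds =
        let s′ , walk , pl , lab , ww = moves ℓ {suc θ} {ys} {s₁} ys-pos (proj₂ (∈-digitLists⁻ {T} c ys∈)) kinds
        in s′ , step (at (subst (λ κ → Step k M T rel κ s s₁) (sym κ≡) st)) (subst (λ t → RWalk VEdge (suc θ , s₁) (t , s′) ℓ) (sym (+-suc θ ℓ)) walk) ,
           trans pl (trans (cong₂ (crit ℓ (suc θ)) (sym tr) pl₁) (cong (λ κ → crit ℓ (suc θ) (turn κ ys) (critStep κ ys (place s))) (sym κ≡))) , lab , ww

      track-half : ∀ {θ} κ → kind θ ≡ κ → turn κ ys ≡ ys → (∀ j → j < ℓ → kind (suc θ + j) ≡ 2) → ∀ s → Len (place s) → track (suc ℓ) θ ys ≡ ys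
      track-half {θ} κ κ≡ tr kinds s len = trans (cong (track ℓ (suc θ)) (trans (cong (λ κ → turn κ ys) κ≡) tr))
        (trans (cong (λ m → track m (suc θ) ys) (*-comm c L)) (go L (suc θ) (λ j j< → kinds j (subst (j <_) (*-comm L c) j<))))
        where
        turns : ∀ m θ zs → (∀ j → j < m → kind (θ + j) ≡ 2) → track m θ zs ≡ iter m rotate zs
        turns zero    θ zs kinds = refl
        turns (suc m) θ zs kinds = trans (cong (λ κ → track m (suc θ) (turn κ zs)) (trans (cong kind (sym (+-identityʳ θ))) (kinds 0 (s≤s z≤n))))
          (turns m (suc θ) (rotate zs) (λ j j<m → trans (cong kind (sym (+-suc θ j))) (kinds (suc j) (s≤s j<m))))
        full : ∀ zs zs′ → iter (length zs) rotate (zs ++ zs′) ≡ zs′ ++ zs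
        full []       zs′ = sym (++-identityʳ zs′)
        full (z ∷ zs) zs′ = trans (cong (iter (length zs) rotate) (++-assoc zs zs′ (z ∷ []))) (trans (full zs (zs′ ++ (z ∷ []))) (++-assoc zs′ (z ∷ []) zs))
        go : ∀ r θ → (∀ j → j < r * c → kind (θ + j) ≡ 2) → track (r * c) θ ys ≡ ys
        go zero    θ kinds = refl
        go (suc r) θ kinds = trans (track-+ c (r * c) θ ys) (trans (cong (track (r * c) (θ + c))
          (trans (turns c θ ys (λ j j<c → kinds j (≤-trans j<c (m≤m+n c _))))
            (trans (cong₂ (λ m zs → iter m rotate zs) (sym ys-len) (sym (++-identityʳ ys))) (full ys []))))
          (go r (θ + c) (λ j j< → trans (cong kind (+-assoc θ c j)) (kinds (c + j) (+-monoʳ-< c j<)))))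

      stage : ∀ {i s} → i < L → Len (place s) →
        ∃[ s′ ] RWalk VEdge (i * S , s) (suc i * S , s′) S × place s′ ≡ crit S (i * S) ys (place s) × (proj₁ s′ < k × label s′ < M)
      stage {i} {s@(w , a , sq , gu , gv , ds)} i<L len =
        let kA = λ j (j<ℓ : j < ℓ) → trans (cong kind (sym (+-suc (i * S) j))) (kindA′ i<L j<ℓ)
            kB = λ j (j<ℓ : j < ℓ) → trans (cong kind (trans (sym (+-suc (i * S + suc ℓ) j)) (+-assoc (i * S) (suc ℓ) (suc j)))) (kindB′ i<L j<ℓ)
            s₁ , walk₁ , pl₁ , lab₁ , w₁ = half {i * S} {0} {s} {μ , a₀ , sq + μ * μ , gu + μ , gv , ds} (kindA i<L) (choose μ<k a₀<M) refl refl kA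
            s₂′ = (ν , b₀ , proj₁ (proj₂ (proj₂ s₁)) + ν * ν , proj₁ (proj₂ (proj₂ (proj₂ s₁))) , proj₁ (proj₂ (proj₂ (proj₂ (proj₂ s₁)))) + ν , proj₂ (proj₂ (proj₂ (proj₂ (proj₂ s₁)))))
            s₂ , walk₂ , pl₂ , lab₂ , w₂ = half {i * S + suc ℓ} {1} {s₁} {s₂′} (kindB i<L)
              (constrain ν<k b₀<M (subst₂ (λ w a → rel w ν a b₀ ≡ true) (sym w₁) (sym lab₁) rel₀)) refl refl kB
            tr = track-half {i * S} 0 (kindA i<L) refl kA s len
            S≡ : suc ℓ + suc ℓ ≡ S
            S≡ = cong (suc ℓ +_) (sym (+-identityʳ (suc ℓ)))
            time≡ : i * S + suc ℓ + suc ℓ ≡ suc i * S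
            time≡ = trans (+-assoc (i * S) (suc ℓ) (suc ℓ)) (trans (cong (i * S +_) S≡) (+-comm (i * S) S))
        in s₂ , subst₂ (λ t l → RWalk VEdge (i * S , s) (t , s₂) l) time≡ S≡ (walk₁ ⋈ walk₂) ,
           trans pl₂ (trans (cong₂ (crit (suc ℓ) (i * S + suc ℓ)) (sym tr) pl₁) (trans (sym (crit-+ (suc ℓ) (suc ℓ) (i * S) ys (place s)))
             (cong (λ m → crit m (i * S) ys (place s)) S≡))) ,
           subst (_< k) (sym w₂) ν<k , subst (_< M) (sym lab₂) b₀<M

      s₀ : State
      -- The first step overwrites vertex and label, so any initial ones do; 0 is in range as `k`
      -- and `M` are positive.
      s₀ = 0 , 0 , headℕ g , headℕ (tailL g) , headℕ (tailL (tailL g)) , tailL (tailL (tailL g))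

      g-parts : ∀ h → length h ≡ 3 + c → position (0 , headℕ h , headℕ (tailL h) , headℕ (tailL (tailL h)) , tailL (tailL (tailL h))) ≡ h
      g-parts (_ ∷ _ ∷ _ ∷ _) len = refl

      g-len = proj₁ (∈-digitLists⁻ {P₁} (3 + c) g∈)

      pos₀ : position (place s₀) ≡ g
      pos₀ = g-parts g g-len

      len₀ : Len (place s₀)
      len₀ = suc-injective (suc-injective (suc-injective (trans (cong length pos₀) g-len)))

      stages : ∀ i → i ≤ L → ∃[ s′ ] RWalk VEdge (0 , s₀) (i * S , s′) (i * S) × place s′ ≡ crit (i * S) 0 ys (place s₀) × (proj₁ s′ < k × label s′ < M)
      stages zero    _   = s₀ , done , refl , 0<k , 0<M
      stages (suc i) i<L =
        let s₁ , walk₁ , pl₁ , _ = stages i (<⇒≤ i<L)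
            crit≡ , track≡ = critStages {i} (place s₀) (<⇒≤ i<L) len₀
            len₁ = subst Len (sym (trans pl₁ crit≡)) (stages-len i {place s₀} len₀)
            s₂ , walk₂ , pl₂ , bounds = stage {i} {s₁} i<L len₁
            comm = +-comm (i * S) S
        in s₂ , subst (RWalk VEdge (0 , s₀) (suc i * S , s₂)) comm (walk₁ ⋈ walk₂) ,
           trans pl₂ (trans (cong₂ (crit S (i * S)) (sym track≡) pl₁) (trans (sym (crit-+ (i * S) S 0 ys (place s₀))) (cong (λ m → crit m 0 ys (place s₀)) comm))) ,
           bounds

      sₑ : State
      sₑ = proj₁ (stages L ≤-refl)

      whole : RWalk VEdge (0 , s₀) (Θ , sₑ) Θ
      whole = proj₁ (proj₂ (stages L ≤-refl))

      placeₑ : place sₑ ≡ crit Θ 0 ys (place s₀)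
      placeₑ = proj₁ (proj₂ (proj₂ (stages L ≤-refl)))

      private
        boxed : ∀ {s} → proj₁ s < k → label s < M → length (position (place s)) ≡ 3 + c → All (_< P) (position (place s)) → Fwd s × Bwd s
        boxed w< a< len (sq< ∷ gu< ∷ gv< ∷ ds<) = (w< , a< , suc-injective (suc-injective (suc-injective len))) , sq< , gu< , gv< , ds<

        below : ∀ xs ts → All (_< P₁) xs → All (λ x → x + P₁ ≤ P) ts → All (_< P) (xs ⊞ ts)
        below []       _        _          _          = []
        below (_ ∷ _)  []       _          _          = []
        below (x ∷ xs) (t ∷ ts) (x< ∷ xs<) (t≤ ∷ ts≤) = <-≤-trans (+-monoˡ-< t x<) (≤-trans (≤-reflexive (+-comm P₁ t)) t≤) ∷ below xs ts xs< ts≤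

        P₁≤P : P₁ ≤ P
        P₁≤P with room μ<k ν<k ys∈ 0<L
        ... | x≤ ∷ _ = m+n≤o⇒n≤o _ x≤

      box₀ : Box (0 , s₀)
      box₀ = z≤n , boxed {s₀} 0<k 0<M (trans (cong length pos₀) g-len)
        (subst (All (_< P)) (sym pos₀) (All-map (λ x< → <-≤-trans x< P₁≤P) (proj₂ (∈-digitLists⁻ {P₁} (3 + c) g∈))))

      posₑ : position (place sₑ) ≡ g ⊞ times (3 + c) L stageVec
      posₑ = trans (cong position (trans placeₑ (proj₁ (critStages {L} (place s₀) ≤-refl len₀))))
        (trans (stages-pos L {place s₀} len₀) (cong (_⊞ times (3 + c) L stageVec) pos₀))

      boxₑ : Box (Θ , sₑ)
      boxₑ = ≤-refl , boxed {sₑ} (proj₁ (proj₂ (proj₂ (proj₂ (stages L ≤-refl))))) (proj₂ (proj₂ (proj₂ (proj₂ (stages L ≤-refl)))))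
        (trans (cong length posₑ) (⊞-len g (times (3 + c) L stageVec) g-len (times-length (3 + c) L stageVec (stageVec-length L c μ ν ys ys-len))))
        (subst (All (_< P)) (sym posₑ) (below g (times (3 + c) L stageVec) (proj₂ (∈-digitLists⁻ {P₁} (3 + c) g∈)) (roomEnd μ<k ν<k ys∈)))

      h : ℕ → List ℕ
      h i = g ⊞ offset L c μ ν ys i

      round-w : ∀ r e → proj₁ (iter r roundP e) ≡ proj₁ e
      round-w zero    e = refl
      round-w (suc r) e = round-w r (roundP e)

      posA : ∀ i r → position (iter r roundP (chooseP (iter i stageP (place s₀)))) ≡ h i ⊞ times (3 + c) r (rVec ys)
      posA i r = trans (rounds-pos r {chooseP E} (stages-len i {place s₀} len₀)) (cong (_⊞ times (3 + c) r (rVec ys)) (start i))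
        where
        E = iter i stageP (place s₀)
        start : ∀ i → position (chooseP (iter i stageP (place s₀))) ≡ h i
        start i = trans (choose-pos {iter i stageP (place s₀)} (stages-len i {place s₀} len₀)) (trans (cong (_⊞ uVec c μ)
          (trans (stages-pos i {place s₀} len₀) (cong (_⊞ times (3 + c) i stageVec) pos₀))) (⊞-assoc g (times (3 + c) i stageVec) (uVec c μ)))

      posB : ∀ i r → position (iter r roundP (constrainP (iter L roundP (chooseP (iter i stageP (place s₀)))))) ≡
        h i ⊞ times (3 + c) L (rVec ys) ⊞ vVec c ν ⊞ times (3 + c) r (rVec ys)
      posB i r = trans (rounds-pos r {constrainP E} E-len) (cong (_⊞ times (3 + c) r (rVec ys))
        (trans (constrain-pos {E} E-len) (cong (_⊞ vVec c ν) (posA i L))))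
        where
        E = iter L roundP (chooseP (iter i stageP (place s₀)))
        E-len : Len E
        E-len = iter-inv L roundP Len (λ {e} → round-len {e}) {chooseP (iter i stageP (place s₀))} (stages-len i {place s₀} len₀)

      -- `W` is the expansion of a walk with few hops, over which there is no control but for its
      -- ends. Since these are the ends of the critical walk, `tube` fixes its place at every time.
      module Found {u v m} (W : RWalk VEdge u v m) (u≡ : u ≡ (0 , s₀)) (v≡ : v ≡ (Θ , sₑ)) where

        m≡ : m ≡ Θ
        m≡ = trans (sym (trans (Ex.time W) (cong (_+ m) (cong proj₁ u≡)))) (cong proj₁ v≡)

        private
          tubed : ∀ {u v m} (W : RWalk VEdge u v m) → u ≡ (0 , s₀) → v ≡ (Θ , sₑ) → m ≡ Θ → ∀ {t} → t ≤ Θ → place (stateAt W t) ≡ crit t 0 ys (place s₀)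
          tubed W refl refl refl {t} t≤ = let p , q = Ex.cutWalk W t≤ in
            tube ys ys-pos (trans ys-len (sym len₀)) p q (cong proj₂ (trans placeₑ (cong (λ m → crit m 0 ys (place s₀)) (sym (m+[n∸m]≡n t≤)))))

        onTube : ∀ {t} → t ≤ Θ → place (stateAt W t) ≡ crit t 0 ys (place s₀)
        onTube = tubed W u≡ v≡ m≡

        stepW : ∀ {t} → t < Θ → Step k M T rel (kind t) (stateAt W t) (stateAt W (suc t))
        stepW {t} t< = subst (λ θ → Step k M T rel (kind (θ + t)) (stateAt W t) (stateAt W (suc t))) (cong proj₁ u≡)
          (Ex.stateAt-step W (subst (t <_) (sym m≡) t<))

        private
          move-label : ∀ {κ s s′} → κ ≡ 2 → Step k M T rel κ s s′ → label s′ ≡ label s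
          move-label refl (move _) = refl

        keepLabel : ∀ {t} r → t + r ≤ Θ → (∀ j → j < r → kind (t + j) ≡ 2) → label (stateAt W (t + r)) ≡ label (stateAt W t)
        keepLabel {t} zero    _  _     = cong (λ t → label (stateAt W t)) (+-identityʳ t)
        keepLabel {t} (suc r) t≤ kinds = trans (cong (λ t → label (stateAt W t)) (+-suc t r))
          (trans (move-label (kinds r ≤-refl) (stepW (≤-trans (≤-reflexive (sym (+-suc t r))) t≤)))
            (keepLabel r (≤-trans (+-monoʳ-≤ t (n≤1+n r)) t≤) (λ j j<r → kinds j (m≤n⇒m≤1+n j<r))))

    criticalWalk : ∀ {μ ν ys g} → μ < k → ν < k → e μ ν ≡ true → ys ∈ˡ digitLists T c → g ∈ˡ digitLists P₁ (3 + c) →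
      ∃[ i ] i < L × (∃[ r ] r < L × (∃[ r′ ] r′ < L × (∃[ a ] ∃[ b ] rel μ ν a b ≡ true ×
        (keyA L c r μ ys (g ⊞ offset L c μ ν ys i) , a) ∈ˡ entries (tA i r) ×
        (keyB L c r′ ν ys (g ⊞ offset L c μ ν ys i) , b) ∈ˡ entries (tB i r′))))
    criticalWalk {μ} {ν} {ys} {g} μ<k ν<k edge ys∈ g∈ =
      assemble (near ≤-refl (lift (idx box₀) (idx boxₑ) (vtx-idx box₀) (vtx-idx boxₑ) whole))
      where
      open CritWalk μ ν μ<k ν<k edge ys ys∈ g g∈
      open Critical k M T L c P (<⇒≤ c>1) rel μ ν ys ys-len

      clock≡0 : Ex.clock (idx box₀) ≡ 0
      clock≡0 = cong proj₁ (vtx-idx box₀)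

      rounds≤ : ∀ {r} → r < L → r * c + c ≤ ℓ
      rounds≤ {r} r<L = ≤-trans (≤-reflexive (+-comm (r * c) c)) (≤-trans (*-monoˡ-≤ c r<L) (≤-reflexive (*-comm L c)))

      inStage : ∀ {i x} → i < L → x ≤ S → i * S + x ≤ Θ
      inStage {i} i<L x≤S = ≤-trans (+-monoʳ-≤ (i * S) x≤S) (≤-trans (≤-reflexive (+-comm (i * S) S)) (*-monoˡ-≤ S i<L))

      nextA : ∀ i r → tA i r + c ≡ tA i (suc r)
      nextA i r = trans (+-assoc (i * S) (suc (r * c)) c) (cong (λ z → i * S + suc z) (+-comm (r * c) c))

      nextB : ∀ i r → tB i r + c ≡ tB i (suc r)
      nextB i r = trans (+-assoc (i * S) _ c) (cong (i * S +_) (trans (+-assoc (suc ℓ) (suc (r * c)) c) (cong (λ z → suc ℓ + suc z) (+-comm (r * c) c))))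

      lateA : ∀ {i r} → i < L → r ≤ L → tA i r ≤ Θ
      lateA i<L r≤L = inStage i<L (≤-trans (s≤s (≤-trans (*-monoˡ-≤ c r≤L) (≤-reflexive (*-comm L c)))) (m≤m+n (suc ℓ) _))

      lateB : ∀ {i r} → i < L → r ≤ L → tB i r ≤ Θ
      lateB i<L r≤L = inStage i<L (+-monoʳ-≤ (suc ℓ) (≤-trans (s≤s (≤-trans (*-monoˡ-≤ c r≤L) (≤-reflexive (*-comm L c)))) (≤-reflexive (sym (+-identityʳ (suc ℓ))))))

      result : ∀ {l′ i r r′ zA zA′ zB zB′} (N : RWalk Hop (idx box₀) (idx boxₑ) l′) → i < L → r < L → r′ < L →
        Ch.Cut zA zA′ → readAt zA zA′ (tA i r) ≡ just (stateAt (proj₂ (Ex.expand N)) (tA i r ∸ Ex.clock (idx box₀)) , stateAt (proj₂ (Ex.expand N)) (tA i r + c ∸ Ex.clock (idx box₀))) →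
        Ch.Cut zB zB′ → readAt zB zB′ (tB i r′) ≡ just (stateAt (proj₂ (Ex.expand N)) (tB i r′ ∸ Ex.clock (idx box₀)) , stateAt (proj₂ (Ex.expand N)) (tB i r′ + c ∸ Ex.clock (idx box₀))) →
        ∃[ a ] ∃[ b ] rel μ ν a b ≡ true × (keyA L c r μ ys (h i) , a) ∈ˡ entries (tA i r) × (keyB L c r′ ν ys (h i) , b) ∈ˡ entries (tB i r′)
      result {i = i} {r} {r′} N i<L r<L r′<L cutA readA cutB readB =
        label (at′ (tA i r)) , label (at′ (tB i r′)) , related ,
        subst (λ κ → (κ , label (at′ (tA i r))) ∈ˡ entries (tA i r)) keyA≡ (entries⁺ (tA i r) cutA (trans readA (cong just (cong₂ _,_ refl₀ (trans refl₀ (cong at′ (nextA i r))))))) ,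
        subst (λ κ → (κ , label (at′ (tB i r′))) ∈ˡ entries (tB i r′)) keyB≡ (entries⁺ (tB i r′) cutB (trans readB (cong just (cong₂ _,_ refl₀ (trans refl₀ (cong at′ (nextB i r′)))))))
        where
        W = proj₂ (Ex.expand N)
        open Found W (vtx-idx box₀) (vtx-idx boxₑ)
        at′ : ℕ → State
        at′ t = stateAt W t
        refl₀ : ∀ {t} → stateAt W (t ∸ Ex.clock (idx box₀)) ≡ at′ t
        refl₀ {t} = cong (λ z → stateAt W (t ∸ z)) clock≡0
        plA : ∀ {r} → r ≤ L → place (at′ (tA i r)) ≡ iter r roundP (chooseP (iter i stageP (place s₀)))
        plA r≤L = trans (onTube (lateA i<L r≤L)) (critA {i} (place s₀) i<L r≤L len₀)
        plB : ∀ {r} → r ≤ L → place (at′ (tB i r)) ≡ iter r roundP (constrainP (iter L roundP (chooseP (iter i stageP (place s₀)))))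
        plB r≤L = trans (onTube (lateB i<L r≤L)) (critB {i} (place s₀) i<L r≤L len₀)
        keyA≡ : (proj₁ (at′ (tA i r)) , position (place (at′ (tA i r))) , position (place (at′ (tA i (suc r))))) ≡ keyA L c r μ ys (h i)
        keyA≡ = cong₂ _,_ (trans (cong proj₁ (plA (<⇒≤ r<L))) (round-w r (chooseP (iter i stageP (place s₀)))))
          (cong₂ _,_ (trans (cong position (plA (<⇒≤ r<L))) (posA i r)) (trans (cong position (plA r<L)) (posA i (suc r))))
        keyB≡ : (proj₁ (at′ (tB i r′)) , position (place (at′ (tB i r′))) , position (place (at′ (tB i (suc r′))))) ≡ keyB L c r′ ν ys (h i)
        keyB≡ = cong₂ _,_ (trans (cong proj₁ (plB (<⇒≤ r′<L))) (round-w r′ (constrainP (iter L roundP (chooseP (iter i stageP (place s₀)))))))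
          (cong₂ _,_ (trans (cong position (plB (<⇒≤ r′<L))) (posB i r′)) (trans (cong position (plB r′<L)) (posB i (suc r′))))

        mid = i * S + suc ℓ
        mid< : mid < Θ
        mid< = ≤-trans (≤-reflexive (sym (+-suc (i * S) (suc ℓ)))) (inStage i<L (≤-trans (≤-reflexive (+-comm 1 (suc ℓ))) (+-monoʳ-≤ (suc ℓ) (s≤s z≤n))))
        restA : tA i r + (ℓ ∸ r * c) ≡ mid
        restA = trans (+-assoc (i * S) (suc (r * c)) _) (cong (λ z → i * S + suc z) (m+[n∸m]≡n (≤-trans (m≤m+n (r * c) c) (rounds≤ r<L))))
        labelA : label (at′ mid) ≡ label (at′ (tA i r))
        labelA = trans (cong (label ∘ at′) (sym restA)) (keepLabel (ℓ ∸ r * c) (≤-trans (≤-reflexive restA) (<⇒≤ mid<))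
          (λ j j< → trans (cong kind (trans (+-assoc (i * S) (suc (r * c)) j) refl)) (kindA′ i<L (≤-trans (≤-reflexive (sym (+-suc (r * c) j)))
            (≤-trans (+-monoʳ-≤ (r * c) j<) (≤-reflexive (m+[n∸m]≡n (≤-trans (m≤m+n (r * c) c) (rounds≤ r<L)))))))))
        tB₀ : tB i 0 ≡ suc mid
        tB₀ = trans (cong (i * S +_) (+-comm (suc ℓ) 1)) (+-suc (i * S) (suc ℓ))
        restB : suc mid + r′ * c ≡ tB i r′
        restB = trans (cong (_+ r′ * c) (sym tB₀)) (trans (+-assoc (i * S) _ (r′ * c)) (cong (i * S +_) (+-assoc (suc ℓ) 1 (r′ * c))))
        labelB : label (at′ (tB i r′)) ≡ label (at′ (suc mid))
        labelB = trans (cong (label ∘ at′) (sym restB)) (keepLabel (r′ * c) (≤-trans (≤-reflexive restB) (lateB i<L (<⇒≤ r′<L)))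
          (λ j j< → trans (cong kind (trans (cong (_+ j) (sym tB₀)) (trans (+-assoc (i * S) _ j) (cong (i * S +_) (+-assoc (suc ℓ) 1 j)))))
            (kindB′ i<L (<-≤-trans j< (≤-trans (m≤m+n (r′ * c) c) (rounds≤ r′<L))))))
        wA : proj₁ (at′ mid) ≡ μ
        wA = trans (cong (λ z → proj₁ (at′ (i * S + suc z))) (*-comm c L))
          (trans (cong proj₁ (plA ≤-refl)) (round-w L (chooseP (iter i stageP (place s₀)))))
        wB : proj₁ (at′ (suc mid)) ≡ ν
        wB = trans (cong (λ z → proj₁ (at′ z)) (sym tB₀)) (cong proj₁ (plB z≤n))

        related : rel μ ν (label (at′ (tA i r))) (label (at′ (tB i r′))) ≡ true
        -- Moves preserve labels: the label read in the first half is still present when the element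
        -- of B is chosen, and the label read in the second half is the one chosen at that moment.
        -- The constraint checked by this step therefore relates the two.
        related = subst₂ (λ a b → rel μ ν a b ≡ true) labelA (sym labelB)
          (subst₂ (λ w v → rel w v (label (at′ mid)) (label (at′ (suc mid))) ≡ true) wA wB (constraint (kindB i<L) (stepW mid<)))

      assemble : ∃[ l′ ] l′ < L * L × RWalk Hop (idx box₀) (idx boxₑ) l′ →
        ∃[ i ] i < L × (∃[ r ] r < L × (∃[ r′ ] r′ < L × (∃[ a ] ∃[ b ] rel μ ν a b ≡ true ×
          (keyA L c r μ ys (h i) , a) ∈ˡ entries (tA i r) × (keyB L c r′ ν ys (h i) , b) ∈ˡ entries (tB i r′))))
      assemble (l′ , l′< , N) = fast (Ex.fastStage N clock≡0 (cong proj₁ (vtx-idx boxₑ)) l′<)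
        where
        fast : ∃[ i ] i < L × (∃[ r ] r < L × Ex.Jumped N (tA i r)) × (∃[ r ] r < L × Ex.Jumped N (tB i r)) → _
        fast (i , i< , (r , r< , zA , zA′ , cutA , readA) , (r′ , r′< , zB , zB′ , cutB , readB)) =
          i , i< , r , r< , r′ , r′< , result {l′} {i} {r} {r′} {zA} {zA′} {zB} {zB′} N i< r< r′< cutA readA cutB readB

  module _ (τ X Δ : ℕ)
    (regularA : ∀ {μ} → μ < k → ΣL (upTo k) (λ ν → bit (e μ ν)) ≡ Δ)
    (regularB : ∀ {ν} → ν < k → ΣL (upTo k) (λ μ → bit (e μ ν)) ≡ Δ)
    (sound : ∀ (ψ φ : ℕ → ℕ) → X * ΣL (upTo k) (λ μ → ΣL (upTo k) (λ ν → bit (e μ ν) * bit (rel μ ν (ψ μ) (φ ν)))) ≤ k * Δ)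
    where

    counted : X * (τ * (k * Δ * (T ^ c * P₁ ^ (3 + c)))) ≤
      L * (L * L) * (X * (2 * (Δ * cap)) + τ * (T ^ c * (P ^ (3 + c) * (τ * (τ * (k * Δ))))))
    counted = Counting.count k T c P₁ P L τ X Δ cap rel e (λ i r → entries (tA i r)) (λ i r → entries (tB i r))
      (λ i r → entries-length (tA i r)) (λ i r → entries-length (tB i r)) room criticalWalk regularA regularB sound

-- From a labeling to a set of jumps of small diameter

relabel : ℕ → State → State
relabel a′ (w , a , rest) = w , a′ , rest

module YesCase (k M T L c P : ℕ) (c>0 : 0 < c) (0<T : 0 < T) (0<L : 0 < L) (rel : ℕ → ℕ → ℕ → ℕ → Bool) (ψ φ : ℕ → ℕ)
  (ψ<M : ∀ {μ} → μ < k → ψ μ < M) (φ<M : ∀ {ν} → ν < k → φ ν < M)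
  (complete : ∀ {μ ν a b} → μ < k → ν < k → rel μ ν a b ≡ true → rel μ ν (ψ μ) (φ ν) ≡ true) where
  open Paths k M T L c P c>0 rel

  -- These contain every displacement of a block: `L` rounds add less than `L * T` to a digit, `ℓ`
  -- squares sum to less than `ℓ * (T * T)`, and the counters stay. Pairs that leave the vertex set
  -- or are not joined by a walk are sorted out when the solution is formed.
  shifts : List (List ℕ)
  shifts = concatMap (λ x → concatMap (λ ds → (x ∷ 0 ∷ 0 ∷ ds) ∷ []) (digitLists (L * T) c)) (upTo (ℓ * (T * T)))

  stateOf : ℕ → ℕ → List ℕ → State
  stateOf w a g = w , a , headℕ g , headℕ (tailL g) , headℕ (tailL (tailL g)) , tailL (tailL (tailL g))

  jumpsFrom : (ℕ → ℕ) → ℕ → List (Vert × Vert)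
  jumpsFrom lab t = concatMap (λ w → concatMap (λ g → concatMap (λ δ →
    ((t , stateOf w (lab w) g) , (t + ℓ , stateOf w (lab w) (g ⊞ δ))) ∷ []) shifts) (digitLists P (3 + c))) (upTo k)

  jumps : List (Vert × Vert)
  jumps = concatMap (λ i → jumpsFrom ψ (suc (i * S)) ++ jumpsFrom φ (suc (i * S + suc ℓ))) (upTo L)

  jumps-length : length jumps ≡ 2 * (L * (k * (P ^ (3 + c) * ((L * T) ^ c * (ℓ * (T * T))))))
  jumps-length = trans (length-for _ (K + K) L (λ i → trans (length-++ (jumpsFrom ψ (suc (i * S)))) (cong₂ _+_ (from ψ (suc (i * S))) (from φ (suc (i * S + suc ℓ)))))) (ring L K)
    where
    K = k * (P ^ (3 + c) * ((L * T) ^ c * (ℓ * (T * T))))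
    ring : ∀ L K → L * (K + K) ≡ 2 * (L * K)
    ring = solve-∀
    shifts-length : length shifts ≡ (L * T) ^ c * (ℓ * (T * T))
    shifts-length = trans (length-for _ ((L * T) ^ c) (ℓ * (T * T)) (λ x → trans (length-concatMap _ 1 (λ _ → refl) (digitLists (L * T) c))
      (trans (*-identityʳ _) (digitLists-length (L * T) c)))) (*-comm (ℓ * (T * T)) _)
    from : ∀ lab t → length (jumpsFrom lab t) ≡ K
    from lab t = length-for (λ w → concatMap (λ g → concatMap (λ δ → ((t , stateOf w (lab w) g) , (t + ℓ , stateOf w (lab w) (g ⊞ δ))) ∷ []) shifts) (digitLists P (3 + c))) _ k (λ w →
      trans (length-concatMap (λ g → concatMap (λ δ → ((t , stateOf w (lab w) g) , (t + ℓ , stateOf w (lab w) (g ⊞ δ))) ∷ []) shifts) _ (λ g →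
        trans (length-concatMap (λ δ → ((t , stateOf w (lab w) g) , (t + ℓ , stateOf w (lab w) (g ⊞ δ))) ∷ []) 1 (λ _ → refl) shifts)
          (trans (*-identityʳ _) shifts-length)) (digitLists P (3 + c)))
        (cong (_* ((L * T) ^ c * (ℓ * (T * T)))) (digitLists-length P (3 + c))))

  Jump : Vert → Vert → Set
  Jump u v = (u , v) ∈ˡ jumps × ∃[ l ] RWalk VEdge u v l

  Hop : Vert → Vert → Set
  Hop u v = Box u × Box v × (VEdge u v ⊎ Jump u v)

  private
    moveStep : ∀ {κ w a sq gu gv ds s′} → κ ≡ 2 → Step k M T rel κ (w , a , sq , gu , gv , ds) s′ →
      ∃[ x ] x < T × s′ ≡ (w , a , sq + x * x , gu , gv , tailL ds ++ (headℕ ds + x ∷ []))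
    moveStep refl (move x<T) = _ , x<T , refl

    sweep : ∀ {m θ θ′ w a sq gu gv s′} ds₁ ds₂ → length ds₁ ≡ m → (∀ j → j < m → kind (θ + j) ≡ 2) →
      RWalk VEdge (θ , w , a , sq , gu , gv , ds₁ ++ ds₂) (θ′ , s′) m →
      ∃[ xs ] length xs ≡ m × All (_< T) xs × s′ ≡ (w , a , sq + normSq xs , gu , gv , ds₂ ++ (ds₁ ⊞ xs))
    sweep {zero} {sq = sq} [] ds₂ _ _ done = [] , refl , [] , cong₂ (λ a b → _ , _ , a , _ , _ , b) (sym (+-identityʳ sq)) (sym (++-identityʳ ds₂))
    sweep {suc m} {θ} {θ′} {w} {a} {sq} {gu} {gv} {s′} (d ∷ ds₁) ds₂ len kinds (step (at st) walk)
      with moveStep (trans (cong kind (sym (+-identityʳ θ))) (kinds 0 (s≤s z≤n))) st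
    ... | x , x<T , refl
      with sweep {m} {suc θ} {θ′} {w} {a} {sq + x * x} {gu} {gv} {s′} ds₁ (ds₂ ++ (d + x ∷ [])) (suc-injective len)
             (λ j j<m → trans (cong kind (sym (+-suc θ j))) (kinds (suc j) (s≤s j<m)))
             (subst (λ ds → RWalk VEdge (suc θ , w , a , sq + x * x , gu , gv , ds) (θ′ , s′) m) (++-assoc ds₁ ds₂ (d + x ∷ [])) walk)
    ...   | xs , xs-len , xs<T , eq = x ∷ xs , cong suc xs-len , x<T ∷ xs<T ,
      trans eq (cong₂ (λ a′ b → w , a , a′ , gu , gv , b) (+-assoc sq (x * x) (normSq xs)) (++-assoc ds₂ (d + x ∷ []) (ds₁ ⊞ xs)))

    normSq-< : ∀ xs → 0 < length xs → All (_< T) xs → normSq xs < length xs * (T * T)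
    normSq-< (x ∷ [])          _ (x<T ∷ [])  = <-≤-trans (≤-<-trans (≤-reflexive (+-identityʳ (x * x))) (*-mono-< x<T x<T)) (m≤m+n _ _)
    normSq-< (x ∷ xs@(_ ∷ _)) _ (x<T ∷ xs<T) = +-mono-<  (*-mono-< x<T x<T) (normSq-< xs (s≤s z≤n) xs<T)

    sum-< : ∀ {a b} xs zs → All (_< a) xs → All (_< b) zs → All (_< a + b) (xs ⊞ zs)
    sum-< []       _        _          _          = []
    sum-< (_ ∷ _)  []       _          _          = []
    sum-< (x ∷ xs) (z ∷ zs) (x< ∷ xs<) (z< ∷ zs<) = +-mono-< x< z< ∷ sum-< xs zs xs< zs<

    Displaced : ℕ → State → State → Set
    Displaced r (w , a , sq , gu , gv , ds) s′ = ∃[ Q ] ∃[ zs ] Q < r * (c * (T * T)) × length zs ≡ c × All (_< r * T) zs ×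
      s′ ≡ (w , a , sq + Q , gu , gv , ds ⊞ zs)

    rounds : ∀ r {θ θ′ w a sq gu gv ds s′} → 0 < r → length ds ≡ c → (∀ j → j < r * c → kind (θ + j) ≡ 2) →
      RWalk VEdge (θ , w , a , sq , gu , gv , ds) (θ′ , s′) (r * c) → Displaced r (w , a , sq , gu , gv , ds) s′
    rounds (suc r) {θ} {θ′} {w} {a} {sq} {gu} {gv} {ds} {s′} _ len kinds walk with splitAt c walk
    ... | (θ₁ , s₁) , walk₁ , walk₂ with walk-time walk₁
    ...   | refl with sweep ds [] len (λ j j<c → kinds j (≤-trans j<c (m≤m+n c _)))
                      (subst (λ z → RWalk VEdge (θ , w , a , sq , gu , gv , z) (θ + c , s₁) c) (sym (++-identityʳ ds)) walk₁)
    ...     | xs , xs-len , xs<T , refl = finish r walk₂ kinds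
      where
      xs-sq : normSq xs < c * (T * T)
      xs-sq = subst (λ m → normSq xs < m * (T * T)) xs-len (normSq-< xs (subst (0 <_) (sym xs-len) c>0) xs<T)
      ds₁-len : length (ds ⊞ xs) ≡ c
      ds₁-len = ⊞-len ds xs len xs-len
      finish : ∀ r → RWalk VEdge (θ + c , w , a , sq + normSq xs , gu , gv , ds ⊞ xs) (θ′ , s′) (r * c) →
        (∀ j → j < c + r * c → kind (θ + j) ≡ 2) → Displaced (suc r) (w , a , sq , gu , gv , ds) s′
      finish zero    done _ = normSq xs , xs , subst (normSq xs <_) (sym (+-identityʳ _)) xs-sq , xs-len , subst (λ m → All (_< m) xs) (sym (+-identityʳ T)) xs<T , refl
      finish (suc r) walk₂ kinds =
        let Q , zs , Q< , zs-len , zs< , eq = rounds (suc r) {θ + c} (s≤s z≤n) ds₁-len (λ j j< → trans (cong kind (+-assoc θ c j)) (kinds (c + j) (+-monoʳ-< c j<))) walk₂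
        in normSq xs + Q , xs ⊞ zs , +-mono-< xs-sq Q< , ⊞-len xs zs xs-len zs-len , sum-< xs zs xs<T zs< ,
           trans eq (cong₂ (λ a′ b → w , a , a′ , gu , gv , b) (+-assoc sq (normSq xs) Q) (⊞-assoc ds xs zs))

    relabelWalk : ∀ a′ m {θ θ′ s s′} → (∀ j → j < m → kind (θ + j) ≡ 2) → RWalk VEdge (θ , s) (θ′ , s′) m →
      RWalk VEdge (θ , relabel a′ s) (θ′ , relabel a′ s′) m
    relabelWalk a′ zero    kinds done = done
    relabelWalk a′ (suc m) {θ} kinds (step (at st) walk) =
      step (at (again (trans (cong kind (sym (+-identityʳ θ))) (kinds 0 (s≤s z≤n))) st))
        (relabelWalk a′ m (λ j j<m → trans (cong kind (sym (+-suc θ j))) (kinds (suc j) (s≤s j<m))) walk)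
      where
      again : ∀ {κ s s′} → κ ≡ 2 → Step k M T rel κ s s′ → Step k M T rel κ (relabel a′ s) (relabel a′ s′)
      again refl (move x<T) = move x<T

    ∈-shifts : ∀ {Q zs} → Q < ℓ * (T * T) → length zs ≡ c → All (_< L * T) zs → (Q ∷ 0 ∷ 0 ∷ zs) ∈ˡ shifts
    ∈-shifts {Q} {zs} Q< len zs< = ∈-concatMap⁺ _ (∈-upTo⁺ Q<) (∈-concatMap⁺ _ (subst (λ m → zs ∈ˡ digitLists (L * T) m) len (∈-digitLists⁺ zs zs<)) (here refl))

    -- A half-stage of moves can be replaced by a jump between vertices with the
    -- chosen label.
    jump : ∀ {t s s′} (lab : ℕ → ℕ) → (∀ {u v} → (u , v) ∈ˡ jumpsFrom lab t → (u , v) ∈ˡ jumps) →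
      (∀ j → j < ℓ → kind (t + j) ≡ 2) → Fwd s → Bwd s → RWalk VEdge (t , s) (t + ℓ , s′) ℓ →
      proj₁ s′ ≡ proj₁ s × Jump (t , relabel (lab (proj₁ s)) s) (t + ℓ , relabel (lab (proj₁ s)) s′)
    jump {t} {s@(w , a , sq , gu , gv , ds)} {s′} lab ⊆jumps kinds (w<k , _ , len) (sq< , gu< , gv< , ds<) walk
      with rounds L {t} 0<L len (λ j j< → kinds j (subst (j <_) (*-comm L c) j<)) (subst (RWalk VEdge (t , s) (t + ℓ , s′)) (*-comm c L) walk)
    ... | Q , zs , Q< , zs-len , zs< , refl = refl ,
      subst₂ (λ x y → ((t , w , lab w , sq , gu , gv , ds) , (t + ℓ , w , lab w , sq + Q , x , y , ds ⊞ zs)) ∈ˡ jumps) (+-identityʳ gu) (+-identityʳ gv)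
        (⊆jumps (∈-concatMap⁺ _ (∈-upTo⁺ w<k) (∈-concatMap⁺ _ (subst (λ m → (sq ∷ gu ∷ gv ∷ ds) ∈ˡ digitLists P (3 + m)) len
          (∈-digitLists⁺ (sq ∷ gu ∷ gv ∷ ds) (sq< ∷ gu< ∷ gv< ∷ ds<)))
          (∈-concatMap⁺ _ (∈-shifts (subst (Q <_) (ring L c (T * T)) Q<) zs-len zs<) (here refl))))) ,
      ℓ , relabelWalk (lab w) ℓ kinds walk
      where
      ring : ∀ L c x → L * (c * x) ≡ c * L * x
      ring = solve-∀

    ⊆A : ∀ {i u v} → i < L → (u , v) ∈ˡ jumpsFrom ψ (suc (i * S)) → (u , v) ∈ˡ jumps
    ⊆A i<L h = ∈-concatMap⁺ _ (∈-upTo⁺ i<L) (∈-++⁺ˡ h)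

    ⊆B : ∀ {i u v} → i < L → (u , v) ∈ˡ jumpsFrom φ (suc (i * S + suc ℓ)) → (u , v) ∈ˡ jumps
    ⊆B {i} i<L h = ∈-concatMap⁺ _ (∈-upTo⁺ i<L) (∈-++⁺ʳ (jumpsFrom ψ (suc (i * S))) h)

    positionOf : State → List ℕ
    positionOf s = position (place s)

    -- A step of kind 0 takes nothing but the position from its source. Stages can thus be replaced
    -- one after another although their final labels change.
    rechoose : ∀ {κ s t s′} a′ → κ ≡ 0 → positionOf t ≡ positionOf s → a′ < M → Step k M T rel κ s s′ → Step k M T rel κ t (relabel a′ s′)
    rechoose {s = _ , _ , _} {_ , _ , _} a′ refl refl a′<M (choose u<k _) = choose u<k a′<M

    chosen : ∀ {κ s s′} → κ ≡ 0 → Step k M T rel κ s s′ → proj₁ s′ < k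
    chosen refl (choose u<k _) = u<k

    reconstrain : ∀ {κ s s′} → κ ≡ 1 → proj₁ s < k → Step k M T rel κ s s′ →
      proj₁ s′ < k × Step k M T rel κ (relabel (ψ (proj₁ s)) s) (relabel (φ (proj₁ s′)) s′)
    reconstrain refl w<k (constrain v<k _ R) = v<k , constrain v<k (φ<M v<k) (complete w<k v<k R)

    relabel-box : ∀ {θ s a′} → a′ < M → Box (θ , s) → Box (θ , relabel a′ s)
    relabel-box a′<M (θ≤ , (w< , _ , len) , bwd) = θ≤ , (w< , a′<M , len) , bwd

  fwdWalk : ∀ {θ s θ′ s′ l} → RWalk VEdge (θ , s) (θ′ , s′) l → Fwd s → Fwd s′
  fwdWalk done             f = f
  fwdWalk (step (at st) w) f = fwdWalk w (step-fwd st f)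

  midBox : ∀ {u x v l l′} → RWalk VEdge u x l → RWalk VEdge x v l′ → Box u → Box v → Box x
  midBox w w′ (_ , f , _) (θ≤ , _ , b) = ≤-trans (≤-trans (m≤m+n _ _) (≤-reflexive (sym (walk-time w′)))) θ≤ , fwdWalk w f , walk-bwd w′ b

  plain : ∀ {u v l} → RWalk VEdge u v l → Box u → Box v → RWalk Hop u v l
  plain done                 bu bv = done
  plain (step e w) bu bv = let bx = midBox (step e done) w bu bv in step (bu , bx , inj₁ e) (plain w bx bv)

  private
    S≡ : S ≡ suc (ℓ + suc ℓ)
    S≡ = cong (suc ℓ +_) (+-identityʳ (suc ℓ))

    -- The four hops are the two choices, made with the labels of the labeling, each followed by a
    -- jump over its block. The vertices chosen are those of the given walk, so the position at the
    -- end agrees while the label may differ.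
    oneStage : ∀ {i s s′ t} → i < L → RWalk VEdge (i * S , s) (suc i * S , s′) S → Box (i * S , s) → Box (suc i * S , s′) →
      Box (i * S , t) → positionOf t ≡ positionOf s →
      ∃[ t′ ] RWalk Hop (i * S , t) (suc i * S , t′) 4 × Box (suc i * S , t′) × positionOf t′ ≡ positionOf s′
    oneStage {i} {s} {s′} {t} i<L walk bs bs′ bt pos = go (subst (RWalk VEdge (i * S , s) (suc i * S , s′)) S≡ walk)
      where
      kA : ∀ j → j < ℓ → kind (suc (i * S) + j) ≡ 2
      kA j j<ℓ = trans (cong kind (sym (+-suc (i * S) j))) (kindA′ i<L j<ℓ)
      kB : ∀ j → j < ℓ → kind (suc (i * S + suc ℓ) + j) ≡ 2
      kB j j<ℓ = trans (cong kind (trans (sym (+-suc (i * S + suc ℓ) j)) (+-assoc (i * S) (suc ℓ) (suc j)))) (kindB′ i<L j<ℓ)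
      mid≡ : suc (i * S) + ℓ ≡ i * S + suc ℓ
      mid≡ = sym (+-suc (i * S) ℓ)
      end≡ : suc (i * S + suc ℓ) + ℓ ≡ suc i * S
      end≡ = trans (cong suc (+-assoc (i * S) (suc ℓ) ℓ)) (trans (sym (+-suc (i * S) (suc ℓ + ℓ))) (trans (cong (i * S +_) (trans (cong suc (sym (+-suc ℓ ℓ))) (sym S≡))) (+-comm (i * S) S)))
      go : RWalk VEdge (i * S , s) (suc i * S , s′) (suc (ℓ + suc ℓ)) →
        ∃[ t′ ] RWalk Hop (i * S , t) (suc i * S , t′) 4 × Box (suc i * S , t′) × positionOf t′ ≡ positionOf s′
      go (step (at {s′ = s₁} st₁) w₁) with splitAt ℓ w₁
      ... | (θ₂ , s₂) , w₂ , w₃ with trans (walk-time w₂) mid≡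
      ...   | refl with w₃
      ...     | step (at {s′ = s₃} st₃) w₄ =
        let b₁ = midBox (step (at st₁) done) w₁ bs bs′
            b₂ = midBox w₂ w₃ b₁ bs′
            b₃ = midBox (step (at st₃) done) w₄ b₂ bs′
            μ<k = chosen (kindA i<L) st₁
            w≡ , J₁ = jump {suc (i * S)} {s₁} {s₂} ψ (⊆A i<L) kA (proj₁ (proj₂ b₁)) (proj₂ (proj₂ b₁))
                        (subst (λ θ → RWalk VEdge (suc (i * S) , s₁) (θ , s₂) ℓ) (sym mid≡) w₂)
            ν<k , st₃′ = reconstrain (kindB i<L) (subst (_< k) (sym w≡) μ<k) st₃
            w≡′ , J₂ = jump {suc (i * S + suc ℓ)} {s₃} {s′} φ (⊆B i<L) kB (proj₁ (proj₂ b₃)) (proj₂ (proj₂ b₃))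
                        (subst (λ θ → RWalk VEdge (suc (i * S + suc ℓ) , s₃) (θ , s′) ℓ) (sym end≡) w₄)
            t₁ = relabel (ψ (proj₁ s₁)) s₁
            t₂ = relabel (ψ (proj₁ s₁)) s₂
            t₃ = relabel (φ (proj₁ s₃)) s₃
            t₄ = relabel (φ (proj₁ s₃)) s′
            c₁ = relabel-box {suc (i * S)} {s₁} (ψ<M μ<k) b₁
            c₂ = relabel-box {i * S + suc ℓ} {s₂} (ψ<M μ<k) b₂
            c₃ = relabel-box {suc (i * S + suc ℓ)} {s₃} (φ<M ν<k) b₃
            c₄ = relabel-box {suc i * S} {s′} (φ<M ν<k) bs′
        in t₄ ,
           step (bt , c₁ , inj₁ (at (rechoose (ψ (proj₁ s₁)) (kindA i<L) pos (ψ<M μ<k) st₁)))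
           (step (c₁ , c₂ , inj₂ (subst (λ θ → Jump (suc (i * S) , t₁) (θ , t₂)) mid≡ J₁))
           (step (c₂ , c₃ , inj₁ (at (subst (λ w → Step k M T rel (kind (i * S + suc ℓ)) (relabel (ψ w) s₂) t₃) w≡ st₃′)))
           (step (c₃ , c₄ , inj₂ (subst (λ θ → Jump (suc (i * S + suc ℓ) , t₃) (θ , t₄)) end≡ J₂)) done))) , c₄ , refl

    stages : ∀ j {i s s′ t} → i + j ≤ L → RWalk VEdge (i * S , s) ((i + j) * S , s′) (j * S) → Box (i * S , s) → Box ((i + j) * S , s′) →
      Box (i * S , t) → positionOf t ≡ positionOf s →
      ∃[ t′ ] RWalk Hop (i * S , t) ((i + j) * S , t′) (j * 4) × Box ((i + j) * S , t′) × positionOf t′ ≡ positionOf s′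
    stages zero    {i} {s} {s′} {t} _ walk bs bs′ bt pos with i + 0 | +-identityʳ i
    stages zero    {i} {t = t} _ done bs bs′ bt pos | _ | refl = t , done , bt , pos
    stages (suc j) {i} {s} {s′} {t} i+j≤L walk bs bs′ bt pos with splitAt S walk
    ... | (θ₁ , s₁) , w₁ , w₂ with trans (walk-time w₁) (+-comm (i * S) S)
    ...   | refl =
      let i<L = ≤-trans (≤-reflexive (+-comm 1 i)) (≤-trans (+-monoʳ-≤ i (s≤s z≤n)) i+j≤L)
          b₁ = midBox w₁ w₂ bs bs′
          t₁ , h₁ , bt₁ , pos₁ = oneStage {i} {s} {s₁} {t} i<L w₁ bs b₁ bt pos
          t₂ , h₂ , bt₂ , pos₂ = stages j {suc i} {s₁} {s′} {t₁} (≤-trans (≤-reflexive (sym (+-suc i j))) i+j≤L)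
            (subst (λ z → RWalk VEdge (suc i * S , s₁) (z * S , s′) (j * S)) (+-suc i j) w₂) b₁ (subst (λ z → Box (z * S , s′)) (+-suc i j) bs′) bt₁ pos₁
      in t₂ , h₁ ⋈ subst (λ z → RWalk Hop (suc i * S , t₁) (z * S , t₂) (j * 4)) (sym (+-suc i j)) h₂ ,
         subst (λ z → Box (z * S , t₂)) (sym (+-suc i j)) bt₂ , pos₂

    restart : ∀ {i s t v l} → i < L → RWalk VEdge (i * S , s) v (suc l) → Box (i * S , s) → Box v → Box (i * S , t) → positionOf t ≡ positionOf s →
      RWalk Hop (i * S , t) v (suc l)
    restart {i} {s} {t} i<L (step (at {s′ = s₁} st) w) bs bv bt pos =
      let b₁ = midBox (step (at st) done) w bs bv
          st′ = rechoose (label s₁) (kindA i<L) pos (proj₁ (proj₂ (proj₁ (proj₂ b₁)))) st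
      in step (bt , b₁ , inj₁ (at st′)) (plain w b₁ bv)

    instance
      S≢0 : NonZero S
      S≢0 = _

  -- At most `S` edges lead to the next stage boundary, and fewer than `2 * S` edges remain at the
  -- end, where one entire stage is held back. Its first step can pick the original label again, so
  -- the new walk ends in exactly the prescribed state. All stages between cost four hops each.
  nearby : ∀ {u v l} → RWalk VEdge u v l → Box u → Box v → ∃[ l′ ] l′ ≤ 3 * S + 4 * L × RWalk Hop u v l′
  nearby {θ , s} {θ′ , s′} {l} walk bu bv with suc (suc (θ / S)) ≤? θ′ / S
  ... | no  far = l , few , plain walk bu bv
    where
    few : l ≤ 3 * S + 4 * L
    few = +-cancelˡ-≤ θ l _ (begin
      θ + l                         ≡⟨ walk-time walk ⟨
      θ′                            ≡⟨ m≡m%n+[m/n]*n θ′ S ⟩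
      θ′ % S + θ′ / S * S           ≤⟨ +-mono-≤ (<⇒≤ (m%n<n θ′ S)) (*-monoˡ-≤ S (≤-pred (≰⇒> far))) ⟩
      S + (S + θ / S * S)           ≤⟨ +-monoʳ-≤ S (+-monoʳ-≤ S (≤-trans (m≤n+m _ (θ % S)) (≤-reflexive (sym (m≡m%n+[m/n]*n θ S))))) ⟩
      S + (S + θ)                   ≤⟨ m≤m+n _ (S + 4 * L) ⟩
      S + (S + θ) + (S + 4 * L)     ≡⟨ ring S θ (4 * L) ⟩
      θ + (3 * S + 4 * L)           ∎)
      where
      open ≤-Reasoning
      ring : ∀ S θ x → S + (S + θ) + (S + x) ≡ θ + (3 * S + x)
      ring = solve-∀
  ... | yes i+1≤ = build (m≤n⇒∃[o]m+o≡n i+1≤)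
    where
    i = suc (θ / S)
    pre = i * S ∸ θ
    θ≤ : θ ≤ i * S
    θ≤ = ≤-trans (≤-reflexive (m≡m%n+[m/n]*n θ S)) (+-monoˡ-≤ (θ / S * S) (<⇒≤ (m%n<n θ S)))
    pre≤ : pre ≤ S
    pre≤ = ≤-trans (∸-monoʳ-≤ (i * S) (≤-trans (m≤n+m (θ / S * S) (θ % S)) (≤-reflexive (sym (m≡m%n+[m/n]*n θ S))))) (≤-reflexive (m+n∸n≡m S (θ / S * S)))
    build : ∃[ j ] suc i + j ≡ θ′ / S → ∃[ l′ ] l′ ≤ 3 * S + 4 * L × RWalk Hop (θ , s) (θ′ , s′) l′
    build (j , j≡) = glue (splitAt pre (subst (RWalk VEdge (θ , s) (θ′ , s′)) l≡ walk))
      where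
      open ≤-Reasoning
      i′ = i + j
      rest = θ′ % S
      θ′≡ : θ′ ≡ S + rest + i′ * S
      θ′≡ = begin-equality
        θ′                     ≡⟨ m≡m%n+[m/n]*n θ′ S ⟩
        rest + θ′ / S * S      ≡⟨ cong (λ z → rest + z * S) j≡ ⟨
        rest + (S + i′ * S)    ≡⟨ ring rest S (i′ * S) ⟩
        S + rest + i′ * S      ∎
        where
        ring : ∀ a b c → a + (b + c) ≡ b + a + c
        ring = solve-∀
      i′<L : i′ < L
      i′<L = *-cancelʳ-≤ (suc i′) L S (begin
        S + i′ * S         ≤⟨ +-monoˡ-≤ (i′ * S) (m≤m+n S rest) ⟩
        S + rest + i′ * S  ≡⟨ θ′≡ ⟨
        θ′                 ≤⟨ proj₁ bv ⟩
        L * S              ∎)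
      l≡ : l ≡ pre + (j * S + (S + rest))
      l≡ = +-cancelˡ-≡ θ l _ (begin-equality
        θ + l                                  ≡⟨ walk-time walk ⟨
        θ′                                     ≡⟨ θ′≡ ⟩
        S + rest + i′ * S                      ≡⟨ cong (S + rest +_) (*-distribʳ-+ S i j) ⟩
        S + rest + (i * S + j * S)             ≡⟨ cong (λ z → S + rest + (z + j * S)) (m+[n∸m]≡n θ≤) ⟨
        S + rest + (θ + pre + j * S)           ≡⟨ ring (S + rest) θ pre (j * S) ⟩
        θ + (pre + (j * S + (S + rest)))       ∎)
        where
        ring : ∀ a b c d → a + (b + c + d) ≡ b + (c + (d + a))
        ring = solve-∀
      glue : ∃[ x ] RWalk VEdge (θ , s) x pre × RWalk VEdge x (θ′ , s′) (j * S + (S + rest)) → ∃[ l′ ] l′ ≤ 3 * S + 4 * L × RWalk Hop (θ , s) (θ′ , s′) l′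
      glue ((θ₁ , s₁) , w₁ , w₂) with trans (walk-time w₁) (m+[n∸m]≡n θ≤) | splitAt (j * S) w₂
      ... | refl | (θ₂ , s₂) , w₃ , w₄ with trans (walk-time w₃) (sym (*-distribʳ-+ S i j))
      ...   | refl =
        let b₁ = midBox w₁ w₂ bu bv
            b₂ = midBox w₃ w₄ b₁ bv
            t , h , bt , pos = stages j {i} {s₁} {s₂} {s₁} (<⇒≤ i′<L) w₃ b₁ b₂ b₁ refl
        in pre + (j * 4 + (S + rest)) , within , (plain w₁ bu b₁ ⋈ (h ⋈ restart {i′} {s₂} {t} i′<L w₄ b₂ bv bt pos))
        where
        within : pre + (j * 4 + (S + rest)) ≤ 3 * S + 4 * L
        within = begin
          pre + (j * 4 + (S + rest))   ≤⟨ +-mono-≤ pre≤ (+-mono-≤ (*-monoˡ-≤ 4 (≤-trans (m≤n+m j i) (<⇒≤ i′<L))) (+-monoʳ-≤ S (<⇒≤ (m%n<n θ′ S)))) ⟩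
          S + (L * 4 + (S + S))        ≡⟨ ring S L ⟩
          3 * S + 4 * L                ∎
          where
          ring : ∀ S L → S + (L * 4 + (S + S)) ≡ 3 * S + 4 * L
          ring = solve-∀

  liftHops : ∀ {Q : Fin n → Fin n → Set} → (∀ {i j} → Hop (vtx i) (vtx j) → Q i j) →
    ∀ {u v l} i j → vtx i ≡ u → vtx j ≡ v → RWalk Hop u v l → RWalk Q i j l
  liftHops {Q} q i j i≡ j≡ done = subst (λ j → RWalk Q i j 0) (vtx-injective (trans i≡ (sym j≡))) done
  liftHops {Q} q i j i≡ j≡ (step {y = y} hop@(_ , by , _) w) =
    step (q (subst₂ Hop (sym i≡) (sym (vtx-idx by)) hop)) (liftHops q (idx by) j (vtx-idx by) j≡ w)

-- Sets of pairs as Boolean matrices and their cardinalities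

mat : ∀ {m n} → (Fin m → Fin n → Bool) → Pairs m n
mat f = tabulateᵛ λ i → tabulateᵛ (f i)

mat⁻ : ∀ {m n} {f : Fin m → Fin n → Bool} {i j} → (i , j) ∈ₚ mat f → f i j ≡ true
mat⁻ {f = f} {i} {j} h = trans (sym (trans (cong (λ r → lookupᵛ r j) (lookup∘tabulate (λ i → tabulateᵛ (f i)) i)) (lookup∘tabulate (f i) j))) ([]=⇒lookup h)

mat⁺ : ∀ {m n} {f : Fin m → Fin n → Bool} {i j} → f i j ≡ true → (i , j) ∈ₚ mat f
mat⁺ {f = f} {i} {j} h = lookup⇒[]= j _ (trans (trans (cong (λ r → lookupᵛ r j) (lookup∘tabulate (λ i → tabulateᵛ (f i)) i)) (lookup∘tabulate (f i) j)) h)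

∪ₚ⁻ : ∀ {m n} {R Q : Pairs m n} {i j} → (i , j) ∈ₚ (R ∪ₚ Q) → (i , j) ∈ₚ R ⊎ (i , j) ∈ₚ Q
∪ₚ⁻ {R = R} {Q} {i} {j} h = x∈p∪q⁻ (lookupᵛ R i) (lookupᵛ Q i) (subst (j ∈ˢ_) (lookup-zipWith _∪ˢ_ i R Q) h)

∪ₚ⁺ : ∀ {m n} {R Q : Pairs m n} {i j} → (i , j) ∈ₚ R ⊎ (i , j) ∈ₚ Q → (i , j) ∈ₚ (R ∪ₚ Q)
∪ₚ⁺ {R = R} {Q} {i} {j} h = subst (j ∈ˢ_) (sym (lookup-zipWith _∪ˢ_ i R Q)) (x∈p∪q⁺ h)

rowCount : ∀ {X : Set} (xs : List X) (f : Fin (length xs) → Bool) (h : X → Bool) → (∀ i → f i ≡ true → h (lookup xs i) ≡ true) →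
  ∣ tabulateᵛ f ∣ ≤ ΣL xs (λ x → bit (h x))
rowCount []       f h imp = z≤n
rowCount (x ∷ xs) f h imp with f fzero in eq
... | true  = +-mono-≤ (≤-reflexive (sym (cong bit (imp fzero eq)))) (rowCount xs (f ∘ fsuc) h (imp ∘ fsuc))
... | false = m≤n⇒m≤o+n (bit (h x)) (rowCount xs (f ∘ fsuc) h (imp ∘ fsuc))

matCount : ∀ {X Z : Set} (xs : List X) (zs : List Z) (f : Fin (length xs) → Fin (length zs) → Bool) (h : X → Z → Bool) →
  (∀ i j → f i j ≡ true → h (lookup xs i) (lookup zs j) ≡ true) → card (mat f) ≤ ΣL xs (λ x → ΣL zs (λ z → bit (h x z)))
matCount []       zs f h imp = z≤n
matCount (x ∷ xs) zs f h imp = +-mono-≤ (rowCount zs (f fzero) (h x) (imp fzero)) (matCount xs zs (f ∘ fsuc) h (imp ∘ fsuc))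

-- Every counted element occurs in `xs`, and no occurrence in `xs` can serve two elements of the
-- repetition-free `zs`.
countIn : ∀ {X : Set} (_≟ˣ_ : (x y : X) → Dec (x ≡ y)) {zs} xs (p : X → Bool) → Unique zs → (∀ {z} → p z ≡ true → z ∈ˡ xs) →
  ΣL zs (λ z → bit (p z)) ≤ length xs
countIn _≟ˣ_ {zs} xs p u imp = begin
  ΣL zs (λ z → bit (p z))                          ≤⟨ ΣL-mono zs (λ {z} _ → found z) ⟩
  ΣL zs (λ z → ΣL xs (λ x → bit (does (z ≟ˣ x))))  ≡⟨ ΣL-swap zs xs (λ z x → bit (does (z ≟ˣ x))) ⟩
  ΣL xs (λ x → ΣL zs (λ z → bit (does (z ≟ˣ x))))  ≤⟨ ΣL-mono xs (λ {x} _ → ΣL-one u (λ _ → bit-≤1 _) (λ {z} {z′} _ _ a b → trans (same z x a) (sym (same z′ x b)))) ⟩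
  ΣL xs (λ _ → 1)                                  ≡⟨ trans (ΣL-const xs 1) (*-identityʳ _) ⟩
  length xs                                        ∎
  where
  open ≤-Reasoning
  same : ∀ z x → 0 < bit (does (z ≟ˣ x)) → z ≡ x
  same z x pos with z ≟ˣ x
  ... | yes eq = eq
  self : ∀ z → bit (does (z ≟ˣ z)) ≡ 1
  self z with z ≟ˣ z
  ... | yes _ = refl
  ... | no ≢  = ⊥-elim (≢ refl)
  found : ∀ z → bit (p z) ≤ ΣL xs (λ x → bit (does (z ≟ˣ x)))
  found z with p z in eq
  ... | false = z≤n
  ... | true  = ≤-trans (≤-reflexive (sym (self z))) (ΣL-term {f = λ x → bit (does (z ≟ˣ x))} (imp eq))

encodeVec-tabulate : ∀ {X Z : Set} (e : Z → Tree) (g : X → Z) xs → encodeVec e (tabulateᵛ (λ i → g (lookup xs i))) ≡ encList e (map g xs)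
encodeVec-tabulate e g []       = refl
encodeVec-tabulate e g (x ∷ xs) = cong (cons (e (g x))) (encodeVec-tabulate e g xs)

row-entry : ∀ {n} (p : Vec Bool n) (j : Fin n) → isCons (entry (encodeVec encodeBool p) (toℕ j)) ≡ lookupᵛ p j
row-entry (b ∷ᵛ p) fzero    = isCons-encodeBool b
row-entry (b ∷ᵛ p) (fsuc j) = row-entry p j

pairs-entry : ∀ {m n} (R : Pairs m n) i j → encodePairs R ⟦ toℕ i , toℕ j ⟧ ≡ lookupᵛ (lookupᵛ R i) j
pairs-entry (p ∷ᵛ R) fzero    j = row-entry p j
pairs-entry (p ∷ᵛ R) (fsuc i) j = pairs-entry R i j

entry⁺ : ∀ {m n} {R : Pairs m n} {i j} → (i , j) ∈ₚ R → encodePairs R ⟦ toℕ i , toℕ j ⟧ ≡ true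
entry⁺ {R = R} {i} {j} h = trans (pairs-entry R i j) ([]=⇒lookup h)

entry⁻ : ∀ {m n} {R : Pairs m n} {i j} → encodePairs R ⟦ toℕ i , toℕ j ⟧ ≡ true → (i , j) ∈ₚ R
entry⁻ {R = R} {i} {j} h = lookup⇒[]= j _ (trans (sym (pairs-entry R i j)) h)

card-entries : ∀ {m n} (R : Pairs m n) → Σ< m (λ i → Σ< n (λ j → bit (encodePairs R ⟦ i , j ⟧))) ≡ card R
card-entries []ᵛ       = refl
card-entries (p ∷ᵛ R) = cong₂ _+_ (row p) (card-entries R)
  where
  row : ∀ {n} (p : Vec Bool n) → Σ< n (λ j → bit (isCons (entry (encodeVec encodeBool p) j))) ≡ ∣ p ∣
  row []ᵛ            = refl
  row (true ∷ᵛ p)  = cong suc (row p)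
  row (false ∷ᵛ p) = row p

toR : ∀ {n} {G : Graph n} {i j l} → Walk G i j l → RWalk (λ i j → (i , j) ∈ₚ G) i j l
toR []      = done
toR (e ∷ w) = step e (toR w)

fromR : ∀ {n} {G : Graph n} {i j l} → RWalk (λ i j → (i , j) ∈ₚ G) i j l → Walk G i j l
fromR done       = []
fromR (step e w) = e ∷ fromR w

-- `DiameterAtMost` speaks of distances only, so a shortest walk must exist before the diameter can
-- be applied. Reachability within a given number of steps is decided by `reach`, which makes the
-- search for a minimum constructive.
shortest : ∀ {n} (G : Graph n) {i j l} → Walk G i j l → ∃[ l′ ] IsDist G i j l′
shortest {n} G {i} {j} {l} w = least l (≤-reflexive refl) w
  where
  t = encodePairs G
  within? : ∀ r → (∃[ l′ ] l′ ≤ r × Walk G i j l′) ⊎ (∀ l′ → l′ ≤ r → ¬ Walk G i j l′)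
  within? r with reach n t r ⟦ toℕ i , toℕ j ⟧ in eq
  ... | true  = let l′ , l′≤ , w′ = proj₁ (reach-correct n t r i j) eq in inj₁ (l′ , l′≤ , fromR (mapWalk id (λ i j → entry⁻ {R = G} {i} {j}) w′))
  ... | false = inj₂ λ l′ l′≤ w′ → case trans (sym eq) (proj₂ (reach-correct n t r i j) l′ l′≤ (mapWalk id (λ i j → entry⁺ {R = G} {i} {j}) (toR w′))) of λ ()
  least : ∀ b {l} → l ≤ b → Walk G i j l → ∃[ l′ ] IsDist G i j l′
  least zero    z≤n w = 0 , w , λ _ _ → z≤n
  least (suc b) {zero}  _ w = 0 , w , λ _ _ → z≤n
  least (suc b) {suc l} (s≤s l≤b) w with within? l
  ... | inj₁ (l′ , l′≤ , w′) = least b (≤-trans l′≤ l≤b) w′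
  ... | inj₂ none            = suc l , w , λ l′ w′ → ≰⇒> (λ l′≤l → none l′ l′≤l w′)

or-not : ∀ a {b} → (not a ≡ true → b ≡ true) → (if a then true else b) ≡ true
or-not true  h = refl
or-not false h = h refl

does⁻ : ∀ {X : Set} (d : Dec X) → does d ≡ true → X
does⁻ (yes x) _ = x

does⁺ : ∀ {X : Set} (d : Dec X) → X → does d ≡ true
does⁺ (yes _) _ = refl
does⁺ (no ¬x) x = ⊥-elim (¬x x)

check-graph : ∀ n G Θ d′ cap (E′ : Graph n) → card E′ ≤ cap →
  (∀ i j → (i , j) ∈ₚ E′ → closureOf n G Θ ⟦ toℕ i , toℕ j ⟧ ≡ true) →
  (∀ {i j l} → RWalk (λ i j → G ⟦ toℕ i , toℕ j ⟧ ≡ true) i j l →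
     ∃[ l′ ] l′ ≤ d′ × RWalk (λ i j → G ⟦ toℕ i , toℕ j ⟧ ≡ true ⊎ (i , j) ∈ₚ E′) i j l′) →
  checkOf n G Θ d′ cap (encodePairs E′) ≡ true
check-graph n G Θ d′ cap E′ size≤ sub near = Check.check⁺ n G Θ d′ cap y few λ w →
  let l′ , l′≤ , w′ = near w in l′ , l′≤ , mapWalk id (λ i j → map₂ λ e → sub i j e , entry⁺ {R = E′} {i} {j} e) w′
  where
  y = encodePairs E′
  C = closureOf n G Θ
  bit-mono : ∀ a b → (a ≡ true → b ≡ true) → bit a ≤ bit b
  bit-mono false b h = z≤n
  bit-mono true  b h = ≤-reflexive (sym (cong bit (h refl)))
  cut⁻ : ∀ i j → i < n → j < n → cutOf n C y ⟦ i , j ⟧ ≡ true → y ⟦ i , j ⟧ ≡ true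
  cut⁻ i j i<n j<n h = proj₂ (and⁻ {C ⟦ i , j ⟧} (trans (sym (mkMat-entry {n} {λ i j → if C ⟦ i , j ⟧ then y ⟦ i , j ⟧ else false} i<n j<n)) h))
  length-pairs : ∀ f → length (pairsOf n f) ≡ Σ< n (λ i → Σ< n (λ j → bit (f i j)))
  length-pairs f = trans (rows (upTo n)) (trans (ΣL-upTo n _) (Σ<-cong n λ i → trans (row i (upTo n)) (ΣL-upTo n _)))
    where
    row : ∀ i js → length (concatMap (λ j → if f i j then (i , j) ∷ [] else []) js) ≡ ΣL js (λ j → bit (f i j))
    row i []       = refl
    row i (j ∷ js) with f i j
    ... | true  = cong suc (row i js)
    ... | false = row i js
    rows : ∀ is → length (concatMap (λ i → concatMap (λ j → if f i j then (i , j) ∷ [] else []) (upTo n)) is) ≡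
      ΣL is (λ i → length (concatMap (λ j → if f i j then (i , j) ∷ [] else []) (upTo n)))
    rows []       = refl
    rows (i ∷ is) = trans (length-++ (concatMap (λ j → if f i j then (i , j) ∷ [] else []) (upTo n))) (cong (_ +_) (rows is))
  few : length (cutPairsOf n (cutOf n C y)) ≤ cap
  few = ≤-trans (≤-reflexive (length-pairs (λ i j → cutOf n C y ⟦ i , j ⟧))) (≤-trans (Σ<-mono n λ {i} i<n → Σ<-mono n λ {j} j<n →
    bit-mono (cutOf n C y ⟦ i , j ⟧) (y ⟦ i , j ⟧) (cut⁻ i j i<n j<n)) (≤-trans (≤-reflexive (card-entries E′)) size≤))

-- Shortcuts and TC spanners of the constructed graph

module Bridge (k M T L c P : ℕ) (c>0 : 0 < c) (rel : ℕ → ℕ → ℕ → ℕ → Bool) where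
  open Paths k M T L c P c>0 rel

  E : Graph n
  E = mat λ i j → adj (vtx i) (vtx j)

  encode-E : encodePairs E ≡ graphTree
  encode-E = trans (encodeVec-tabulate (encodeVec encodeBool) (λ u → tabulateᵛ (λ j → adj u (vtx j))) verts)
    (trans (rows verts) (sym (cong (encList (encList encodeBool)) (concatMap-single _ verts))))
    where
    rows : ∀ us → encList (encodeVec encodeBool) (map (λ u → tabulateᵛ (λ j → adj u (vtx j))) us) ≡
      encList (encList encodeBool) (map (λ u → concatMap (λ v → adj u v ∷ []) verts) us)
    rows []       = refl
    rows (u ∷ us) = cong₂ cons (trans (encodeVec-tabulate encodeBool (adj u) verts) (cong (encList encodeBool) (sym (concatMap-single (adj u) verts)))) (rows us)

  E⁻ : ∀ {i j} → (i , j) ∈ₚ E → Edge i j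
  E⁻ {i} {j} h = adj⁻ (vtx i) (vtx j) (mat⁻ {f = λ i j → adj (vtx i) (vtx j)} h)

  E⁺ : ∀ {i j} → Edge i j → (i , j) ∈ₚ E
  E⁺ h = mat⁺ {f = λ i j → adj (vtx i) (vtx j)} (adj⁺ h)

  walk-≤Θ : ∀ {i j l} → RWalk Edge i j l → l ≤ Θ
  walk-≤Θ {i} {j} {l} w = ≤-trans (m≤n+m l (proj₁ (vtx i))) (≤-trans (≤-reflexive (sym (walk-time (mapWalk vtx (λ _ _ r → r) w)))) (proj₁ (box j)))

  reaches⁺ : ∀ {i j l} → RWalk Edge i j l → Reaches E i j
  reaches⁺ w = _ , fromR (mapWalk id (λ _ _ → E⁺) w)

  reaches⁻ : ∀ {i j} → Reaches E i j → ∃[ l ] RWalk Edge i j l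
  reaches⁻ (l , w) = l , mapWalk id (λ _ _ → E⁻) (toR w)

  _≟ᵛ_ : (u v : Vert) → Dec (u ≡ v)
  _≟ᵛ_ = ×-≡-dec _≟_ (×-≡-dec _≟_ (×-≡-dec _≟_ (×-≡-dec _≟_ (×-≡-dec _≟_ (×-≡-dec _≟_ (List-≡-dec _≟_))))))

  edgeCount : ℕ
  edgeCount = ΣL verts (λ u → ΣL verts (λ v → bit (adj u v)))

  card-E : card E ≤ edgeCount
  card-E = matCount verts verts (λ i j → adj (vtx i) (vtx j)) adj (λ _ _ h → h)

  -- A choice has at most `k * M` outcomes, a vertex with a label, and a move has `T`; the sum
  -- bounds the out-degree whatever the kind.
  edgeCount≤ : edgeCount ≤ n * (k * M + T)
  edgeCount≤ = ≤-trans (ΣL-mono verts (λ {u} _ → row u)) (≤-reflexive (ΣL-const verts (k * M + T)))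
    where
    tick : ℕ → State → Vert
    tick θ s = suc θ , s
    successors : Vert → List Vert
    successors (θ , s) = map (tick θ) (nbrsOf k M T rel (kind θ) s)
    nbrs-length : ∀ κ s → length (nbrsOf k M T rel κ s) ≤ k * M + T
    nbrs-length 0 (w , a , sq , gu , gv , ds) = ≤-trans (≤-reflexive (length-for _ M k (λ u → trans (length-for (λ a′ → (u , a′ , sq + u * u , gu + u , gv , ds) ∷ []) 1 M (λ _ → refl)) (*-identityʳ M)))) (m≤m+n _ T)
    nbrs-length 1 (w , a , sq , gu , gv , ds) = ≤-trans (≤-trans (at-most _ M (upTo k) (λ v → ≤-trans (at-most _ 1 (upTo M) (λ b → single (rel w v a b))) (≤-reflexive (trans (*-identityʳ _) (length-upTo M)))))
        (≤-reflexive (cong (_* M) (length-upTo k)))) (m≤m+n _ T)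
      where
      single : ∀ {X : Set} {x : X} b → length (if b then x ∷ [] else []) ≤ 1
      single true  = ≤-refl
      single false = z≤n
      at-most : ∀ {X Z : Set} (f : X → List Z) m xs → (∀ x → length (f x) ≤ m) → length (concatMap f xs) ≤ length xs * m
      at-most f m []       h = z≤n
      at-most f m (x ∷ xs) h = ≤-trans (≤-reflexive (length-++ (f x))) (+-mono-≤ (h x) (at-most f m xs h))
    nbrs-length (suc (suc κ)) (w , a , sq , gu , gv , ds) =
      ≤-trans (≤-reflexive (trans (length-for (λ x → (w , a , sq + x * x , gu , gv , tailL ds ++ (headℕ ds + x ∷ [])) ∷ []) 1 T (λ _ → refl)) (*-identityʳ T))) (m≤n+m T _)
    row : ∀ u → ΣL verts (λ v → bit (adj u v)) ≤ k * M + T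
    row u@(θ , s) = ≤-trans (countIn _≟ᵛ_ (successors u) (adj u) verts-unique (λ {v} h → member (adj⁻ u v h)))
      (≤-trans (≤-reflexive (length-map (tick θ) (nbrsOf k M T rel (kind θ) s))) (nbrs-length (kind θ) s))
      where
      member : ∀ {u v} → VEdge u v → v ∈ˡ successors u
      member (at {θ} st) = ∈-map⁺ (tick θ) (Step⁺ k M T rel st)

  -- What a shortcut and a TC spanner have in common
  Solves : ℕ → ℕ → Graph n → Set
  Solves s d E′ = (∀ i j → (i , j) ∈ₚ E′ → Reaches E i j) × card E′ ≤ s ×
    (∀ i j → Reaches E i j → ∃[ l ] l ≤ d × Walk (E ∪ₚ E′) i j l)

  shortcut-solves : ∀ {s d E′} → IsShortcut E s d E′ → Solves s d E′
  shortcut-solves {d = d} {E′} (sub , size≤ , diam) = (λ i j h → proj₁ (sub i j h)) , size≤ , λ i j (l , w) →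
    let l′ , dist@(w′ , _) = shortest (E ∪ₚ E′) (fromR (mapWalk id (λ _ _ e → ∪ₚ⁺ {R = E} {E′} (inj₁ e)) (toR w)))
    in l′ , diam i j l′ dist , w′

  spanner-solves : ∀ {s d E′} → IsTCSpanner E s d E′ → Solves s d E′
  spanner-solves {d = d} {E′} (sub , equiv , size≤ , diam) = sub , size≤ , λ i j r →
    let l′ , dist@(w′ , _) = shortest E′ (proj₂ (Equivalence.from (equiv i j) r))
    in l′ , diam i j l′ dist , fromR (mapWalk id (λ _ _ e → ∪ₚ⁺ {R = E} {E′} (inj₂ e)) (toR w′))

  accept : ∀ {d′ cap} E′ → Solves cap d′ E′ → checkOf n graphTree Θ d′ cap (encodePairs E′) ≡ true
  accept {d′} {cap} E′ (sub , size≤ , near) = check-graph n graphTree Θ d′ cap E′ size≤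
    (λ i j e → let l , w = reaches⁻ (sub i j e) in closure⁺ {i} {j} (walk-≤Θ w) w)
    λ {i} {j} w → let l , l≤ , w′ = near i j (reaches⁺ (mapWalk id edge⁻ w)) in
      l , l≤ , mapWalk id (λ i j h → map₁ (λ e → edge⁺ i j (E⁻ e)) (∪ₚ⁻ {R = E} {E′} h)) (toR w′)

  module Solution (0<T : 0 < T) (0<L : 0 < L) (ψ φ : ℕ → ℕ)
    (ψ<M : ∀ {μ} → μ < k → ψ μ < M) (φ<M : ∀ {ν} → ν < k → φ ν < M)
    (complete : ∀ {μ ν a b} → μ < k → ν < k → rel μ ν a b ≡ true → rel μ ν (ψ μ) (φ ν) ≡ true)
    (s d : ℕ) (jumps≤ : 2 * (L * (k * (P ^ (3 + c) * ((L * T) ^ c * (ℓ * (T * T)))))) ≤ s)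
    (edges≤ : edgeCount + 2 * (L * (k * (P ^ (3 + c) * ((L * T) ^ c * (ℓ * (T * T)))))) ≤ s)
    (d≥ : 3 * S + 4 * L ≤ d) where
    open YesCase k M T L c P c>0 0<T 0<L rel ψ φ ψ<M φ<M complete

    isJump : Vert → Vert → Bool
    isJump u v = does ((u , v) ∈? jumps)
      where open DecMembership (×-≡-dec _≟ᵛ_ _≟ᵛ_) using (_∈?_)

    isJump⁻ : ∀ {u v} → isJump u v ≡ true → (u , v) ∈ˡ jumps
    isJump⁻ {u} {v} h = does⁻ ((u , v) ∈? jumps) h
      where open DecMembership (×-≡-dec _≟ᵛ_ _≟ᵛ_) using (_∈?_)

    isJump⁺ : ∀ {u v} → (u , v) ∈ˡ jumps → isJump u v ≡ true
    isJump⁺ {u} {v} p = does⁺ ((u , v) ∈? jumps) p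
      where open DecMembership (×-≡-dec _≟ᵛ_ _≟ᵛ_) using (_∈?_)

    jumpCount : ΣL verts (λ u → ΣL verts (λ v → bit (isJump u v))) ≤ 2 * (L * (k * (P ^ (3 + c) * ((L * T) ^ c * (ℓ * (T * T))))))
    jumpCount = ≤-trans (≤-reflexive (sym (ΣL-product verts verts (λ (u , v) → bit (isJump u v)))))
      (≤-trans (countIn (×-≡-dec _≟ᵛ_ _≟ᵛ_) jumps (λ (u , v) → isJump u v) (cartesianProduct⁺ verts-unique verts-unique) isJump⁻) (≤-reflexive jumps-length))

    -- The shortcut consists of the jumps that are not edges, the spanner of the jumps and all
    -- edges. With the edges of the graph added to the shortcut both have the same hops, so a single
    -- bound on the diameter serves for the two.
    inF inSpanner : Fin n → Fin n → Bool
    inF i j = if closure ⟦ toℕ i , toℕ j ⟧ then (if isJump (vtx i) (vtx j) then not (adj (vtx i) (vtx j)) else false) else false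
    inSpanner i j = if adj (vtx i) (vtx j) then true else inF i j

    F Sp : Graph n
    F  = mat inF
    Sp = mat inSpanner

    private
      F⁻ : ∀ {i j} → inF i j ≡ true → closure ⟦ toℕ i , toℕ j ⟧ ≡ true × isJump (vtx i) (vtx j) ≡ true × not (adj (vtx i) (vtx j)) ≡ true
      F⁻ {i} {j} h = let a , b = and⁻ {closure ⟦ toℕ i , toℕ j ⟧} h ; c , d = and⁻ {isJump (vtx i) (vtx j)} b in a , c , d

      hop⁺ : ∀ {i j} → Hop (vtx i) (vtx j) → inSpanner i j ≡ true
      hop⁺ {i} {j} (_ , _ , inj₁ e) = or⁺ {adj (vtx i) (vtx j)} {inF i j} (inj₁ (adj⁺ e))
      hop⁺ {i} {j} (_ , _ , inj₂ (J , l , w)) = or-not (adj (vtx i) (vtx j)) λ h →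
        and⁺ (closure⁺ {i} {j} (walk-≤Θ w′) w′) (and⁺ (isJump⁺ J) h)
        where w′ = lift i j refl refl w

      reach-spanner : ∀ {i j} → inSpanner i j ≡ true → Reaches E i j
      reach-spanner {i} {j} h = [ (λ e → reaches⁺ (step (adj⁻ (vtx i) (vtx j) e) done)) ,
        (λ f → let l , w = closure⁻ {i} {j} (proj₁ (F⁻ {i} {j} f)) in reaches⁺ w) ]′ (or⁻ {adj (vtx i) (vtx j)} {inF i j} h)

      near-spanner : ∀ {i j l} → RWalk Edge i j l → ∃[ l′ ] l′ ≤ d × RWalk (λ i j → inSpanner i j ≡ true) i j l′
      near-spanner {i} {j} w = let l′ , l′≤ , h = nearby (mapWalk vtx (λ _ _ r → r) w) (box i) (box j) in
        l′ , ≤-trans l′≤ d≥ , liftHops hop⁺ i j refl refl h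

      collapse : ∀ {i j l} → RWalk (λ i j → inSpanner i j ≡ true) i j l → ∃[ m ] RWalk Edge i j m
      collapse done       = 0 , done
      collapse (step h w) = let m , v = reaches⁻ (reach-spanner h) ; m′ , v′ = collapse w in m + m′ , v ⋈ v′

      diameter : ∀ (G : Graph n) → (∀ i j → (i , j) ∈ₚ G → inSpanner i j ≡ true) → (∀ i j → inSpanner i j ≡ true → (i , j) ∈ₚ G) → DiameterAtMost G d
      diameter G G⁻ G⁺ i j l (w , minimal) = let m , v = collapse (mapWalk id G⁻ (toR w)) ; l′ , l′≤ , h = near-spanner v in
        ≤-trans (minimal l′ (fromR (mapWalk id G⁺ h))) l′≤

    shortcut : IsShortcut E s d F
    shortcut = sub , ≤-trans (matCount verts verts inF isJump (λ i j h → proj₁ (proj₂ (F⁻ {i} {j} h)))) (≤-trans jumpCount jumps≤) ,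
      diameter (E ∪ₚ F) out into
      where
      sub : ∀ i j → (i , j) ∈ₚ F → Reaches E i j × ¬ ((i , j) ∈ₚ E)
      sub i j h = reach-spanner {i} {j} (or⁺ {adj (vtx i) (vtx j)} (inj₂ (mat⁻ {f = inF} h))) ,
        λ e → contra (trans (sym (cong not (mat⁻ {f = λ i j → adj (vtx i) (vtx j)} e))) (proj₂ (proj₂ (F⁻ {i} {j} (mat⁻ {f = inF} h)))))
        where
        contra : false ≡ true → ⊥
        contra ()
      out : ∀ i j → (i , j) ∈ₚ (E ∪ₚ F) → inSpanner i j ≡ true
      out i j h = or⁺ {adj (vtx i) (vtx j)} {inF i j}
        (map⊎ (mat⁻ {f = λ i j → adj (vtx i) (vtx j)}) (mat⁻ {f = inF}) (∪ₚ⁻ {R = E} {F} h))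
      into : ∀ i j → inSpanner i j ≡ true → (i , j) ∈ₚ (E ∪ₚ F)
      into i j h = ∪ₚ⁺ {R = E} {F} (map⊎ (mat⁺ {f = λ i j → adj (vtx i) (vtx j)}) (mat⁺ {f = inF}) (or⁻ {adj (vtx i) (vtx j)} {inF i j} h))

    spanner : IsTCSpanner E s d Sp
    spanner = (λ i j h → reach-spanner {i} {j} (mat⁻ {f = inSpanner} {i} {j} h)) , (λ i j → mk⇔ back forth) , size≤ ,
      diameter Sp (λ i j → mat⁻ {f = inSpanner} {i} {j}) (λ i j → mat⁺ {f = inSpanner} {i} {j})
      where
      back : ∀ {i j} → Reaches Sp i j → Reaches E i j
      back (l , w) = let m , v = collapse (mapWalk id (λ i j → mat⁻ {f = inSpanner} {i} {j}) (toR w)) in reaches⁺ v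
      forth : ∀ {i j} → Reaches E i j → Reaches Sp i j
      forth r = let m , v = reaches⁻ r ; l′ , _ , h = near-spanner v in l′ , fromR (mapWalk id (λ i j → mat⁺ {f = inSpanner} {i} {j}) h)
      either : Vert → Vert → Bool
      either u v = if adj u v then true else isJump u v
      bit-or : ∀ a b → bit (if a then true else b) ≤ bit a + bit b
      bit-or true  b = s≤s z≤n
      bit-or false b = ≤-refl
      size≤ : card Sp ≤ s
      size≤ = begin
        card Sp                                                    ≤⟨ matCount verts verts inSpanner either (λ i j h → or⁺ {adj (vtx i) (vtx j)} {isJump (vtx i) (vtx j)}
                                                                        (map₂ (λ f → proj₁ (proj₂ (F⁻ {i} {j} f))) (or⁻ {adj (vtx i) (vtx j)} {inF i j} h))) ⟩
        ΣL verts (λ u → ΣL verts (λ v → bit (either u v)))         ≤⟨ ΣL-mono verts (λ {u} _ → ΣL-mono verts (λ {v} _ → bit-or (adj u v) (isJump u v))) ⟩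
        ΣL verts (λ u → ΣL verts (λ v → bit (adj u v) + bit (isJump u v))) ≡⟨ ΣL-cong verts (λ u → ΣL-+ verts (λ v → bit (adj u v)) (λ v → bit (isJump u v))) ⟩
        ΣL verts (λ u → ΣL verts (λ v → bit (adj u v)) + ΣL verts (λ v → bit (isJump u v)))
          ≡⟨ ΣL-+ verts (λ u → ΣL verts (λ v → bit (adj u v))) (λ u → ΣL verts (λ v → bit (isJump u v))) ⟩
        edgeCount + ΣL verts (λ u → ΣL verts (λ v → bit (isJump u v))) ≤⟨ +-monoʳ-≤ edgeCount jumpCount ⟩
        _                                                          ≤⟨ edges≤ ⟩
        s                                                          ∎
        where open ≤-Reasoning

-- Label cover instances as read by the program

pairs-below : ∀ {m n} (R : Pairs m n) i j → encodePairs R ⟦ i , j ⟧ ≡ true → ∃[ a ] ∃[ b ] toℕ a ≡ i × toℕ b ≡ j × (a , b) ∈ₚ R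
pairs-below []ᵛ i j h = ⊥-elim (none i j h)
  where
  entry-nil : ∀ i → entry nil i ≡ nil
  entry-nil zero    = refl
  entry-nil (suc i) = entry-nil i
  none : ∀ i j → nil ⟦ i , j ⟧ ≡ true → ⊥
  none i j h rewrite entry-nil i | entry-nil j = case h of λ ()
pairs-below (p ∷ᵛ R) zero j h = let b , b≡ , b∈ = row p j h in fzero , b , refl , b≡ , b∈
  where
  row : ∀ {n} (p : Vec Bool n) j → isCons (entry (encodeVec encodeBool p) j) ≡ true → ∃[ b ] toℕ b ≡ j × b ∈ˢ p
  row []ᵛ j h = ⊥-elim (none j h)
    where
    none : ∀ j → isCons (entry nil j) ≡ true → ⊥
    none zero    ()
    none (suc j) h = none j h
  row (true ∷ᵛ p)  zero    h = fzero , refl , Data.Vec.here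
  row (c ∷ᵛ p)     (suc j) h = let b , b≡ , b∈ = row p j h in fsuc b , cong suc b≡ , Data.Vec.there b∈
pairs-below (p ∷ᵛ R) (suc i) j h = let a , b , a≡ , b≡ , ∈ = pairs-below R i j h in fsuc a , b , cong suc a≡ , b≡ , ∈

entry-encodeVec : ∀ {X : Set} (e : X → Tree) {n} (v : Vec X n) (i : Fin n) → entry (encodeVec e v) (toℕ i) ≡ e (lookupᵛ v i)
entry-encodeVec e (x ∷ᵛ v) fzero    = refl
entry-encodeVec e (x ∷ᵛ v) (fsuc i) = entry-encodeVec e v i

length-toList-encodeVec : ∀ {X : Set} (e : X → Tree) {n} (v : Vec X n) → length (toList (encodeVec e v)) ≡ n
length-toList-encodeVec e []ᵛ       = refl
length-toList-encodeVec e (x ∷ᵛ v) = cong suc (length-toList-encodeVec e v)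

length-toList : ∀ t → length (toList t) ≤ size t
length-toList nil        = z≤n
length-toList (cons x y) = s≤s (≤-trans (length-toList y) (m≤n+m _ (size x)))

length-for-trees : ∀ (f : Tree → List Tree) → (∀ t → length (f t) ≤ size t) → ∀ t → length (concatMap f (toList t)) ≤ size t
length-for-trees f h nil        = z≤n
length-for-trees f h (cons x y) = ≤-trans (≤-reflexive (length-++ (f x))) (≤-trans (+-mono-≤ (h x) (length-for-trees f h y)) (n≤1+n _))

rowsOf : Tree → ℕ
rowsOf x = length (concatMap (λ row → concatMap (λ en → toList (tail en)) (toList row)) (toList x))

rowsOf-≤ : ∀ x → rowsOf x ≤ size x
rowsOf-≤ = length-for-trees _ (length-for-trees _ λ t → ≤-trans (length-toList (tail t)) (size-tail t))

module Instance (I : LabelCover) where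
  open LabelCover I public

  x : Tree
  x = encoding

  e : ℕ → ℕ → Bool
  e μ ν = isCons (entry (entry x μ) ν)

  private
    entry-at : ∀ u v → entry (entry x (toℕ u)) (toℕ v) ≡ encodeMaybe encodePairs (constraintAt constraints u v)
    entry-at u v = trans (cong (λ t → entry t (toℕ v)) (entry-encodeVec _ constraints u)) (entry-encodeVec _ (lookupᵛ constraints u) v)

    edge-at : ∀ u v → lookupᵛ (lookupᵛ edges u) v ≡ is-just (constraintAt constraints u v)
    edge-at u v = trans (cong (λ r → lookupᵛ r v) (lookup-map u (mapᵛ is-just) constraints)) (lookup-map v is-just (lookupᵛ constraints u))

    isCons-maybe : ∀ (m : Maybe (Pairs l l)) → isCons (encodeMaybe encodePairs m) ≡ is-just m
    isCons-maybe nothing  = refl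
    isCons-maybe (just _) = refl

  e-at : ∀ u v → e (toℕ u) (toℕ v) ≡ lookupᵛ (lookupᵛ edges u) v
  e-at u v = trans (cong isCons (entry-at u v)) (trans (isCons-maybe (constraintAt constraints u v)) (sym (edge-at u v)))

  rel-at : ∀ u v a b → relOf x (toℕ u) (toℕ v) a b ≡ true →
    ∃[ π ] constraintAt constraints u v ≡ just π × (∃[ a′ ] ∃[ b′ ] toℕ a′ ≡ a × toℕ b′ ≡ b × (a′ , b′) ∈ₚ π)
  rel-at u v a b h = go (constraintAt constraints u v) refl (subst (λ t → tail t ⟦ a , b ⟧ ≡ true) (entry-at u v) h)
    where
    go : ∀ m → constraintAt constraints u v ≡ m → tail (encodeMaybe encodePairs m) ⟦ a , b ⟧ ≡ true →
      ∃[ π ] constraintAt constraints u v ≡ just π × (∃[ a′ ] ∃[ b′ ] toℕ a′ ≡ a × toℕ b′ ≡ b × (a′ , b′) ∈ₚ π)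
    go nothing  eq h = case pairs-below {0} {0} []ᵛ a b h of λ { (() , _) }
    go (just π) eq h = π , eq , pairs-below π a b h

  rel-in : ∀ u v {π a b} → constraintAt constraints u v ≡ just π → (a , b) ∈ₚ π → relOf x (toℕ u) (toℕ v) (toℕ a) (toℕ b) ≡ true
  rel-in u v {π} {a} {b} eq h = trans (cong (λ t → tail t ⟦ toℕ a , toℕ b ⟧) (trans (entry-at u v) (cong (encodeMaybe encodePairs) eq))) (entry⁺ {R = π} h)

  edge⇒just : ∀ u v → e (toℕ u) (toℕ v) ≡ true → ∃[ π ] constraintAt constraints u v ≡ just π
  edge⇒just u v h = go (constraintAt constraints u v) refl (trans (sym (isCons-maybe _)) (trans (cong isCons (sym (entry-at u v))) h))
    where
    go : ∀ m → constraintAt constraints u v ≡ m → is-just m ≡ true → ∃[ π ] constraintAt constraints u v ≡ just π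
    go (just π) eq _ = π , eq

  just⇒edge : ∀ u v {π} → constraintAt constraints u v ≡ just π → (u , v) ∈ₚ edges
  just⇒edge u v eq = lookup⇒[]= v _ (trans (edge-at u v) (cong is-just eq))

  rowSum : ∀ {n} (p : Vec Bool n) (f : ℕ → Bool) → (∀ j → f (toℕ j) ≡ lookupᵛ p j) → ΣL (upTo n) (λ j → bit (f j)) ≡ ∣ p ∣
  rowSum {n} p f h = trans (ΣL-upTo n _) (go p f h)
    where
    go : ∀ {n} (p : Vec Bool n) (f : ℕ → Bool) → (∀ j → f (toℕ j) ≡ lookupᵛ p j) → Σ< n (λ j → bit (f j)) ≡ ∣ p ∣
    go []ᵛ            f h = refl
    go (true ∷ᵛ p)  f h = cong₂ _+_ (cong bit (h fzero)) (go p (f ∘ suc) (h ∘ fsuc))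
    go (false ∷ᵛ p) f h = cong₂ _+_ (cong bit (h fzero)) (go p (f ∘ suc) (h ∘ fsuc))

  cardSum : ∀ {m n} (R : Pairs m n) (f : ℕ → ℕ → Bool) → (∀ i j → f (toℕ i) (toℕ j) ≡ lookupᵛ (lookupᵛ R i) j) →
    ΣL (upTo m) (λ i → ΣL (upTo n) (λ j → bit (f i j))) ≡ card R
  cardSum {m} {n} R f h = trans (ΣL-upTo m _) (go R f h)
    where
    go : ∀ {m} (R : Pairs m n) (f : ℕ → ℕ → Bool) → (∀ i j → f (toℕ i) (toℕ j) ≡ lookupᵛ (lookupᵛ R i) j) →
      Σ< m (λ i → ΣL (upTo n) (λ j → bit (f i j))) ≡ card R
    go []ᵛ       f h = refl
    go (p ∷ᵛ R) f h = cong₂ _+_ (rowSum p (f 0) (h fzero)) (go R (f ∘ suc) (h ∘ fsuc))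

  private
    at< : ∀ {Q : ℕ → Set} → (∀ (u : Fin k) → Q (toℕ u)) → ∀ {i} → i < k → Q i
    at< {Q} h i<k = subst Q (toℕ-fromℕ< i<k) (h (fromℕ< i<k))

  regularA : ∀ {μ} → μ < k → ΣL (upTo k) (λ ν → bit (e μ ν)) ≡ degree
  regularA = at< λ u → trans (rowSum (lookupᵛ edges u) (e (toℕ u)) (e-at u)) (regular-A u)

  regularB : ∀ {ν} → ν < k → ΣL (upTo k) (λ μ → bit (e μ ν)) ≡ degree
  regularB = at< λ v → trans (rowSum (lookupᵛ (transpose edges) v) (λ μ → e μ (toℕ v)) (λ u → trans (e-at u v) (sym (lookup-transpose edges v u)))) (regular-B v)
    where
    column : ∀ {m n} (p : Vec Bool n) (R : Vec (Vec Bool n) m) j → lookupᵛ (transpose (p ∷ᵛ R)) j ≡ lookupᵛ p j ∷ᵛ lookupᵛ (transpose R) j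
    column {n = n} p R j = trans (lookup-⊛ j (replicateᵛ n _∷ᵛ_ ⊛ p) (transpose R)) (cong (λ f → f (lookupᵛ (transpose R) j))
      (trans (lookup-⊛ j (replicateᵛ n _∷ᵛ_) p) (cong (λ f → f (lookupᵛ p j)) (lookup-replicate j _∷ᵛ_))))
    lookup-transpose : ∀ {m n} (R : Vec (Vec Bool n) m) j i → lookupᵛ (lookupᵛ (transpose R) j) i ≡ lookupᵛ (lookupᵛ R i) j
    lookup-transpose (p ∷ᵛ R) j fzero    = cong (λ r → lookupᵛ r fzero) (column p R j)
    lookup-transpose (p ∷ᵛ R) j (fsuc i) = trans (cong (λ r → lookupᵛ r (fsuc i)) (column p R j)) (lookup-transpose R j i)

  edge-count : card edges ≡ k * degree
  edge-count = trans (sym (cardSum edges e e-at)) (trans (≤-antisym (ΣL-mono (upTo k) (λ μ∈ → ≤-reflexive (regularA (∈-upTo⁻ μ∈))))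
    (ΣL-mono (upTo k) (λ μ∈ → ≤-reflexive (sym (regularA (∈-upTo⁻ μ∈)))))) (trans (ΣL-const (upTo k) degree) (cong (_* degree) (length-upTo k))))

  0<edges : 0 < k * degree
  0<edges = subst (0 <_) edge-count has-edge

  0<k : 0 < k
  0<k = n≢0⇒n>0 λ k≡0 → <-irrefl refl (subst (λ z → 0 < z * degree) k≡0 0<edges)

  0<degree : 0 < degree
  0<degree = n≢0⇒n>0 λ d≡0 → <-irrefl (sym (*-zeroʳ k)) (subst (λ z → 0 < k * z) d≡0 0<edges)

  someEdge : ∃[ u ] ∃[ v ] e (toℕ u) (toℕ v) ≡ true
  someEdge with ΣL-positive (upTo k) {λ μ → ΣL (upTo k) (λ ν → bit (e μ ν))} (subst (0 <_) (sym (cardSum edges e e-at)) has-edge)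
  ... | μ , μ∈ , p with ΣL-positive (upTo k) {λ ν → bit (e μ ν)} p
  ...   | ν , ν∈ , q = fromℕ< (∈-upTo⁻ μ∈) , fromℕ< (∈-upTo⁻ ν∈) ,
    subst₂ (λ μ ν → e μ ν ≡ true) (sym (toℕ-fromℕ< (∈-upTo⁻ μ∈))) (sym (toℕ-fromℕ< (∈-upTo⁻ ν∈))) (bit⁻ q)

  labelOf : Fin l
  labelOf = let u , v , h = someEdge ; π , eq = edge⇒just u v h in proj₁ (nonempty u v π eq)

  0<l : 0 < l
  0<l = <-≤-trans (s≤s z≤n) (toℕ<n labelOf)

  k≡ : length (toList x) ≡ k
  k≡ = length-toList-encodeVec _ constraints

  -- A constraint matrix has `l` rows, and a missing edge has none. As there is at least one edge
  -- and one label, neither `k` nor `l` exceeds this number.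
  rows≡ : rowsOf x ≡ k * degree * l
  rows≡ = begin
    rowsOf x                                                  ≡⟨ lengthOuter constraints ⟩
    card (mapᵛ (mapᵛ is-just) constraints) * l                 ≡⟨ cong (_* l) edge-count ⟩
    k * degree * l                                            ∎
    where
    open ≡-Reasoning
    lengthInner : ∀ {n} (r : Vec (Maybe (Pairs l l)) n) → length (concatMap (λ en → toList (tail en)) (toList (encodeVec (encodeMaybe encodePairs) r))) ≡ ∣ mapᵛ is-just r ∣ * l
    lengthInner []ᵛ            = refl
    lengthInner (nothing ∷ᵛ r) = lengthInner r
    lengthInner (just π ∷ᵛ r)  = trans (length-++ (toList (encodePairs π))) (cong₂ _+_ (length-toList-encodeVec _ π) (lengthInner r))
    lengthOuter : ∀ {m n} (c : Vec (Vec (Maybe (Pairs l l)) n) m) →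
      length (concatMap (λ row → concatMap (λ en → toList (tail en)) (toList row)) (toList (encodeVec (encodeVec (encodeMaybe encodePairs)) c))) ≡ card (mapᵛ (mapᵛ is-just) c) * l
    lengthOuter []ᵛ       = refl
    lengthOuter (r ∷ᵛ c) = trans (length-++ (concatMap (λ en → toList (tail en)) (toList (encodeVec (encodeMaybe encodePairs) r))))
      (trans (cong₂ _+_ (lengthInner r) (lengthOuter c)) (sym (*-distribʳ-+ l ∣ mapᵛ is-just r ∣ _)))

  l≤rows : l ≤ rowsOf x
  l≤rows = ≤-trans (≤-trans (≤-reflexive (sym (*-identityˡ l))) (*-monoˡ-≤ l 0<edges)) (≤-reflexive (sym rows≡))

  k≤rows : k ≤ rowsOf x
  k≤rows = ≤-trans (≤-trans (≤-trans (≤-reflexive (sym (*-identityʳ k))) (*-monoʳ-≤ k 0<degree))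
    (≤-trans (≤-reflexive (sym (*-identityʳ _))) (*-monoʳ-≤ (k * degree) 0<l))) (≤-reflexive (sym rows≡))

  satisfiable : ∀ {μ ν} → μ < k → ν < k → e μ ν ≡ true → ∃[ a ] ∃[ b ] a < rowsOf x × b < rowsOf x × relOf x μ ν a b ≡ true
  satisfiable {ν = ν} μ<k = at< {λ μ → ν < k → e μ ν ≡ true → ∃[ a ] ∃[ b ] a < rowsOf x × b < rowsOf x × relOf x μ ν a b ≡ true}
    (λ u → at< {λ ν → e (toℕ u) ν ≡ true → ∃[ a ] ∃[ b ] a < rowsOf x × b < rowsOf x × relOf x (toℕ u) ν a b ≡ true} λ v h →
      let π , eq = edge⇒just u v h
          a , b , ∈ = nonempty u v π eq
      in toℕ a , toℕ b , <-≤-trans (toℕ<n a) l≤rows , <-≤-trans (toℕ<n b) l≤rows , rel-in u v eq ∈) μ<k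

  toLabel : ℕ → Fin l
  toLabel a with a <? l
  ... | yes a<l = fromℕ< a<l
  ... | no  _   = labelOf

  toLabel-toℕ : ∀ (a : Fin l) → toLabel (toℕ a) ≡ a
  toLabel-toℕ a with toℕ a <? l
  ... | yes a<l = fromℕ<-toℕ a a<l
  ... | no ≮    = ⊥-elim (≮ (toℕ<n a))

  asLabeling : (ℕ → ℕ) → (ℕ → ℕ) → Labeling
  asLabeling ψ φ (inj₁ u) = toLabel (ψ (toℕ u))
  asLabeling ψ φ (inj₂ v) = toLabel (φ (toℕ v))

  -- The relation read from the tree holds only between numbers that encode labels. Replacing all
  -- other numbers by a default label therefore cannot uncover an edge.
  soundSum : ∀ (ψ φ : ℕ → ℕ) → ΣL (upTo k) (λ μ → ΣL (upTo k) (λ ν → bit (e μ ν) * bit (relOf x μ ν (ψ μ) (φ ν)))) ≤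
    card (covered (asLabeling ψ φ))
  soundSum ψ φ = ≤-trans (ΣL-mono (upTo k) λ {μ} μ∈ → ΣL-mono (upTo k) λ {ν} ν∈ → each (∈-upTo⁻ μ∈) (∈-upTo⁻ ν∈))
    (≤-reflexive (trans (trans (ΣL-upTo k _) (Σ<-cong k λ i → ΣL-upTo k _)) (card-entries (covered Ψ))))
    where
    Ψ = asLabeling ψ φ
    cov : Fin k → Fin k → Bool
    cov u v = maybe′ (λ π → lookupᵛ (lookupᵛ π (Ψ (inj₁ u))) (Ψ (inj₂ v))) false (constraintAt constraints u v)
    cov-true : ∀ u v → relOf x (toℕ u) (toℕ v) (ψ (toℕ u)) (φ (toℕ v)) ≡ true → cov u v ≡ true
    cov-true u v h = let π , eq , a , b , a≡ , b≡ , ∈ = rel-at u v _ _ h in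
      trans (cong (maybe′ (λ π → lookupᵛ (lookupᵛ π (Ψ (inj₁ u))) (Ψ (inj₂ v))) false) eq)
        (trans (cong₂ (λ a b → lookupᵛ (lookupᵛ π a) b) (trans (cong toLabel (sym a≡)) (toLabel-toℕ a)) (trans (cong toLabel (sym b≡)) (toLabel-toℕ b))) ([]=⇒lookup ∈))
    weaken : ∀ a b c → (b ≡ true → c ≡ true) → bit a * bit b ≤ bit c
    weaken a     false c h = ≤-trans (≤-reflexive (*-zeroʳ (bit a))) z≤n
    weaken false true  c h = z≤n
    weaken true  true  c h = ≤-reflexive (sym (cong bit (h refl)))
    each : ∀ {μ ν} → μ < k → ν < k → bit (e μ ν) * bit (relOf x μ ν (ψ μ) (φ ν)) ≤ bit (encodePairs (covered Ψ) ⟦ μ , ν ⟧)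
    each {ν = ν} = at< {λ μ → ν < k → bit (e μ ν) * bit (relOf x μ ν (ψ μ) (φ ν)) ≤ bit (encodePairs (covered Ψ) ⟦ μ , ν ⟧)} λ u →
      at< {λ ν → bit (e (toℕ u) ν) * bit (relOf x (toℕ u) ν (ψ (toℕ u)) (φ ν)) ≤ bit (encodePairs (covered Ψ) ⟦ toℕ u , ν ⟧)} λ v →
        weaken (e (toℕ u) (toℕ v)) _ _ λ h → entry⁺ {R = covered Ψ} (mat⁺ {f = cov} (cov-true u v h))

  module Completed (ψ : Labeling) (all : ∀ u v → (u , v) ∈ₚ edges → Covers ψ u v) where

    labelA labelB : ℕ → ℕ
    labelA μ with μ <? k
    ... | yes μ<k = toℕ (ψ (inj₁ (fromℕ< μ<k)))
    ... | no _    = 0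
    labelB ν with ν <? k
    ... | yes ν<k = toℕ (ψ (inj₂ (fromℕ< ν<k)))
    ... | no _    = 0

    private
      A-at : ∀ u → labelA (toℕ u) ≡ toℕ (ψ (inj₁ u))
      A-at u with toℕ u <? k
      ... | yes u<k = cong (toℕ ∘ ψ ∘ inj₁) (fromℕ<-toℕ u u<k)
      ... | no ≮    = ⊥-elim (≮ (toℕ<n u))
      B-at : ∀ v → labelB (toℕ v) ≡ toℕ (ψ (inj₂ v))
      B-at v with toℕ v <? k
      ... | yes v<k = cong (toℕ ∘ ψ ∘ inj₂) (fromℕ<-toℕ v v<k)
      ... | no ≮    = ⊥-elim (≮ (toℕ<n v))

    labelA< : ∀ {μ} → μ < k → labelA μ < rowsOf x
    labelA< = at< {λ μ → labelA μ < rowsOf x} λ u → subst (_< rowsOf x) (sym (A-at u)) (<-≤-trans (toℕ<n _) l≤rows)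

    labelB< : ∀ {ν} → ν < k → labelB ν < rowsOf x
    labelB< = at< {λ ν → labelB ν < rowsOf x} λ v → subst (_< rowsOf x) (sym (B-at v)) (<-≤-trans (toℕ<n _) l≤rows)

    completed : ∀ {μ ν a b} → μ < k → ν < k → relOf x μ ν a b ≡ true → relOf x μ ν (labelA μ) (labelB ν) ≡ true
    completed {ν = ν} {a} {b} = at< {λ μ → ν < k → relOf x μ ν a b ≡ true → relOf x μ ν (labelA μ) (labelB ν) ≡ true} λ u →
      at< {λ ν → relOf x (toℕ u) ν a b ≡ true → relOf x (toℕ u) ν (labelA (toℕ u)) (labelB ν) ≡ true} λ v h →
        let _ , eq , _ = rel-at u v a b h
            π , eq′ , ∈ = all u v (just⇒edge u v eq)
        in subst₂ (λ a b → relOf x (toℕ u) (toℕ v) a b ≡ true) (sym (A-at u)) (sym (B-at v)) (rel-in u v eq′ ∈)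

-- The choice of the parameters

module Numbers (q₀ Y K p : ℕ) (0<q₀ : 0 < q₀) (0<Y : 0 < Y) (K≡ : K ≡ q₀ * (13 * Y + 60)) (p≡ : p ≡ 4 * K + 2 * Y + 12) (Y-large : 6 * K + Y + 10 ≤ Y * Y)
  (β M k : ℕ) (β-large : 8 * Y + 100 ≤ β) (M≥ : β ^ K ≤ M) (M< : M < suc β ^ K) (0<k : 0 < k) (k≤M : k ≤ M) where

  T L ℓ S Θ P₁ P D Q Jm : ℕ
  T  = β ^ Y
  L  = β ^ 3
  ℓ  = Y * L
  S  = 2 * suc ℓ
  Θ  = L * S
  P₁ = β ^ p
  P  = β * P₁
  Q  = P ^ (3 + Y)
  D  = (L * T) ^ Y * (ℓ * (T * T))
  Jm = L * (k * (Q * D))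

  100≤β : 100 ≤ β
  100≤β = ≤-trans (m≤n+m 100 (8 * Y)) β-large

  private
    β>0 : 0 < β
    β>0 = ≤-trans (s≤s z≤n) 100≤β

    2≤β : 2 ≤ β
    2≤β = ≤-trans (m≤m+n 2 98) 100≤β

    8≤β : 8 ≤ β
    8≤β = ≤-trans (m≤m+n 8 92) 100≤β

    Y≤β : Y ≤ β
    Y≤β = ≤-trans (≤-trans (m≤n*m Y 8) (m≤m+n (8 * Y) 100)) β-large

    -- Keeping the exponent as an index lets unification recover it.
    data _≼_ (a i : ℕ) : Set where
      ⟨_⟩ : a ≤ β ^ i → a ≼ i

    ⟪_⟫ : ∀ {a i} → a ≼ i → a ≤ β ^ i
    ⟪ ⟨ h ⟩ ⟫ = h

    one : ∀ {a} → a ≤ β → a ≼ 1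
    one h = ⟨ ≤-trans h (≤-reflexive (sym (*-identityʳ β))) ⟩

    up : ∀ {a i j} → i ≤ j → a ≼ i → a ≼ j
    up i≤j ⟨ h ⟩ = ⟨ ≤-trans h (^-monoʳ-≤ β {{>-nonZero β>0}} i≤j) ⟩

    _at_ : ∀ {a i j} → a ≼ i → i ≡ j → a ≼ j
    h at refl = h

    infixr 7 _⊠_
    _⊠_ : ∀ {a b i j} → a ≼ i → b ≼ j → (a * b) ≼ (i + j)
    _⊠_ {i = i} {j} ⟨ h ⟩ ⟨ h′ ⟩ = ⟨ ≤-trans (*-mono-≤ h h′) (≤-reflexive (sym (^-distribˡ-+-* β i j))) ⟩

    plus : ∀ {a b i} → a ≼ i → b ≼ i → (a + b) ≼ (1 + i)
    plus {i = i} ⟨ h ⟩ ⟨ h′ ⟩ = ⟨ ≤-trans (+-mono-≤ h h′) (≤-trans (≤-reflexive (cong (β ^ i +_) (sym (+-identityʳ (β ^ i))))) (*-monoˡ-≤ (β ^ i) 2≤β)) ⟩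

    same : ∀ {i} → (β ^ i) ≼ i
    same = ⟨ ≤-refl ⟩

    pow>0 : ∀ i → 0 < β ^ i
    pow>0 i = m^n>0 β {{>-nonZero β>0}} i

  private
   M≼ : M ≼ (2 * K)
   M≼ = ⟨ ≤-trans (<⇒≤ M<) (≤-trans (^-monoˡ-≤ K sβ) (≤-reflexive (^-*-assoc β 2 K))) ⟩
      where
      sβ : suc β ≤ β ^ 2
      sβ = ≤-trans (≤-trans (≤-reflexive (+-comm 1 β)) (+-monoʳ-≤ β β>0)) (≤-trans (≤-reflexive (cong (β +_) (sym (+-identityʳ β)))) (≤-trans (*-monoˡ-≤ β 2≤β) (≤-reflexive (cong (β *_) (sym (*-identityʳ β))))))

   k≼ : k ≼ (2 * K)
   k≼ = ⟨ ≤-trans k≤M ⟪ M≼ ⟫ ⟩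

  0<M : 0 < M
  0<M = ≤-trans (pow>0 K) M≥

  0<L : 0 < L
  0<L = pow>0 3

  0<T : 0 < T
  0<T = pow>0 Y

  d′<L² : β ^ 5 < L * L
  d′<L² = <-≤-trans (≤-trans (≤-reflexive (+-comm 1 (β ^ 5))) (+-monoʳ-≤ (β ^ 5) (pow>0 5)))
    (≤-trans ⟪ plus (same {5}) (same {5}) ⟫ (≤-reflexive (^-distribˡ-+-* β 3 3)))

  hops : 3 * S + 4 * L ≤ β ^ 4
  hops = begin
    3 * S + 4 * L                ≡⟨ r₁ Y L ⟩
    6 + (6 * Y + 4) * L          ≤⟨ +-monoˡ-≤ _ (≤-trans (≤-reflexive (sym (*-identityʳ 6))) (*-monoʳ-≤ 6 0<L)) ⟩
    6 * L + (6 * Y + 4) * L      ≡⟨ r₂ Y L ⟩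
    (6 * Y + 10) * L             ≤⟨ *-monoˡ-≤ L (≤-trans (+-mono-≤ (*-monoˡ-≤ Y (m≤m+n 6 2)) (m≤m+n 10 90)) β-large) ⟩
    β * L                        ∎
    where
    open ≤-Reasoning
    r₁ : ∀ Y L → 3 * (2 * (1 + Y * L)) + 4 * L ≡ 6 + (6 * Y + 4) * L
    r₁ = solve-∀
    r₂ : ∀ Y L → 6 * L + (6 * Y + 4) * L ≡ (6 * Y + 10) * L
    r₂ = solve-∀

  private
    S≼ : S ≼ 4
    S≼ = ⟨ ≤-trans (≤-trans (m≤n*m S 3) (m≤m+n (3 * S) (4 * L))) hops ⟩

    sΘ≼ : suc Θ ≼ 8
    sΘ≼ = subst (_≼ 8) (+-comm Θ 1) (plus (same {3} ⊠ S≼) ⟨ pow>0 7 ⟩)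

  -- Bounds on every coordinate of a displacement: `kk` for a choice in the instance, `lytt` for the
  -- `L` rounds of a block, and `B` for an entire stage.
  kk lytt B : ℕ
  kk   = k * k
  lytt = L * (Y * (T * T))
  B    = kk + (lytt + (kk + lytt))

  private
    kk≼ : kk ≼ (4 * K)
    kk≼ = (k≼ ⊠ k≼) at ring K
      where
      ring : ∀ K → 2 * K + 2 * K ≡ 4 * K
      ring = solve-∀

    lytt≼ : lytt ≼ (2 * Y + 4)
    lytt≼ = (same {3} ⊠ one Y≤β ⊠ same {Y} ⊠ same {Y}) at ring Y
      where
      ring : ∀ Y → 3 + (1 + (Y + Y)) ≡ 2 * Y + 4
      ring = solve-∀

    E₀ = 4 * K + 2 * Y + 4

    B≼ : B ≼ (3 + E₀)
    B≼ = plus {i = 2 + E₀} (up (m≤n⇒m≤o+n 2 ≤K) kk≼) (plus {i = 1 + E₀} (up (m≤n⇒m≤o+n 1 ≤Y) lytt≼) (plus {i = E₀} (up ≤K kk≼) (up ≤Y lytt≼)))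
      where
      ≤K : 4 * K ≤ E₀
      ≤K = ≤-trans (m≤m+n (4 * K) (2 * Y)) (m≤m+n _ 4)
      ≤Y : 2 * Y + 4 ≤ E₀
      ≤Y = ≤-trans (m≤n+m (2 * Y + 4) (4 * K)) (≤-reflexive (sym (+-assoc (4 * K) (2 * Y) 4)))

  -- The exponent `p` is chosen for this. All displacements along a critical walk stay below the
  -- side `P₁` of the starting box, so the box of side `β * P₁` holds the whole walk, and the
  -- enlargement costs only a factor β per coordinate.
  fits : L * B + kk ≤ P₁
  fits = ⟪ up {i = 7 + E₀} 7+E₀≤p (plus {i = 6 + E₀} (same {3} ⊠ B≼) (up (≤-trans (m≤m+n (4 * K) (2 * Y)) (≤-trans (m≤m+n _ 4) (m≤n+m E₀ 6))) kk≼)) ⟫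
    where
    ring : ∀ K Y → 7 + (4 * K + 2 * Y + 4) + 1 ≡ 4 * K + 2 * Y + 12
    ring = solve-∀
    7+E₀≤p : 7 + E₀ ≤ p
    7+E₀≤p = ≤-trans (m≤m+n _ 1) (≤-reflexive (trans (ring K Y) (sym p≡)))

  P₁+P₁≤P : P₁ + P₁ ≤ P
  P₁+P₁≤P = ≤-trans (≤-reflexive (cong (P₁ +_) (sym (+-identityʳ P₁)))) (*-monoˡ-≤ P₁ 2≤β)

  private
    Bounded : ℕ → List ℕ → Set
    Bounded b = All (_≤ b)

    weakenᵇ : ∀ {a b} → a ≤ b → ∀ {xs} → Bounded a xs → Bounded b xs
    weakenᵇ a≤b = All-map (λ h → ≤-trans h a≤b)

    zerosᵇ : ∀ n {b} → Bounded b (zeros n)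
    zerosᵇ zero    = []
    zerosᵇ (suc n) = z≤n ∷ zerosᵇ n

    ⊞ᵇ : ∀ {a b xs ys} → Bounded a xs → Bounded b ys → Bounded (a + b) (xs ⊞ ys)
    ⊞ᵇ []       _        = []
    ⊞ᵇ (_ ∷ _)  []       = []
    ⊞ᵇ (h ∷ hs) (g ∷ gs) = +-mono-≤ h g ∷ ⊞ᵇ hs gs

    timesᵇ : ∀ n r {b xs} → Bounded b xs → Bounded (r * b) (times n r xs)
    timesᵇ n zero    h = zerosᵇ n
    timesᵇ n (suc r) h = ⊞ᵇ h (timesᵇ n r h)

    squareᵇ : ∀ {μ} → μ < k → μ ≤ kk
    squareᵇ μ<k = ≤-trans (<⇒≤ μ<k) (≤-trans (≤-reflexive (sym (*-identityʳ k))) (*-monoʳ-≤ k 0<k))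

    uᵇ : ∀ {μ} → μ < k → Bounded kk (uVec Y μ)
    uᵇ μ<k = *-mono-≤ (<⇒≤ μ<k) (<⇒≤ μ<k) ∷ squareᵇ μ<k ∷ z≤n ∷ zerosᵇ Y

    vᵇ : ∀ {ν} → ν < k → Bounded kk (vVec Y ν)
    vᵇ ν<k = *-mono-≤ (<⇒≤ ν<k) (<⇒≤ ν<k) ∷ z≤n ∷ squareᵇ ν<k ∷ zerosᵇ Y

    rᵇ : ∀ {ys} → ys ∈ˡ digitLists T Y → Bounded (Y * (T * T)) (rVec ys)
    rᵇ {ys} ys∈ = ≤-trans (normᵇ ys ys<) (≤-reflexive (cong (_* (T * T)) len)) ∷ z≤n ∷ z≤n ∷
      All-map (λ h → ≤-trans (<⇒≤ h) (≤-trans (≤-trans (≤-reflexive (sym (*-identityʳ T))) (*-monoʳ-≤ T 0<T)) (≤-trans (≤-reflexive (sym (*-identityˡ (T * T)))) (*-monoˡ-≤ (T * T) 0<Y)))) ys<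
      where
      len = proj₁ (∈-digitLists⁻ {T} Y ys∈)
      ys< = proj₂ (∈-digitLists⁻ {T} Y ys∈)
      normᵇ : ∀ ys → All (_< T) ys → normSq ys ≤ length ys * (T * T)
      normᵇ []       []       = z≤n
      normᵇ (y ∷ ys) (h ∷ hs) = +-mono-≤ (*-mono-≤ (<⇒≤ h) (<⇒≤ h)) (normᵇ ys hs)

    stageᵇ : ∀ {μ ν ys} → μ < k → ν < k → ys ∈ˡ digitLists T Y → Bounded B (stageVecOf L Y μ ν ys)
    stageᵇ μ<k ν<k ys∈ = ⊞ᵇ (uᵇ μ<k) (⊞ᵇ R (⊞ᵇ (vᵇ ν<k) R))
      where R = timesᵇ (3 + Y) L (rᵇ ys∈)

    roomOf : ∀ {xs} → Bounded (L * B + kk) xs → All (λ x → x + P₁ ≤ P) xs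
    roomOf = All-map (λ h → ≤-trans (+-monoˡ-≤ P₁ (≤-trans h fits)) P₁+P₁≤P)

  room : ∀ {μ ν ys i} → μ < k → ν < k → ys ∈ˡ digitLists T Y → i < L → All (λ x → x + P₁ ≤ P) (offset L Y μ ν ys i)
  room {i = i} μ<k ν<k ys∈ i<L = roomOf (⊞ᵇ (weakenᵇ (*-monoˡ-≤ B (<⇒≤ i<L)) (timesᵇ (3 + Y) i (stageᵇ μ<k ν<k ys∈))) (uᵇ μ<k))

  roomEnd : ∀ {μ ν ys} → μ < k → ν < k → ys ∈ˡ digitLists T Y → All (λ x → x + P₁ ≤ P) (times (3 + Y) L (stageVecOf L Y μ ν ys))
  roomEnd μ<k ν<k ys∈ = roomOf (weakenᵇ (m≤m+n (L * B) kk) (timesᵇ (3 + Y) L (stageᵇ μ<k ν<k ys∈)))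

  n : ℕ
  n = suc Θ * (k * (M * Q))

  -- Up to the common factor `k * Q`, the edges have exponent `6 * K + Y + 10` including the extra
  -- β, while the `T ^ Y` displacements counted in `D` have exponent `Y * Y`. The extra β is what
  -- turns `s ≥ m` into `s ≥ m^(1+ε)`.
  many-jumps : β * (n * (k * M + T)) ≤ Jm
  many-jumps = begin
    β * (suc Θ * (k * (M * Q)) * (k * M + T))     ≡⟨ r₁ β (suc Θ) k M Q (k * M + T) ⟩
    β * (suc Θ * (M * (k * M + T))) * (k * Q)     ≤⟨ *-monoˡ-≤ (k * Q) (≤-trans small Y²) ⟩
    T ^ Y * (k * Q)                               ≤⟨ *-monoˡ-≤ (k * Q) T^Y≤D ⟩
    D * (k * Q)                                   ≤⟨ ≤-trans (≤-reflexive (sym (*-identityˡ _))) (*-monoˡ-≤ (D * (k * Q)) 0<L) ⟩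
    L * (D * (k * Q))                             ≡⟨ r₂ L D k Q ⟩
    L * (k * (Q * D))                             ∎
    where
    open ≤-Reasoning
    r₁ : ∀ β θ k M Q x → β * (θ * (k * (M * Q)) * x) ≡ β * (θ * (M * x)) * (k * Q)
    r₁ = solve-∀
    r₂ : ∀ L D k Q → L * (D * (k * Q)) ≡ L * (k * (Q * D))
    r₂ = solve-∀
    small : β * (suc Θ * (M * (k * M + T))) ≤ β ^ (6 * K + Y + 10)
    small = ⟪ (one ≤-refl ⊠ sΘ≼ ⊠ M≼ ⊠ plus (up (m≤m+n (4 * K) Y) ((k≼ ⊠ M≼) at r₃ K)) (up (m≤n+m Y (4 * K)) (same {Y}))) at r₄ K Y ⟫
      where
      r₃ : ∀ K → 2 * K + 2 * K ≡ 4 * K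
      r₃ = solve-∀
      r₄ : ∀ K Y → 1 + (8 + (2 * K + (1 + (4 * K + Y)))) ≡ 6 * K + Y + 10
      r₄ = solve-∀
    Y² : β ^ (6 * K + Y + 10) ≤ T ^ Y
    Y² = ≤-trans (^-monoʳ-≤ β {{>-nonZero β>0}} Y-large) (≤-reflexive (sym (^-*-assoc β Y Y)))
    T^Y≤D : T ^ Y ≤ D
    T^Y≤D = ≤-trans (^-monoˡ-≤ Y (≤-trans (≤-reflexive (sym (*-identityˡ T))) (*-monoˡ-≤ T 0<L)))
      (≤-trans (≤-reflexive (sym (*-identityʳ _))) (*-monoʳ-≤ ((L * T) ^ Y) (*-mono-≤ (*-mono-≤ 0<Y 0<L) (*-mono-≤ 0<T 0<T))))

  -- The exponent of the number of vertices: 8 for the times, `2 * K` each for vertex and label, and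
  -- the rest for the `3 + Y` coordinates, each below `β ^ (1 + p)`.
  ν : ℕ
  ν = 8 + (4 * K + (1 + p) * (3 + Y))

  n≤ : n ≤ β ^ ν
  n≤ = ⟪ (sΘ≼ ⊠ k≼ ⊠ M≼ ⊠ Q≼) at ring K ((1 + p) * (3 + Y)) ⟫
    where
    Q≼ : Q ≼ ((1 + p) * (3 + Y))
    Q≼ = ⟨ ≤-reflexive (^-*-assoc β (1 + p) (3 + Y)) ⟩
    ring : ∀ K z → 8 + (2 * K + (2 * K + z)) ≡ 8 + (4 * K + z)
    ring = solve-∀

  -- Jumps exceed what one label per vertex requires by a factor of at most `β ^ (6 * Y + 21)`, the
  -- sum over triples included, and `τ` exceeds this by `β ^ 2`. The short lists lose `L * (L * L)`,
  -- the enlargement `β ^ (3 + Y)` of the box and `τ * τ` index pairs, at most `β ^ (13 * Y + 58)`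
  -- in all, and `X` exceeds that by `β ^ 2` again.
  τ X : ℕ
  τ = β ^ (6 * Y + 23)
  X = β ^ (13 * Y + 60)

  -- Both sides are multiples of the number `A` of critical walks. Each summand on the right is at
  -- most `β ^ (19 * Y + 81)` times `A`, and the left side is `β ^ 2` times as large as this bound,
  -- where `β ^ 2` exceeds 2.
  contradiction : ∀ Δ → 0 < Δ → let cap = β * (4 * Jm) in
    ¬ (X * (τ * (k * Δ * (T ^ Y * P₁ ^ (3 + Y)))) ≤
       L * (L * L) * (X * (2 * (Δ * cap)) + τ * (T ^ Y * (Q * (τ * (τ * (k * Δ)))))))
  contradiction Δ 0<Δ le = <-irrefl refl (begin-strict
    X * (τ * A)                                               ≤⟨ le ⟩
    L * (L * L) * (X * (2 * (Δ * (β * (4 * Jm)))) + τ * (T ^ Y * (Q * (τ * (τ * (k * Δ))))))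
      ≡⟨ cong₂ (λ Q D → L * (L * L) * (X * (2 * (Δ * (β * (4 * (L * (k * (Q * D))))))) + τ * (T ^ Y * (Q * (τ * (τ * (k * Δ))))))) Q≡ D≡ ⟩
    L * (L * L) * (X * (2 * (Δ * (β * (4 * (L * (k * (β ^ (3 + Y) * P₁ ^ (3 + Y) * (L ^ Y * T ^ Y * (Y * L * (T * T))))))))))
                   + τ * (T ^ Y * (β ^ (3 + Y) * P₁ ^ (3 + Y) * (τ * (τ * (k * Δ))))))
      ≡⟨ r₁ L X Δ β k (β ^ (3 + Y)) (P₁ ^ (3 + Y)) (L ^ Y) (T ^ Y) Y (T * T) τ ⟩
    X * (8 * (L * (L * L) * (β * (L * (β ^ (3 + Y) * (L ^ Y * (Y * (L * (T * T)))))))) * A)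
      + τ * (L * (L * L) * (β ^ (3 + Y) * (τ * τ)) * A)
      ≤⟨ +-mono-≤ (*-monoʳ-≤ X (*-monoˡ-≤ A e₁)) (*-monoʳ-≤ τ (*-monoˡ-≤ A e₂)) ⟩
    X * (β ^ (6 * Y + 21) * A) + τ * (β ^ (13 * Y + 58) * A)
      ≡⟨ cong₂ _+_ (r₂ X (β ^ (6 * Y + 21)) A) (r₂ τ (β ^ (13 * Y + 58)) A) ⟩
    X * β ^ (6 * Y + 21) * A + τ * β ^ (13 * Y + 58) * A
      ≡⟨ cong₂ (λ a b → a * A + b * A) (trans (sym (^-distribˡ-+-* β (13 * Y + 60) _)) (cong (β ^_) (e₃ Y))) (trans (sym (^-distribˡ-+-* β (6 * Y + 23) _)) (cong (β ^_) (e₄ Y))) ⟩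
    β ^ (19 * Y + 81) * A + β ^ (19 * Y + 81) * A              ≡⟨ cong (β ^ (19 * Y + 81) * A +_) (sym (+-identityʳ _)) ⟩
    2 * (β ^ (19 * Y + 81) * A)                               <⟨ *-monoˡ-< (β ^ (19 * Y + 81) * A) {{>-nonZero (*-mono-< (pow>0 (19 * Y + 81)) A>0)}} 2<β² ⟩
    β ^ 2 * (β ^ (19 * Y + 81) * A)                           ≡⟨ r₂ (β ^ 2) (β ^ (19 * Y + 81)) A ⟩
    β ^ 2 * β ^ (19 * Y + 81) * A                             ≡⟨ cong (_* A) (trans (sym (^-distribˡ-+-* β 2 (19 * Y + 81))) (cong (β ^_) (e₅ Y))) ⟩
    β ^ (13 * Y + 60 + (6 * Y + 23)) * A                      ≡⟨ cong (_* A) (^-distribˡ-+-* β (13 * Y + 60) (6 * Y + 23)) ⟩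
    X * τ * A                                                 ≡⟨ *-assoc X τ A ⟩
    X * (τ * A)                                               ∎)
    where
    open ≤-Reasoning
    A = k * Δ * (T ^ Y * P₁ ^ (3 + Y))
    A>0 : 0 < A
    A>0 = *-mono-< (*-mono-< 0<k 0<Δ) (*-mono-< (m^n>0 T {{>-nonZero 0<T}} Y) (m^n>0 P₁ {{>-nonZero (pow>0 p)}} (3 + Y)))
    Q≡ : Q ≡ β ^ (3 + Y) * P₁ ^ (3 + Y)
    Q≡ = ^-distribʳ-* (3 + Y) β P₁
    D≡ : D ≡ L ^ Y * T ^ Y * (Y * L * (T * T))
    D≡ = cong (_* (Y * L * (T * T))) (^-distribʳ-* Y L T)
    r₁ : ∀ L X Δ β k b P l t Y tt τ → L * (L * L) * (X * (2 * (Δ * (β * (4 * (L * (k * (b * P * (l * t * (Y * L * tt))))))))) + τ * (t * (b * P * (τ * (τ * (k * Δ)))))) ≡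
      X * (8 * (L * (L * L) * (β * (L * (b * (l * (Y * (L * tt))))))) * (k * Δ * (t * P))) + τ * (L * (L * L) * (b * (τ * τ)) * (k * Δ * (t * P)))
    r₁ = solve-∀
    r₂ : ∀ a b c → a * (b * c) ≡ a * b * c
    r₂ a b c = sym (*-assoc a b c)
    e₁ : 8 * (L * (L * L) * (β * (L * (β ^ (3 + Y) * (L ^ Y * (Y * (L * (T * T)))))))) ≤ β ^ (6 * Y + 21)
    e₁ = ⟪ (one 8≤β ⊠ (same {3} ⊠ same {3} ⊠ same {3}) ⊠ one ≤-refl ⊠ same {3} ⊠ same {3 + Y} ⊠ ⟨ ≤-reflexive (^-*-assoc β 3 Y) ⟩ ⊠ one Y≤β ⊠ same {3} ⊠ same {Y} ⊠ same {Y}) at ring Y ⟫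
      where
      ring : ∀ Y → 1 + (9 + (1 + (3 + (3 + Y + (3 * Y + (1 + (3 + (Y + Y)))))))) ≡ 6 * Y + 21
      ring = solve-∀
    e₂ : L * (L * L) * (β ^ (3 + Y) * (τ * τ)) ≤ β ^ (13 * Y + 58)
    e₂ = ⟪ ((same {3} ⊠ same {3} ⊠ same {3}) ⊠ same {3 + Y} ⊠ same {6 * Y + 23} ⊠ same {6 * Y + 23}) at ring Y ⟫
      where
      ring : ∀ Y → 9 + (3 + Y + (6 * Y + 23 + (6 * Y + 23))) ≡ 13 * Y + 58
      ring = solve-∀
    e₃ : ∀ Y → 13 * Y + 60 + (6 * Y + 21) ≡ 19 * Y + 81
    e₃ = solve-∀
    e₄ : ∀ Y → 6 * Y + 23 + (13 * Y + 58) ≡ 19 * Y + 81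
    e₄ = solve-∀
    e₅ : ∀ Y → 2 + (19 * Y + 81) ≡ 13 * Y + 60 + (6 * Y + 23)
    e₅ = solve-∀
    2<β² : 2 < β ^ 2
    2<β² = ≤-trans (≤-trans (m≤m+n 3 97) 100≤β) (≤-trans (≤-reflexive (sym (*-identityʳ β))) (*-monoʳ-≤ β (≤-trans β>0 (≤-reflexive (sym (*-identityʳ β))))))

root-correct : ∀ K M → 0 < K → let β = iter M (λ b → if isSuc (suc M ∸ suc b ^ K) then suc b else b) 0 in
  β ^ K ≤ M × M < suc β ^ K
root-correct K M 0<K = go M 0 (≤-trans (≤-reflexive (0^ K 0<K)) z≤n) (inj₁ (sym (+-identityʳ M)))
  where
  next : ℕ → ℕ
  next b = if isSuc (suc M ∸ suc b ^ K) then suc b else b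
  0^ : ∀ K → 0 < K → 0 ^ K ≡ 0
  0^ (suc K) _ = refl
  m≤m^K : ∀ m → suc m ≤ suc m ^ K
  m≤m^K m = ≤-trans (≤-reflexive (sym (*-identityʳ (suc m)))) (^-monoʳ-≤ (suc m) 0<K)
  -- Either the counter has not stopped yet or it has reached the root.
  go : ∀ r b → b ^ K ≤ M → (M ≡ r + b) ⊎ (M < suc b ^ K) → iter r next b ^ K ≤ M × M < suc (iter r next b) ^ K
  go zero    b b≤ (inj₁ refl) = b≤ , m≤m^K b
  go zero    b b≤ (inj₂ M<)   = b≤ , M<
  go (suc r) b b≤ state = case-split (isSuc (suc M ∸ suc b ^ K)) refl
    where
    case-split : ∀ t → isSuc (suc M ∸ suc b ^ K) ≡ t → iter r next (if t then suc b else b) ^ K ≤ M × M < suc (iter r next (if t then suc b else b)) ^ K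
    case-split true  eq = let le = isSuc-≤ (suc b ^ K) M eq in go r (suc b) le (advance state)
      where
      advance : (M ≡ suc r + b) ⊎ (M < suc b ^ K) → (M ≡ r + suc b) ⊎ (M < suc (suc b) ^ K)
      advance (inj₁ M≡) = inj₁ (trans M≡ (sym (+-suc r b)))
      advance (inj₂ M<) = ⊥-elim (<-irrefl refl (<-≤-trans M< (isSuc-≤ (suc b ^ K) M eq)))
    case-split false eq = go r b b≤ (inj₂ (≰⇒> λ le → case trans (sym (≤-isSuc le)) eq of λ ()))

^-cancelʳ-≤ : ∀ {a b} n → 0 < n → a ^ n ≤ b ^ n → a ≤ b
^-cancelʳ-≤ {a} {b} n 0<n le = ≮⇒≥ λ b<a → <-irrefl refl (<-≤-trans (^-monoˡ-< n {{>-nonZero 0<n}} b<a) le)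

-- The approximation guarantees are stated with both sides raised to the `n`-th power. If the `n`-th
-- root of `a` is at most `b`, they yield the plain inequality with factor `b`.
product-cancel : ∀ {a b c g} n → 0 < n → a ≤ b ^ n → g ^ n ≤ a * c ^ n → g ≤ b * c
product-cancel {a} {b} {c} n 0<n a≤ h = ^-cancelʳ-≤ n 0<n (≤-trans h (≤-trans (*-monoˡ-≤ (c ^ n) a≤) (≤-reflexive (sym (^-distribʳ-* n b c)))))

card-≤ : ∀ {m n} (R : Pairs m n) → card R ≤ m * n
card-≤ []ᵛ       = z≤n
card-≤ (p ∷ᵛ R) = +-mono-≤ (∣p∣≤n p) (card-≤ R)

-- Acceptance and rejection on large instances, for both problems at once

IsSolution : Bool → ∀ {n} → Graph n → ℕ → ℕ → Graph n → Set
IsSolution true  = IsShortcut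
IsSolution false = IsTCSpanner

module _ (Y p β M : ℕ) (rel : ℕ → ℕ → ℕ → ℕ → Bool) (k : ℕ) where

  budget : ℕ
  budget = 4 * (β ^ 3 * (k * ((β * β ^ p) ^ (3 + Y) * ((β ^ 3 * β ^ Y) ^ Y * (Y * β ^ 3 * (β ^ Y * β ^ Y))))))

  -- The number of vertices is the last argument, so that it can be replaced: the program obtains it
  -- as the length of a list, which equals `k` only propositionally.
  inputAt : Tree
  inputAt = cons (Semantics.graphTree k M (β ^ Y) (β ^ 3) Y (β * β ^ p) rel) (cons (encodeℕ (β ^ 4)) (encodeℕ budget))

  checkAt : Tree → Bool
  checkAt = checkOf (Semantics.n k M (β ^ Y) (β ^ 3) Y (β * β ^ p) rel) (Semantics.graphTree k M (β ^ Y) (β ^ 3) Y (β * β ^ p) rel)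
    (Semantics.Θ k M (β ^ Y) (β ^ 3) Y (β * β ^ p) rel) (β ^ 5) (β * budget)

module Large (q₀ Y K p : ℕ) (0<q₀ : 0 < q₀) (1<Y : 1 < Y) (K≡ : K ≡ q₀ * (13 * Y + 60)) (p≡ : p ≡ 4 * K + 2 * Y + 12) (Y-large : 6 * K + Y + 10 ≤ Y * Y)
  (β M k : ℕ) (β-large : 8 * Y + 100 ≤ β) (M≥ : β ^ K ≤ M) (M< : M < suc β ^ K) (0<k : 0 < k) (k≤M : k ≤ M) (rel : ℕ → ℕ → ℕ → ℕ → Bool) where

  private
    0<Y = <⇒≤ 1<Y
    module N = Numbers q₀ Y K p 0<q₀ 0<Y K≡ p≡ Y-large β M k β-large M≥ M< 0<k k≤M
    module Br = Bridge k M N.T N.L Y N.P 0<Y rel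
    open Paths k M N.T N.L Y N.P 0<Y rel using (n; n≡)
    s = budget Y p β M rel k

    -- The vertices number at most `β ^ ν` and the edges at most the square of this. So with the
    -- exponent `1 / den` both n^ε and m^ε are at most β.
    den : ℕ
    den = suc (2 * N.ν)

    0<β : 0 < β
    0<β = ≤-trans (m≤m+n 1 99) N.100≤β

    n≤ν : n ≤ β ^ N.ν
    n≤ν = ≤-trans (≤-reflexive n≡) N.n≤

    ν≤2ν : N.ν ≤ 2 * N.ν
    ν≤2ν = m≤n*m N.ν 2

    n≤ : n ≤ β ^ den
    n≤ = ≤-trans n≤ν (^-monoʳ-≤ β {{>-nonZero 0<β}} (m≤n⇒m≤1+n ν≤2ν))

    edges≤jumps : β * Br.edgeCount ≤ N.Jm
    edges≤jumps = ≤-trans (*-monoʳ-≤ β (≤-trans Br.edgeCount≤ (≤-reflexive (cong (_* (k * M + N.T)) n≡)))) N.many-jumps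

    edges≤′ : Br.edgeCount ≤ N.Jm
    edges≤′ = ≤-trans (≤-trans (≤-reflexive (sym (*-identityˡ _))) (*-monoˡ-≤ Br.edgeCount 0<β)) edges≤jumps

    1·Jm≤s : N.Jm ≤ s
    1·Jm≤s = m≤n*m N.Jm 4

    inRange-s : card Br.E ^ 1 * card Br.E ^ den ≤ (1 * s) ^ den
    inRange-s = begin
      card Br.E ^ 1 * card Br.E ^ den   ≤⟨ *-monoˡ-≤ (card Br.E ^ den) (≤-trans (≤-reflexive (*-identityʳ _)) m≤) ⟩
      β ^ den * card Br.E ^ den         ≡⟨ sym (^-distribʳ-* den β (card Br.E)) ⟩
      (β * card Br.E) ^ den             ≤⟨ ^-monoˡ-≤ den (≤-trans (*-monoʳ-≤ β Br.card-E) (≤-trans edges≤jumps (≤-trans 1·Jm≤s (≤-reflexive (sym (*-identityˡ s)))))) ⟩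
      (1 * s) ^ den                     ∎
      where
      open ≤-Reasoning
      m≤ : card Br.E ≤ β ^ den
      m≤ = ≤-trans (card-≤ Br.E) (≤-trans (*-mono-≤ n≤ν n≤ν) (≤-trans (≤-reflexive (trans (sym (^-distribˡ-+-* β N.ν N.ν)) (cong (λ z → β ^ (N.ν + z)) (sym (+-identityʳ N.ν)))))
        (^-monoʳ-≤ β {{>-nonZero 0<β}} (n≤1+n (2 * N.ν)))))

    inRange-d : n ^ 1 * 1 ^ den ≤ (1 * β ^ 4) ^ den
    inRange-d = begin
      n ^ 1 * 1 ^ den    ≡⟨ cong₂ _*_ (*-identityʳ n) (^-zeroˡ den) ⟩
      n * 1              ≡⟨ *-identityʳ n ⟩
      n                  ≤⟨ n≤ ⟩
      β ^ den            ≤⟨ ^-monoˡ-≤ den (≤-trans (≤-trans (≤-reflexive (sym (*-identityʳ β))) (*-monoʳ-≤ β N.0<L)) (≤-reflexive (sym (*-identityˡ (β ^ 4))))) ⟩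
      (1 * β ^ 4) ^ den  ∎
      where open ≤-Reasoning

    solves : ∀ b {s d E′} → IsSolution b Br.E s d E′ → Br.Solves s d E′
    solves true  = Br.shortcut-solves
    solves false = Br.spanner-solves

  module _ (ψ φ : ℕ → ℕ) (ψ<M : ∀ {μ} → μ < k → ψ μ < M) (φ<M : ∀ {ν} → ν < k → φ ν < M)
    (complete : ∀ {μ ν a b} → μ < k → ν < k → rel μ ν a b ≡ true → rel μ ν (ψ μ) (φ ν) ≡ true) where

    private
      2+1≤4 : Br.edgeCount + 2 * N.Jm ≤ s
      2+1≤4 = ≤-trans (+-monoˡ-≤ (2 * N.Jm) edges≤′) (*-monoˡ-≤ N.Jm (m≤m+n 3 1))

      module So = Br.Solution N.0<T N.0<L ψ φ ψ<M φ<M complete s (β ^ 4) (*-monoˡ-≤ N.Jm (m≤m+n 2 2)) 2+1≤4 N.hops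

      solvable : ∀ b → ∃[ F ] IsSolution b Br.E s (β ^ 4) F
      solvable true  = So.F , So.shortcut
      solvable false = So.Sp , So.spanner

    -- Since n^ε is at most β, the answer has at most `β * s` pairs and diameter at most `β ^ 5`,
    -- which are the bounds that the check imposes. The range conditions hold with constant 1.
    accepts : ∀ b ε → num ε ≡ 1 → ↧ₙ ε ≡ den → ∀ prog (f : Tree → Tree) → (∀ {x y} → Outputs prog x y → f x ≡ y) →
      Approximates (IsSolution b) ε 1 prog → checkAt Y p β M rel k (f (inputAt Y p β M rel k)) ≡ true
    accepts b ε num≡ den≡ prog f unique approx = finish (approx n Br.E (β ^ 4) s inRange (solvable b))
      where
      inRange : InRange ε 1 Br.E (β ^ 4) s
      inRange = subst₂ (λ a q → card Br.E ^ a * card Br.E ^ q ≤ (1 * s) ^ q) (sym num≡) (sym den≡) inRange-s ,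
                subst₂ (λ a q → n ^ a * 1 ^ q ≤ (1 * β ^ 4) ^ q) (sym num≡) (sym den≡) inRange-d
      within : ∀ {z t} → z ≤[ n ^ ε ]· t → z ≤ β * t
      within {z} {t} h = product-cancel {n ^ 1} {β} {t} {z} den (s≤s z≤n) (≤-trans (≤-reflexive (*-identityʳ n)) n≤)
        (subst₂ (λ a q → z ^ q ≤ n ^ a * t ^ q) num≡ den≡ h)
      finish : ∃[ E′ ] Outputs prog (encodeInput Br.E (β ^ 4) s) (encodePairs E′) ×
        (∃[ s′ ] ∃[ d′ ] (s′ ≤[ n ^ ε ]· s) × (d′ ≤[ n ^ ε ]· (β ^ 4)) × IsSolution b Br.E s′ d′ E′) →
        checkAt Y p β M rel k (f (inputAt Y p β M rel k)) ≡ true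
      finish (E′ , out , s′ , d′ , s′≤ , d′≤ , sol) = trans (cong (checkAt Y p β M rel k) output) (Br.accept E′ (sub , ≤-trans small (within {s′} {s} s′≤) ,
          λ i j r → let l , l≤ , w = near i j r in l , ≤-trans l≤ (within {d′} {β ^ 4} d′≤) , w))
        where
        sub   = proj₁ (solves b sol)
        small = proj₁ (proj₂ (solves b sol))
        near  = proj₂ (proj₂ (solves b sol))
        output : f (inputAt Y p β M rel k) ≡ encodePairs E′
        output = trans (cong (λ t → f (cons t (cons (encodeℕ (β ^ 4)) (encodeℕ s)))) (sym Br.encode-E)) (unique out)

  -- Nothing about the algorithm enters: any accepted tree whatsoever would satisfy the counting
  -- inequality that `contradiction` refutes.
  rejects : ∀ (e : ℕ → ℕ → Bool) Δ → 0 < Δ →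
    (∀ {μ ν} → μ < k → ν < k → e μ ν ≡ true → ∃[ a ] ∃[ b ] a < M × b < M × rel μ ν a b ≡ true) →
    (∀ {μ} → μ < k → ΣL (upTo k) (λ ν → bit (e μ ν)) ≡ Δ) →
    (∀ {ν} → ν < k → ΣL (upTo k) (λ μ → bit (e μ ν)) ≡ Δ) →
    (∀ (ψ φ : ℕ → ℕ) → β ^ (13 * Y + 60) * ΣL (upTo k) (λ μ → ΣL (upTo k) (λ ν → bit (e μ ν) * bit (rel μ ν (ψ μ) (φ ν)))) ≤ k * Δ) →
    ∀ y → ¬ (checkAt Y p β M rel k y ≡ true)
  rejects e Δ 0<Δ satisfiable regularA regularB sound y accepted = N.contradiction Δ 0<Δ
    (NoCase.counted k M N.T N.L Y N.P₁ N.P (β ^ 5) (β * s) 1<Y rel e y 0<k N.0<M N.0<L N.d′<L² accepted satisfiable N.room N.roomEnd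
      N.τ N.X Δ regularA regularB sound)

-- A table for the instances that are too small for the reduction

treesUpTo : ℕ → List Tree
treesUpTo zero    = []
treesUpTo (suc N) = nil ∷ map (λ (s , t) → cons s t) (cartesianProduct (treesUpTo N) (treesUpTo N))

∈-treesUpTo : ∀ N t → size t ≤ N → t ∈ˡ treesUpTo N
∈-treesUpTo (suc N) nil        _       = here refl
∈-treesUpTo (suc N) (cons s t) (s≤s h) = there (∈-map⁺ _ (∈-cartesianProduct⁺
  (∈-treesUpTo N s (≤-trans (m≤m+n (size s) (size t)) h)) (∈-treesUpTo N t (≤-trans (m≤n+m (size t) (size s)) h))))

-- The table exists only classically, which suffices to refute hardness.
¬¬-table : ∀ (Q : Tree → Set) ts → ¬ ¬ (∃[ tab ] All Q tab × (∀ {t} → t ∈ˡ ts → Q t → t ∈ˡ tab))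
¬¬-table Q []       κ = κ ([] , [] , λ ())
¬¬-table Q (t ∷ ts) κ = ¬¬-table Q ts λ (tab , all , has) → κ (tab , all , λ where
  (here refl) q → ⊥-elim (κ (t ∷ tab , q ∷ all , λ where
    (here refl) _ → here refl
    (there m)   q → there (has m q)))
  (there m)   q → has m q)

memberF : List Tree → Fun treeᵗ boolᵗ
memberF []       = constF false
memberF (t ∷ ts) = ifF (eqF idF (constF t)) (constF true) (memberF ts)

memberF⁺ : ∀ {t ts} → t ∈ˡ ts → fn (memberF ts) t ≡ true
memberF⁺ {t} (here refl)        = or⁺ {treeEq t t} (inj₁ (treeEq-refl t))
memberF⁺ {t} {s ∷ _} (there t∈) = or⁺ {treeEq t s} (inj₂ (memberF⁺ t∈))

memberF⁻ : ∀ {t} ts → fn (memberF ts) t ≡ true → t ∈ˡ ts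
memberF⁻ {t} (s ∷ ts) h = [ (λ eq → here (treeEq-sound t s eq)) , (λ h → there (memberF⁻ ts h)) ]′ (or⁻ {treeEq t s} h)

size-encodeVec : ∀ {X : Set} {e : X → Tree} {b m n} (v : Vec X n) → n ≤ m → (∀ x → size (e x) ≤ b) → size (encodeVec e v) ≤ 1 + m * (1 + b)
size-encodeVec                 []ᵛ      _         h = s≤s z≤n
size-encodeVec {e = e} {b} (x ∷ᵛ v) (s≤s n≤m) h = s≤s (≤-trans (+-mono-≤ (h x) (size-encodeVec {e = e} v n≤m h)) (≤-reflexive (+-suc b _)))

-- Two levels of vectors for the pairs of vertices, then two for the pairs of labels inside a
-- constraint; an encoded bit has size at most 3.
encodingBound : ℕ → ℕ
encodingBound m = vec (vec (2 + vec (vec 3)))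
  where
  vec : ℕ → ℕ
  vec b = 1 + m * (1 + b)

encoding-≤ : ∀ I {m} → LabelCover.k I ≤ m → LabelCover.l I ≤ m → LabelCover.inputSize I ≤ encodingBound m
encoding-≤ I {m} k≤m l≤m = size-encodeVec constraints k≤m λ row → size-encodeVec row k≤m λ where
    nothing  → s≤s z≤n
    (just π) → s≤s (s≤s (size-encodeVec π l≤m λ row → size-encodeVec row l≤m λ where
      false → s≤s z≤n
      true  → ≤-refl))
  where open LabelCover I

CompleteTree : Tree → Set
CompleteTree t = ∃[ I ] LabelCover.encoding I ≡ t × LabelCover.Complete I

-- The table knows encodings, and a tree enters it by way of some complete instance that need not be
-- given as the same record. The labeling is therefore transported along the equality of trees. It
-- covers all edges, which contradicts soundness, as the size of an instance is at least 2.
complete⇒¬sound : ∀ ε → 0 < num ε → ∀ I → CompleteTree (LabelCover.encoding I) → ¬ LabelCover.Sound I ε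
complete⇒¬sound ε 0<num I (J , J≡ , ψ , all) sound = <-irrefl refl (begin-strict
  m ^ q                                        <⟨ m<n+m (m ^ q) (m^n>0 m {{>-nonZero A.has-edge}} q) ⟩
  m ^ q + m ^ q                                ≡⟨ cong (m ^ q +_) (sym (+-identityʳ _)) ⟩
  2 * m ^ q                                    ≤⟨ *-mono-≤ 2≤ (^-monoˡ-≤ q m≤) ⟩
  A.inputSize ^ num ε * card (A.covered Ψ) ^ q ≤⟨ sound Ψ ⟩
  m ^ q                                        ∎)
  where
  open ≤-Reasoning
  module A = Instance I
  module B = Instance J
  module C = B.Completed ψ all
  m = card A.edges
  q = ↧ₙ ε
  Ψ = A.asLabeling C.labelA C.labelB
  same-k : A.k ≡ B.k
  same-k = trans (sym A.k≡) (trans (cong (length ∘ toList) (sym J≡)) B.k≡)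
  completed : ∀ {μ ν a b} → μ < A.k → ν < A.k → relOf A.x μ ν a b ≡ true → relOf A.x μ ν (C.labelA μ) (C.labelB ν) ≡ true
  completed {μ} {ν} {a} {b} μ<k ν<k = subst (λ t → relOf t μ ν a b ≡ true → relOf t μ ν (C.labelA μ) (C.labelB ν) ≡ true) J≡
    (C.completed {μ} {ν} {a} {b} (subst (μ <_) same-k μ<k) (subst (ν <_) same-k ν<k))
  bit-and : ∀ c r → (c ≡ true → r ≡ true) → bit c ≤ bit c * bit r
  bit-and false r h = z≤n
  bit-and true  r h = ≤-reflexive (sym (cong (λ r → bit r + 0) (h refl)))
  m≤ : m ≤ card (A.covered Ψ)
  m≤ = ≤-trans (≤-reflexive (sym (A.cardSum A.edges A.e A.e-at))) (≤-trans (ΣL-mono (upTo A.k) λ {μ} μ∈ → ΣL-mono (upTo A.k) λ {ν} ν∈ →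
    bit-and (A.e μ ν) (relOf A.x μ ν (C.labelA μ) (C.labelB ν)) λ h →
      let a , b , _ , _ , r = A.satisfiable (∈-upTo⁻ μ∈) (∈-upTo⁻ ν∈) h in completed {a = a} {b} (∈-upTo⁻ μ∈) (∈-upTo⁻ ν∈) r) (A.soundSum C.labelA C.labelB))
  nonempty-size : ∀ t → 0 < length (toList t) → 2 ≤ size t
  nonempty-size (cons s t) _ = s≤s (≤-trans (size>0 s) (m≤m+n (size s) (size t)))
  2≤ : 2 ≤ A.inputSize ^ num ε
  2≤ = ≤-trans (nonempty-size A.x (subst (0 <_) (sym A.k≡) A.0<k)) (≤-trans (≤-reflexive (sym (*-identityʳ _)))
    (^-monoʳ-≤ A.inputSize {{>-nonZero (size>0 A.x)}} 0<num))

-- The distinguishing program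

module Distinguisher (Y K p : ℕ) (ε₀ : ℚ) (0<num : 0 < num ε₀) (1<Y : 1 < Y) (K≡ : K ≡ ↧ₙ ε₀ * (13 * Y + 60)) (p≡ : p ≡ 4 * K + 2 * Y + 12)
  (Y-large : 6 * K + Y + 10 ≤ Y * Y) (0<K : 0 < K)
  (b : Bool) (ε : ℚ) (num≡ : num ε ≡ 1) (den≡ : ↧ₙ ε ≡ suc (2 * (8 + (4 * K + (1 + p) * (3 + Y)))))
  (prog : Program) (ptime : PolynomialTime prog) (approx : Approximates (IsSolution b) ε 1 prog) where
  open Reduction Y K p using (βF; inputF; checkF)

  private
    q₀ = ↧ₙ ε₀

    solver : Tree → Tree
    solver t = proj₁ (proj₂ (proj₂ ptime) t)

    solverF : Fun treeᵗ treeᵗ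
    solverF = mkFun (λ x → solver (enc (treeᵗ ⊗ (treeᵗ ⊗ treeᵗ)) (fn inputF x))) (programPT ptime ∘PT pt inputF) λ x → cong solver (ok inputF x)

    verdictF : Fun treeᵗ boolᵗ
    verdictF = checkF ∘F (idF ▵ solverF)

    decideF : List Tree → Fun treeᵗ boolᵗ
    decideF tab = ifF (constF (8 * Y + 100) ≤F βF) verdictF (memberF tab)

    root : ∀ x → fn βF x ^ K ≤ rowsOf x × rowsOf x < suc (fn βF x) ^ K
    root x = root-correct K (rowsOf x) 0<K

    module _ (I : LabelCover) (β-large : 8 * Y + 100 ≤ fn βF (LabelCover.encoding I)) where
      open Instance I

      private
        β = fn βF x
        module Lg = Large q₀ Y K p (s≤s z≤n) 1<Y K≡ p≡ Y-large β (rowsOf x) k β-large (proj₁ (root x)) (proj₂ (root x)) 0<k k≤rows (relOf x)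
        checkₖ : ℕ → Tree → Bool
        checkₖ = checkAt Y p β (rowsOf x) (relOf x)
        inputₖ : ℕ → Tree
        inputₖ = inputAt Y p β (rowsOf x) (relOf x)

      large-complete : Complete → fn verdictF x ≡ true
      -- The program reads the number of vertices off the encoding; the substitution replaces this
      -- length by `k`.
      large-complete (ψ , all) = subst (λ κ → checkₖ κ (solver (inputₖ κ)) ≡ true) (sym k≡)
        (Lg.accepts labelA labelB labelA< labelB< (λ {μ} {ν} {a} {b} → completed {μ} {ν} {a} {b}) b ε num≡ den≡ prog solver (outputs-unique ptime) approx)
        where open Completed ψ all

      large-sound : Sound ε₀ → ¬ (fn verdictF x ≡ true)
      large-sound sound h = Lg.rejects e degree 0<degree satisfiable regularA regularB few _ (subst (λ κ → checkₖ κ (solver (inputₖ (length (toList x)))) ≡ true) k≡ h)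
        where
        X = β ^ (13 * Y + 60)
        -- By the choice of `K`, the left side is `β ^ K`, which is at most the number of rows and
        -- hence at most the input size. The positive numerator of ε₀ can only enlarge the right
        -- side, so `X` is at most N^ε₀.
        X^q₀≤ : X ^ q₀ ≤ inputSize ^ num ε₀
        X^q₀≤ = begin
          X ^ q₀                        ≡⟨ ^-*-assoc β (13 * Y + 60) q₀ ⟩
          β ^ ((13 * Y + 60) * q₀)      ≡⟨ cong (β ^_) (trans (*-comm (13 * Y + 60) q₀) (sym K≡)) ⟩
          β ^ K                         ≤⟨ proj₁ (root x) ⟩
          rowsOf x                      ≤⟨ rowsOf-≤ x ⟩
          inputSize                     ≡⟨ sym (*-identityʳ inputSize) ⟩
          inputSize ^ 1                 ≤⟨ ^-monoʳ-≤ inputSize {{>-nonZero (size>0 x)}} 0<num ⟩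
          inputSize ^ num ε₀            ∎
          where open ≤-Reasoning
        few : ∀ ψ φ → X * ΣL (upTo k) (λ μ → ΣL (upTo k) (λ ν → bit (e μ ν) * bit (relOf x μ ν (ψ μ) (φ ν)))) ≤ k * degree
        few ψ φ = ≤-trans (*-monoʳ-≤ X (soundSum ψ φ)) (≤-trans (^-cancelʳ-≤ q₀ (s≤s z≤n) (≤-trans (≤-reflexive (^-distribʳ-* q₀ X _))
          (≤-trans (*-monoˡ-≤ (card (covered (asLabeling ψ φ)) ^ q₀) X^q₀≤) (sound (asLabeling ψ φ))))) (≤-reflexive edge-count))

    smallSize : ℕ
    smallSize = encodingBound ((8 * Y + 100) ^ K)

    -- A small root bounds the number of rows, which bounds vertices and labels. Only finitely many
    -- encodings remain.
    small : ∀ I → fn βF (LabelCover.encoding I) < 8 * Y + 100 → LabelCover.encoding I ∈ˡ treesUpTo smallSize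
    small I β< = ∈-treesUpTo smallSize x (encoding-≤ I (≤-trans k≤rows rows≤) (≤-trans l≤rows rows≤))
      where
      open Instance I
      rows≤ : rowsOf x ≤ (8 * Y + 100) ^ K
      rows≤ = ≤-trans (<⇒≤ (proj₂ (root x))) (^-monoˡ-≤ K β<)

    not-true : ∀ {c} → ¬ (c ≡ true) → c ≡ false
    not-true {true}  h = ⊥-elim (h refl)
    not-true {false} _ = refl

    module _ (tab : List Tree) (all : All CompleteTree tab) (has : ∀ {t} → t ∈ˡ treesUpTo smallSize → CompleteTree t → t ∈ˡ tab) (I : LabelCover) where
      open Instance I

      private
        decide : Bool → Bool
        decide c = if c then fn verdictF x else fn (memberF tab) x

        split : ∀ c → c ≡ fn (constF {A = treeᵗ} (8 * Y + 100) ≤F βF) x → (Complete → decide c ≡ true) × (Sound ε₀ → decide c ≡ false)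
        split true  eq = large-complete I β-large , λ sound → not-true (large-sound I β-large sound)
          where β-large = isSuc-≤ (8 * Y + 100) (fn βF x) (sym eq)
        split false eq = (λ comp → memberF⁺ (has (small I β<) (I , refl , comp))) ,
          λ sound → not-true λ h → complete⇒¬sound ε₀ 0<num I (All-lookup all (memberF⁻ tab h)) sound
          where
          β< : fn βF x < 8 * Y + 100
          β< = ≰⇒> λ le → case trans eq (≤-isSuc le) of λ ()

      decides : (Complete → fn (decideF tab) x ≡ true) × (Sound ε₀ → fn (decideF tab) x ≡ false)
      decides = split _ refl

  ¬¬-distinguished : ¬ ¬ (∃[ q ] PolynomialTime q × Distinguishes ε₀ q)
  ¬¬-distinguished κ = ¬¬-table CompleteTree (treesUpTo smallSize) λ (tab , all , has) →
    let q , q-ptime , outputs = toProgram (pt (decideF tab))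
        out : ∀ I {c} → fn (decideF tab) (LabelCover.encoding I) ≡ c → Outputs q (LabelCover.encoding I) (encodeBool c)
        out = λ I eq → subst (Outputs q (LabelCover.encoding I)) (trans (ok (decideF tab) (LabelCover.encoding I)) (cong encodeBool eq)) (outputs (LabelCover.encoding I))
    in κ (q , q-ptime , λ I → (λ comp → out I (proj₁ (decides tab all has I) comp)) , (λ sound → out I (proj₂ (decides tab all has I) sound)))

0<num : ∀ ε → Positiveℚ ε → 0 < num ε
0<num (mkℚ ℤ.+[1+ _ ] _ _) _ = s≤s z≤n
0<num (mkℚ ℤ.+0       _ _) record { pos = () }
0<num (mkℚ ℤ.-[1+ _ ] _ _) record { pos = () }

theorem2p10 : WeakPGC →
  ∃[ ε ] 0ℚ <ℚ ε × (∃[ C ] 0 < C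
    × ¬ (∃[ p ] PolynomialTime p × Approximates IsShortcut ε C p)
    × ¬ (∃[ p ] PolynomialTime p × Approximates IsTCSpanner ε C p))
theorem2p10 (ε₀ , 0<ε₀ , hard) = ε , positive⁻¹ ε , 1 , s≤s z≤n ,
  (λ (prog , ptime , approx) → refute true prog ptime approx) , (λ (prog , ptime , approx) → refute false prog ptime approx)
  where
  q₀ = ↧ₙ ε₀
  -- The square of `Y` has to exceed `6 * K + Y + 10`, whose leading term is `78 * q₀ * Y`; the
  -- factor 100 is a convenient choice above 78.
  Y  = 100 * q₀
  K  = q₀ * (13 * Y + 60)
  p  = 4 * K + 2 * Y + 12
  ε : ℚ
  -- `mkℚ` stores the denominator less one, so the denominator is one more than twice the exponent
  -- of β that bounds the number of vertices.
  ε  = mkℚ (ℤ.+ 1) (2 * (8 + (4 * K + (1 + p) * (3 + Y)))) (1-coprimeTo _)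

  1<Y : 1 < Y
  1<Y = ≤-trans (m≤m+n 2 98) (*-monoʳ-≤ 100 {1} {q₀} (s≤s z≤n))

  0<K : 0 < K
  0<K = *-mono-≤ {1} {q₀} (s≤s z≤n) (≤-trans (m≤m+n 1 59) (m≤n+m 60 (13 * Y)))

  Y-large : 6 * K + Y + 10 ≤ Y * Y
  Y-large = go q₀ (s≤s z≤n)
    where
    go : ∀ q → 0 < q → 6 * (q * (13 * (100 * q) + 60)) + 100 * q + 10 ≤ 100 * q * (100 * q)
    -- The polynomial that is added is the exact difference of the two sides at `suc q`; its
    -- coefficients are all positive.
    go (suc q) _ = ≤-trans (m≤m+n _ (2200 * q * q + 3940 * q + 1730)) (≤-reflexive (ring q))
      where
      ring : ∀ q → 6 * (suc q * (13 * (100 * suc q) + 60)) + 100 * suc q + 10 + (2200 * q * q + 3940 * q + 1730) ≡ 100 * suc q * (100 * suc q)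
      ring = solve-∀

  refute : ∀ b prog → PolynomialTime prog → Approximates (IsSolution b) ε 1 prog → ⊥
  refute b prog ptime approx = Distinguisher.¬¬-distinguished Y K p ε₀ (0<num ε₀ (positive 0<ε₀)) 1<Y refl refl Y-large 0<K
    b ε refl refl prog ptime approx hard
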